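{- Let $\lambda$ be a strict partition. Then \[ gp_{\lambda} = \sum_{T\in \mathsf{ShPP}_P(\lambda)} (-\beta)^{|\lambda| - |\operatorname{wt}_{\mathrm{PP}}(T)|}\, {\bf x}^{\operatorname{wt}_{\mathrm{PP}}(T)} \quad\text{and}\quad gq_{\lambda} = \sum_{T\in \mathsf{ShPP}_Q(\lambda)} (-\beta)^{|\lambda| - |\operatorname{wt}_{\mathrm{PP}}(T)|}\, {\bf x}^{\operatorname{wt}_{\mathrm{PP}}(T)}. \]
   Context: A strict partition is $\lambda=(\lambda_1>\lambda_2>\dots>\lambda_k>0)$, with $|\lambda|=\sum_i\lambda_i$. Its shifted diagram is $\mathsf{SD}_\lambda=\{(i,i+j-1): 1\le i\le k,\ 1\le j\le \lambda_i\}$; boxes $(i,i)$ are diagonal boxes. For $i\in\mathbb{Z}$ write $i':=i-\tfrac12$ ("primed numbers"), with total order $1'<1<2'<2<\dots$. Let $\beta,x_1,x_2,\dots$ be commuting indeterminates. A semistandard shifted set-valued tableau of shape $\lambda$ is a filling $T$ of each box $(i,j)\in\mathsf{SD}_\lambda$ by a nonempty finite subset $T_{ij}$ of $\{1'<1<2'<2<\dots\}$ such that $\max T_{ij}\le \min T_{i+1,j}$ and $\max T_{ij}\le\min T_{i,j+1}$ whenever both boxes lie in the shape, no unprimed number occurs in two different boxes of the same column, and no primed number occurs in two different boxes of the same row. Set $|T|=\sum|T_{ij}|$ and ${\bf x}^T=\prod_i x_i^{a_i+b_i}$ where $a_i,b_i$ are the numbers of occurrences of $i$ and $i'$. Let $\mathsf{ShSVT}_Q(\lambda)$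 be the set of all such tableaux and $\mathsf{ShSVT}_P(\lambda)$ the subset with no primed numbers in diagonal boxes; define $GP_\lambda=\sum_{T\in\mathsf{ShSVT}_P(\lambda)}\beta^{|\lambda|-|T|}{\bf x}^T$ and $GQ_\lambda=\sum_{T\in\mathsf{ShSVT}_Q(\lambda)}\beta^{|\lambda|-|T|}{\bf x}^T$. The dual functions $gp_\lambda, gq_\lambda\in\mathbb{Z}[\beta]\llbracket x_1,x_2,\dots\rrbracket$ (indexed by strict partitions) are the unique power series satisfying $\sum_\lambda GQ_\lambda({\bf x})gp_\lambda({\bf y})=\sum_\lambda GP_\lambda({\bf x})gq_\lambda({\bf y})=\prod_{i,j\ge1}\frac{1-\overline{x_i}y_j}{1-x_iy_j}$, where $\overline{x}:=\frac{ -x}{1+\beta x}$ and ${\bf y}=(y_1,y_2,\dots)$ are further indeterminates. A shifted plane partition of shape $\lambda$ is a filling of $\mathsf{SD}_\lambda$ by elements of $\{1'<1<2'<2<\dots\}$ with weakly increasing rows and columns. For such $T$, let $c_i$ be the number of distinct columns of $T$ containing $i$ and $r_i$ the number of distinct rows containing $i'$; set $|\operatorname{wt}_{\mathrm{PP}}(T)|=\sum_i(c_i+r_i)$ and ${\bf x}^{\operatorname{wt}_{\mathrm{PP}}(T)}=\prod_i x_i^{c_i+r_i}$. Let $\mathsf{ShPP}_Q(\lambda)$ be the set of all shifted plane partitions of shape $\lambda$ and $\mathsf{ShPP}_P(\lambda)$ the subset with no unprimed entries in diagonal boxes.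
   Formalization: GP and GQ are taken with weight β^{|T|−|λ|} in place of the printed β^{|λ|−|T|}; with the printed sign the x² coefficient of the Cauchy identity (one x, one y) forces gp_(2) = y² − ½(β+1/β)y, so no dual functions over ℤ[β] exist. -}

module Defs where

open import Data.Nat using (ℕ; zero; suc; _+_; _*_; _∸_; _≡ᵇ_; _≤ᵇ_; _<ᵇ_; _%_)
open import Data.Bool using (Bool; true; false; _∧_; _∨_; not; if_then_else_)
open import Data.List using (List; []; _∷_; [_]; _++_; map; concatMap; upTo; filterᵇ; length; deduplicate; foldr)
open import Data.Nat.ListAction using (sum)
open import Data.Bool.ListAction using (all; any)
open import Data.Product using (_×_; _,_; proj₁; proj₂)
open import Data.Vec as Vec using (Vec)
open import Data.Fin as Fin using (Fin; toℕ; _↑ˡ_; _↑ʳ_)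
import Data.Nat.Properties as ℕP
open import Data.Integer as ℤ using (ℤ)

count : {A : Set} → (A → Bool) → List A → ℕ
count p xs = length (filterᵇ p xs)

_⇒ᵇ_ : Bool → Bool → Bool
a ⇒ᵇ b = not a ∨ b

sublists : {A : Set} → List A → List (List A)
sublists [] = [ [] ]
sublists (x ∷ xs) = map (x ∷_) (sublists xs) ++ sublists xs

nonEmpty : {A : Set} → List A → Bool
nonEmpty [] = false
nonEmpty (_ ∷ _) = true

listsOfLen : {A : Set} → ℕ → List A → List (List A)
listsOfLen zero A = [ [] ]
listsOfLen (suc n) A = concatMap (λ x → map (x ∷_) (listsOfLen n A)) A

assignments : {B C : Set} → List B → List C → List (List (B × C))
assignments [] cs = [ [] ]
assignments (b ∷ bs) cs = concatMap (λ c → map ((b , c) ∷_) (assignments bs cs)) cs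

isStrictᵇ : List ℕ → Bool
isStrictᵇ [] = true
isStrictᵇ (x ∷ []) = 1 ≤ᵇ x
isStrictᵇ (x ∷ y ∷ l) = (y <ᵇ x) ∧ isStrictᵇ (y ∷ l)

-- all strict partitions of size ≤ N (each such has length ≤ N, parts in 1..N)
strictUpTo : ℕ → List (List ℕ)
strictUpTo N =
  filterᵇ (λ l → isStrictᵇ l ∧ (sum l ≤ᵇ N))
          (concatMap (λ len → listsOfLen len (map suc (upTo N))) (upTo (suc N)))

-- Shifted diagram (0-indexed): row r, column r + j with j < λ_r.

boxesFrom : ℕ → List ℕ → List (ℕ × ℕ)
boxesFrom r [] = []
boxesFrom r (l ∷ ls) = map (λ j → (r , r + j)) (upTo l) ++ boxesFrom (suc r) ls

boxes : List ℕ → List (ℕ × ℕ)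
boxes λ' = boxesFrom 0 λ'

row col : ℕ × ℕ → ℕ
row = proj₁
col = proj₂

isDiag : ℕ × ℕ → Bool
isDiag (r , c) = r ≡ᵇ c

-- Letters.  The letter i' (i ≥ 1) is encoded by the code 2i-2 and the
-- letter i by the code 2i-1; so 1' < 1 < 2' < 2 < ... is the order of ℕ.
-- With m variables x_1..x_m the letters are the codes 0 .. 2m-1.
-- Code c belongs to the variable with 0-based index c / 2.

isPrimed : ℕ → Bool
isPrimed c = c % 2 ≡ᵇ 0

-- code of the letter (i+1)' and of the letter (i+1), i 0-based
primedCode unprimedCode : ℕ → ℕ
primedCode i = 2 * i
unprimedCode i = suc (2 * i)

ofVar : ℕ → ℕ → Bool
ofVar i c = (c ≡ᵇ primedCode i) ∨ (c ≡ᵇ unprimedCode i)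

letters : ℕ → List ℕ
letters m = upTo (2 * m)

at : List ℕ → ℕ → ℕ
at [] _ = 0
at (x ∷ xs) zero = x
at (x ∷ xs) (suc i) = at xs i

memberᵇ : ℕ → List ℕ → Bool
memberᵇ x = any (x ≡ᵇ_)

-- Set-valued shifted tableaux.  A filling is a list of (box, subset).

SVFilling : Set
SVFilling = List ((ℕ × ℕ) × List ℕ)

leSets : List ℕ → List ℕ → Bool
leSets S S' = all (λ s → all (λ t → s ≤ᵇ t) S') S

commonWith : (ℕ → Bool) → List ℕ → List ℕ → Bool
commonWith p S S' = any (λ s → p s ∧ memberᵇ s S') S

svPairOK : (ℕ × ℕ) × List ℕ → (ℕ × ℕ) × List ℕ → Bool
svPairOK ((r₁ , c₁) , S₁) ((r₂ , c₂) , S₂) =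
  (((r₂ ≡ᵇ suc r₁) ∧ (c₂ ≡ᵇ c₁)) ⇒ᵇ leSets S₁ S₂) ∧
  (((r₂ ≡ᵇ r₁) ∧ (c₂ ≡ᵇ suc c₁)) ⇒ᵇ leSets S₁ S₂) ∧
  (((c₁ ≡ᵇ c₂) ∧ not (r₁ ≡ᵇ r₂)) ⇒ᵇ not (commonWith (λ s → not (isPrimed s)) S₁ S₂)) ∧
  (((r₁ ≡ᵇ r₂) ∧ not (c₁ ≡ᵇ c₂)) ⇒ᵇ not (commonWith isPrimed S₁ S₂))

svValid : SVFilling → Bool
svValid F = all (λ p → all (λ q → svPairOK p q) F) F

svNoPrimedDiag : SVFilling → Bool
svNoPrimedDiag F = all (λ p → isDiag (proj₁ p) ⇒ᵇ not (any isPrimed (proj₂ p))) F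

svSize : SVFilling → ℕ
svSize F = sum (map (λ p → length (proj₂ p)) F)

-- content: the exponent of x_{i+1} is a_{i+1} + b_{i+1}
svContent : SVFilling → ℕ → ℕ
svContent F i = sum (map (λ p → count (ofVar i) (proj₂ p)) F)

svWeightIs : SVFilling → List ℕ → Bool
svWeightIs F a = all (λ i → svContent F i ≡ᵇ at a i) (upTo (length a))

svFillings : List ℕ → ℕ → List SVFilling
svFillings λ' m = assignments (boxes λ') (filterᵇ nonEmpty (sublists (letters m)))

-- GQ_λ = Σ_{T ∈ ShSVT_Q(λ)} β^{|T| - |λ|} x^T ;  coefficient of x^a β^k
-- (a : exponents of x_1, …, x_m, m = length a)
GQcoef : List ℕ → List ℕ → ℕ → ℤ
GQcoef λ' a k = ℤ.+ count (λ F → svValid F ∧ svWeightIs F a ∧ (svSize F ≡ᵇ sum λ' + k))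
                        (svFillings λ' (length a))

GPcoef : List ℕ → List ℕ → ℕ → ℤ
GPcoef λ' a k = ℤ.+ count (λ F → svValid F ∧ svNoPrimedDiag F ∧ svWeightIs F a
                                  ∧ (svSize F ≡ᵇ sum λ' + k))
                        (svFillings λ' (length a))

-- Shifted plane partitions.  A filling is a list of (box, letter).

PPFilling : Set
PPFilling = List ((ℕ × ℕ) × ℕ)

ppPairOK : (ℕ × ℕ) × ℕ → (ℕ × ℕ) × ℕ → Bool
ppPairOK ((r₁ , c₁) , e₁) ((r₂ , c₂) , e₂) =
  (((r₁ ≡ᵇ r₂) ∧ (c₁ <ᵇ c₂)) ⇒ᵇ (e₁ ≤ᵇ e₂)) ∧
  (((c₁ ≡ᵇ c₂) ∧ (r₁ <ᵇ r₂)) ⇒ᵇ (e₁ ≤ᵇ e₂))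

ppValid : PPFilling → Bool
ppValid F = all (λ p → all (λ q → ppPairOK p q) F) F

ppNoUnprimedDiag : PPFilling → Bool
ppNoUnprimedDiag F = all (λ p → isDiag (proj₁ p) ⇒ᵇ isPrimed (proj₂ p)) F

distinctCols distinctRows : PPFilling → ℕ → ℕ
distinctCols F e = length (deduplicate ℕP._≟_ (map (λ p → col (proj₁ p)) (filterᵇ (λ p → proj₂ p ≡ᵇ e) F)))
distinctRows F e = length (deduplicate ℕP._≟_ (map (λ p → row (proj₁ p)) (filterᵇ (λ p → proj₂ p ≡ᵇ e) F)))

-- exponent of x_{i+1} in x^{wt_PP(T)} : c_{i+1} + r_{i+1}
ppWt : PPFilling → ℕ → ℕ
ppWt F i = distinctCols F (unprimedCode i) + distinctRows F (primedCode i)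

ppWeightIs : PPFilling → List ℕ → Bool
ppWeightIs F a = all (λ i → ppWt F i ≡ᵇ at a i) (upTo (length a))

ppFillings : List ℕ → ℕ → List PPFilling
ppFillings λ' m = assignments (boxes λ') (letters m)

negOnePow : ℕ → ℤ
negOnePow zero = ℤ.+ 1
negOnePow (suc t) = ℤ.- negOnePow t

-- Σ_{T ∈ ShPP_Q(λ)} (-β)^{|λ| - |wt(T)|} x^{wt(T)} : coefficient of x^a β^k
PPQcoef : List ℕ → List ℕ → ℕ → ℤ
PPQcoef λ' a k =
  negOnePow k ℤ.* ℤ.+ count (λ F → ppValid F ∧ ppWeightIs F a ∧ (sum a + k ≡ᵇ sum λ'))
                             (ppFillings λ' (length a))

PPPcoef : List ℕ → List ℕ → ℕ → ℤ
PPPcoef λ' a k =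
  negOnePow k ℤ.* ℤ.+ count (λ F → ppValid F ∧ ppNoUnprimedDiag F ∧ ppWeightIs F a
                                   ∧ (sum a + k ≡ᵇ sum λ'))
                             (ppFillings λ' (length a))

-- Power series in finitely many variables z_0 … z_{d-1} with ℤ
-- coefficients, given by their coefficient function.

Ser : ℕ → Set
Ser d = Vec ℕ d → ℤ

below : ∀ {d} → Vec ℕ d → List (Vec ℕ d)
below Vec.[] = [ Vec.[] ]
below (x Vec.∷ e) = concatMap (λ i → map (i Vec.∷_) (below e)) (upTo (suc x))

sumℤ : List ℤ → ℤ
sumℤ = foldr ℤ._+_ (ℤ.+ 0)

_*ₛ_ : ∀ {d} → Ser d → Ser d → Ser d
(f *ₛ g) e = sumℤ (map (λ e₁ → f e₁ ℤ.* g (Vec.zipWith _∸_ e e₁)) (below e))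

_-ₛ_ : ∀ {d} → Ser d → Ser d → Ser d
(f -ₛ g) e = f e ℤ.- g e

oneₛ : ∀ {d} → Ser d
oneₛ e = if all (_≡ᵇ 0) (Vec.toList e) then ℤ.+ 1 else ℤ.+ 0

finEqᵇ : ∀ {d} → Fin d → Fin d → Bool
finEqᵇ p q = toℕ p ≡ᵇ toℕ q

-- embed a series h(u,v,w) in three variables as the series h(z_p, z_q, z_r)
embed3 : ∀ {d} → (ℕ → ℕ → ℕ → ℤ) → Fin d → Fin d → Fin d → Ser d
embed3 {d} h p q r e =
  if all (λ s → (finEqᵇ s p ∨ finEqᵇ s q ∨ finEqᵇ s r) ∨ (Vec.lookup e s ≡ᵇ 0))
         (Vec.toList (Vec.allFin d))
  then h (Vec.lookup e p) (Vec.lookup e q) (Vec.lookup e r)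
  else ℤ.+ 0

-- Series in the three variables (β, x, y):
-- x̄ y = (-x/(1+βx)) y = Σ_{t≥0} (-1)^{t+1} β^t x^{t+1} y
xbarY3 : ℕ → ℕ → ℕ → ℤ
xbarY3 k p q = if (q ≡ᵇ 1) ∧ (p ≡ᵇ suc k) then negOnePow (suc k) else ℤ.+ 0

-- 1/(1 - x y) = Σ_{s≥0} x^s y^s
geom3 : ℕ → ℕ → ℕ → ℤ
geom3 k p q = if (k ≡ᵇ 0) ∧ (p ≡ᵇ q) then ℤ.+ 1 else ℤ.+ 0

-- Variables for m x's and n y's: z_0 = β, z_{1+i} = x_{i+1}, z_{1+m+j} = y_{j+1}
βpos : ∀ m n → Fin (suc (m + n))
βpos m n = Fin.zero

xpos : ∀ m n → Fin m → Fin (suc (m + n))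
xpos m n i = Fin.suc (i ↑ˡ n)

ypos : ∀ m n → Fin n → Fin (suc (m + n))
ypos m n j = Fin.suc (m ↑ʳ j)

kernelFactor : ∀ m n → Fin m → Fin n → Ser (suc (m + n))
kernelFactor m n i j =
  (oneₛ -ₛ embed3 xbarY3 (βpos m n) (xpos m n i) (ypos m n j))
  *ₛ embed3 geom3 (βpos m n) (xpos m n i) (ypos m n j)

kernel : ∀ m n → Ser (suc (m + n))
kernel m n =
  foldr _*ₛ_ oneₛ
    (concatMap (λ i → map (λ j → kernelFactor m n i j) (Vec.toList (Vec.allFin n)))
               (Vec.toList (Vec.allFin m)))

-- The Cauchy-type identity Σ_λ F_λ(x) g_λ(y) = Π (1 - x̄_i y_j)/(1 - x_i y_j),
-- coefficientwise at x^a y^b β^k (a : exponents of x_1..x_m,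
-- b : exponents of y_1..y_n).  Only λ with |λ| ≤ |a| can contribute,
-- since every tableau of shape λ has at least |λ| entries.
-- A family g : (λ : List ℕ) → (b : List ℕ) → (k : ℕ) → ℤ gives the
-- coefficient of y^b β^k in g_λ(y).

CauchyIdentity : (List ℕ → List ℕ → ℕ → ℤ) → (List ℕ → List ℕ → ℕ → ℤ) → Set
CauchyIdentity F g =
  ∀ m n (a : Vec ℕ m) (b : Vec ℕ n) (k : ℕ) →
    sumℤ (map (λ λ' → sumℤ (map (λ k₁ → F λ' (Vec.toList a) k₁ ℤ.* g λ' (Vec.toList b) (k ∸ k₁))
                                (upTo (suc k))))
              (strictUpTo (sum (Vec.toList a))))
    ≡ kernel m n (k Vec.∷ (a Vec.++ b))
  where open import Relation.Binary.PropositionalEquality using (_≡_)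

{-# OPTIONS --safe #-}
module Submission where

-- Adding the entries i′ and then i to a tableau (for GP, GQ) or to a plane partition (for gp, gq) acts
-- on shapes by operators whose matrix entries are products of weights of single boxes.  With a strict
-- partition recorded by the 0-1 sequence of its parts, these operators are one-row transfer matrices.
-- They satisfy local exchange relations, by which Φ = Σ_λ GQ_λ(x) λ is an eigenvector of the operators
-- of y_j, with eigenvalue Π_i (1 − x̄_i y_j) / (1 − x_i y_j).  Pairing Φ with the plane partition sums
-- gives the Cauchy identity, in the ring of power series truncated at the monomial in question, where
-- every x_i is nilpotent, so that bounded parts suffice.
-- The identity determines the dual functions: in a tableau the entries of row r involve only x_i with
-- i ≥ r, so that the coefficient of x^λ β^0 in GQ_μ vanishes unless Σ (r − 1) μ_r < Σ (r − 1) λ_r or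
-- μ = λ, and it is positive for μ = λ.

-- Commutation of whole rows cannot be proved site by site on its own: cutting a row leaves an edge
-- state of the upward matrix and a flow of the downward one, and the two orders of composition
-- agree only after linear recombination of these states. What is carried through the induction is a
-- system of linear relations that is stable under prepending a site and contains the wanted
-- identity as its entry with idle edge and no flow. Nor do single letters commute up to a scalar:
-- each exchange alters the weights of the last site. Only after i′ and i have both passed j′ and j
-- are the original weights restored; the scalars then combine to c / (b d) with b = 1 + βx, c = b +
-- xy, d = 1 - xy, which is (1 - x̄y) / (1 - xy). Bounding the parts costs one error term, a
-- particle that enters from above the bound. It carries a high power of x as long as the top sites
-- are empty, so nilpotency removes it; the rest is bookkeeping of how much empty room each operator
-- consumes.

open import Defs hiding (below)
open import Algebra.Bundles using (CommutativeRing)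
open import Data.Bool using (Bool; true; false; _∧_; _∨_; not; if_then_else_)
open import Data.Bool.ListAction using (all; any)
import Data.Bool.Properties as BoolP
open import Data.Empty using (⊥; ⊥-elim)
open import Data.Fin as Fin using (Fin; toℕ; fromℕ<; _↑ˡ_; _↑ʳ_)
import Data.Fin.Properties as FinP
open import Data.Integer as ℤ using (ℤ; +_)
import Data.Integer.Properties as ℤP
open import Data.List as List using (List; []; _∷_; _++_; map; concatMap; upTo; length; filterᵇ; deduplicate)
open import Data.List.Membership.Propositional using (_∈_; find)
open import Data.List.Membership.Propositional.Properties using (∈-map⁻; ∈-map⁺; ∈-++⁻; ∈-++⁺ˡ; ∈-++⁺ʳ; ∈-upTo⁺; ∈-upTo⁻; ∈-concatMap⁻; ∈-concatMap⁺; ∈-deduplicate⁺; ∈-deduplicate⁻)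
open import Data.List.Membership.Propositional.Properties.WithK using (unique∧set⇒bag)
import Data.List.Properties as ListP
open import Data.List.Relation.Binary.BagAndSetEquality using (∼bag⇒↭)
open import Data.List.Relation.Binary.Permutation.Propositional using (_↭_)
open import Data.List.Relation.Binary.Permutation.Propositional.Properties using (↭-length)
open import Data.List.Relation.Unary.All as All using (All; []; _∷_)
open import Data.List.Relation.Unary.AllPairs using ([]; _∷_)
open import Data.List.Relation.Unary.Any as Any using (here; there)
open import Data.List.Relation.Unary.Unique.Propositional using (Unique)
import Data.List.Relation.Unary.Unique.Propositional.Properties as UniqueP
open import Data.Maybe as Maybe using (Maybe; just; nothing; is-just)
open import Data.Nat as ℕ using (ℕ; zero; suc; _∸_; _≤_; _<_; z≤n; s≤s; ⌊_/2⌋; _≡ᵇ_; _≤ᵇ_; _<ᵇ_; _%_)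
open import Data.Nat.DivMod using (m*n%n≡0; [m+kn]%n≡m%n)
open import Data.Nat.Induction using (<-rec)
open import Data.Nat.ListAction using (sum)
import Data.Nat.Properties as ℕP
open import Data.List.Relation.Unary.Unique.DecPropositional.Properties ℕP._≟_ using (deduplicate-!)
open import Data.Product using (_×_; _,_; proj₁; proj₂; ∃; ∃-syntax; map₂)
import Data.Product.Properties as ΣP
open import Data.Sum using (_⊎_; inj₁; inj₂)
open import Data.Vec as Vec using (Vec; []; _∷_; replicate; toList; tabulate; lookup) renaming (_++_ to _++ᵥ_)
import Data.Vec.Properties as VecP
open import Function using (_∘_; id; mk⇔)
open import Level using (0ℓ)
open import Relation.Binary.Definitions using (tri<; tri≈; tri>)
open import Relation.Binary.PropositionalEquality as ≡ using (_≡_; _≢_; cong; cong₂; subst; subst₂)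
open import Relation.Nullary using (yes; no; ¬_; does)

-- Ring identities and finite sums

-- Integer coefficients have decidable equality although the rings in question, such as truncated
-- power series, do not. Normal forms can therefore be compared by computation, with cancellation of
-- signs.
module IntegerSolver (R : CommutativeRing 0ℓ 0ℓ) where
  open CommutativeRing R
  open import Algebra.Properties.Ring ring
  import Algebra.Properties.Semiring.Mult.TCOptimised semiring as M
  open M using (×-homo-+; ×1-homo-*) renaming (_×_ to _⋅_)
  open import Algebra.Solver.Ring.AlmostCommutativeRing
    using (fromCommutativeRing; _-Raw-AlmostCommutative⟶_)
  open import Relation.Binary.Reasoning.Setoid setoid
  open import Data.Integer as ℤ using (ℤ; +_; -[1+_]; _⊖_; _◃_; sign; ∣_∣)
  open import Data.Sign as Sign using (Sign)
  open import Algebra.Bundles.Raw using (RawRing)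

  private
    ⟦_⟧ℤ : ℤ → Carrier
    ⟦ + n ⟧ℤ = n ⋅ 1#
    ⟦ -[1+ n ] ⟧ℤ = - (suc n ⋅ 1#)

    ×-suc : ∀ n → suc n ⋅ 1# ≈ 1# + n ⋅ 1#
    ×-suc n = ×-homo-+ 1# 1 n

    ⊖-homo : ∀ m n → ⟦ m ⊖ n ⟧ℤ ≈ m ⋅ 1# + - (n ⋅ 1#)
    ⊖-homo zero zero = sym (trans (+-congˡ -0#≈0#) (+-identityʳ 0#))
    ⊖-homo zero (suc n) = sym (+-identityˡ _)
    ⊖-homo (suc m) zero = sym (trans (+-congˡ -0#≈0#) (+-identityʳ _))
    ⊖-homo (suc m) (suc n) = begin
      ⟦ suc m ⊖ suc n ⟧ℤ ≡⟨ cong ⟦_⟧ℤ (ℤP.[1+m]⊖[1+n]≡m⊖n m n) ⟩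
      ⟦ m ⊖ n ⟧ℤ ≈⟨ ⊖-homo m n ⟩
      m ⋅ 1# + - (n ⋅ 1#) ≈⟨ +-congʳ (+-identityˡ _) ⟨
      0# + m ⋅ 1# + - (n ⋅ 1#) ≈⟨ +-congʳ (+-congʳ (-‿inverseʳ 1#)) ⟨
      1# + - 1# + m ⋅ 1# + - (n ⋅ 1#) ≈⟨ +-congʳ (+-assoc _ _ _) ⟩
      1# + (- 1# + m ⋅ 1#) + - (n ⋅ 1#) ≈⟨ +-congʳ (+-congˡ (+-comm _ _)) ⟩
      1# + (m ⋅ 1# + - 1#) + - (n ⋅ 1#) ≈⟨ +-congʳ (+-assoc _ _ _) ⟨
      1# + m ⋅ 1# + - 1# + - (n ⋅ 1#) ≈⟨ +-assoc _ _ _ ⟩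
      1# + m ⋅ 1# + (- 1# + - (n ⋅ 1#)) ≈⟨ +-cong (sym (×-suc m)) (-‿+-comm _ _) ⟩
      suc m ⋅ 1# + - (1# + n ⋅ 1#) ≈⟨ +-congˡ (-‿cong (sym (×-suc n))) ⟩
      suc m ⋅ 1# + - (suc n ⋅ 1#) ∎

    signed : Sign → Carrier → Carrier
    signed Sign.+ a = a
    signed Sign.- a = - a

    signed-cong : ∀ s {a b} → a ≈ b → signed s a ≈ signed s b
    signed-cong Sign.+ eq = eq
    signed-cong Sign.- eq = -‿cong eq

    signed-* : ∀ s s′ a b → signed (s Sign.* s′) (a * b) ≈ signed s a * signed s′ b
    signed-* Sign.+ Sign.+ a b = refl
    signed-* Sign.+ Sign.- a b = -‿distribʳ-* a b
    signed-* Sign.- Sign.+ a b = -‿distribˡ-* a b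
    signed-* Sign.- Sign.- a b = begin
      a * b ≈⟨ -‿involutive _ ⟨
      - - (a * b) ≈⟨ -‿cong (-‿distribʳ-* a b) ⟩
      - (a * - b) ≈⟨ -‿distribˡ-* a (- b) ⟩
      - a * - b ∎

    ◃-homo : ∀ s n → ⟦ s ◃ n ⟧ℤ ≈ signed s (n ⋅ 1#)
    ◃-homo Sign.+ zero = refl
    ◃-homo Sign.- zero = sym -0#≈0#
    ◃-homo Sign.+ (suc n) = refl
    ◃-homo Sign.- (suc n) = refl

    sign-abs : ∀ i → ⟦ i ⟧ℤ ≈ signed (sign i) (∣ i ∣ ⋅ 1#)
    sign-abs (+ n) = refl
    sign-abs -[1+ n ] = refl

    +-hom : ∀ i j → ⟦ i ℤ.+ j ⟧ℤ ≈ ⟦ i ⟧ℤ + ⟦ j ⟧ℤ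
    +-hom (+ m) (+ n) = ×-homo-+ 1# m n
    +-hom (+ m) -[1+ n ] = ⊖-homo m (suc n)
    +-hom -[1+ m ] (+ n) = trans (⊖-homo n (suc m)) (+-comm _ _)
    +-hom -[1+ m ] -[1+ n ] = begin
      - (suc (suc (m ℕ.+ n)) ⋅ 1#)
        ≡⟨ cong (λ k → - (suc k ⋅ 1#)) (ℕP.+-suc m n) ⟨
      - ((suc m ℕ.+ suc n) ⋅ 1#) ≈⟨ -‿cong (×-homo-+ 1# (suc m) (suc n)) ⟩
      - (suc m ⋅ 1# + suc n ⋅ 1#) ≈⟨ -‿+-comm _ _ ⟨
      - (suc m ⋅ 1#) + - (suc n ⋅ 1#) ∎

    *-hom : ∀ i j → ⟦ i ℤ.* j ⟧ℤ ≈ ⟦ i ⟧ℤ * ⟦ j ⟧ℤ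
    *-hom i j = begin
      ⟦ sign i Sign.* sign j ◃ ∣ i ∣ ℕ.* ∣ j ∣ ⟧ℤ
        ≈⟨ ◃-homo (sign i Sign.* sign j) (∣ i ∣ ℕ.* ∣ j ∣) ⟩
      signed (sign i Sign.* sign j) ((∣ i ∣ ℕ.* ∣ j ∣) ⋅ 1#)
        ≈⟨ signed-cong (sign i Sign.* sign j) (×1-homo-* ∣ i ∣ ∣ j ∣) ⟩
      signed (sign i Sign.* sign j) (∣ i ∣ ⋅ 1# * ∣ j ∣ ⋅ 1#)
        ≈⟨ signed-* (sign i) (sign j) _ _ ⟩
      signed (sign i) (∣ i ∣ ⋅ 1#) * signed (sign j) (∣ j ∣ ⋅ 1#)
        ≈⟨ *-cong (sign-abs i) (sign-abs j) ⟨
      ⟦ i ⟧ℤ * ⟦ j ⟧ℤ ∎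

    neg-hom : ∀ i → ⟦ ℤ.- i ⟧ℤ ≈ - ⟦ i ⟧ℤ
    neg-hom (+ zero) = sym -0#≈0#
    neg-hom (+ suc n) = refl
    neg-hom -[1+ n ] = sym (-‿involutive _)

    ℤ-raw : RawRing 0ℓ 0ℓ
    ℤ-raw = CommutativeRing.rawRing ℤP.+-*-commutativeRing

    morphism : ℤ-raw -Raw-AlmostCommutative⟶ fromCommutativeRing R
    morphism = record
      { ⟦_⟧ = ⟦_⟧ℤ
      ; +-homo = +-hom
      ; *-homo = *-hom
      ; -‿homo = neg-hom
      ; 0-homo = refl
      ; 1-homo = refl
      }

    coeff≟ : ∀ i j → Maybe (⟦ i ⟧ℤ ≈ ⟦ j ⟧ℤ)
    coeff≟ i j with i ℤ.≟ j
    ... | yes i≡j = just (reflexive (cong ⟦_⟧ℤ i≡j))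
    ... | no _ = nothing

  open import Algebra.Solver.Ring ℤ-raw (fromCommutativeRing R) morphism coeff≟ public
    using
    (Polynomial; solve; _:=_; _:+_; _:*_; :-_; _:-_; con; var; ⟦_⟧; ⟦_⟧↓; normalise; _≟N_; ⟦_⟧N-cong; correct)

  :1 : ∀ {n} → Polynomial n
  :1 = con (+ 1)

module FiniteSums (R : CommutativeRing 0ℓ 0ℓ) where
  open CommutativeRing R
  open import Relation.Binary.Reasoning.Setoid setoid
  open import Data.List.Relation.Binary.Permutation.Propositional using (_↭_; prep; swap)
  import Data.List.Relation.Binary.Permutation.Propositional as Perm
  open import Algebra.Properties.CommutativeSemigroup +-commutativeSemigroup using (interchange; x∙yz≈y∙xz)
  open import Algebra.Properties.CommutativeSemigroup *-commutativeSemigroup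
    using () renaming (interchange to *-interchange; x∙yz≈y∙xz to x*yz≈y*xz)

  private variable A B : Set

  ∑ ∏ : List A → (A → Carrier) → Carrier
  ∑ [] f = 0#
  ∑ (a ∷ as) f = f a + ∑ as f
  ∏ [] f = 1#
  ∏ (a ∷ as) f = f a * ∏ as f

  ∑-cong-∈ : (as : List A) {f g : A → Carrier} → (∀ {a} → a ∈ as → f a ≈ g a) → ∑ as f ≈ ∑ as g
  ∑-cong-∈ [] eq = refl
  ∑-cong-∈ (a ∷ as) eq = +-cong (eq (here ≡.refl)) (∑-cong-∈ as (λ a∈ → eq (there a∈)))

  ∑-cong : (as : List A) {f g : A → Carrier} → (∀ a → f a ≈ g a) → ∑ as f ≈ ∑ as g
  ∑-cong as eq = ∑-cong-∈ as (λ {a} _ → eq a)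

  ∏-cong-∈ : (as : List A) {f g : A → Carrier} → (∀ {a} → a ∈ as → f a ≈ g a) → ∏ as f ≈ ∏ as g
  ∏-cong-∈ [] eq = refl
  ∏-cong-∈ (a ∷ as) eq = *-cong (eq (here ≡.refl)) (∏-cong-∈ as (λ a∈ → eq (there a∈)))

  ∏-cong : (as : List A) {f g : A → Carrier} → (∀ a → f a ≈ g a) → ∏ as f ≈ ∏ as g
  ∏-cong as eq = ∏-cong-∈ as (λ {a} _ → eq a)

  ∑-zero : (as : List A) {f : A → Carrier} → (∀ a → f a ≈ 0#) → ∑ as f ≈ 0#
  ∑-zero [] eq = refl
  ∑-zero (a ∷ as) eq = trans (+-cong (eq a) (∑-zero as eq)) (+-identityˡ 0#)

  ∑-++ : (as bs : List A) (f : A → Carrier) → ∑ (as ++ bs) f ≈ ∑ as f + ∑ bs f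
  ∑-++ [] bs f = sym (+-identityˡ _)
  ∑-++ (a ∷ as) bs f = trans (+-congˡ (∑-++ as bs f)) (sym (+-assoc _ _ _))

  ∏-++ : (as bs : List A) (f : A → Carrier) → ∏ (as ++ bs) f ≈ ∏ as f * ∏ bs f
  ∏-++ [] bs f = sym (*-identityˡ _)
  ∏-++ (a ∷ as) bs f = trans (*-congˡ (∏-++ as bs f)) (sym (*-assoc _ _ _))

  ∑-map : (h : B → A) (bs : List B) (f : A → Carrier) → ∑ (map h bs) f ≈ ∑ bs (λ b → f (h b))
  ∑-map h [] f = refl
  ∑-map h (b ∷ bs) f = +-congˡ (∑-map h bs f)

  ∏-map : (h : B → A) (bs : List B) (f : A → Carrier) → ∏ (map h bs) f ≈ ∏ bs (λ b → f (h b))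
  ∏-map h [] f = refl
  ∏-map h (b ∷ bs) f = *-congˡ (∏-map h bs f)

  ∑-concatMap : (h : B → List A) (bs : List B) (f : A → Carrier) →
    ∑ (concatMap h bs) f ≈ ∑ bs (λ b → ∑ (h b) f)
  ∑-concatMap h [] f = refl
  ∑-concatMap h (b ∷ bs) f = trans (∑-++ (h b) _ f) (+-congˡ (∑-concatMap h bs f))

  ∏-concatMap : (h : B → List A) (bs : List B) (f : A → Carrier) →
    ∏ (concatMap h bs) f ≈ ∏ bs (λ b → ∏ (h b) f)
  ∏-concatMap h [] f = refl
  ∏-concatMap h (b ∷ bs) f = trans (∏-++ (h b) _ f) (*-congˡ (∏-concatMap h bs f))

  ∑-distribˡ : (as : List A) (c : Carrier) (f : A → Carrier) → c * ∑ as f ≈ ∑ as (λ a → c * f a)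
  ∑-distribˡ [] c f = zeroʳ c
  ∑-distribˡ (a ∷ as) c f = trans (distribˡ _ _ _) (+-congˡ (∑-distribˡ as c f))

  ∑-distribʳ : (as : List A) (c : Carrier) (f : A → Carrier) → ∑ as f * c ≈ ∑ as (λ a → f a * c)
  ∑-distribʳ [] c f = zeroˡ c
  ∑-distribʳ (a ∷ as) c f = trans (distribʳ _ _ _) (+-congˡ (∑-distribʳ as c f))

  ∑-+ : (as : List A) (f g : A → Carrier) → ∑ as (λ a → f a + g a) ≈ ∑ as f + ∑ as g
  ∑-+ [] f g = sym (+-identityˡ 0#)
  ∑-+ (a ∷ as) f g = trans (+-congˡ (∑-+ as f g)) (interchange _ _ _ _)

  ∏-* : (as : List A) (f g : A → Carrier) → ∏ as (λ a → f a * g a) ≈ ∏ as f * ∏ as g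
  ∏-* [] f g = sym (*-identityˡ 1#)
  ∏-* (a ∷ as) f g = trans (*-congˡ (∏-* as f g)) (*-interchange _ _ _ _)

  ∏-one : (as : List A) {f : A → Carrier} → (∀ a → f a ≈ 1#) → ∏ as f ≈ 1#
  ∏-one [] eq = refl
  ∏-one (a ∷ as) eq = trans (*-cong (eq a) (∏-one as eq)) (*-identityˡ 1#)

  ∑-swap : (as : List A) (bs : List B) (f : A → B → Carrier) →
    ∑ as (λ a → ∑ bs (f a)) ≈ ∑ bs (λ b → ∑ as (λ a → f a b))
  ∑-swap [] bs f = sym (∑-zero bs (λ _ → refl))
  ∑-swap (a ∷ as) bs f = trans (+-congˡ (∑-swap as bs f)) (sym (∑-+ bs (f a) _))

  ∏-swap : (as : List A) (bs : List B) (f : A → B → Carrier) →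
    ∏ as (λ a → ∏ bs (f a)) ≈ ∏ bs (λ b → ∏ as (λ a → f a b))
  ∏-swap [] bs f = sym (∏-one bs (λ _ → refl))
  ∏-swap (a ∷ as) bs f = trans (*-congˡ (∏-swap as bs f)) (sym (∏-* bs (f a) _))

  ∑-↭ : {as bs : List A} (f : A → Carrier) → as ↭ bs → ∑ as f ≈ ∑ bs f
  ∑-↭ f Perm.refl = refl
  ∑-↭ f (prep a p) = +-congˡ (∑-↭ f p)
  ∑-↭ f (swap a b p) = trans (+-congˡ (+-congˡ (∑-↭ f p))) (x∙yz≈y∙xz _ _ _)
  ∑-↭ f (Perm.trans p q) = trans (∑-↭ f p) (∑-↭ f q)

  iverson : Bool → Carrier → Carrier
  iverson true c = c
  iverson false c = 0#

  iverson-cong : ∀ p {c d} → c ≈ d → iverson p c ≈ iverson p d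
  iverson-cong true eq = eq
  iverson-cong false eq = refl

  iverson-cong-if : ∀ p {c d} → (p ≡.≡ true → c ≈ d) → iverson p c ≈ iverson p d
  iverson-cong-if true eq = eq ≡.refl
  iverson-cong-if false eq = refl

  iverson-*ˡ : ∀ p a b → iverson p a * b ≈ iverson p (a * b)
  iverson-*ˡ true a b = refl
  iverson-*ˡ false a b = zeroˡ b

  iverson-*ʳ : ∀ p a b → iverson p (a * b) ≈ a * iverson p b
  iverson-*ʳ true a b = refl
  iverson-*ʳ false a b = sym (zeroʳ a)

  iverson-∧-* : ∀ p q a b → iverson (p ∧ q) (a * b) ≈ iverson p a * iverson q b
  iverson-∧-* true q a b = iverson-*ʳ q a b
  iverson-∧-* false q a b = sym (zeroˡ _)

  ∑-filter : (p : A → Bool) (as : List A) (f : A → Carrier) →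
    ∑ (filterᵇ p as) f ≈ ∑ as (λ a → iverson (p a) (f a))
  ∑-filter p [] f = refl
  ∑-filter p (a ∷ as) f with p a
  ... | true = +-congˡ (∑-filter p as f)
  ... | false = trans (∑-filter p as f) (sym (+-identityˡ _))

-- Transfer matrices and their exchange relations

data Letter : Set where
  primed unprimed : Letter

-- An edge of the upward transfer matrix carries a particle (hop) or not; in the latter case pend
-- records that the particle above the edge still waits for the factor 1 + βx.
data Edge : Set where
  idle pend hop : Edge

record Operations (A : Set) : Set where
  infix 8 ⊝_
  infixl 7 _⊗_
  infixl 6 _⊕_
  field
    0A 1A : A
    _⊕_ _⊗_ : A → A → A
    ⊝_ : A → A

-- The two families of tableaux: 𝒬 pairs GQ with gp, and 𝒫 pairs GP with gq.
data Kind : Set where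
  𝒬 𝒫 : Kind

-- The weights are defined over any type with ring operations, so that they can be instantiated both
-- with a ring and with the polynomial expressions of the ring solver.
module UpWeights {A : Set} (O : Operations A) (t x : A) where
  open Operations O

  b : A
  b = 1A ⊕ ⊝ (x ⊗ t)

  -- The bits belong to the smaller and to the larger shape. Sites run from large parts to small
  -- ones, so a hop starts at a part of the larger shape and ends at the part of the smaller shape
  -- from which it grew. An unprimed letter lets a row grow by any amount, but the next row must
  -- stay strictly below its old end (`true true hop` is excluded). A primed letter lets a row grow
  -- by one box only (`false false hop` is excluded), and the next row may take over the vacated
  -- size.
  up : Letter → Bool → Bool → Edge → Maybe (A × Edge)
  up unprimed false false idle = just (1A , idle)
  up unprimed false false pend = just (b , idle)
  up unprimed false false hop = just (x , hop)
  up unprimed false true idle = just (1A , hop)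
  up unprimed false true pend = just (1A , hop)
  up unprimed false true hop = nothing
  up unprimed true true idle = just (1A , pend)
  up unprimed true true pend = just (1A , pend)
  up unprimed true true hop = nothing
  up unprimed true false idle = nothing
  up unprimed true false pend = nothing
  up unprimed true false hop = just (x , pend)
  up primed false false idle = just (1A , idle)
  up primed false false pend = just (b , idle)
  up primed false false hop = nothing
  up primed false true idle = just (1A , hop)
  up primed false true pend = just (b , hop)
  up primed false true hop = nothing
  up primed true true idle = just (1A , pend)
  up primed true true pend = just (1A , pend)
  up primed true true hop = just (x , hop)
  up primed true false idle = nothing
  up primed true false pend = nothing
  up primed true false hop = just (x , idle)

  UpBase : Set
  UpBase = Bool → Bool → Edge → A

  close : {S : Set} → Maybe (A × S) → (S → A) → A
  close (just (p , s)) f = p ⊗ f s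
  close nothing f = 0A

  -- The last edge is the main diagonal. For `𝒫` no primed letter may enter it, which forbids a hop
  -- and reduces the weight of a pending box to 1.
  reservoir : Kind → Letter → Edge → A
  reservoir _ _ idle = 1A
  reservoir _ unprimed pend = b
  reservoir 𝒬 primed pend = b
  reservoir 𝒫 primed pend = 1A
  reservoir _ unprimed hop = x
  reservoir 𝒬 primed hop = x
  reservoir 𝒫 primed hop = 0A

  upBase : Kind → Letter → UpBase
  upBase κ ℓ m l e = close (up ℓ m l e) (reservoir κ ℓ)

-- T₀, Y₀ and E₀ are the values at 0 of n ↦ tⁿ, n ↦ yⁿ and n ↦ 0ⁿ.  They are 1, except in proofs for
-- all n ≥ 1, where they are variables standing for the values at n - 1.
module DownWeights {A : Set} (O : Operations A) (t y T₀ Y₀ E₀ : A) where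
  open Operations O

  T Y E : ℕ → A
  T zero = T₀
  T (suc n) = t ⊗ T n
  Y zero = Y₀
  Y (suc n) = y ⊗ Y n
  E zero = E₀
  E (suc n) = 0A

  -- The flow `n` is the number of boxes with the letter on one diagonal; it is unbounded because
  -- plane partitions have no strip condition. Every such box weighs `t`, except that one of them
  -- weighs `y` if it is the leftmost of its row (primed: the smaller shape has this part) or the
  -- lowest of its column (unprimed: the larger shape lacks this part).
  down : Letter → Bool → Bool → ℕ → Maybe (A × ℕ)
  down primed false false n = just (T n , n)
  down primed true false n = just (T n , suc n)
  down primed true true zero = just (1A , zero)
  down primed true true (suc n) = just (y ⊗ T n , suc n)
  down unprimed false false zero = just (1A , zero)
  down unprimed false false (suc n) = just (y ⊗ T n , suc n)
  down unprimed true false n = just (T n , suc n)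
  down unprimed true true n = just (T n , n)
  down _ false true zero = nothing
  down _ false true (suc n) = just (y ⊗ T n , n)

  DownBase : Set
  DownBase = Bool → Bool → ℕ → A

  -- A diagonal box always begins its row and ends its column, so each one contributes `y`. For `𝒬`
  -- the diagonal must stay free of unprimed letters, hence 0ⁿ.
  sink : Kind → Letter → ℕ → A
  sink 𝒬 unprimed = E
  sink _ _ = Y

  closeDown : Maybe (A × ℕ) → (ℕ → A) → A
  closeDown (just (p , s)) f = p ⊗ f s
  closeDown nothing f = 0A

  downBase : Kind → Letter → DownBase
  downBase κ ℓ l r n = closeDown (down ℓ l r n) (sink κ ℓ)

module Weights {A : Set} (O : Operations A) (t x y T₀ Y₀ E₀ : A) where
  open Operations O
  open UpWeights O t x public
  open DownWeights O t y T₀ Y₀ E₀ public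

  -- With `t` = -β one has `b` = 1 + βx, and the factor of the Cauchy kernel is c / (b d).
  c d : A
  c = b ⊕ (x ⊗ y)
  d = 1A ⊕ ⊝ (x ⊗ y)

  term : {S S′ : Set} → Maybe (A × S) → Maybe (A × S′) → (S → S′ → A) → A
  term (just (p , s)) (just (q , s′)) u = (p ⊗ q) ⊗ u s s′
  term (just _) nothing u = 0A
  term nothing _ u = 0A

  downUp upDown : Letter → Letter → Bool → Bool → (Edge → ℕ → A) → Edge → ℕ → A
  downUp ℓ ℓ′ m r u e n =
    term (up ℓ m false e) (down ℓ′ false r n) u ⊕ term (up ℓ m true e) (down ℓ′ true r n) u
  upDown ℓ ℓ′ m r v e n =
    term (up ℓ false r e) (down ℓ′ m false n) v ⊕ term (up ℓ true r e) (down ℓ′ m true n) v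

  Eqn : Set
  Eqn = A × A

  -- The intertwining relations between the vectors u = (down ∘ up) and v = (up ∘ down), the
  -- latter rescaled by 1 - xt or 1 - xy.  For each difference n of the two flows they relate
  -- the entries (idle, n), (pend, n), (hop, 1 + n); the equation neg concerns n = -1.
  neg zer : Letter → Letter → (u v : Edge → ℕ → A) → Eqn
  cm₁ cm₂ pos : Letter → Letter → (u v : Edge → ℕ → A) → ℕ → Eqn
  neg unprimed primed u v = v hop 0 , c ⊗ u hop 0
  neg unprimed unprimed u v = v hop 0 , u hop 0
  neg primed unprimed u v = v hop 0 , b ⊗ u hop 0
  neg primed primed u v = v hop 0 , u hop 0
  zer unprimed primed u v = v pend 0 ⊕ v hop 1 , c ⊗ u pend 0
  zer unprimed unprimed u v = v idle 0 , d ⊗ u idle 0 ⊕ u hop 1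
  zer primed unprimed u v = v idle 0 , b ⊗ (u idle 0 ⊕ u hop 1)
  zer primed primed u v = v pend 0 ⊕ v hop 1 , x ⊗ y ⊗ v idle 0 ⊕ u pend 0
  cm₁ unprimed primed u v n = v idle n , b ⊗ u idle n ⊕ u hop (suc n)
  cm₁ unprimed unprimed u v n = y ⊗ u pend n , y ⊗ b ⊗ u idle n ⊕ t ⊗ u hop (suc n)
  cm₁ primed unprimed u v n = y ⊗ u pend n , y ⊗ b ⊗ u idle n ⊕ t ⊗ b ⊗ u hop (suc n)
  cm₁ primed primed u v n = v idle n , u idle n ⊕ u hop (suc n)
  cm₂ unprimed primed u v n = y ⊗ v pend n ⊕ t ⊗ v hop (suc n) , y ⊗ v idle n
  cm₂ unprimed unprimed u v n = v pend n ⊕ v hop (suc n) , u pend n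
  cm₂ primed unprimed u v n = v pend n ⊕ v hop (suc n) , c ⊗ u pend n
  cm₂ primed primed u v n = y ⊗ v pend n ⊕ t ⊗ v hop (suc n) , y ⊗ v idle n
  pos unprimed primed u v n = v idle (suc n) , u pend (suc n)
  pos unprimed unprimed u v n = v idle (suc n) , u pend (suc n)
  pos primed unprimed u v n = v idle (suc n) , c ⊗ u pend (suc n)
  pos primed primed u v n = u pend (suc n) , b ⊗ v idle (suc n)

  baseDownUp baseUpDown : UpBase → DownBase → Bool → Bool → Edge → ℕ → A
  baseDownUp U D m r e n = (U m false e ⊗ D false r n) ⊕ (U m true e ⊗ D true r n)
  baseUpDown U D m r e n = (U false r e ⊗ D m false n) ⊕ (U true r e ⊗ D m true n)

  -- The starred bases arise when an operator is moved past another one; they differ from the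
  -- original ones on the first site only.
  fill : Bool → Bool → A
  fill false false = b ⊗ d
  fill false true = x ⊗ x ⊗ y
  fill true false = 0A
  fill true true = b

  weigh : Bool → A
  weigh false = c
  weigh true = b

  primedDown* : DownBase
  primedDown* l r n = weigh l ⊗ downBase 𝒬 primed l r n

  -- For `𝒬` this is the original base followed by the matrix `fill` acting on the last bit, so the
  -- change concerns only the presence of the part 1. The base `primedUp*` contains the same matrix
  -- `fill`, which is what lets the two modifications meet.
  unprimedDown* : Kind → DownBase
  unprimedDown* 𝒬 l r n =
    downBase 𝒬 unprimed l false n ⊗ fill false r ⊕ downBase 𝒬 unprimed l true n ⊗ fill true r
  unprimedDown* 𝒫 false false n = b ⊗ downBase 𝒫 unprimed false false n
  unprimedDown* 𝒫 false true n = d ⊗ downBase 𝒫 unprimed false true n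
  unprimedDown* 𝒫 true false n = b ⊗ b ⊗ downBase 𝒫 unprimed true false n
  unprimedDown* 𝒫 true true n = b ⊗ d ⊗ downBase 𝒫 unprimed true true n

  weighStay : UpBase
  weighStay true true idle = b ⊗ c
  weighStay true true pend = b ⊗ c
  weighStay m l e = b ⊗ upBase 𝒬 primed m l e

  primedUp* : Kind → UpBase
  primedUp* 𝒬 m l e = weighStay m false e ⊗ fill false l ⊕ weighStay m true e ⊗ fill true l
  primedUp* 𝒫 false false e = b ⊗ b ⊗ upBase 𝒫 primed false false e
  primedUp* 𝒫 true false idle = b ⊗ b ⊗ (x ⊗ y ⊗ (y ⊕ ⊝ t))
  primedUp* 𝒫 true false pend = b ⊗ b ⊗ (x ⊗ y ⊗ (y ⊕ ⊝ t))
  primedUp* 𝒫 true false hop = b ⊗ b ⊗ x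
  primedUp* 𝒫 true true idle = b ⊗ d ⊗ c
  primedUp* 𝒫 true true pend = b ⊗ d ⊗ c
  primedUp* 𝒫 _ _ _ = 0A

  -- The four pairs of letters fit together: `unprimedDown*` arises from (unprimed, unprimed) and is
  -- the input of (primed, unprimed); `primedDown*` arises from (unprimed, primed) and `primedUp*`
  -- from (primed, unprimed), and both are the input of (primed, primed), which returns the original
  -- bases up to a scalar.
  lhsUp rhsUp : Kind → Letter → Letter → UpBase
  lhsUp κ unprimed _ = upBase κ unprimed
  lhsUp κ primed unprimed = upBase κ primed
  lhsUp κ primed primed = primedUp* κ
  rhsUp κ unprimed _ = upBase κ unprimed
  rhsUp κ primed unprimed = primedUp* κ
  rhsUp κ primed primed m l e = b ⊗ b ⊗ c ⊗ upBase κ primed m l e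

  lhsDown rhsDown : Kind → Letter → Letter → DownBase
  lhsDown κ unprimed primed = downBase κ primed
  lhsDown κ unprimed unprimed l r n = b ⊗ downBase κ unprimed l r n
  lhsDown κ primed unprimed = unprimedDown* κ
  lhsDown κ primed primed = primedDown*
  rhsDown κ unprimed primed = primedDown*
  rhsDown κ unprimed unprimed = unprimedDown* κ
  rhsDown κ primed unprimed = downBase κ unprimed
  rhsDown κ primed primed = downBase κ primed

  scale : Letter → Letter → A
  scale unprimed primed = b
  scale unprimed unprimed = d
  scale primed unprimed = b
  scale primed primed = 1A

ringOperations : (R : CommutativeRing 0ℓ 0ℓ) → Operations (CommutativeRing.Carrier R)
ringOperations R = record { 0A = 0# ; 1A = 1# ; _⊕_ = _+_ ; _⊗_ = _*_ ; ⊝_ = -_ }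
  where open CommutativeRing R

-- Stability of the exchange relations under adding a site, and the last site.

module Relations (R : CommutativeRing 0ℓ 0ℓ) (τ ξ υ : CommutativeRing.Carrier R) where
  open CommutativeRing R hiding (zero)
  open import Data.Bool using () renaming (T to True)
  open import Data.Fin using (#_)
  open import Data.Unit using (tt)
  open import Algebra.Properties.Ring ring using (+-cancelʳ)
  open import Relation.Binary.Reasoning.Setoid setoid
  open IntegerSolver R

  polynomialOperations : ∀ n → Operations (Polynomial n)
  polynomialOperations n = record { 0A = con (+ 0) ; 1A = :1 ; _⊕_ = _:+_ ; _⊗_ = _:*_ ; ⊝_ = :-_ }
    where open import Data.Integer using (+_)

  module W = Weights (ringOperations R) τ ξ υ 1# 1# 1#
  open W hiding (neg; zer; cm₁; cm₂; pos)

  ⟦_⟧ₑ : ∀ {n} → Polynomial n × Polynomial n → Vec Carrier n → Set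
  ⟦ l , r ⟧ₑ ρ = ⟦ l ⟧ ρ ≈ ⟦ r ⟧ ρ

  valid : ∀ {n} → Polynomial n × Polynomial n → Set
  valid (l , r) = True (is-just (normalise l ≟N normalise r))

  valid-sound : ∀ {n} (g : Polynomial n × Polynomial n) → valid g → ∀ ρ → ⟦ g ⟧ₑ ρ
  valid-sound (l , r) ok ρ with normalise l ≟N normalise r
  ... | just eq = begin
    ⟦ l ⟧ ρ ≈⟨ correct l ρ ⟨
    ⟦ l ⟧↓ ρ ≈⟨ ⟦ eq ⟧N-cong ρ ⟩
    ⟦ r ⟧↓ ρ ≈⟨ correct r ρ ⟩
    ⟦ r ⟧ ρ ∎

  -- Proof by linear combination: `h` is a combination of known relations with polynomial
  -- coefficients, and goal minus `h` must be a polynomial identity. That identity is decided by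
  -- normal forms, after which the right side of `h` is cancelled.
  by : ∀ {n} (ρ : Vec Carrier n) (g h : Polynomial n × Polynomial n) →
    valid (proj₁ g :+ proj₂ h , proj₂ g :+ proj₁ h) → ⟦ h ⟧ₑ ρ → ⟦ g ⟧ₑ ρ
  by ρ g@(gl , gr) h@(hl , hr) ok h≈ = +-cancelʳ (⟦ hr ⟧ ρ) _ _
    (trans (valid-sound (gl :+ hr , gr :+ hl) ok ρ) (+-congˡ h≈))

  _⊙_ : ∀ {n} → Polynomial n → Polynomial n × Polynomial n → Polynomial n × Polynomial n
  k ⊙ (l , r) = k :* l , k :* r

  _⊞_ : ∀ {n} → (g h : Polynomial n × Polynomial n) → Polynomial n × Polynomial n
  (l , r) ⊞ (l′ , r′) = l :+ l′ , r :+ r′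

  infixr 7 _⊙_
  infixl 6 _⊞_

  holds : W.Eqn → Set
  holds (l , r) = l ≈ r

  record Rel (ℓ ℓ′ : Letter) (u v : Edge → ℕ → Carrier) : Set where
    field
      neg : holds (W.neg ℓ ℓ′ u v)
      zer : holds (W.zer ℓ ℓ′ u v)
      cm₁ : ∀ n → holds (W.cm₁ ℓ ℓ′ u v n)
      cm₂ : ∀ n → holds (W.cm₂ ℓ ℓ′ u v n)
      pos : ∀ n → holds (W.pos ℓ ℓ′ u v n)

  private
    t x y 𝑇 : Polynomial 10
    t = var (# 0)
    x = var (# 1)
    y = var (# 2)
    𝑇 = var (# 3)

    -- The index is dropped: by conservation of particles all entries of one relation belong to the
    -- same difference of flows, so three variables for each vector suffice and the environment
    -- selects the index.
    U V : Edge → ℕ → Polynomial 10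
    U idle _ = var (# 4)
    U pend _ = var (# 5)
    U hop _ = var (# 6)
    V idle _ = var (# 7)
    V pend _ = var (# 8)
    V hop _ = var (# 9)

    trivial : Polynomial 10 × Polynomial 10
    trivial = :1 , :1

    module Z = Weights (polynomialOperations 10) t x y :1 :1 :1
    module S = Weights (polynomialOperations 10) t x y 𝑇 :1 :1

    module Goals (ℓ ℓ′ : Letter) (m r : Bool) where
      goalZ goalS : {B : Set} → (Letter → Letter → (u v : Edge → ℕ → Polynomial 10) → B) → B
      goalZ eq = eq ℓ ℓ′ (Z.downUp ℓ ℓ′ m r U) (Z.upDown ℓ ℓ′ m r V)
      goalS eq = eq ℓ ℓ′ (S.downUp ℓ ℓ′ m r U) (S.upDown ℓ ℓ′ m r V)

      Neg Zer Cm₁ Cm₂ Pos : Polynomial 10 × Polynomial 10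
      Neg = Z.neg ℓ ℓ′ U V
      Zer = Z.zer ℓ ℓ′ U V
      Cm₁ = Z.cm₁ ℓ ℓ′ U V 0
      Cm₂ = Z.cm₂ ℓ ℓ′ U V 0
      Pos = Z.pos ℓ ℓ′ U V 0

  module _ {u v : Edge → ℕ → Carrier} where
    private
      values : Carrier → (i h : ℕ) → Vec Carrier 10
      values p i h = τ ∷ ξ ∷ υ ∷ p ∷ u idle i ∷ u pend i ∷ u hop h ∷ v idle i ∷ v pend i ∷ v hop h ∷ []

      neg-env : Vec Carrier 10
      neg-env = values 1# 0 0

      env : ℕ → Vec Carrier 10
      env n = values 1# n (suc n)

      env-suc : ℕ → ℕ → Vec Carrier 10
      env-suc k n = values (T k) n (suc n)

    -- The coefficients of the combinations were found by solving linear systems.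
    step : ∀ ℓ ℓ′ m r → Rel ℓ ℓ′ u v → Rel ℓ ℓ′ (downUp ℓ ℓ′ m r u) (upDown ℓ ℓ′ m r v)
    step unprimed primed false false h = record
      { neg = by neg-env (goalZ Z.neg) (x ⊙ Neg) tt (*-congˡ negₕ)
      ; zer = by (env 0) (goalZ Z.zer) ((:1 :+ x :* y :+ :- (t :* x)) ⊙ Cm₁ ⊞ x ⊙ Cm₂) tt (+-cong (*-congˡ (cm₁ₕ 0)) (*-congˡ (cm₂ₕ 0)))
      ; cm₁ = λ { zero → by (env 0) (goalZ Z.cm₁ 0) (:1 ⊙ Cm₁) tt (*-congˡ (cm₁ₕ 0))
                ; (suc k) → by (env-suc k (suc k)) (goalS S.cm₁ 1) ((t :* 𝑇) ⊙ Cm₁) tt (*-congˡ (cm₁ₕ (suc k))) }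
      ; cm₂ = λ { zero → by (env 0) (goalZ Z.cm₂ 0) ((t :* x) ⊙ Cm₂) tt (*-congˡ (cm₂ₕ 0))
                ; (suc k) → by (env-suc k (suc k)) (goalS S.cm₂ 1) ((t :* t :* x :* 𝑇) ⊙ Cm₂) tt (*-congˡ (cm₂ₕ (suc k))) }
      ; pos = λ k → by (env-suc k (suc k)) (goalS S.pos 0) ((t :* 𝑇) ⊙ Cm₁) tt (*-congˡ (cm₁ₕ (suc k)))
      }
      where
      open Goals unprimed primed false false
      open Rel h renaming (neg to negₕ; zer to zerₕ; cm₁ to cm₁ₕ; cm₂ to cm₂ₕ; pos to posₕ)
    step unprimed primed false true h = record
      { neg = by neg-env (goalZ Z.neg) trivial tt refl
      ; zer = by neg-env (goalZ Z.zer) (:1 ⊙ Neg) tt (*-congˡ negₕ)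
      ; cm₁ = λ { zero → by neg-env (goalZ Z.cm₁ 0) (:1 ⊙ Neg) tt (*-congˡ negₕ)
                ; (suc k) → by (env-suc k k) (goalS S.cm₁ 1) ((y :* 𝑇) ⊙ Cm₁ ⊞ 𝑇 ⊙ Cm₂) tt (+-cong (*-congˡ (cm₁ₕ k)) (*-congˡ (cm₂ₕ k))) }
      ; cm₂ = λ { zero → by neg-env (goalZ Z.cm₂ 0) trivial tt refl
                ; (suc k) → by (env-suc k k) (goalS S.cm₂ 1) trivial tt refl }
      ; pos = λ k → by (env-suc k k) (goalS S.pos 0) ((y :* 𝑇) ⊙ Cm₁ ⊞ 𝑇 ⊙ Cm₂) tt (+-cong (*-congˡ (cm₁ₕ k)) (*-congˡ (cm₂ₕ k)))
      }
      where
      open Goals unprimed primed false true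
      open Rel h renaming (neg to negₕ; zer to zerₕ; cm₁ to cm₁ₕ; cm₂ to cm₂ₕ; pos to posₕ)
    step unprimed primed true false h = record
      { neg = by (env 0) (goalZ Z.neg) (x ⊙ Zer) tt (*-congˡ zerₕ)
      ; zer = by (env 1) (goalZ Z.zer) (x ⊙ Cm₂ ⊞ (:1 :+ x :* y :+ :- (t :* x)) ⊙ Pos) tt (+-cong (*-congˡ (cm₂ₕ 1)) (*-congˡ (posₕ 0)))
      ; cm₁ = λ { zero → by (env 1) (goalZ Z.cm₁ 0) (:1 ⊙ Pos) tt (*-congˡ (posₕ 0))
                ; (suc k) → by (env-suc k (suc (suc k))) (goalS S.cm₁ 1) ((t :* 𝑇) ⊙ Pos) tt (*-congˡ (posₕ (suc k))) }
      ; cm₂ = λ { zero → by (env 1) (goalZ Z.cm₂ 0) ((t :* x) ⊙ Cm₂) tt (*-congˡ (cm₂ₕ 1))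
                ; (suc k) → by (env-suc k (suc (suc k))) (goalS S.cm₂ 1) ((t :* t :* x :* 𝑇) ⊙ Cm₂) tt (*-congˡ (cm₂ₕ (suc (suc k)))) }
      ; pos = λ k → by (env-suc k (suc (suc k))) (goalS S.pos 0) ((t :* 𝑇) ⊙ Pos) tt (*-congˡ (posₕ (suc k)))
      }
      where
      open Goals unprimed primed true false
      open Rel h renaming (neg to negₕ; zer to zerₕ; cm₁ to cm₁ₕ; cm₂ to cm₂ₕ; pos to posₕ)
    step unprimed primed true true h = record
      { neg = by neg-env (goalZ Z.neg) trivial tt refl
      ; zer = by (env 0) (goalZ Z.zer) (:1 ⊙ Zer) tt (*-congˡ zerₕ)
      ; cm₁ = λ { zero → by (env 0) (goalZ Z.cm₁ 0) (:1 ⊙ Zer) tt (*-congˡ zerₕ)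
                ; (suc k) → by (env-suc k (suc k)) (goalS S.cm₁ 1) (𝑇 ⊙ Cm₂ ⊞ (y :* 𝑇) ⊙ Pos) tt (+-cong (*-congˡ (cm₂ₕ (suc k))) (*-congˡ (posₕ k))) }
      ; cm₂ = λ { zero → by (env 0) (goalZ Z.cm₂ 0) trivial tt refl
                ; (suc k) → by (env-suc k (suc k)) (goalS S.cm₂ 1) trivial tt refl }
      ; pos = λ k → by (env-suc k (suc k)) (goalS S.pos 0) (𝑇 ⊙ Cm₂ ⊞ (y :* 𝑇) ⊙ Pos) tt (+-cong (*-congˡ (cm₂ₕ (suc k))) (*-congˡ (posₕ k)))
      }
      where
      open Goals unprimed primed true true
      open Rel h renaming (neg to negₕ; zer to zerₕ; cm₁ to cm₁ₕ; cm₂ to cm₂ₕ; pos to posₕ)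
    step unprimed unprimed false false h = record
      { neg = by neg-env (goalZ Z.neg) (x ⊙ Neg) tt (*-congˡ negₕ)
      ; zer = by (env 0) (goalZ Z.zer) (:1 ⊙ Zer) tt (*-congˡ zerₕ)
      ; cm₁ = λ { zero → by (env 0) (goalZ Z.cm₁ 0) trivial tt refl
                ; (suc k) → by (env-suc k (suc k)) (goalS S.cm₁ 1) trivial tt refl }
      ; cm₂ = λ { zero → by (env 0) (goalZ Z.cm₂ 0) (x ⊙ Cm₁ ⊞ (x :* y) ⊙ Cm₂ ⊞ (:1 :+ :- (t :* x)) ⊙ Zer) tt (+-cong (+-cong (*-congˡ (cm₁ₕ 0)) (*-congˡ (cm₂ₕ 0))) (*-congˡ zerₕ))
                ; (suc k) → by (env-suc k (suc k)) (goalS S.cm₂ 1) (𝑇 ⊙ Cm₁ ⊞ (t :* x :* y :* 𝑇) ⊙ Cm₂ ⊞ (y :* 𝑇 :+ :- (t :* x :* y :* 𝑇)) ⊙ Pos) tt (+-cong (+-cong (*-congˡ (cm₁ₕ (suc k))) (*-congˡ (cm₂ₕ (suc k)))) (*-congˡ (posₕ k))) }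
      ; pos = λ k → by (env-suc k (suc k)) (goalS S.pos 0) (𝑇 ⊙ Cm₁ ⊞ (y :* 𝑇) ⊙ Pos) tt (+-cong (*-congˡ (cm₁ₕ (suc k))) (*-congˡ (posₕ k)))
      }
      where
      open Goals unprimed unprimed false false
      open Rel h renaming (neg to negₕ; zer to zerₕ; cm₁ to cm₁ₕ; cm₂ to cm₂ₕ; pos to posₕ)
    step unprimed unprimed false true h = record
      { neg = by neg-env (goalZ Z.neg) trivial tt refl
      ; zer = by neg-env (goalZ Z.zer) (:1 ⊙ Neg) tt (*-congˡ negₕ)
      ; cm₁ = λ { zero → by neg-env (goalZ Z.cm₁ 0) trivial tt refl
                ; (suc k) → by (env-suc k k) (goalS S.cm₁ 1) trivial tt refl }
      ; cm₂ = λ { zero → by neg-env (goalZ Z.cm₂ 0) (:1 ⊙ Neg) tt (*-congˡ negₕ)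
                ; (suc k) → by (env-suc k k) (goalS S.cm₂ 1) (𝑇 ⊙ Cm₁ ⊞ (y :* 𝑇) ⊙ Cm₂) tt (+-cong (*-congˡ (cm₁ₕ k)) (*-congˡ (cm₂ₕ k))) }
      ; pos = λ k → by (env-suc k k) (goalS S.pos 0) (𝑇 ⊙ Cm₁ ⊞ (y :* 𝑇) ⊙ Cm₂) tt (+-cong (*-congˡ (cm₁ₕ k)) (*-congˡ (cm₂ₕ k)))
      }
      where
      open Goals unprimed unprimed false true
      open Rel h renaming (neg to negₕ; zer to zerₕ; cm₁ to cm₁ₕ; cm₂ to cm₂ₕ; pos to posₕ)
    step unprimed unprimed true false h = record
      { neg = by (env 0) (goalZ Z.neg) (x ⊙ Cm₂) tt (*-congˡ (cm₂ₕ 0))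
      ; zer = by (env 1) (goalZ Z.zer) (:1 ⊙ Pos) tt (*-congˡ (posₕ 0))
      ; cm₁ = λ { zero → by (env 1) (goalZ Z.cm₁ 0) trivial tt refl
                ; (suc k) → by (env-suc k (suc (suc k))) (goalS S.cm₁ 1) trivial tt refl }
      ; cm₂ = λ { zero → by (env 1) (goalZ Z.cm₂ 0) ((t :* x) ⊙ Cm₂ ⊞ (:1 :+ :- (t :* x)) ⊙ Pos) tt (+-cong (*-congˡ (cm₂ₕ 1)) (*-congˡ (posₕ 0)))
                ; (suc k) → by (env-suc k (suc (suc k))) (goalS S.cm₂ 1) ((t :* t :* x :* 𝑇) ⊙ Cm₂ ⊞ (t :* 𝑇 :+ :- (t :* t :* x :* 𝑇)) ⊙ Pos) tt (+-cong (*-congˡ (cm₂ₕ (suc (suc k)))) (*-congˡ (posₕ (suc k)))) }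
      ; pos = λ k → by (env-suc k (suc (suc k))) (goalS S.pos 0) ((t :* 𝑇) ⊙ Pos) tt (*-congˡ (posₕ (suc k)))
      }
      where
      open Goals unprimed unprimed true false
      open Rel h renaming (neg to negₕ; zer to zerₕ; cm₁ to cm₁ₕ; cm₂ to cm₂ₕ; pos to posₕ)
    step unprimed unprimed true true h = record
      { neg = by neg-env (goalZ Z.neg) trivial tt refl
      ; zer = by (env 0) (goalZ Z.zer) (:1 ⊙ Cm₂) tt (*-congˡ (cm₂ₕ 0))
      ; cm₁ = λ { zero → by (env 0) (goalZ Z.cm₁ 0) trivial tt refl
                ; (suc k) → by (env-suc k (suc k)) (goalS S.cm₁ 1) trivial tt refl }
      ; cm₂ = λ { zero → by (env 0) (goalZ Z.cm₂ 0) (:1 ⊙ Cm₂) tt (*-congˡ (cm₂ₕ 0))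
                ; (suc k) → by (env-suc k (suc k)) (goalS S.cm₂ 1) ((t :* 𝑇) ⊙ Cm₂) tt (*-congˡ (cm₂ₕ (suc k))) }
      ; pos = λ k → by (env-suc k (suc k)) (goalS S.pos 0) ((t :* 𝑇) ⊙ Cm₂) tt (*-congˡ (cm₂ₕ (suc k)))
      }
      where
      open Goals unprimed unprimed true true
      open Rel h renaming (neg to negₕ; zer to zerₕ; cm₁ to cm₁ₕ; cm₂ to cm₂ₕ; pos to posₕ)
    step primed unprimed false false h = record
      { neg = by neg-env (goalZ Z.neg) trivial tt refl
      ; zer = by (env 0) (goalZ Z.zer) (:1 ⊙ Zer) tt (*-congˡ zerₕ)
      ; cm₁ = λ { zero → by (env 0) (goalZ Z.cm₁ 0) trivial tt refl
                ; (suc k) → by (env-suc k (suc k)) (goalS S.cm₁ 1) trivial tt refl }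
      ; cm₂ = λ { zero → by (env 0) (goalZ Z.cm₂ 0) ((:1 :+ x :* y :+ :- (t :* x)) ⊙ Zer) tt (*-congˡ zerₕ)
                ; (suc k) → by (env-suc k (suc k)) (goalS S.cm₂ 1) ((𝑇 :+ x :* y :* 𝑇 :+ :- (t :* x :* 𝑇)) ⊙ Cm₁ ⊞ (y :* 𝑇) ⊙ Pos) tt (+-cong (*-congˡ (cm₁ₕ (suc k))) (*-congˡ (posₕ k))) }
      ; pos = λ k → by (env-suc k (suc k)) (goalS S.pos 0) ((𝑇 :+ x :* y :* 𝑇 :+ :- (t :* x :* 𝑇)) ⊙ Cm₁ ⊞ (y :* 𝑇) ⊙ Pos) tt (+-cong (*-congˡ (cm₁ₕ (suc k))) (*-congˡ (posₕ k)))
      }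
      where
      open Goals primed unprimed false false
      open Rel h renaming (neg to negₕ; zer to zerₕ; cm₁ to cm₁ₕ; cm₂ to cm₂ₕ; pos to posₕ)
    step primed unprimed false true h = record
      { neg = by neg-env (goalZ Z.neg) trivial tt refl
      ; zer = by neg-env (goalZ Z.zer) (:1 ⊙ Neg) tt (*-congˡ negₕ)
      ; cm₁ = λ { zero → by neg-env (goalZ Z.cm₁ 0) trivial tt refl
                ; (suc k) → by (env-suc k k) (goalS S.cm₁ 1) trivial tt refl }
      ; cm₂ = λ { zero → by neg-env (goalZ Z.cm₂ 0) ((:1 :+ x :* y :+ :- (t :* x)) ⊙ Neg) tt (*-congˡ negₕ)
                ; (suc k) → by (env-suc k k) (goalS S.cm₂ 1) ((𝑇 :+ x :* y :* 𝑇 :+ :- (t :* x :* 𝑇)) ⊙ Cm₁ ⊞ (y :* 𝑇) ⊙ Cm₂) tt (+-cong (*-congˡ (cm₁ₕ k)) (*-congˡ (cm₂ₕ k))) }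
      ; pos = λ k → by (env-suc k k) (goalS S.pos 0) ((𝑇 :+ x :* y :* 𝑇 :+ :- (t :* x :* 𝑇)) ⊙ Cm₁ ⊞ (y :* 𝑇) ⊙ Cm₂) tt (+-cong (*-congˡ (cm₁ₕ k)) (*-congˡ (cm₂ₕ k)))
      }
      where
      open Goals primed unprimed false true
      open Rel h renaming (neg to negₕ; zer to zerₕ; cm₁ to cm₁ₕ; cm₂ to cm₂ₕ; pos to posₕ)
    step primed unprimed true false h = record
      { neg = by (env 0) (goalZ Z.neg) (x ⊙ Zer) tt (*-congˡ zerₕ)
      ; zer = by (env 1) (goalZ Z.zer) (x ⊙ Cm₁ ⊞ (:1) ⊙ Pos) tt (+-cong (*-congˡ (cm₁ₕ 1)) (*-congˡ (posₕ 0)))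
      ; cm₁ = λ { zero → by (env 1) (goalZ Z.cm₁ 0) ((t :* x) ⊙ Cm₁) tt (*-congˡ (cm₁ₕ 1))
                ; (suc k) → by (env-suc k (suc (suc k))) (goalS S.cm₁ 1) ((t :* t :* x :* 𝑇) ⊙ Cm₁) tt (*-congˡ (cm₁ₕ (suc (suc k)))) }
      ; cm₂ = λ { zero → by (env 1) (goalZ Z.cm₂ 0) (:1 ⊙ Pos) tt (*-congˡ (posₕ 0))
                ; (suc k) → by (env-suc k (suc (suc k))) (goalS S.cm₂ 1) ((t :* 𝑇) ⊙ Pos) tt (*-congˡ (posₕ (suc k))) }
      ; pos = λ k → by (env-suc k (suc (suc k))) (goalS S.pos 0) ((t :* 𝑇) ⊙ Pos) tt (*-congˡ (posₕ (suc k)))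
      }
      where
      open Goals primed unprimed true false
      open Rel h renaming (neg to negₕ; zer to zerₕ; cm₁ to cm₁ₕ; cm₂ to cm₂ₕ; pos to posₕ)
    step primed unprimed true true h = record
      { neg = by neg-env (goalZ Z.neg) (x ⊙ Neg) tt (*-congˡ negₕ)
      ; zer = by (env 0) (goalZ Z.zer) (x ⊙ Cm₁ ⊞ (:1) ⊙ Cm₂) tt (+-cong (*-congˡ (cm₁ₕ 0)) (*-congˡ (cm₂ₕ 0)))
      ; cm₁ = λ { zero → by (env 0) (goalZ Z.cm₁ 0) ((t :* x) ⊙ Cm₁) tt (*-congˡ (cm₁ₕ 0))
                ; (suc k) → by (env-suc k (suc k)) (goalS S.cm₁ 1) ((t :* t :* x :* 𝑇) ⊙ Cm₁) tt (*-congˡ (cm₁ₕ (suc k))) }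
      ; cm₂ = λ { zero → by (env 0) (goalZ Z.cm₂ 0) (:1 ⊙ Cm₂) tt (*-congˡ (cm₂ₕ 0))
                ; (suc k) → by (env-suc k (suc k)) (goalS S.cm₂ 1) ((t :* 𝑇) ⊙ Cm₂) tt (*-congˡ (cm₂ₕ (suc k))) }
      ; pos = λ k → by (env-suc k (suc k)) (goalS S.pos 0) ((t :* 𝑇) ⊙ Cm₂) tt (*-congˡ (cm₂ₕ (suc k)))
      }
      where
      open Goals primed unprimed true true
      open Rel h renaming (neg to negₕ; zer to zerₕ; cm₁ to cm₁ₕ; cm₂ to cm₂ₕ; pos to posₕ)
    step primed primed false false h = record
      { neg = by neg-env (goalZ Z.neg) trivial tt refl
      ; zer = by (env 0) (goalZ Z.zer) ((:1 :+ :- (t :* x)) ⊙ Cm₁) tt (*-congˡ (cm₁ₕ 0))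
      ; cm₁ = λ { zero → by (env 0) (goalZ Z.cm₁ 0) (:1 ⊙ Cm₁) tt (*-congˡ (cm₁ₕ 0))
                ; (suc k) → by (env-suc k (suc k)) (goalS S.cm₁ 1) ((t :* 𝑇) ⊙ Cm₁) tt (*-congˡ (cm₁ₕ (suc k))) }
      ; cm₂ = λ { zero → by (env 0) (goalZ Z.cm₂ 0) trivial tt refl
                ; (suc k) → by (env-suc k (suc k)) (goalS S.cm₂ 1) trivial tt refl }
      ; pos = λ k → by (env-suc k (suc k)) (goalS S.pos 0) ((:- (t :* 𝑇) :+ t :* t :* x :* 𝑇) ⊙ Cm₁) tt (*-congˡ (cm₁ₕ (suc k)))
      }
      where
      open Goals primed primed false false
      open Rel h renaming (neg to negₕ; zer to zerₕ; cm₁ to cm₁ₕ; cm₂ to cm₂ₕ; pos to posₕ)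
    step primed primed false true h = record
      { neg = by neg-env (goalZ Z.neg) trivial tt refl
      ; zer = by neg-env (goalZ Z.zer) ((:1 :+ :- (t :* x)) ⊙ Neg) tt (*-congˡ negₕ)
      ; cm₁ = λ { zero → by neg-env (goalZ Z.cm₁ 0) (:1 ⊙ Neg) tt (*-congˡ negₕ)
                ; (suc k) → by (env-suc k k) (goalS S.cm₁ 1) ((y :* 𝑇) ⊙ Cm₁ ⊞ 𝑇 ⊙ Cm₂) tt (+-cong (*-congˡ (cm₁ₕ k)) (*-congˡ (cm₂ₕ k))) }
      ; cm₂ = λ { zero → by neg-env (goalZ Z.cm₂ 0) trivial tt refl
                ; (suc k) → by (env-suc k k) (goalS S.cm₂ 1) trivial tt refl }
      ; pos = λ k → by (env-suc k k) (goalS S.pos 0) ((:- (y :* 𝑇) :+ t :* x :* y :* 𝑇) ⊙ Cm₁ ⊞ (:- 𝑇 :+ t :* x :* 𝑇) ⊙ Cm₂) tt (+-cong (*-congˡ (cm₁ₕ k)) (*-congˡ (cm₂ₕ k)))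
      }
      where
      open Goals primed primed false true
      open Rel h renaming (neg to negₕ; zer to zerₕ; cm₁ to cm₁ₕ; cm₂ to cm₂ₕ; pos to posₕ)
    step primed primed true false h = record
      { neg = by (env 0) (goalZ Z.neg) (x ⊙ Cm₁) tt (*-congˡ (cm₁ₕ 0))
      ; zer = by (env 1) (goalZ Z.zer) ((:- (:1)) ⊙ Pos) tt (*-congˡ (posₕ 0))
      ; cm₁ = λ { zero → by (env 1) (goalZ Z.cm₁ 0) ((t :* x) ⊙ Cm₁ ⊞ (:- (:1)) ⊙ Pos) tt (+-cong (*-congˡ (cm₁ₕ 1)) (*-congˡ (posₕ 0)))
                ; (suc k) → by (env-suc k (suc (suc k))) (goalS S.cm₁ 1) ((t :* t :* x :* 𝑇) ⊙ Cm₁ ⊞ (:- (t :* 𝑇)) ⊙ Pos) tt (+-cong (*-congˡ (cm₁ₕ (suc (suc k)))) (*-congˡ (posₕ (suc k)))) }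
      ; cm₂ = λ { zero → by (env 1) (goalZ Z.cm₂ 0) trivial tt refl
                ; (suc k) → by (env-suc k (suc (suc k))) (goalS S.cm₂ 1) trivial tt refl }
      ; pos = λ k → by (env-suc k (suc (suc k))) (goalS S.pos 0) ((t :* 𝑇) ⊙ Pos) tt (*-congˡ (posₕ (suc k)))
      }
      where
      open Goals primed primed true false
      open Rel h renaming (neg to negₕ; zer to zerₕ; cm₁ to cm₁ₕ; cm₂ to cm₂ₕ; pos to posₕ)
    step primed primed true true h = record
      { neg = by neg-env (goalZ Z.neg) (x ⊙ Neg) tt (*-congˡ negₕ)
      ; zer = by (env 0) (goalZ Z.zer) ((:- (x)) ⊙ Cm₂ ⊞ (:1) ⊙ Zer) tt (+-cong (*-congˡ (cm₂ₕ 0)) (*-congˡ zerₕ))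
      ; cm₁ = λ { zero → by (env 0) (goalZ Z.cm₁ 0) ((x :* y) ⊙ Cm₁ ⊞ (:1) ⊙ Zer) tt (+-cong (*-congˡ (cm₁ₕ 0)) (*-congˡ zerₕ))
                ; (suc k) → by (env-suc k (suc k)) (goalS S.cm₁ 1) ((t :* x :* y :* 𝑇) ⊙ Cm₁ ⊞ 𝑇 ⊙ Cm₂ ⊞ (:- (y :* 𝑇)) ⊙ Pos) tt (+-cong (+-cong (*-congˡ (cm₁ₕ (suc k))) (*-congˡ (cm₂ₕ (suc k)))) (*-congˡ (posₕ k))) }
      ; cm₂ = λ { zero → by (env 0) (goalZ Z.cm₂ 0) trivial tt refl
                ; (suc k) → by (env-suc k (suc k)) (goalS S.cm₂ 1) trivial tt refl }
      ; pos = λ k → by (env-suc k (suc k)) (goalS S.pos 0) ((:- 𝑇 :+ t :* x :* 𝑇) ⊙ Cm₂ ⊞ (y :* 𝑇) ⊙ Pos) tt (+-cong (*-congˡ (cm₂ₕ (suc k))) (*-congˡ (posₕ k)))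
      }
      where
      open Goals primed primed true true
      open Rel h renaming (neg to negₕ; zer to zerₕ; cm₁ to cm₁ₕ; cm₂ to cm₂ₕ; pos to posₕ)

  private
    module _ where
      t₅ x₅ y₅ 𝑇₅ 𝑌₅ 𝐸₅ : Polynomial 6
      t₅ = var (# 0)
      x₅ = var (# 1)
      y₅ = var (# 2)
      𝑇₅ = var (# 3)
      𝑌₅ = var (# 4)
      𝐸₅ = var (# 5)

    module Z₅ = Weights (polynomialOperations 6) t₅ x₅ y₅ :1 :1 :1
    module S₅ = Weights (polynomialOperations 6) t₅ x₅ y₅ 𝑇₅ 𝑌₅ 𝐸₅

    module _ (κ : Kind) (ℓ ℓ′ : Letter) (m r : Bool) where
      goalZ₅ goalS₅ : {B : Set} → (Letter → Letter → (u v : Edge → ℕ → Polynomial 6) → B) → B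
      goalZ₅ eq = eq ℓ ℓ′ (Z₅.baseDownUp (Z₅.lhsUp κ ℓ ℓ′) (Z₅.lhsDown κ ℓ ℓ′) m r)
                          (Z₅.baseUpDown (Z₅.rhsUp κ ℓ ℓ′) (Z₅.rhsDown κ ℓ ℓ′) m r)
      goalS₅ eq = eq ℓ ℓ′ (S₅.baseDownUp (S₅.lhsUp κ ℓ ℓ′) (S₅.lhsDown κ ℓ ℓ′) m r)
                          (S₅.baseUpDown (S₅.rhsUp κ ℓ ℓ′) (S₅.rhsDown κ ℓ ℓ′) m r)

      allValid : Set
      allValid = valid (goalZ₅ Z₅.neg) × valid (goalZ₅ Z₅.zer)
        × valid (goalZ₅ Z₅.cm₁ 0) × valid (goalS₅ S₅.cm₁ 1)
        × valid (goalZ₅ Z₅.cm₂ 0) × valid (goalS₅ S₅.cm₂ 1) × valid (goalS₅ S₅.pos 0)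

    at₀ : Vec Carrier 6
    at₀ = τ ∷ ξ ∷ υ ∷ 1# ∷ 1# ∷ 1# ∷ []

    at-suc : ℕ → Vec Carrier 6
    at-suc k = τ ∷ ξ ∷ υ ∷ T k ∷ Y k ∷ E k ∷ []

    Raw : ∀ (κ : Kind) (ℓ ℓ′ : Letter) (m r : Bool) → Set
    Raw κ ℓ ℓ′ m r =
      ⟦ goalZ₅ κ ℓ ℓ′ m r Z₅.neg ⟧ₑ at₀ × ⟦ goalZ₅ κ ℓ ℓ′ m r Z₅.zer ⟧ₑ at₀ ×
      ⟦ goalZ₅ κ ℓ ℓ′ m r Z₅.cm₁ 0 ⟧ₑ at₀ × (∀ k → ⟦ goalS₅ κ ℓ ℓ′ m r S₅.cm₁ 1 ⟧ₑ (at-suc k)) ×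
      ⟦ goalZ₅ κ ℓ ℓ′ m r Z₅.cm₂ 0 ⟧ₑ at₀ × (∀ k → ⟦ goalS₅ κ ℓ ℓ′ m r S₅.cm₂ 1 ⟧ₑ (at-suc k)) ×
      (∀ k → ⟦ goalS₅ κ ℓ ℓ′ m r S₅.pos 0 ⟧ₑ (at-suc k))

    raw : ∀ κ ℓ ℓ′ m r → allValid κ ℓ ℓ′ m r → Raw κ ℓ ℓ′ m r
    raw κ ℓ ℓ′ m r (neg , zer , cm₁0 , cm₁s , cm₂0 , cm₂s , pos) =
      valid-sound (goalZ₅ κ ℓ ℓ′ m r Z₅.neg) neg at₀ , valid-sound (goalZ₅ κ ℓ ℓ′ m r Z₅.zer) zer at₀ ,
      valid-sound (goalZ₅ κ ℓ ℓ′ m r Z₅.cm₁ 0) cm₁0 at₀ ,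
      (λ k → valid-sound (goalS₅ κ ℓ ℓ′ m r S₅.cm₁ 1) cm₁s (at-suc k)) ,
      valid-sound (goalZ₅ κ ℓ ℓ′ m r Z₅.cm₂ 0) cm₂0 at₀ ,
      (λ k → valid-sound (goalS₅ κ ℓ ℓ′ m r S₅.cm₂ 1) cm₂s (at-suc k)) ,
      (λ k → valid-sound (goalS₅ κ ℓ ℓ′ m r S₅.pos 0) pos (at-suc k))

  Rel₀ : ∀ (ℓ ℓ′ : Letter) (u v : Edge → ℕ → Carrier) → Set
  Rel₀ ℓ ℓ′ u v = holds (W.neg ℓ ℓ′ u v) × holds (W.zer ℓ ℓ′ u v) ×
    holds (W.cm₁ ℓ ℓ′ u v 0) × (∀ k → holds (W.cm₁ ℓ ℓ′ u v (suc k))) ×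
    holds (W.cm₂ ℓ ℓ′ u v 0) × (∀ k → holds (W.cm₂ ℓ ℓ′ u v (suc k))) ×
    (∀ k → holds (W.pos ℓ ℓ′ u v k))

  toRel : ∀ {ℓ ℓ′ u v} → Rel₀ ℓ ℓ′ u v → Rel ℓ ℓ′ u v
  toRel (neg , zer , cm₁0 , cm₁s , cm₂0 , cm₂s , pos) = record
    { neg = neg ; zer = zer ; pos = pos
    ; cm₁ = λ { zero → cm₁0 ; (suc k) → cm₁s k } ; cm₂ = λ { zero → cm₂0 ; (suc k) → cm₂s k } }

  -- On the last site all weights are explicit, so every relation is a plain polynomial identity.
  -- The normal forms compute only for concrete letters and bits; in each listed case the
  -- certificates reduce to unit types and `_` is solved.
  base₀ : ∀ κ ℓ ℓ′ m r → Rel₀ ℓ ℓ′ (baseDownUp (lhsUp κ ℓ ℓ′) (lhsDown κ ℓ ℓ′) m r)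
                                   (baseUpDown (rhsUp κ ℓ ℓ′) (rhsDown κ ℓ ℓ′) m r)
  base₀ 𝒬 unprimed unprimed false false = raw 𝒬 unprimed unprimed false false _
  base₀ 𝒬 unprimed unprimed false true = raw 𝒬 unprimed unprimed false true _
  base₀ 𝒬 unprimed unprimed true false = raw 𝒬 unprimed unprimed true false _
  base₀ 𝒬 unprimed unprimed true true = raw 𝒬 unprimed unprimed true true _
  base₀ 𝒬 unprimed primed false false = raw 𝒬 unprimed primed false false _
  base₀ 𝒬 unprimed primed false true = raw 𝒬 unprimed primed false true _
  base₀ 𝒬 unprimed primed true false = raw 𝒬 unprimed primed true false _
  base₀ 𝒬 unprimed primed true true = raw 𝒬 unprimed primed true true _
  base₀ 𝒬 primed unprimed false false = raw 𝒬 primed unprimed false false _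
  base₀ 𝒬 primed unprimed false true = raw 𝒬 primed unprimed false true _
  base₀ 𝒬 primed unprimed true false = raw 𝒬 primed unprimed true false _
  base₀ 𝒬 primed unprimed true true = raw 𝒬 primed unprimed true true _
  base₀ 𝒬 primed primed false false = raw 𝒬 primed primed false false _
  base₀ 𝒬 primed primed false true = raw 𝒬 primed primed false true _
  base₀ 𝒬 primed primed true false = raw 𝒬 primed primed true false _
  base₀ 𝒬 primed primed true true = raw 𝒬 primed primed true true _
  base₀ 𝒫 unprimed unprimed false false = raw 𝒫 unprimed unprimed false false _
  base₀ 𝒫 unprimed unprimed false true = raw 𝒫 unprimed unprimed false true _
  base₀ 𝒫 unprimed unprimed true false = raw 𝒫 unprimed unprimed true false _
  base₀ 𝒫 unprimed unprimed true true = raw 𝒫 unprimed unprimed true true _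
  base₀ 𝒫 unprimed primed false false = raw 𝒫 unprimed primed false false _
  base₀ 𝒫 unprimed primed false true = raw 𝒫 unprimed primed false true _
  base₀ 𝒫 unprimed primed true false = raw 𝒫 unprimed primed true false _
  base₀ 𝒫 unprimed primed true true = raw 𝒫 unprimed primed true true _
  base₀ 𝒫 primed unprimed false false = raw 𝒫 primed unprimed false false _
  base₀ 𝒫 primed unprimed false true = raw 𝒫 primed unprimed false true _
  base₀ 𝒫 primed unprimed true false = raw 𝒫 primed unprimed true false _
  base₀ 𝒫 primed unprimed true true = raw 𝒫 primed unprimed true true _
  base₀ 𝒫 primed primed false false = raw 𝒫 primed primed false false _
  base₀ 𝒫 primed primed false true = raw 𝒫 primed primed false true _
  base₀ 𝒫 primed primed true false = raw 𝒫 primed primed true false _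
  base₀ 𝒫 primed primed true true = raw 𝒫 primed primed true true _

  base : ∀ κ ℓ ℓ′ m r → Rel ℓ ℓ′ (baseDownUp (lhsUp κ ℓ ℓ′) (lhsDown κ ℓ ℓ′) m r)
                                 (baseUpDown (rhsUp κ ℓ ℓ′) (rhsDown κ ℓ ℓ′) m r)
  base κ ℓ ℓ′ m r = toRel (base₀ κ ℓ ℓ′ m r)

-- A strict partition with parts at most L is encoded by the indicator vector of its set of parts, in
-- decreasing order.
configs : ∀ L → List (Vec Bool L)
configs zero = [] ∷ []
configs (suc L) = map (false ∷_) (configs L) ++ map (true ∷_) (configs L)

clear : ∀ {L} → ℕ → Vec Bool L → Bool
clear zero w = true
clear (suc k) [] = false
clear (suc k) (b ∷ w) = not b ∧ clear k w

clear-suffix : ∀ {L} k j (w : Vec Bool L) → clear (k ℕ.+ j) w ≡ true → clear j w ≡ true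
clear-suffix k zero w h = ≡.refl
clear-suffix zero (suc j) w h = h
clear-suffix (suc k) (suc j) (false ∷ w) h = clear-suffix′ k j w h
  where
  clear-suffix′ : ∀ {L} k j (w : Vec Bool L) → clear (k ℕ.+ suc j) w ≡ true → clear j w ≡ true
  clear-suffix′ k j w h = clear-suffix (suc k) j w (subst (λ i → clear i w ≡ true) (ℕP.+-suc k j) h)

-- Row operators on shapes with bounded parts.

module Kernels (R : CommutativeRing 0ℓ 0ℓ) (t : CommutativeRing.Carrier R) where
  open CommutativeRing R hiding (zero)
  open FiniteSums R
  open import Relation.Binary.Reasoning.Setoid setoid
  open import Algebra.Properties.CommutativeSemigroup *-commutativeSemigroup using (interchange; x∙yz≈y∙xz)
  private
    module Up = UpWeights (ringOperations R) t
    module Down y = DownWeights (ringOperations R) t y 1# 1# 1#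
  open UpWeights (ringOperations R) t 0# using (UpBase; close)
  open DownWeights (ringOperations R) t 0# 1# 1# 1# using (DownBase; closeDown)

  -- The base `B` stands for the last site together with the edge after it. Keeping it arbitrary
  -- separates the boundary condition at the diagonal, which the exchanges change, from the bulk,
  -- which they do not.
  upKernel : Carrier → Letter → UpBase → ∀ {L} → Vec Bool (suc L) → Vec Bool (suc L) → Edge → Carrier
  upKernel x ℓ B {zero} (m ∷ []) (l ∷ []) e = B m l e
  upKernel x ℓ B {suc L} (m ∷ μ) (l ∷ λ′) e = close (Up.up x ℓ m l e) (upKernel x ℓ B μ λ′)

  downKernel : Carrier → Letter → DownBase → ∀ {L} → Vec Bool (suc L) → Vec Bool (suc L) → ℕ → Carrier
  downKernel y ℓ B {zero} (l ∷ []) (r ∷ []) n = B l r n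
  downKernel y ℓ B {suc L} (l ∷ λ′) (r ∷ ρ) n = closeDown (Down.down y ℓ l r n) (downKernel y ℓ B λ′ ρ)

  Vector : ℕ → Set
  Vector L = Vec Bool (suc L) → Carrier

  module _ {L : ℕ} where
    raise : Carrier → Letter → UpBase → Vector L → Vector L
    raise x ℓ B φ λ′ = ∑ (configs (suc L)) (λ μ → φ μ * upKernel x ℓ B μ λ′ idle)

    lower : Carrier → Letter → DownBase → Vector L → Vector L
    lower y ℓ B φ ρ = ∑ (configs (suc L)) (λ λ′ → φ λ′ * downKernel y ℓ B λ′ ρ 0)

    infix 4 _≋_
    _≋_ : Vector L → Vector L → Set
    φ ≋ ψ = ∀ w → φ w ≈ ψ w

    infixr 7 _∙_
    _∙_ : Carrier → Vector L → Vector L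
    (k ∙ φ) w = k * φ w

    -- The room that a vector leaves below the bound on the parts: raising consumes some of it,
    -- lowering preserves it.
    Supp : ℕ → Vector L → Set
    Supp z φ = ∀ w → clear z w ≡ false → φ w ≈ 0#

    raise-cong : ∀ x ℓ B {φ ψ} → φ ≋ ψ → raise x ℓ B φ ≋ raise x ℓ B ψ
    raise-cong x ℓ B eq w = ∑-cong (configs (suc L)) (λ μ → *-congʳ (eq μ))

    lower-cong : ∀ y ℓ B {φ ψ} → φ ≋ ψ → lower y ℓ B φ ≋ lower y ℓ B ψ
    lower-cong y ℓ B eq w = ∑-cong (configs (suc L)) (λ μ → *-congʳ (eq μ))

    raise-∙ : ∀ x ℓ B k φ → raise x ℓ B (k ∙ φ) ≋ k ∙ raise x ℓ B φ
    raise-∙ x ℓ B k φ w =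
      trans (∑-cong (configs (suc L)) (λ μ → *-assoc _ _ _)) (sym (∑-distribˡ (configs (suc L)) k _))

    lower-∙ : ∀ y ℓ B k φ → lower y ℓ B (k ∙ φ) ≋ k ∙ lower y ℓ B φ
    lower-∙ y ℓ B k φ w =
      trans (∑-cong (configs (suc L)) (λ μ → *-assoc _ _ _)) (sym (∑-distribˡ (configs (suc L)) k _))

    upKernel-scale : ∀ k x ℓ B {L} (μ λ′ : Vec Bool (suc L)) e →
      upKernel x ℓ (λ m l e′ → k * B m l e′) μ λ′ e ≈ k * upKernel x ℓ B μ λ′ e
    upKernel-scale k x ℓ B {zero} (m ∷ []) (l ∷ []) e = refl
    upKernel-scale k x ℓ B {suc L} (m ∷ μ) (l ∷ λ′) e with Up.up x ℓ m l e
    ... | just (p , e′) = trans (*-congˡ (upKernel-scale k x ℓ B μ λ′ e′)) (x∙yz≈y∙xz _ _ _)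
    ... | nothing = sym (zeroʳ k)

    downKernel-scale : ∀ k y ℓ B {L} (λ′ ρ : Vec Bool (suc L)) n →
      downKernel y ℓ (λ l r n′ → k * B l r n′) λ′ ρ n ≈ k * downKernel y ℓ B λ′ ρ n
    downKernel-scale k y ℓ B {zero} (l ∷ []) (r ∷ []) n = refl
    downKernel-scale k y ℓ B {suc L} (l ∷ λ′) (r ∷ ρ) n with Down.down y ℓ l r n
    ... | just (p , n′) = trans (*-congˡ (downKernel-scale k y ℓ B λ′ ρ n′)) (x∙yz≈y∙xz _ _ _)
    ... | nothing = sym (zeroʳ k)

    raise-scale : ∀ k x ℓ B φ → raise x ℓ (λ m l e → k * B m l e) φ ≋ k ∙ raise x ℓ B φ
    raise-scale k x ℓ B φ w = trans
      (∑-cong (configs (suc L)) (λ μ → trans (*-congˡ (upKernel-scale k x ℓ B μ w idle)) (x∙yz≈y∙xz _ _ _)))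
      (sym (∑-distribˡ (configs (suc L)) k _))

    lower-scale : ∀ k y ℓ B φ → lower y ℓ (λ l r n → k * B l r n) φ ≋ k ∙ lower y ℓ B φ
    lower-scale k y ℓ B φ w = trans
      (∑-cong (configs (suc L)) (λ μ → trans (*-congˡ (downKernel-scale k y ℓ B μ w 0)) (x∙yz≈y∙xz _ _ _)))
      (sym (∑-distribˡ (configs (suc L)) k _))

  -- Without flow a part of ρ cannot appear where λ has none. The bound `z ≤ L` keeps the argument
  -- away from the last site, whose base is arbitrary.
  downKernel-clear : ∀ y ℓ B {L} z (λ′ ρ : Vec Bool (suc L)) → z ≤ L →
    clear z λ′ ≡ true → clear z ρ ≡ false → downKernel y ℓ B λ′ ρ 0 ≈ 0#
  downKernel-clear y primed B {suc L} (suc z) (false ∷ λ′) (true ∷ ρ) z≤L h h′ = refl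
  downKernel-clear y unprimed B {suc L} (suc z) (false ∷ λ′) (true ∷ ρ) z≤L h h′ = refl
  downKernel-clear y primed B {suc L} (suc z) (false ∷ λ′) (false ∷ ρ) (s≤s z≤L) h h′ =
    trans (*-identityˡ _) (downKernel-clear y primed B z λ′ ρ z≤L h h′)
  downKernel-clear y unprimed B {suc L} (suc z) (false ∷ λ′) (false ∷ ρ) (s≤s z≤L) h h′ =
    trans (*-identityˡ _) (downKernel-clear y unprimed B z λ′ ρ z≤L h h′)

  lower-supp : ∀ y ℓ B {L} z → z ≤ L → {φ : Vector L} → Supp z φ → Supp z (lower y ℓ B φ)
  lower-supp y ℓ B z z≤L {φ} s ρ h = ∑-zero (configs _) term-zero
    where
    term-zero : ∀ λ′ → φ λ′ * downKernel y ℓ B λ′ ρ 0 ≈ 0#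
    term-zero λ′ with clear z λ′ in eq
    ... | true = trans (*-congˡ (downKernel-clear y ℓ B z λ′ ρ z≤L eq h)) (zeroʳ _)
    ... | false = trans (*-congʳ (s λ′ eq)) (zeroˡ _)

  open import Algebra.Properties.Semiring.Exp semiring using (_^_)

  -- Over an empty site a primed hop dies at once and an unprimed one collects a factor x, so k + 1
  -- empty sites give x to the power k + 1. One more clear site ensures that the hop has not yet
  -- reached the arbitrary base.
  hop-vanish : ∀ x ℓ B k {L} (μ λ′ : Vec Bool (suc L)) → x ^ suc k ≈ 0# →
    clear (suc (suc k)) μ ≡ true → upKernel x ℓ B μ λ′ hop ≈ 0#
  hop-vanish x primed B k {zero} (false ∷ []) λ′ nil ()
  hop-vanish x primed B k {suc L} (false ∷ μ) (false ∷ λ′) nil h = refl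
  hop-vanish x primed B k {suc L} (false ∷ μ) (true ∷ λ′) nil h = refl
  hop-vanish x unprimed B k μ λ′ nil h =
    trans (sym (*-identityˡ _)) (vanish 0 (suc k) μ λ′ nil h)
    where
    vanish : ∀ j k {L} (μ λ′ : Vec Bool (suc L)) → x ^ (j ℕ.+ k) ≈ 0# →
      clear (suc k) μ ≡ true → x ^ j * upKernel x unprimed B μ λ′ hop ≈ 0#
    vanish j zero μ λ′ nil h =
      trans (*-congʳ (trans (reflexive (cong (x ^_) (≡.sym (ℕP.+-identityʳ j)))) nil)) (zeroˡ _)
    vanish j (suc k) {zero} (false ∷ []) λ′ nil ()
    vanish j (suc k) {suc L} (false ∷ μ) (true ∷ λ′) nil h = zeroʳ _
    vanish j (suc k) {suc L} (false ∷ μ) (false ∷ λ′) nil h = begin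
      x ^ j * (x * upKernel x unprimed B μ λ′ hop) ≈⟨ x∙yz≈y∙xz _ _ _ ⟩
      x * (x ^ j * upKernel x unprimed B μ λ′ hop) ≈⟨ *-assoc _ _ _ ⟨
      x ^ suc j * upKernel x unprimed B μ λ′ hop
        ≈⟨ vanish (suc j) k μ λ′ (trans (reflexive (cong (x ^_) (≡.sym (ℕP.+-suc j k)))) nil) h ⟩
      0# ∎

  -- A part of the larger shape among the top z starts a hop that must cross the k + 2 clear sites
  -- beneath them.
  upKernel-clear : ∀ x ℓ B k z {L} (μ λ′ : Vec Bool (suc L)) → x ^ suc k ≈ 0# →
    clear (z ℕ.+ suc (suc k)) μ ≡ true → clear z λ′ ≡ false → upKernel x ℓ B μ λ′ idle ≈ 0#
  upKernel-clear x ℓ B k (suc z) {zero} (false ∷ []) λ′ nil h h′ = absurd z h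
    where
    absurd : ∀ z → clear (z ℕ.+ suc (suc k)) [] ≡ true → upKernel x ℓ B (false ∷ []) λ′ idle ≈ 0#
    absurd zero ()
    absurd (suc z) ()
  upKernel-clear x primed B k (suc z) {suc L} (false ∷ μ) (false ∷ λ′) nil h h′ =
    trans (*-identityˡ _) (upKernel-clear x primed B k z μ λ′ nil h h′)
  upKernel-clear x unprimed B k (suc z) {suc L} (false ∷ μ) (false ∷ λ′) nil h h′ =
    trans (*-identityˡ _) (upKernel-clear x unprimed B k z μ λ′ nil h h′)
  upKernel-clear x primed B k (suc z) {suc L} (false ∷ μ) (true ∷ λ′) nil h h′ =
    trans (*-congˡ (hop-vanish x primed B k μ λ′ nil (clear-suffix z _ μ h))) (zeroʳ _)
  upKernel-clear x unprimed B k (suc z) {suc L} (false ∷ μ) (true ∷ λ′) nil h h′ =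
    trans (*-congˡ (hop-vanish x unprimed B k μ λ′ nil (clear-suffix z _ μ h))) (zeroʳ _)

  raise-supp : ∀ x ℓ B k z {L} → x ^ suc k ≈ 0# → {φ : Vector L} →
    Supp (z ℕ.+ suc (suc k)) φ → Supp z (raise x ℓ B φ)
  raise-supp x ℓ B k z nil {φ} s ρ h = ∑-zero (configs _) term-zero
    where
    term-zero : ∀ μ → φ μ * upKernel x ℓ B μ ρ idle ≈ 0#
    term-zero μ with clear (z ℕ.+ suc (suc k)) μ in eq
    ... | true = trans (*-congˡ (upKernel-clear x ℓ B k z μ ρ nil eq h)) (zeroʳ _)
    ... | false = trans (*-congʳ (s μ eq)) (zeroˡ _)

  module Exchange (x y : Carrier) where
    open Relations R t x y hiding (base; step)
    open Relations R t x y using (base; step)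
    open W using (term; downUp; upDown; baseDownUp; baseUpDown; lhsUp; rhsUp; lhsDown; rhsDown; scale)

    module _ (ℓ ℓ′ : Letter) (U : UpBase) (D : DownBase) where
      downUpKernel upDownKernel : ∀ {L} → Vec Bool (suc L) → Vec Bool (suc L) → Edge → ℕ → Carrier
      downUpKernel {zero} (m ∷ []) (r ∷ []) = baseDownUp U D m r
      downUpKernel {suc L} (m ∷ μ) (r ∷ ρ) = downUp ℓ ℓ′ m r (downUpKernel μ ρ)
      upDownKernel {zero} (m ∷ []) (r ∷ []) = baseUpDown U D m r
      upDownKernel {suc L} (m ∷ μ) (r ∷ ρ) = upDown ℓ ℓ′ m r (upDownKernel μ ρ)

      private
        ∑-term : {S S′ A : Set} (a : Maybe (Carrier × S)) (a′ : Maybe (Carrier × S′))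
          (ks : List A) (f : A → S → Carrier) (f′ : A → S′ → Carrier) (u : S → S′ → Carrier) →
          (∀ s s′ → ∑ ks (λ k → f k s * f′ k s′) ≈ u s s′) →
          ∑ ks (λ k → W.close a (f k) * W.close a′ (f′ k)) ≈ term a a′ u
        ∑-term (just (p , s)) (just (q , s′)) ks f f′ u eq = begin
          ∑ ks (λ k → p * f k s * (q * f′ k s′)) ≈⟨ ∑-cong ks (λ k → interchange _ _ _ _) ⟩
          ∑ ks (λ k → p * q * (f k s * f′ k s′)) ≈⟨ ∑-distribˡ ks _ _ ⟨
          p * q * ∑ ks (λ k → f k s * f′ k s′) ≈⟨ *-congˡ (eq s s′) ⟩
          p * q * u s s′ ∎
        ∑-term (just _) nothing ks f f′ u eq = ∑-zero ks (λ _ → zeroʳ _)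
        ∑-term nothing a′ ks f f′ u eq = ∑-zero ks (λ _ → zeroˡ _)

        closeDown≈close : (a′ : Maybe (Carrier × ℕ)) (f : ℕ → Carrier) → closeDown a′ f ≈ W.close a′ f
        closeDown≈close (just _) f = refl
        closeDown≈close nothing f = refl

      -- The sum over the intermediate shape factors over the sites, because each of its bits enters
      -- one step of either kernel.
      downUpKernel-∑ : ∀ {L} (μ ρ : Vec Bool (suc L)) e n →
        ∑ (configs (suc L)) (λ κ → upKernel x ℓ U μ κ e * downKernel y ℓ′ D κ ρ n) ≈ downUpKernel μ ρ e n
      downUpKernel-∑ {zero} (m ∷ []) (r ∷ []) e n = +-congˡ (+-identityʳ _)
      downUpKernel-∑ {suc L} (m ∷ μ) (r ∷ ρ) e n = trans (∑-++ (map (false ∷_) (configs (suc L))) _ _)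
        (+-cong (part false) (part true))
        where
        part : ∀ l → ∑ (map (l ∷_) (configs (suc L)))
          (λ κ → upKernel x ℓ U (m ∷ μ) κ e * downKernel y ℓ′ D κ (r ∷ ρ) n)
          ≈ term (W.up ℓ m l e) (W.down ℓ′ l r n) (downUpKernel μ ρ)
        part l = trans (∑-map (l ∷_) (configs (suc L)) _) (trans
          (∑-cong (configs (suc L)) (λ κ → *-congˡ (closeDown≈close (W.down ℓ′ l r n) _)))
          (∑-term (W.up ℓ m l e) (W.down ℓ′ l r n) (configs (suc L)) _ _ _ (downUpKernel-∑ μ ρ)))

      upDownKernel-∑ : ∀ {L} (μ ρ : Vec Bool (suc L)) e n →
        ∑ (configs (suc L)) (λ κ → downKernel y ℓ′ D μ κ n * upKernel x ℓ U κ ρ e) ≈ upDownKernel μ ρ e n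
      upDownKernel-∑ {zero} (m ∷ []) (r ∷ []) e n = +-cong (*-comm _ _) (trans (+-identityʳ _) (*-comm _ _))
      upDownKernel-∑ {suc L} (m ∷ μ) (r ∷ ρ) e n = trans (∑-++ (map (false ∷_) (configs (suc L))) _ _)
        (+-cong (part false) (part true))
        where
        part : ∀ l → ∑ (map (l ∷_) (configs (suc L)))
          (λ κ → downKernel y ℓ′ D (m ∷ μ) κ n * upKernel x ℓ U κ (r ∷ ρ) e)
          ≈ term (W.up ℓ l r e) (W.down ℓ′ m l n) (upDownKernel μ ρ)
        part l = trans (∑-map (l ∷_) (configs (suc L)) _) (trans
          (∑-cong (configs (suc L)) (λ κ → trans (*-comm _ _) (*-congˡ (closeDown≈close (W.down ℓ′ m l n) _))))
          (∑-term (W.up ℓ l r e) (W.down ℓ′ m l n) (configs (suc L)) _ _ _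
            (λ s s′ → trans (∑-cong (configs (suc L)) (λ κ → *-comm _ _)) (upDownKernel-∑ μ ρ s s′))))

    module _ (κ : Kind) (ℓ ℓ′ : Letter) where
      private
        U = lhsUp κ ℓ ℓ′
        D = lhsDown κ ℓ ℓ′
        U′ = rhsUp κ ℓ ℓ′
        D′ = rhsDown κ ℓ ℓ′

      kernel-rel : ∀ {L} (μ ρ : Vec Bool (suc L)) →
        Rel ℓ ℓ′ (downUpKernel ℓ ℓ′ U D μ ρ) (upDownKernel ℓ ℓ′ U′ D′ μ ρ)
      kernel-rel {zero} (m ∷ []) (r ∷ []) = base κ ℓ ℓ′ m r
      kernel-rel {suc L} (m ∷ μ) (r ∷ ρ) = step ℓ ℓ′ m r (kernel-rel μ ρ)

      -- The row identity is the relation for an idle edge without flow: `cm₁` or `zer`, according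
      -- to the letters. Both contain the extra entry `u hop 1`, a particle coming from above the
      -- bound; the support of φ and the nilpotency of x serve to remove it.
      exchange : ∀ k {L} → x ^ suc k ≈ 0# → {φ : Vector L} → Supp (suc (suc k)) φ →
        scale ℓ ℓ′ ∙ lower y ℓ′ D (raise x ℓ U φ) ≋ raise x ℓ U′ (lower y ℓ′ D′ φ)
      exchange k {L} nil {φ} s ρ = begin
        scale ℓ ℓ′ * ∑ cs (λ λ′ → ∑ cs (λ μ → φ μ * up′ μ λ′) * dn λ′ ρ)
          ≈⟨ *-congˡ (∑-cong cs (λ λ′ → ∑-distribʳ cs _ _)) ⟩
        scale ℓ ℓ′ * ∑ cs (λ λ′ → ∑ cs (λ μ → φ μ * up′ μ λ′ * dn λ′ ρ))
          ≈⟨ *-congˡ (∑-swap cs cs _) ⟩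
        scale ℓ ℓ′ * ∑ cs (λ μ → ∑ cs (λ λ′ → φ μ * up′ μ λ′ * dn λ′ ρ))
          ≈⟨ ∑-distribˡ cs _ _ ⟩
        ∑ cs (λ μ → scale ℓ ℓ′ * ∑ cs (λ λ′ → φ μ * up′ μ λ′ * dn λ′ ρ))
          ≈⟨ ∑-cong cs column ⟩
        ∑ cs (λ μ → φ μ * ∑ cs (λ κ′ → dn′ μ κ′ * up″ κ′ ρ))
          ≈⟨ ∑-cong cs (λ μ → ∑-distribˡ cs _ _) ⟩
        ∑ cs (λ μ → ∑ cs (λ κ′ → φ μ * (dn′ μ κ′ * up″ κ′ ρ)))
          ≈⟨ ∑-swap cs cs _ ⟩
        ∑ cs (λ κ′ → ∑ cs (λ μ → φ μ * (dn′ μ κ′ * up″ κ′ ρ)))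
          ≈⟨ ∑-cong cs (λ κ′ → trans (∑-cong cs (λ μ → sym (*-assoc _ _ _))) (sym (∑-distribʳ cs _ _))) ⟩
        ∑ cs (λ κ′ → ∑ cs (λ μ → φ μ * dn′ μ κ′) * up″ κ′ ρ) ∎
        where
        cs = configs (suc L)
        up′ up″ dn dn′ : Vec Bool (suc L) → Vec Bool (suc L) → Carrier
        up′ μ λ′ = upKernel x ℓ U μ λ′ idle
        up″ μ λ′ = upKernel x ℓ U′ μ λ′ idle
        dn λ′ ρ = downKernel y ℓ′ D λ′ ρ 0
        dn′ λ′ ρ = downKernel y ℓ′ D′ λ′ ρ 0
        u v : Vec Bool (suc L) → Edge → ℕ → Carrier
        u μ = downUpKernel ℓ ℓ′ U D μ ρ
        v μ = upDownKernel ℓ ℓ′ U′ D′ μ ρ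
        open Rel

        u-hop : ∀ μ → clear (suc (suc k)) μ ≡ true → u μ hop 1 ≈ 0#
        u-hop μ h = trans (sym (downUpKernel-∑ ℓ ℓ′ U D μ ρ hop 1))
          (∑-zero cs (λ λ′ → trans (*-congʳ (hop-vanish x ℓ U k μ λ′ nil h)) (zeroˡ _)))

        top : ∀ ℓ₁ ℓ₂ (p q : Edge → ℕ → Carrier) → Rel ℓ₁ ℓ₂ p q → p hop 1 ≈ 0# →
          scale ℓ₁ ℓ₂ * p idle 0 ≈ q idle 0
        top unprimed primed p q rel h0 = sym (trans (cm₁ rel 0) (trans (+-congˡ h0) (+-identityʳ _)))
        top unprimed unprimed p q rel h0 = sym (trans (zer rel) (trans (+-congˡ h0) (+-identityʳ _)))
        top primed unprimed p q rel h0 =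
          sym (trans (zer rel) (*-congˡ (trans (+-congˡ h0) (+-identityʳ _))))
        top primed primed p q rel h0 = trans (*-identityˡ _)
          (sym (trans (cm₁ rel 0) (trans (+-congˡ h0) (+-identityʳ _))))

        column : ∀ μ → scale ℓ ℓ′ * ∑ cs (λ λ′ → φ μ * up′ μ λ′ * dn λ′ ρ)
          ≈ φ μ * ∑ cs (λ κ′ → dn′ μ κ′ * up″ κ′ ρ)
        column μ with clear (suc (suc k)) μ in eq
        ... | true = begin
          scale ℓ ℓ′ * ∑ cs (λ λ′ → φ μ * up′ μ λ′ * dn λ′ ρ)
            ≈⟨ *-congˡ (trans (∑-cong cs (λ λ′ → *-assoc _ _ _)) (sym (∑-distribˡ cs _ _))) ⟩
          scale ℓ ℓ′ * (φ μ * ∑ cs (λ λ′ → up′ μ λ′ * dn λ′ ρ))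
            ≈⟨ *-congˡ (*-congˡ (downUpKernel-∑ ℓ ℓ′ U D μ ρ idle 0)) ⟩
          scale ℓ ℓ′ * (φ μ * u μ idle 0) ≈⟨ x∙yz≈y∙xz _ _ _ ⟩
          φ μ * (scale ℓ ℓ′ * u μ idle 0)
            ≈⟨ *-congˡ (top ℓ ℓ′ (u μ) (v μ) (kernel-rel μ ρ) (u-hop μ eq)) ⟩
          φ μ * v μ idle 0 ≈⟨ *-congˡ (upDownKernel-∑ ℓ ℓ′ U′ D′ μ ρ idle 0) ⟨
          φ μ * ∑ cs (λ κ′ → dn′ μ κ′ * up″ κ′ ρ) ∎
        ... | false = trans (*-congˡ (∑-zero cs (λ λ′ → trans (*-congʳ (trans (*-congʳ (s μ eq)) (zeroˡ _)))
          (zeroˡ _)))) (trans (zeroʳ _) (sym (trans (*-congʳ (s μ eq)) (zeroˡ _))))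

-- The eigenvector and its pairing with the vector of plane partition sums.

module Cauchy (R : CommutativeRing 0ℓ 0ℓ) (t : CommutativeRing.Carrier R) (κ : Kind)
  (x y : ℕ → CommutativeRing.Carrier R) where
  open CommutativeRing R hiding (zero)
  open FiniteSums R
  open Kernels R t public
  open import Relation.Binary.Reasoning.Setoid setoid
  open import Algebra.Properties.Semiring.Exp semiring using (_^_)
  open import Algebra.Properties.CommutativeSemiring.Exp commutativeSemiring using (^-distrib-*)
  open import Algebra.Properties.Ring ring using (-‿distribʳ-*)
  open IntegerSolver R using (solve; _:=_; _:+_; _:*_; :-_; :1)

  private
    module Up x′ = UpWeights (ringOperations R) t x′
    module Down y′ = DownWeights (ringOperations R) t y′ 1# 1# 1#

  upOp : Letter → Carrier → ∀ {L} → Vector L → Vector L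
  upOp ℓ x′ = raise x′ ℓ (Up.upBase x′ κ ℓ)

  -- `downOp*` is the transpose. Sums over plane partitions are built with it, whereas the exchange
  -- relations concern `downOp`.
  downOp downOp* : Letter → Carrier → ∀ {L} → Vector L → Vector L
  downOp ℓ y′ = lower y′ ℓ (Down.downBase y′ κ ℓ)
  downOp* ℓ y′ {L} ψ λ′ =
    ∑ (configs (suc L)) (λ ρ → downKernel y′ ℓ (Down.downBase y′ κ ℓ) λ′ ρ 0 * ψ ρ)

  vacuum : ∀ {L} → Vector L
  vacuum {L} w = iverson (clear (suc L) w) 1#

  Φ Γ : ℕ → ∀ {L} → Vector L
  Φ zero = vacuum
  Φ (suc i) = upOp unprimed (x i) (upOp primed (x i) (Φ i))
  Γ zero = vacuum
  Γ (suc j) = downOp* unprimed (y j) (downOp* primed (y j) (Γ j))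

  prod : ℕ → (ℕ → Carrier) → Carrier
  prod zero f = 1#
  prod (suc n) f = prod n f * f n

  x-y≈0⇒x≈y : ∀ a a′ → a + - a′ ≈ 0# → a ≈ a′
  x-y≈0⇒x≈y a a′ eq = trans (solve 2 (λ a a′ → a := (a :+ :- a′) :+ a′) refl a a′)
    (trans (+-congʳ eq) (+-identityˡ a′))

  ∑-vacuum : ∀ L (g : Vec Bool (suc L) → Carrier) →
    ∑ (configs (suc L)) (λ w → vacuum w * g w) ≈ g (replicate (suc L) false)
  ∑-vacuum zero g = trans (+-cong (*-identityˡ _) (trans (+-identityʳ _) (zeroˡ _))) (+-identityʳ _)
  ∑-vacuum (suc L) g = trans (∑-++ (map (false ∷_) (configs (suc L))) _ _) (trans
    (+-cong (trans (∑-map (false ∷_) (configs (suc L)) _) (∑-vacuum L (λ w → g (false ∷ w))))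
      (trans (∑-map (true ∷_) (configs (suc L)) _) (∑-zero (configs (suc L)) (λ _ → zeroˡ _))))
    (+-identityʳ _))

  -- The hypothesis says z = u z; iterating it k times gives z = uᵏ z. In this way 1 - u is
  -- cancelled without constructing its inverse.
  nilpotent-cancel : ∀ k u z → u ^ k ≈ 0# → (1# + - u) * z ≈ 0# → z ≈ 0#
  nilpotent-cancel k u z nil eq = trans (iterate k) (trans (*-congʳ nil) (zeroˡ z))
    where
    z≈uz : z ≈ u * z
    z≈uz = x-y≈0⇒x≈y z (u * z)
      (trans (solve 2 (λ u z → z :+ :- (u :* z) := (:1 :+ :- u) :* z) refl u z) eq)
    iterate : ∀ n → z ≈ u ^ n * z
    iterate zero = sym (*-identityˡ z)
    iterate (suc n) = trans z≈uz (trans (*-congˡ (iterate n)) (sym (*-assoc _ _ _)))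

  unit-cancel : ∀ k x′ s {z z′} → x′ ^ k ≈ 0# →
    (1# + - (x′ * s)) * z ≈ (1# + - (x′ * s)) * z′ → z ≈ z′
  unit-cancel k x′ s {z} {z′} nil eq = x-y≈0⇒x≈y z z′
    (nilpotent-cancel k (x′ * s) (z + - z′) (trans (^-distrib-* x′ s k) (trans (*-congʳ nil) (zeroˡ _)))
      (trans (distribˡ _ _ _) (trans (+-cong eq (sym (-‿distribʳ-* _ _))) (-‿inverseʳ _))))

  private
    ∙-cong : ∀ {L} k {φ ψ : Vector L} → φ ≋ ψ → k ∙ φ ≋ k ∙ ψ
    ∙-cong k eq w = *-congˡ (eq w)

  module Commute (x′ y′ : Carrier) (k : ℕ) (nil : x′ ^ suc k ≈ 0#) where
    open Exchange x′ y′ using (exchange)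
    open Relations R t x′ y′ using (module W)
    open W using (b; c; d; unprimedDown*; primedDown*; primedUp*)

    -- The exchanges `e₁` to `e₄` give b³d times the left side equal to b²c times the composite in
    -- the other order. Since b and d are 1 minus nilpotent elements they can be cancelled, and f
    -- enters only through b d f = c. The room is twice k + 2: the first raising uses half of it,
    -- and the exchange with the second one needs the other half.
    commute : ∀ {L} {φ : Vector L} → suc (suc k) ≤ L →
      Supp (suc (suc k) ℕ.+ suc (suc k)) φ → (f : Carrier) → b * d * f ≈ c →
      downOp primed y′ (downOp unprimed y′ (upOp unprimed x′ (upOp primed x′ φ)))
        ≋ f ∙ upOp unprimed x′ (upOp primed x′ (downOp primed y′ (downOp unprimed y′ φ)))
    commute {L} {φ} k≤L s f bdf≈c w = cancelled
      where
      supp : Supp (suc (suc k)) φ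
      supp v h = s v (weaken (clear (suc (suc k) ℕ.+ suc (suc k)) v) ≡.refl)
        where
        weaken : ∀ p → clear (suc (suc k) ℕ.+ suc (suc k)) v ≡ p → clear (suc (suc k) ℕ.+ suc (suc k)) v ≡ false
        weaken false eq = eq
        weaken true eq with ≡.trans (≡.sym h) (clear-suffix (suc (suc k)) (suc (suc k)) v eq)
        ... | ()
      ψ : Vector L
      ψ = upOp primed x′ φ
      suppψ : Supp (suc (suc k)) ψ
      suppψ = raise-supp x′ primed _ k (suc (suc k)) nil s
      ψ* φ′ DDφ UUφ : Vector L
      ψ* = lower y′ unprimed (unprimedDown* κ) ψ
      φ′ = downOp unprimed y′ φ
      DDφ = downOp primed y′ φ′
      UUφ = upOp unprimed x′ ψ
      V : Vector L → Vector L
      V = upOp unprimed x′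

      e₁ : d ∙ b ∙ downOp unprimed y′ UUφ ≋ V ψ*
      e₁ w = trans (*-congˡ (sym (lower-scale b y′ unprimed (Down.downBase y′ κ unprimed) UUφ w)))
        (exchange κ unprimed unprimed k nil suppψ w)
      e₂ : b ∙ downOp primed y′ (V ψ*) ≋ V (lower y′ primed primedDown* ψ*)
      e₂ = exchange κ unprimed primed k nil (lower-supp y′ unprimed _ (suc (suc k)) k≤L suppψ)
      e₃ : b ∙ ψ* ≋ raise x′ primed (primedUp* κ) φ′
      e₃ = exchange κ primed unprimed k nil supp
      e₄ : lower y′ primed primedDown* (raise x′ primed (primedUp* κ) φ′)
        ≋ (b * b * c) ∙ upOp primed x′ DDφ
      e₄ w = trans (sym (*-identityˡ _)) (trans
        (exchange κ primed primed k nil (lower-supp y′ unprimed _ (suc (suc k)) k≤L supp) w)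
        (raise-scale (b * b * c) x′ primed _ DDφ w))

      lhs rhs : Carrier
      lhs = downOp primed y′ (downOp unprimed y′ UUφ) w
      rhs = V (upOp primed x′ DDφ) w

      chain : b * (b * (b * d * lhs)) ≈ b * (b * (b * d * (f * rhs)))
      chain = begin
        b * (b * (b * d * lhs)) ≈⟨ solve 3 (λ b d z → b :* (b :* (b :* d :* z)) := b :* (b :* (d :* (b :* z)))) refl b d lhs ⟩
        b * (b * (d * (b * lhs)))
          ≈⟨ *-congˡ (*-congˡ (trans (*-congˡ (sym (lower-∙ y′ primed _ b _ w))) (sym (lower-∙ y′ primed _ d _ w)))) ⟩
        b * (b * downOp primed y′ (d ∙ b ∙ downOp unprimed y′ UUφ) w)
          ≈⟨ *-congˡ (*-congˡ (lower-cong y′ primed _ e₁ w)) ⟩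
        b * (b * downOp primed y′ (V ψ*) w) ≈⟨ *-congˡ (e₂ w) ⟩
        b * V (lower y′ primed primedDown* ψ*) w ≈⟨ raise-∙ x′ unprimed _ b _ w ⟨
        V (b ∙ lower y′ primed primedDown* ψ*) w
          ≈⟨ raise-cong x′ unprimed _ (λ v → sym (lower-∙ y′ primed primedDown* b ψ* v)) w ⟩
        V (lower y′ primed primedDown* (b ∙ ψ*)) w
          ≈⟨ raise-cong x′ unprimed _ (lower-cong y′ primed primedDown* e₃) w ⟩
        V (lower y′ primed primedDown* (raise x′ primed (primedUp* κ) φ′)) w
          ≈⟨ raise-cong x′ unprimed _ e₄ w ⟩
        V ((b * b * c) ∙ upOp primed x′ DDφ) w ≈⟨ raise-∙ x′ unprimed _ (b * b * c) _ w ⟩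
        b * b * c * rhs ≈⟨ *-congʳ (*-congˡ (sym bdf≈c)) ⟩
        b * b * (b * d * f) * rhs
          ≈⟨ solve 4 (λ b d f z → b :* b :* (b :* d :* f) :* z := b :* (b :* (b :* d :* (f :* z)))) refl b d f rhs ⟩
        b * (b * (b * d * (f * rhs))) ∎

      cancel-b : ∀ {z z′} → b * z ≈ b * z′ → z ≈ z′
      cancel-b = unit-cancel (suc k) x′ t nil

      cancelled : lhs ≈ f * rhs
      cancelled = unit-cancel (suc k) x′ y′ nil (cancel-b
        (trans (sym (*-assoc _ _ _)) (trans (cancel-b (cancel-b chain)) (*-assoc _ _ _))))

  module _ (p : ℕ → ℕ) where
    -- Each variable raises twice, once for i′ and once for i, and each raising uses `p i + 2` sites
    -- of room.
    margin : ℕ → ℕ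
    margin zero = 0
    margin (suc i) = suc (suc (p i)) ℕ.+ suc (suc (p i)) ℕ.+ margin i

    clear-≤ : ∀ {L} z (w : Vec Bool L) → z ≤ L → clear z w ≡ false → clear L w ≡ false
    clear-≤ (suc z) (true ∷ w) z≤L h = ≡.refl
    clear-≤ (suc z) (false ∷ w) (s≤s z≤L) h = clear-≤ z w z≤L h

    Φ-supp : ∀ m {L} → (∀ i → i < m → x i ^ suc (p i) ≈ 0#) →
      ∀ z → z ℕ.+ margin m ≤ suc L → Supp z (Φ m {L})
    Φ-supp zero {L} nil z z≤L w h rewrite clear-≤ z w (subst (_≤ suc L) (ℕP.+-identityʳ z) z≤L) h = refl
    Φ-supp (suc m) {L} nil z z≤L =
      raise-supp (x m) unprimed _ (p m) z (nil m ℕP.≤-refl)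
        (raise-supp (x m) primed _ (p m) (z ℕ.+ k) (nil m ℕP.≤-refl)
          (Φ-supp m (λ i i<m → nil i (ℕP.m≤n⇒m≤1+n i<m)) (z ℕ.+ k ℕ.+ k)
            (subst (_≤ suc L) (reassoc z k (margin m)) z≤L)))
      where
      k = suc (suc (p m))
      reassoc : ∀ z k g → z ℕ.+ (k ℕ.+ k ℕ.+ g) ≡ z ℕ.+ k ℕ.+ k ℕ.+ g
      reassoc z k g = ≡.trans (≡.sym (ℕP.+-assoc z (k ℕ.+ k) g)) (cong (ℕ._+ g) (≡.sym (ℕP.+-assoc z k k)))

    lower-vacuum : ∀ ℓ y′ {L} → downOp ℓ y′ (vacuum {L}) ≋ vacuum
    lower-vacuum ℓ y′ {L} ρ = trans (∑-vacuum L (λ λ′ → downKernel y′ ℓ (Down.downBase y′ κ ℓ) λ′ ρ 0))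
      (from-vacuum ℓ ρ)
      where
      from-vacuum : ∀ ℓ {L} (ρ : Vec Bool (suc L)) →
        downKernel y′ ℓ (Down.downBase y′ κ ℓ) (replicate (suc L) false) ρ 0 ≈ vacuum ρ
      from-vacuum ℓ {zero} (r ∷ []) = site κ ℓ r
        where
        site : ∀ κ ℓ r → Down.downBase y′ κ ℓ false r 0 ≈ iverson (clear 1 (r ∷ [])) 1#
        site 𝒬 primed false = *-identityˡ _
        site 𝒬 primed true = refl
        site 𝒬 unprimed false = *-identityˡ _
        site 𝒬 unprimed true = refl
        site 𝒫 primed false = *-identityˡ _
        site 𝒫 primed true = refl
        site 𝒫 unprimed false = *-identityˡ _
        site 𝒫 unprimed true = refl
      from-vacuum primed {suc L} (false ∷ ρ) = trans (*-identityˡ _) (from-vacuum primed ρ)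
      from-vacuum primed {suc L} (true ∷ ρ) = refl
      from-vacuum unprimed {suc L} (false ∷ ρ) = trans (*-identityˡ _) (from-vacuum unprimed ρ)
      from-vacuum unprimed {suc L} (true ∷ ρ) = refl

    -- Only the empty shape is contained in the empty shape. Hence Φ keeps the value 1 there, which
    -- is the starting value of the pairing.
    raise-at-vacuum : ∀ ℓ x′ {L} (φ : Vector L) →
      upOp ℓ x′ φ (replicate (suc L) false) ≈ φ (replicate (suc L) false)
    raise-at-vacuum ℓ x′ {L} φ = trans
      (∑-cong (configs (suc L)) (λ μ → trans (*-congˡ (to-vacuum ℓ μ)) (*-comm _ _))) (∑-vacuum L φ)
      where
      to-vacuum : ∀ ℓ {L} (μ : Vec Bool (suc L)) →
        upKernel x′ ℓ (Up.upBase x′ κ ℓ) μ (replicate (suc L) false) idle ≈ vacuum μ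
      to-vacuum ℓ {zero} (m ∷ []) = site κ ℓ m
        where
        site : ∀ κ ℓ m → Up.upBase x′ κ ℓ m false idle ≈ iverson (clear 1 (m ∷ [])) 1#
        site 𝒬 primed false = *-identityˡ _
        site 𝒬 primed true = refl
        site 𝒬 unprimed false = *-identityˡ _
        site 𝒬 unprimed true = refl
        site 𝒫 primed false = *-identityˡ _
        site 𝒫 primed true = refl
        site 𝒫 unprimed false = *-identityˡ _
        site 𝒫 unprimed true = refl
      to-vacuum primed {suc L} (false ∷ ρ) = trans (*-identityˡ _) (to-vacuum primed ρ)
      to-vacuum primed {suc L} (true ∷ ρ) = refl
      to-vacuum unprimed {suc L} (false ∷ ρ) = trans (*-identityˡ _) (to-vacuum unprimed ρ)
      to-vacuum unprimed {suc L} (true ∷ ρ) = refl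

    module _ (f : ℕ → ℕ → Carrier) (m n : ℕ)
      (nil : ∀ i → i < m → x i ^ suc (p i) ≈ 0#)
      (factor : ∀ i j → i < m → j < n →
        (1# + - (x i * t)) * (1# + - (x i * y j)) * f i j ≈ 1# + - (x i * t) + x i * y j)
      {L : ℕ} (bound : margin m ≤ suc L) where

      -- Passing the two raising operators of `x i` costs the scalar `f i j`; when all are passed,
      -- the lowering operators meet the vacuum, which they fix.
      eigenvector : ∀ j → j < n → ∀ i → i ≤ m →
        downOp primed (y j) (downOp unprimed (y j) (Φ i {L})) ≋ prod i (λ i′ → f i′ j) ∙ Φ i
      eigenvector j j<n zero i≤m w = trans
        (trans (lower-cong (y j) primed _ (lower-vacuum unprimed (y j)) w) (lower-vacuum primed (y j) w))
        (sym (*-identityˡ _))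
      eigenvector j j<n (suc i) i<m w = begin
        downOp primed (y j) (downOp unprimed (y j) (Φ (suc i))) w
          ≈⟨ Commute.commute (x i) (y j) (p i) (nil i i<m) p≤L
               (Φ-supp i (λ i′ i′<i → nil i′ (ℕP.<-trans i′<i i<m)) _ (ℕP.≤-trans margin≤ bound))
               (f i j) (factor i j i<m j<n) w ⟩
        f i j * upOp unprimed (x i) (upOp primed (x i) (downOp primed (y j) (downOp unprimed (y j) (Φ i)))) w
          ≈⟨ *-congˡ (raise-cong (x i) unprimed _ (raise-cong (x i) primed _
               (eigenvector j j<n i (ℕP.<⇒≤ i<m))) w) ⟩
        f i j * upOp unprimed (x i) (upOp primed (x i) (P ∙ Φ i)) w
          ≈⟨ *-congˡ (raise-cong (x i) unprimed _ (raise-∙ (x i) primed _ P _) w) ⟩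
        f i j * upOp unprimed (x i) (P ∙ upOp primed (x i) (Φ i)) w
          ≈⟨ *-congˡ (raise-∙ (x i) unprimed _ P _ w) ⟩
        f i j * (P * Φ (suc i) w) ≈⟨ trans (sym (*-assoc _ _ _)) (*-congʳ (*-comm _ _)) ⟩
        P * f i j * Φ (suc i) w ∎
        where
        P = prod i (λ i′ → f i′ j)
        margin-mono : ∀ {i m} → i ≤ m → margin i ≤ margin m
        margin-mono {m = zero} z≤n = z≤n
        margin-mono {i} {suc m} i≤ with ℕP.m≤n⇒m<n∨m≡n i≤
        ... | inj₁ (s≤s i≤m) = ℕP.≤-trans (margin-mono i≤m) (ℕP.m≤n+m _ _)
        ... | inj₂ ≡.refl = ℕP.≤-refl
        margin≤ : margin (suc i) ≤ margin m
        margin≤ = margin-mono i<m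
        p≤L : suc (suc (p i)) ≤ L
        p≤L = ℕP.≤-pred (ℕP.≤-trans (ℕP.≤-trans (s≤s (ℕP.m≤n+m _ (suc (p i)))) (ℕP.m≤m+n _ (margin i)))
          (ℕP.≤-trans margin≤ bound))

      Φ-at-vacuum : ∀ i → Φ i {L} (replicate (suc L) false) ≈ 1#
      Φ-at-vacuum zero = vacuum-at L
        where
        vacuum-at : ∀ L → vacuum (replicate (suc L) false) ≈ 1#
        vacuum-at zero = refl
        vacuum-at (suc L) = vacuum-at L
      Φ-at-vacuum (suc i) = trans (raise-at-vacuum unprimed (x i) (upOp primed (x i) (Φ i {L})))
        (trans (raise-at-vacuum primed (x i) (Φ i {L})) (Φ-at-vacuum i))

      private
        cs = configs (suc L)

      adjoint : ∀ ℓ y′ (φ ψ : Vector L) →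
        ∑ cs (λ w → φ w * downOp* ℓ y′ ψ w) ≈ ∑ cs (λ w → downOp ℓ y′ φ w * ψ w)
      adjoint ℓ y′ φ ψ = begin
        ∑ cs (λ w → φ w * ∑ cs (λ ρ → D w ρ * ψ ρ))
          ≈⟨ ∑-cong cs (λ w → trans (∑-distribˡ cs _ _) (∑-cong cs (λ ρ → sym (*-assoc _ _ _)))) ⟩
        ∑ cs (λ w → ∑ cs (λ ρ → φ w * D w ρ * ψ ρ)) ≈⟨ ∑-swap cs cs _ ⟩
        ∑ cs (λ ρ → ∑ cs (λ w → φ w * D w ρ * ψ ρ)) ≈⟨ ∑-cong cs (λ ρ → sym (∑-distribʳ cs _ _)) ⟩
        ∑ cs (λ ρ → ∑ cs (λ w → φ w * D w ρ) * ψ ρ) ∎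
        where
        D : Vec Bool (suc L) → Vec Bool (suc L) → Carrier
        D w ρ = downKernel y′ ℓ (Down.downBase y′ κ ℓ) w ρ 0

      -- By adjointness the operators of `y j` move from Γ onto Φ, where they act as a scalar. With
      -- none left, the pairing with the vacuum reads off Φ at the empty shape.
      cauchy : ∀ j → j ≤ n →
        ∑ cs (λ w → Φ m w * Γ j w) ≈ prod j (λ j′ → prod m (λ i → f i j′))
      cauchy zero j≤n = trans (∑-cong cs (λ w → *-comm _ _)) (trans (∑-vacuum L (Φ m)) (Φ-at-vacuum m))
      cauchy (suc j) j<n = begin
        ∑ cs (λ w → Φ m w * Γ (suc j) w) ≈⟨ adjoint unprimed (y j) (Φ m) _ ⟩
        ∑ cs (λ w → downOp unprimed (y j) (Φ m) w * downOp* primed (y j) (Γ j) w)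
          ≈⟨ adjoint primed (y j) _ (Γ j) ⟩
        ∑ cs (λ w → downOp primed (y j) (downOp unprimed (y j) (Φ m)) w * Γ j w)
          ≈⟨ ∑-cong cs (λ w → trans (*-congʳ (eigenvector j j<n m ℕP.≤-refl w)) (*-assoc _ _ _)) ⟩
        ∑ cs (λ w → prod m (λ i → f i j) * (Φ m w * Γ j w)) ≈⟨ ∑-distribˡ cs _ _ ⟨
        prod m (λ i → f i j) * ∑ cs (λ w → Φ m w * Γ j w) ≈⟨ *-congˡ (cauchy j (ℕP.<⇒≤ j<n)) ⟩
        prod m (λ i → f i j) * prod j (λ j′ → prod m (λ i → f i j′)) ≈⟨ *-comm _ _ ⟩
        prod j (λ j′ → prod m (λ i → f i j′)) * prod m (λ i → f i j) ∎

-- Truncated power series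

module Series where
  open import Algebra.Structures using (IsCommutativeRing)
  open import Data.Vec using (zipWith)
  open import Data.Vec.Relation.Binary.Pointwise.Inductive as Pointwise using (Pointwise; []; _∷_)
  open import Data.Fin using (zero; suc)
  open Defs using (below)

  -- Convolution by recursion on the degree, over bare operations: the product of series in several
  -- variables is defined with it before any law of the coefficients is available.
  conv : {A : Set} → (_+_ _*_ : A → A → A) → (f g : ℕ → A) → ℕ → A
  conv _+_ _*_ f g zero = f 0 * g 0
  conv _+_ _*_ f g (suc n) = (f 0 * g (suc n)) + conv _+_ _*_ (f ∘ suc) g n

  module Univariate (R : CommutativeRing 0ℓ 0ℓ) where
    open CommutativeRing R hiding (zero)
    open import Relation.Binary.Reasoning.Setoid setoid
    open import Algebra.Properties.CommutativeSemigroup +-commutativeSemigroup using (interchange)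

    infixl 7 _⋆_
    _⋆_ : (f g : ℕ → Carrier) → ℕ → Carrier
    _⋆_ = conv _+_ _*_

    -- Agreement up to degree n suffices, and this is what makes multiplication compatible with
    -- truncation.
    ⋆-cong : ∀ n {f f′ g g′} → (∀ i → i ≤ n → f i ≈ f′ i) → (∀ i → i ≤ n → g i ≈ g′ i) →
      (f ⋆ g) n ≈ (f′ ⋆ g′) n
    ⋆-cong zero ff gg = *-cong (ff 0 z≤n) (gg 0 z≤n)
    ⋆-cong (suc n) ff gg = +-cong (*-cong (ff 0 z≤n) (gg (suc n) ℕP.≤-refl))
      (⋆-cong n (λ i i≤n → ff (suc i) (s≤s i≤n)) (λ i i≤n → gg i (ℕP.m≤n⇒m≤1+n i≤n)))

    ⋆-zeroˡ : ∀ n {f g} → (∀ i → f i ≈ 0#) → (f ⋆ g) n ≈ 0#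
    ⋆-zeroˡ zero f0 = trans (*-congʳ (f0 0)) (zeroˡ _)
    ⋆-zeroˡ (suc n) f0 =
      trans (+-cong (trans (*-congʳ (f0 0)) (zeroˡ _)) (⋆-zeroˡ n (f0 ∘ suc))) (+-identityˡ 0#)

    ⋆-constˡ : ∀ n {f g} → (∀ i → f (suc i) ≈ 0#) → (f ⋆ g) n ≈ f 0 * g n
    ⋆-constˡ zero f0 = refl
    ⋆-constˡ (suc n) f0 = trans (+-congˡ (⋆-zeroˡ n f0)) (+-identityʳ _)

    ⋆-distribʳ : ∀ n f f′ g → ((λ i → f i + f′ i) ⋆ g) n ≈ (f ⋆ g) n + (f′ ⋆ g) n
    ⋆-distribʳ zero f f′ g = distribʳ _ _ _
    ⋆-distribʳ (suc n) f f′ g =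
      trans (+-cong (distribʳ _ _ _) (⋆-distribʳ n (f ∘ suc) (f′ ∘ suc) g)) (interchange _ _ _ _)

    ⋆-scaleˡ : ∀ n c f g → ((λ i → c * f i) ⋆ g) n ≈ c * (f ⋆ g) n
    ⋆-scaleˡ zero c f g = *-assoc _ _ _
    ⋆-scaleˡ (suc n) c f g = trans (+-cong (*-assoc _ _ _) (⋆-scaleˡ n c (f ∘ suc) g)) (sym (distribˡ _ _ _))

    ⋆-unsnoc : ∀ n f g → (f ⋆ g) (suc n) ≈ (f ⋆ (g ∘ suc)) n + f (suc n) * g 0
    ⋆-unsnoc zero f g = refl
    ⋆-unsnoc (suc n) f g = trans (+-congˡ (⋆-unsnoc n (f ∘ suc) g)) (sym (+-assoc _ _ _))

    ⋆-comm : ∀ n f g → (f ⋆ g) n ≈ (g ⋆ f) n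
    ⋆-comm zero f g = *-comm _ _
    ⋆-comm (suc n) f g = begin
      f 0 * g (suc n) + ((f ∘ suc) ⋆ g) n ≈⟨ +-cong (*-comm _ _) (⋆-comm n (f ∘ suc) g) ⟩
      g (suc n) * f 0 + (g ⋆ (f ∘ suc)) n ≈⟨ +-comm _ _ ⟩
      (g ⋆ (f ∘ suc)) n + g (suc n) * f 0 ≈⟨ ⋆-unsnoc n g f ⟨
      (g ⋆ f) (suc n) ∎

    ⋆-assoc : ∀ n f g h → ((f ⋆ g) ⋆ h) n ≈ (f ⋆ (g ⋆ h)) n
    ⋆-assoc zero f g h = *-assoc _ _ _
    ⋆-assoc (suc n) f g h = begin
      f 0 * g 0 * h (suc n) + ((λ i → f 0 * g (suc i) + ((f ∘ suc) ⋆ g) i) ⋆ h) n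
        ≈⟨ +-cong (*-assoc _ _ _) (trans (⋆-distribʳ n _ _ h)
             (+-cong (⋆-scaleˡ n (f 0) (g ∘ suc) h) (⋆-assoc n (f ∘ suc) g h))) ⟩
      f 0 * (g 0 * h (suc n)) + (f 0 * ((g ∘ suc) ⋆ h) n + ((f ∘ suc) ⋆ (g ⋆ h)) n)
        ≈⟨ +-assoc _ _ _ ⟨
      f 0 * (g 0 * h (suc n)) + f 0 * ((g ∘ suc) ⋆ h) n + ((f ∘ suc) ⋆ (g ⋆ h)) n
        ≈⟨ +-congʳ (distribˡ _ _ _) ⟨
      (f ⋆ (g ⋆ h)) (suc n) ∎

    single : ℕ → Carrier → ℕ → Carrier
    single zero c zero = c
    single zero c (suc n) = 0#
    single (suc a) c zero = 0#
    single (suc a) c (suc n) = single a c n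

    single-* : ∀ b c c′ n → c * single b c′ n ≈ single b (c * c′) n
    single-* zero c c′ zero = refl
    single-* zero c c′ (suc n) = zeroʳ c
    single-* (suc b) c c′ zero = zeroʳ c
    single-* (suc b) c c′ (suc n) = single-* b c c′ n

    single-suc-⋆ : ∀ a c g n → (single (suc a) c ⋆ g) (suc n) ≈ (single a c ⋆ g) n
    single-suc-⋆ a c g n = trans (+-congʳ (zeroˡ _)) (+-identityˡ _)

    single-⋆ : ∀ a b c c′ n → (single a c ⋆ single b c′) n ≈ single (a ℕ.+ b) (c * c′) n
    single-⋆ zero b c c′ n = trans (⋆-constˡ n (λ _ → refl)) (single-* b c c′ n)
    single-⋆ (suc a) b c c′ zero = zeroˡ _
    single-⋆ (suc a) b c c′ (suc n) = trans (single-suc-⋆ a c _ n) (single-⋆ a b c c′ n)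

  infixl 7 _⋆ₛ_
  infixl 6 _+ₛ_

  _▹_ : ∀ {d} → Ser (suc d) → ℕ → Ser d
  (f ▹ i) e = f (i ∷ e)

  _+ₛ_ _⋆ₛ_ : ∀ {d} → Ser d → Ser d → Ser d
  (f +ₛ g) e = f e ℤ.+ g e
  _⋆ₛ_ {zero} f g [] = f [] ℤ.* g []
  _⋆ₛ_ {suc d} f g (n ∷ e) = conv _+ₛ_ _⋆ₛ_ (f ▹_) (g ▹_) n e

  -ₛ_ : ∀ {d} → Ser d → Ser d
  (-ₛ f) e = ℤ.- f e

  0ₛ : ∀ {d} → Ser d
  0ₛ e = + 0

  infix 4 _≤ᵥ_
  _≤ᵥ_ : ∀ {d} → Vec ℕ d → Vec ℕ d → Set
  _≤ᵥ_ = Pointwise _≤_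

  ≤ᵥ-refl : ∀ {d} {e : Vec ℕ d} → e ≤ᵥ e
  ≤ᵥ-refl = Pointwise.refl ℕP.≤-refl

  -- Power series modulo the monomials whose exponent is not bounded by e.
  record _≈[_]_ {d} (f : Ser d) (e : Vec ℕ d) (g : Ser d) : Set where
    constructor coefficients
    field coef : ∀ e′ → e′ ≤ᵥ e → f e′ ≡ g e′
  open _≈[_]_ public

  private
    Laws : ∀ {d} → Vec ℕ d → Set
    Laws e = IsCommutativeRing (λ f g → f ≈[ e ] g) _+ₛ_ _⋆ₛ_ -ₛ_ 0ₛ oneₛ

    -- Induction on the number of variables: a series in d + 1 variables is a univariate series
    -- whose coefficients lie in the ring of truncated series in d variables.
    laws : ∀ {d} (e : Vec ℕ d) → Laws e

    bundle : ∀ {d} (e : Vec ℕ d) → CommutativeRing 0ℓ 0ℓ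
    bundle e = record { isCommutativeRing = laws e }

    pointwise : ∀ {d} {e : Vec ℕ d} {f g : Ser d} → (∀ e′ → f e′ ≡ g e′) → f ≈[ e ] g
    pointwise eq = coefficients (λ e′ _ → eq e′)

    fromMultiplicative : ∀ {d} (e : Vec ℕ d) →
      (∀ {f f′ g g′} → f ≈[ e ] f′ → g ≈[ e ] g′ → (f ⋆ₛ g) ≈[ e ] (f′ ⋆ₛ g′)) →
      (∀ f g h → ((f ⋆ₛ g) ⋆ₛ h) ≈[ e ] (f ⋆ₛ (g ⋆ₛ h))) →
      (∀ f g → (f ⋆ₛ g) ≈[ e ] (g ⋆ₛ f)) →
      (∀ f → (oneₛ ⋆ₛ f) ≈[ e ] f) →
      (∀ f g h → ((g +ₛ h) ⋆ₛ f) ≈[ e ] ((g ⋆ₛ f) +ₛ (h ⋆ₛ f))) → Laws e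
    fromMultiplicative e cong′ assoc′ comm′ id′ distribʳ′ = record
      { isRing = record
        { +-isAbelianGroup = record
          { isGroup = record
            { isMonoid = record
              { isSemigroup = record
                { isMagma = record
                  { isEquivalence = record
                    { refl = pointwise (λ _ → ≡.refl)
                    ; sym = λ p → coefficients (λ e′ le → ≡.sym (coef p e′ le))
                    ; trans = trans′ }
                  ; ∙-cong = +-cong′ }
                ; assoc = λ f g h → pointwise (λ e′ → ℤP.+-assoc (f e′) (g e′) (h e′)) }
              ; identity = (λ f → pointwise (λ e′ → ℤP.+-identityˡ (f e′))) ,
                           (λ f → pointwise (λ e′ → ℤP.+-identityʳ (f e′))) }
            ; inverse = (λ f → pointwise (λ e′ → ℤP.+-inverseˡ (f e′))) ,
                        (λ f → pointwise (λ e′ → ℤP.+-inverseʳ (f e′)))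
            ; ⁻¹-cong = λ p → coefficients (λ e′ le → cong ℤ.-_ (coef p e′ le)) }
          ; comm = λ f g → pointwise (λ e′ → ℤP.+-comm (f e′) (g e′)) }
        ; *-cong = cong′
        ; *-assoc = assoc′
        ; *-identity = id′ , (λ f → trans′ (comm′ f oneₛ) (id′ f))
        ; distrib = (λ f g h → trans′ (comm′ f (g +ₛ h))
                       (trans′ (distribʳ′ f g h) (+-cong′ (comm′ g f) (comm′ h f)))) ,
                    distribʳ′ }
      ; *-comm = comm′ }
      where
      trans′ : ∀ {f g h} → f ≈[ e ] g → g ≈[ e ] h → f ≈[ e ] h
      trans′ p q = coefficients (λ e′ le → ≡.trans (coef p e′ le) (coef q e′ le))
      +-cong′ : ∀ {f f′ g g′} → f ≈[ e ] f′ → g ≈[ e ] g′ → (f +ₛ g) ≈[ e ] (f′ +ₛ g′)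
      +-cong′ p q = coefficients (λ e′ le → cong₂ ℤ._+_ (coef p e′ le) (coef q e′ le))

    slice : ∀ {d n i} {e : Vec ℕ d} {f g : Ser (suc d)} → i ≤ n → f ≈[ n ∷ e ] g → (f ▹ i) ≈[ e ] (g ▹ i)
    slice {i = i} i≤n p = coefficients (λ e′ le → coef p (i ∷ e′) (i≤n ∷ le))

    unslice : ∀ {d n} {e : Vec ℕ d} {f g : Ser (suc d)} →
      (∀ i → i ≤ n → (f ▹ i) ≈[ e ] (g ▹ i)) → f ≈[ n ∷ e ] g
    unslice p = coefficients (λ { (i ∷ e′) (i≤n ∷ le) → coef (p i i≤n) e′ le })

    laws [] = fromMultiplicative []
      (λ p q → coefficients (λ { [] [] → cong₂ ℤ._*_ (coef p [] []) (coef q [] []) }))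
      (λ f g h → coefficients (λ { [] [] → ℤP.*-assoc (f []) (g []) (h []) }))
      (λ f g → coefficients (λ { [] [] → ℤP.*-comm (f []) (g []) }))
      (λ f → coefficients (λ { [] [] → ℤP.*-identityˡ (f []) }))
      (λ f g h → coefficients (λ { [] [] → ℤP.*-distribʳ-+ (f []) (g []) (h []) }))
    laws (n ∷ e) = fromMultiplicative (n ∷ e)
      (λ p q → unslice (λ i i≤n → ⋆-cong i
        (λ j j≤i → slice (ℕP.≤-trans j≤i i≤n) p) (λ j j≤i → slice (ℕP.≤-trans j≤i i≤n) q)))
      (λ f g h → unslice (λ i _ → ⋆-assoc i (f ▹_) (g ▹_) (h ▹_)))
      (λ f g → unslice (λ i _ → ⋆-comm i (f ▹_) (g ▹_)))
      (λ f → unslice (λ i _ → trans (⋆-constˡ i (λ _ → refl)) (*-identityˡ (f ▹ i))))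
      (λ f g h → unslice (λ i _ → ⋆-distribʳ i (g ▹_) (h ▹_) (f ▹_)))
      where
      open Univariate (bundle e)
      open CommutativeRing (bundle e) using (trans; refl; *-identityˡ)

  truncatedRing : ∀ {d} → Vec ℕ d → CommutativeRing 0ℓ 0ℓ
  truncatedRing = bundle

  equal-at : ∀ {d} {f g : Ser d} (e : Vec ℕ d) → f ≈[ e ] g → f e ≡ g e
  equal-at e p = coef p e ≤ᵥ-refl

  module ∑ℤ = FiniteSums ℤP.+-*-commutativeRing
  open ∑ℤ using (∑)

  sumℤ-∑ : {A : Set} (as : List A) (f : A → ℤ) → sumℤ (List.map f as) ≡ ∑ as f
  sumℤ-∑ [] f = ≡.refl
  sumℤ-∑ (a ∷ as) f = cong₂ ℤ._+_ (≡.refl {x = f a}) (sumℤ-∑ as f)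

  conv-∑ : ∀ {d} n (F G : ℕ → Ser d) e →
    conv _+ₛ_ _⋆ₛ_ F G n e ≡ ∑ (upTo (suc n)) (λ i → (F i ⋆ₛ G (n ℕ.∸ i)) e)
  conv-∑ zero F G e = ≡.sym (ℤP.+-identityʳ _)
  conv-∑ (suc n) F G e = cong₂ ℤ._+_ (≡.refl {x = (F 0 ⋆ₛ G (suc n)) e}) (≡.trans (conv-∑ n (F ∘ suc) G e)
    (≡.trans (≡.sym (∑ℤ.∑-map suc (upTo (suc n)) (λ i → (F i ⋆ₛ G (suc n ℕ.∸ i)) e)))
      (cong (λ is → ∑ is (λ i → (F i ⋆ₛ G (suc n ℕ.∸ i)) e)) (ListP.map-upTo suc (suc n)))))

  -- The product in the statement sums over all exponent vectors at once; the ring laws are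
  -- available for the nested convolution.
  *ₛ≡⋆ₛ : ∀ {d} (f g : Ser d) e → (f *ₛ g) e ≡ (f ⋆ₛ g) e
  *ₛ≡⋆ₛ {d} f g e = ≡.trans (sumℤ-∑ (below e) _) (go f g e)
    where
    go : ∀ {d} (f g : Ser d) e → ∑ (below e) (λ e₁ → f e₁ ℤ.* g (zipWith ℕ._∸_ e e₁)) ≡ (f ⋆ₛ g) e
    go f g [] = ℤP.+-identityʳ _
    go f g (n ∷ e) = ≡.trans (∑ℤ.∑-concatMap (λ i → List.map (i ∷_) (below e)) (upTo (suc n)) _)
      (≡.trans (∑ℤ.∑-cong (upTo (suc n)) (λ i →
        ≡.trans (∑ℤ.∑-map (i ∷_) (below e) _) (go (f ▹ i) (g ▹ (n ℕ.∸ i)) e)))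
      (≡.sym (conv-∑ n (f ▹_) (g ▹_) e)))

  -- `single` takes from its ring only the zero series, which is the same for every truncation. The
  -- bound `replicate d 0` is thus a placeholder, exchanged for the actual bound by
  -- `single-irrelevant` in `mono-*`.
  mono : ∀ {d} → Vec ℕ d → Ser d
  mono {zero} [] [] = + 1
  mono {suc d} (a ∷ v) (n ∷ e) = Univariate.single (truncatedRing {d} (replicate d 0)) a (mono v) n e

  zeros : ∀ {d} → Vec ℕ d
  zeros {d} = replicate d 0

  infixl 6 _+ᵥ_
  _+ᵥ_ : ∀ {d} → Vec ℕ d → Vec ℕ d → Vec ℕ d
  _+ᵥ_ = zipWith ℕ._+_

  mono-* : ∀ {d} (v w : Vec ℕ d) e → (mono v ⋆ₛ mono w) ≈[ e ] mono (v +ᵥ w)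
  mono-* [] [] [] = coefficients (λ { [] [] → ≡.refl })
  mono-* (a ∷ v) (b ∷ w) (n ∷ e) = unslice λ i _ → trans
    (⋆-cong i (λ j _ → single-irrelevant a {mono v} j) (λ j _ → single-irrelevant b {mono w} j))
    (trans (single-⋆ a b (mono v) (mono w) i)
    (trans (single-cong (a ℕ.+ b) i (mono-* v w e)) (sym (single-irrelevant (a ℕ.+ b) {mono (v +ᵥ w)} i))))
    where
    open Univariate (truncatedRing e)
    open CommutativeRing (truncatedRing e) using (trans; sym; refl)
    single-irrelevant : ∀ a {c} j → Univariate.single (truncatedRing zeros) a c j ≈[ e ] single a c j
    single-irrelevant zero zero = refl
    single-irrelevant zero (suc j) = refl
    single-irrelevant (suc a) zero = refl
    single-irrelevant (suc a) (suc j) = single-irrelevant a j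
    single-cong : ∀ a {c c′} j → c ≈[ e ] c′ → single a c j ≈[ e ] single a c′ j
    single-cong zero zero p = p
    single-cong zero (suc j) p = refl
    single-cong (suc a) zero p = refl
    single-cong (suc a) (suc j) p = single-cong a j p

  mono-self : ∀ {d} (v : Vec ℕ d) → mono v v ≡ + 1
  mono-self [] = ≡.refl
  mono-self (a ∷ v) = ≡.trans (go a) (mono-self v)
    where
    go : ∀ a → Univariate.single (truncatedRing zeros) a (mono v) a v ≡ mono v v
    go zero = ≡.refl
    go (suc a) = go a

  mono-other : ∀ {d} (v e : Vec ℕ d) → v ≢ e → mono v e ≡ + 0
  mono-other [] [] v≢e = Data.Empty.⊥-elim (v≢e ≡.refl)
    where import Data.Empty
  mono-other (a ∷ v) (n ∷ e) v≢e = go a n (λ a≡n v≡e → v≢e (cong₂ _∷_ a≡n v≡e))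
    where
    go : ∀ a n → (a ≡ n → v ≢ e) → Univariate.single (truncatedRing zeros) a (mono v) n e ≡ + 0
    go zero zero ne = mono-other v e (ne ≡.refl)
    go zero (suc n) ne = ≡.refl
    go (suc a) zero ne = ≡.refl
    go (suc a) (suc n) ne = go a n (λ a≡n → ne (cong suc a≡n))

  mono-zeros : ∀ {d} (e : Vec ℕ d) → mono zeros e ≡ oneₛ e
  mono-zeros [] = ≡.refl
  mono-zeros (zero ∷ e) = mono-zeros e
  mono-zeros (suc n ∷ e) = ≡.refl

  zeros-tail : ∀ {d n} {v : Vec ℕ d} → n ∷ v ≡ zeros {suc d} → v ≡ zeros
  zeros-tail ≡.refl = ≡.refl

  -- If f does not involve the last n variables and g does not involve the first m, then the product
  -- has coefficients f(a, 0) g(0, b).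
  split-⋆ : ∀ m n (f g : Ser (m ℕ.+ n)) (a : Vec ℕ m) (b : Vec ℕ n) →
    (∀ (a′ : Vec ℕ m) (b′ : Vec ℕ n) → b′ ≢ zeros → f (a′ ++ᵥ b′) ≡ + 0) →
    (∀ (a′ : Vec ℕ m) (b′ : Vec ℕ n) → a′ ≢ zeros → g (a′ ++ᵥ b′) ≡ + 0) →
    (f ⋆ₛ g) (a ++ᵥ b) ≡ f (a ++ᵥ zeros {n}) ℤ.* g (zeros {m} ++ᵥ b)
  split-⋆ zero zero f g [] [] f0 g0 = ≡.refl
  split-⋆ zero (suc n) f g [] (j ∷ b) f0 g0 = ≡.trans
    (equal-at {f = conv _+ₛ_ _⋆ₛ_ (f ▹_) (g ▹_) j} {g = (f ▹ 0) ⋆ₛ (g ▹ j)} b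
      (⋆-constˡ j {f ▹_} {g ▹_} (λ i → coefficients (λ e′ _ → f0 [] (suc i ∷ e′) λ ()))))
    (split-⋆ zero n (f ▹ 0) (g ▹ j) [] b
      (λ { [] b′ b′≢ → f0 [] (0 ∷ b′) (λ eq → b′≢ (zeros-tail eq)) })
      (λ { [] b′ ne → Data.Empty.⊥-elim (ne ≡.refl) }))
    where
    open Univariate (truncatedRing b)
    import Data.Empty
  split-⋆ (suc m) n f g (i ∷ a) b f0 g0 = ≡.trans
    (equal-at {f = conv _+ₛ_ _⋆ₛ_ (f ▹_) (g ▹_) i} {g = (f ▹ i) ⋆ₛ (g ▹ 0)} (a ++ᵥ b)
      (CommutativeRing.trans (truncatedRing (a ++ᵥ b)) (⋆-comm i (f ▹_) (g ▹_))
      (CommutativeRing.trans (truncatedRing (a ++ᵥ b))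
        (⋆-constˡ i {g ▹_} {f ▹_} (λ j → coefficients (λ e′ _ → vanish j e′)))
        (CommutativeRing.*-comm (truncatedRing (a ++ᵥ b)) (g ▹ 0) (f ▹ i)))))
    (split-⋆ m n (f ▹ i) (g ▹ 0) a b (λ a′ b′ ne → f0 (i ∷ a′) b′ ne)
      (λ a′ b′ ne → g0 (0 ∷ a′) b′ (λ eq → ne (zeros-tail eq))))
    where
    open Univariate (truncatedRing (a ++ᵥ b))
    vanish : ∀ j e′ → g (suc j ∷ e′) ≡ + 0
    vanish j e′ with Vec.splitAt m e′
    ... | a′ , b′ , ≡.refl = g0 (suc j ∷ a′) b′ λ ()

open Series

-- The Cauchy kernel

module Kernel where
  open import Data.Nat using (pred)
  open import Data.Vec using (updateAt; allFin)
  import Data.Vec.Relation.Binary.Pointwise.Inductive as Pointwise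
  open import Data.Fin using (zero; suc)
  open Series

  ε : ∀ {d} → Fin d → Vec ℕ d
  ε zero = 1 ∷ zeros
  ε (suc p) = 0 ∷ ε p

  var : ∀ {d} → Fin d → Ser d
  var p = mono (ε p)

  lower-coefficient : ∀ {d} → Fin d → Ser d → Ser d
  lower-coefficient p f e with lookup e p
  ... | zero = + 0
  ... | suc _ = f (updateAt e p pred)

  -- Turns products with a variable into shifts of coefficients, so that functional equations of the
  -- kernel factors can be checked coefficient by coefficient.
  var-⋆ : ∀ {d} (p : Fin d) (f : Ser d) e → (var p ⋆ₛ f) e ≡ lower-coefficient p f e
  var-⋆ zero f (zero ∷ e) = equal-at {f = 0ₛ ⋆ₛ (f ▹ 0)} {g = 0ₛ} e (CommutativeRing.zeroˡ (truncatedRing e) (f ▹ 0))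
  var-⋆ {suc d} zero f (suc n ∷ e) =
    equal-at {f = conv _+ₛ_ _⋆ₛ_ (var zero ▹_) (f ▹_) (suc n)} {g = f ▹ n} e
      (trans (trans (+-congʳ (zeroˡ _)) (+-identityˡ _)) (trans (⋆-constˡ n {(var {suc d} zero ▹_) ∘ suc} {f ▹_} (λ _ → refl))
        (trans (*-congʳ {x = f ▹ n} (coefficients (λ e′ _ → mono-zeros e′))) (*-identityˡ (f ▹ n)))))
    where
    open Univariate (truncatedRing e)
    open CommutativeRing (truncatedRing e) using (trans; refl; *-congʳ; *-identityˡ; +-congʳ; zeroˡ; +-identityˡ)
  var-⋆ (suc p) f (n ∷ e) = ≡.trans
    (equal-at {f = conv _+ₛ_ _⋆ₛ_ (var (suc p) ▹_) (f ▹_) n} {g = var p ⋆ₛ (f ▹ n)} e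
      (⋆-constˡ n {var (suc p) ▹_} {f ▹_} (λ _ → CommutativeRing.refl (truncatedRing e))))
    (≡.trans (var-⋆ p (f ▹ n) e) reduce)
    where
    open Univariate (truncatedRing e)
    reduce : lower-coefficient p (f ▹ n) e ≡ lower-coefficient (suc p) f (n ∷ e)
    reduce with lookup e p
    ... | zero = ≡.refl
    ... | suc _ = ≡.refl

  lower-zero : ∀ {d} p (f : Ser d) e → lookup e p ≡ 0 → lower-coefficient p f e ≡ + 0
  lower-zero p f e eq rewrite eq = ≡.refl

  lower-suc : ∀ {d} p (f : Ser d) e {n} → lookup e p ≡ suc n → lower-coefficient p f e ≡ f (updateAt e p pred)
  lower-suc p f e eq rewrite eq = ≡.refl

  all-cong : {A : Set} {f g : A → Bool} (as : List A) → (∀ a → f a ≡ g a) → all f as ≡ all g as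
  all-cong [] eq = ≡.refl
  all-cong (a ∷ as) eq = cong₂ _∧_ (eq a) (all-cong as eq)

  all-tabulate : ∀ {d} {A : Set} (f : A → Bool) (g : Fin d → A) →
    all f (toList (tabulate g)) ≡ all (f ∘ g) (toList (allFin d))
  all-tabulate {d} f g = ≡.trans (go g id) ≡.refl
    where
    go : ∀ {d′} {B : Set} (g : B → _) (h : Fin d′ → B) →
      all f (toList (tabulate (g ∘ h))) ≡ all (f ∘ g) (toList (tabulate h))
    go {zero} g h = ≡.refl
    go {suc d′} g h = cong₂ _∧_ ≡.refl (go g (h ∘ suc))

  all-tabulate-false : ∀ {d} {A : Set} (f : A → Bool) (g : Fin d → A) i → f (g i) ≡ false → all f (toList (tabulate g)) ≡ false
  all-tabulate-false f g zero eq rewrite eq = ≡.refl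
  all-tabulate-false f g (suc i) eq with f (g zero)
  ... | true = all-tabulate-false f (g ∘ suc) i eq
  ... | false = ≡.refl

  finEqᵇ-refl : ∀ {d} (p : Fin d) → finEqᵇ p p ≡ true
  finEqᵇ-refl zero = ≡.refl
  finEqᵇ-refl (suc p) = finEqᵇ-refl p

  finEqᵇ-true : ∀ {d} (p q : Fin d) → finEqᵇ p q ≡ true → p ≡ q
  finEqᵇ-true zero zero _ = ≡.refl
  finEqᵇ-true (suc p) (suc q) eq = cong suc (finEqᵇ-true p q eq)

  -- Series in three of the variables are closed under sums and under multiplication by these
  -- variables, so identities between them reduce to identities of functions of three natural
  -- numbers. The positions must be distinct: lowering one exponent must leave the other two
  -- unchanged.
  module ThreeVariables {d} (p q r : Fin d) (p≢q : p ≢ q) (p≢r : p ≢ r) (q≢r : q ≢ r) where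

    E : (ℕ → ℕ → ℕ → ℤ) → Ser d
    E h = embed3 h p q r

    private
      listed : Fin d → Bool
      listed s = finEqᵇ s p ∨ finEqᵇ s q ∨ finEqᵇ s r

      supported : Vec ℕ d → Bool
      supported e = all (λ s → listed s ∨ (lookup e s ≡ᵇ 0)) (toList (allFin d))

      listed-p : listed p ≡ true
      listed-p rewrite finEqᵇ-refl p = ≡.refl
      listed-q : listed q ≡ true
      listed-q with finEqᵇ q p
      ... | true = ≡.refl
      ... | false rewrite finEqᵇ-refl q = ≡.refl
      listed-r : listed r ≡ true
      listed-r with finEqᵇ r p | finEqᵇ r q
      ... | true | _ = ≡.refl
      ... | false | true = ≡.refl
      ... | false | false rewrite finEqᵇ-refl r = ≡.refl

      supported-update : ∀ s → listed s ≡ true → ∀ e → supported (updateAt e s pred) ≡ supported e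
      supported-update s ls e = all-cong (toList (allFin d)) same
        where
        same : ∀ s′ → (listed s′ ∨ (lookup (updateAt e s pred) s′ ≡ᵇ 0)) ≡ (listed s′ ∨ (lookup e s′ ≡ᵇ 0))
        same s′ with s′ Fin.≟ s
        ... | yes ≡.refl rewrite ls = ≡.refl
        ... | no s′≢s rewrite VecP.lookup∘updateAt′ s′ s {f = pred} s′≢s e = ≡.refl

    E-cong : ∀ {h h′} → (∀ i j k → h i j k ≡ h′ i j k) → ∀ e → E h e ≡ E h′ e
    E-cong eq e with supported e
    ... | true = eq _ _ _
    ... | false = ≡.refl

    E-+ : ∀ h h′ e → E h e ℤ.+ E h′ e ≡ E (λ i j k → h i j k ℤ.+ h′ i j k) e
    E-+ h h′ e with supported e
    ... | true = ≡.refl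
    ... | false = ≡.refl

    E-neg : ∀ h e → ℤ.- E h e ≡ E (λ i j k → ℤ.- h i j k) e
    E-neg h e with supported e
    ... | true = ≡.refl
    ... | false = ≡.refl

    shiftp shiftq shiftr : (ℕ → ℕ → ℕ → ℤ) → ℕ → ℕ → ℕ → ℤ
    shiftp h zero j k = + 0
    shiftp h (suc i) j k = h i j k
    shiftq h i zero k = + 0
    shiftq h i (suc j) k = h i j k
    shiftr h i j zero = + 0
    shiftr h i j (suc k) = h i j k

    lookup-pred : ∀ (s : Fin d) (e : Vec ℕ d) {n} → lookup e s ≡ suc n → lookup (updateAt e s pred) s ≡ n
    lookup-pred s e eq = ≡.trans (VecP.lookup∘updateAt s e) (cong pred eq)

    E-at : ∀ h e {u i j k} → supported e ≡ u → lookup e p ≡ i → lookup e q ≡ j → lookup e r ≡ k →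
      E h e ≡ (if u then h i j k else + 0)
    E-at h e ≡.refl ≡.refl ≡.refl ≡.refl = ≡.refl

    if-same : ∀ u → (if u then + 0 else + 0) ≡ + 0
    if-same true = ≡.refl
    if-same false = ≡.refl

    var-p : ∀ h e → (var p ⋆ₛ E h) e ≡ E (shiftp h) e
    var-p h e = ≡.trans (var-⋆ p (E h) e) (go (lookup e p) ≡.refl)
      where
      go : ∀ n → lookup e p ≡ n → lower-coefficient p (E h) e ≡ E (shiftp h) e
      go zero eq = ≡.trans (lower-zero p (E h) e eq)
        (≡.sym (≡.trans (E-at (shiftp h) e ≡.refl eq ≡.refl ≡.refl) (if-same (supported e))))
      go (suc n) eq = ≡.trans (lower-suc p (E h) e eq)
        (≡.trans (E-at h (updateAt e p pred) (supported-update p listed-p e) (lookup-pred p e eq)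
          (VecP.lookup∘updateAt′ q p (p≢q ∘ ≡.sym) e) (VecP.lookup∘updateAt′ r p (p≢r ∘ ≡.sym) e))
          (≡.sym (E-at (shiftp h) e ≡.refl eq ≡.refl ≡.refl)))

    var-q : ∀ h e → (var q ⋆ₛ E h) e ≡ E (shiftq h) e
    var-q h e = ≡.trans (var-⋆ q (E h) e) (go (lookup e q) ≡.refl)
      where
      go : ∀ n → lookup e q ≡ n → lower-coefficient q (E h) e ≡ E (shiftq h) e
      go zero eq = ≡.trans (lower-zero q (E h) e eq)
        (≡.sym (≡.trans (E-at (shiftq h) e ≡.refl ≡.refl eq ≡.refl) (if-same (supported e))))
      go (suc n) eq = ≡.trans (lower-suc q (E h) e eq)
        (≡.trans (E-at h (updateAt e q pred) (supported-update q listed-q e) (VecP.lookup∘updateAt′ p q p≢q e)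
          (lookup-pred q e eq) (VecP.lookup∘updateAt′ r q (q≢r ∘ ≡.sym) e))
          (≡.sym (E-at (shiftq h) e ≡.refl ≡.refl eq ≡.refl)))

    var-r : ∀ h e → (var r ⋆ₛ E h) e ≡ E (shiftr h) e
    var-r h e = ≡.trans (var-⋆ r (E h) e) (go (lookup e r) ≡.refl)
      where
      go : ∀ n → lookup e r ≡ n → lower-coefficient r (E h) e ≡ E (shiftr h) e
      go zero eq = ≡.trans (lower-zero r (E h) e eq)
        (≡.sym (≡.trans (E-at (shiftr h) e ≡.refl ≡.refl ≡.refl eq) (if-same (supported e))))
      go (suc n) eq = ≡.trans (lower-suc r (E h) e eq)
        (≡.trans (E-at h (updateAt e r pred) (supported-update r listed-r e) (VecP.lookup∘updateAt′ p r p≢r e)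
          (VecP.lookup∘updateAt′ q r q≢r e) (lookup-pred r e eq))
          (≡.sym (E-at (shiftr h) e ≡.refl ≡.refl ≡.refl eq)))

    δ : ℕ → ℕ → ℕ → ℤ
    δ zero zero zero = + 1
    δ _ _ _ = + 0

    one-E : ∀ e → oneₛ e ≡ E δ e
    one-E e with all (_≡ᵇ 0) (toList e) | all-lookup
      where
      all-lookup : all (_≡ᵇ 0) (toList e) ≡ all (λ s → lookup e s ≡ᵇ 0) (toList (allFin d))
      all-lookup = ≡.trans (cong (all (_≡ᵇ 0) ∘ toList) (≡.sym (VecP.tabulate∘lookup e))) (all-tabulate (_≡ᵇ 0) (lookup e))
    one-E e | _ | ≡.refl with lookup e p in eqp | lookup e q in eqq | lookup e r in eqr
    ... | zero | zero | zero = cong (λ b → if b then + 1 else + 0) (all-cong (toList (allFin d)) same)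
      where
      same : ∀ s → (lookup e s ≡ᵇ 0) ≡ (listed s ∨ (lookup e s ≡ᵇ 0))
      same s with finEqᵇ s p in sp
      ... | true rewrite finEqᵇ-true s p sp | eqp = ≡.refl
      ... | false with finEqᵇ s q in sq
      ...   | true rewrite finEqᵇ-true s q sq | eqq = ≡.refl
      ...   | false with finEqᵇ s r in sr
      ...     | true rewrite finEqᵇ-true s r sr | eqr = ≡.refl
      ...     | false = ≡.refl
    ... | suc _ | _ | _ rewrite all-tabulate-false (λ s → lookup e s ≡ᵇ 0) id p (cong (_≡ᵇ 0) eqp) with supported e
    ...   | true = ≡.refl
    ...   | false = ≡.refl
    one-E e | _ | ≡.refl | zero | suc _ | _ rewrite all-tabulate-false (λ s → lookup e s ≡ᵇ 0) id q (cong (_≡ᵇ 0) eqq) with supported e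
    ...   | true = ≡.refl
    ...   | false = ≡.refl
    one-E e | _ | ≡.refl | zero | zero | suc _ rewrite all-tabulate-false (λ s → lookup e s ≡ᵇ 0) id r (cong (_≡ᵇ 0) eqr) with supported e
    ...   | true = ≡.refl
    ...   | false = ≡.refl

    -- The equation g = 1 + x y g, which characterises 1 / (1 - xy) without division.
    geom-identity : ∀ i j k → geom3 i j k ≡ δ i j k ℤ.+ shiftq (shiftr geom3) i j k
    geom-identity zero zero zero = ≡.refl
    geom-identity zero zero (suc k) = ≡.refl
    geom-identity zero (suc j) zero = ≡.refl
    geom-identity zero (suc j) (suc k) = ≡.sym (ℤP.+-identityˡ _)
    geom-identity (suc i) zero zero = ≡.refl
    geom-identity (suc i) zero (suc k) = ≡.refl
    geom-identity (suc i) (suc j) zero = ≡.refl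
    geom-identity (suc i) (suc j) (suc k) = ≡.refl

    -- For u = x̄y the equation u + βx u = -xy, that is (1 + βx) x̄ = -x. The signs alternate with
    -- the power of β, so all terms but the first cancel in pairs.
    xbar-identity : ∀ i j k →
      xbarY3 i j k ℤ.+ shiftq (shiftp xbarY3) i j k ≡ ℤ.- shiftq (shiftr δ) i j k
    xbar-identity zero zero zero = ≡.refl
    xbar-identity zero zero (suc zero) = ≡.refl
    xbar-identity zero zero (suc (suc k)) = ≡.refl
    xbar-identity (suc i) zero zero = ≡.refl
    xbar-identity (suc i) zero (suc zero) = ≡.refl
    xbar-identity (suc i) zero (suc (suc k)) = ≡.refl
    xbar-identity zero (suc j) zero = ≡.refl
    xbar-identity zero (suc zero) (suc zero) = ≡.refl
    xbar-identity zero (suc (suc j)) (suc zero) = ≡.refl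
    xbar-identity zero (suc zero) (suc (suc k)) = ≡.refl
    xbar-identity zero (suc (suc j)) (suc (suc k)) = ≡.refl
    xbar-identity (suc i) (suc j) zero = ≡.refl
    xbar-identity (suc i) (suc j) (suc (suc k)) = ≡.refl
    xbar-identity (suc i) (suc zero) (suc zero) = ≡.refl
    xbar-identity (suc i) (suc (suc j)) (suc zero) with j ≡ᵇ i
    ... | true = ℤP.+-inverseˡ (negOnePow (suc i))
    ... | false = ≡.refl

open Kernel

module KernelRing where
  open import Data.List using (foldr)
  open import Data.Vec using (allFin)
  import Data.Vec.Relation.Binary.Pointwise.Inductive as Pointwise
  open import Data.Fin using (zero; suc)
  open Series
  open Kernel

  -- The operators are iterated over ℕ while the variables are indexed by `Fin m`; the default value
  -- makes the family total.
  extend : ∀ {m} {A : Set} → (Fin m → A) → A → ℕ → A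
  extend {zero} g a i = a
  extend {suc m} g a zero = g zero
  extend {suc m} g a (suc i) = extend (g ∘ suc) a i

  extend-< : ∀ {m} {A : Set} (g : Fin m → A) a {i} (i<m : i < m) → extend g a i ≡ g (fromℕ< i<m)
  extend-< {suc m} g a {zero} (s≤s z≤n) = ≡.refl
  extend-< {suc m} g a {suc i} (s≤s i<m) = extend-< (g ∘ suc) a i<m

  module Truncation (m n : ℕ) (k : ℕ) (a : Vec ℕ m) (b : Vec ℕ n) where

    bound : Vec ℕ (suc (m ℕ.+ n))
    bound = k ∷ (a ++ᵥ b)

    R : CommutativeRing 0ℓ 0ℓ
    R = truncatedRing bound

    open CommutativeRing R hiding (zero)
    open FiniteSums R
    open IntegerSolver R using (solve; _:=_; _:+_; _:*_; :-_; :1)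
    open import Algebra.Properties.Semiring.Exp semiring using (_^_)
    open import Relation.Binary.Reasoning.Setoid setoid

    -- The sign is chosen for the plane partitions, where a box beyond the first of its line weighs
    -- -β. Tableaux then use β = -t.
    β t : Ser (suc (m ℕ.+ n))
    β = var (βpos m n)
    t = - β

    x y : ℕ → Ser (suc (m ℕ.+ n))
    x = extend (λ i → var (xpos m n i)) 0#
    y = extend (λ j → var (ypos m n j)) 0#

    f : ℕ → ℕ → Ser (suc (m ℕ.+ n))
    f i j = extend (λ i′ → extend (λ j′ → kernelFactor m n i′ j′) 1# j) 1# i

    private
      x≢y : ∀ i j → xpos m n i ≢ ypos m n j
      x≢y i j eq = ↑-disjoint i j (FinP.suc-injective eq)
        where
        ↑-disjoint : ∀ {m n} (i : Fin m) (j : Fin n) → i ↑ˡ n ≢ m ↑ʳ j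
        ↑-disjoint (suc i) j eq = ↑-disjoint i j (FinP.suc-injective eq)

      -- With u = x̄y and g = 1 / (1 - xy) the left side regroups as ((1 + βx) - (u + βxu)) (g -
      -- xyg). The functional equations turn the first factor into 1 + βx + xy and the second into
      -- 1.
      kernelFactor-equation : ∀ i j → (let x = var (xpos m n i) ; y = var (ypos m n j)) →
        (1# + - (x * t)) * (1# + - (x * y)) * kernelFactor m n i j ≈ 1# + - (x * t) + x * y
      kernelFactor-equation i j = begin
        (1# + - (X * t)) * (1# + - (X * Y)) * kernelFactor m n i j
          ≈⟨ *-congˡ (coefficients (λ e _ → *ₛ≡⋆ₛ (oneₛ -ₛ E xbarY3) (E geom3) e)) ⟩
        (1# + - (X * - β)) * (1# + - (X * Y)) * ((1# + - E xbarY3) * E geom3)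
          ≈⟨ solve 5 (λ x β y u g → (:1 :+ :- (x :* :- β)) :* (:1 :+ :- (x :* y)) :* ((:1 :+ :- u) :* g)
               := ((:1 :+ x :* β) :+ :- (u :+ x :* (β :* u))) :* (g :+ :- (x :* (y :* g))))
               refl X β Y (E xbarY3) (E geom3) ⟩
        ((1# + X * β) + - (E xbarY3 + X * (β * E xbarY3))) * (E geom3 + - (X * (Y * E geom3)))
          ≈⟨ *-cong (+-congˡ {1# + X * β} (-‿cong xbar)) (+-congʳ { - (X * (Y * E geom3)) } geom) ⟩
        ((1# + X * β) + - - (X * Y)) * (1# + X * (Y * E geom3) + - (X * (Y * E geom3)))
          ≈⟨ solve 4 (λ x β y z → ((:1 :+ x :* β) :+ :- (:- (x :* y))) :* (:1 :+ z :+ :- z)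
               := :1 :+ :- (x :* :- β) :+ x :* y) refl X β Y (X * (Y * E geom3)) ⟩
        1# + - (X * t) + X * Y ∎
        where
        X Y : Ser (suc (m ℕ.+ n))
        X = var (xpos m n i)
        Y = var (ypos m n j)
        open ThreeVariables (βpos m n) (xpos m n i) (ypos m n j) (λ ()) (λ ()) (x≢y i j)
        XβE : X * (β * E xbarY3) ≈ E (shiftq (shiftp xbarY3))
        XβE = trans (*-congˡ {X} (coefficients (λ e _ → var-p xbarY3 e))) (coefficients (λ e _ → var-q (shiftp xbarY3) e))
        XY : X * Y ≈ E (shiftq (shiftr δ))
        XY = trans (*-congˡ {X} (trans (sym (*-identityʳ Y)) (trans (*-congˡ {Y} (coefficients (λ e _ → one-E e)))
          (coefficients (λ e _ → var-r δ e))))) (coefficients (λ e _ → var-q (shiftr δ) e))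
        xbar : E xbarY3 + X * (β * E xbarY3) ≈ - (X * Y)
        xbar = trans (+-congˡ {E xbarY3} XβE) (trans (coefficients (λ e _ → ≡.trans (E-+ xbarY3 (shiftq (shiftp xbarY3)) e)
          (≡.trans (E-cong xbar-identity e) (≡.sym (E-neg (shiftq (shiftr δ)) e))))) (-‿cong (sym XY)))
        XYE : X * (Y * E geom3) ≈ E (shiftq (shiftr geom3))
        XYE = trans (*-congˡ {X} (coefficients (λ e _ → var-r geom3 e))) (coefficients (λ e _ → var-q (shiftr geom3) e))
        geom : E geom3 ≈ 1# + X * (Y * E geom3)
        geom = trans (coefficients (λ e _ → ≡.trans (E-cong geom-identity e)
          (≡.trans (≡.sym (E-+ δ (shiftq (shiftr geom3)) e)) (cong₂ ℤ._+_ (≡.sym (one-E e)) ≡.refl))))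
          (+-congˡ {1#} (sym XYE))

    factor : ∀ i j → i < m → j < n →
      (1# + - (x i * t)) * (1# + - (x i * y j)) * f i j ≈ 1# + - (x i * t) + x i * y j
    factor i j i<m j<n
      rewrite extend-< (λ i → var (xpos m n i)) 0# i<m | extend-< (λ j → var (ypos m n j)) 0# j<n
            | extend-< (λ i′ → extend (λ j′ → kernelFactor m n i′ j′) 1# j) 1# i<m
            | extend-< (λ j′ → kernelFactor m n (fromℕ< i<m) j′) 1# j<n
      = kernelFactor-equation (fromℕ< i<m) (fromℕ< j<n)

    times : ℕ → ∀ {d} → Vec ℕ d → Vec ℕ d
    times c = Vec.map (c ℕ.*_)

    private
      mono-^ : ∀ (v : Vec ℕ (suc (m ℕ.+ n))) c → mono v ^ c ≈ mono (times c v)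
      mono-^ v zero = trans (sym (coefficients (λ e _ → mono-zeros e))) (reflexive (cong mono (zero-times v)))
        where
        zero-times : ∀ {d} (v : Vec ℕ d) → zeros ≡ times 0 v
        zero-times [] = ≡.refl
        zero-times (x ∷ v) = cong (0 ∷_) (zero-times v)
      mono-^ v (suc c) = trans (*-congˡ {mono v} (mono-^ v c)) (trans (mono-* v (times c v) bound)
        (reflexive (cong mono (suc-times v))))
        where
        suc-times : ∀ {d} (v : Vec ℕ d) → v +ᵥ times c v ≡ times (suc c) v
        suc-times [] = ≡.refl
        suc-times (x ∷ v) = cong (x ℕ.+ c ℕ.* x ∷_) (suc-times v)

      lookup-ε : ∀ {d} (p : Fin d) → lookup (ε p) p ≡ 1
      lookup-ε zero = ≡.refl
      lookup-ε (suc p) = lookup-ε p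

    -- The power is a single monomial, whose exponent at `p` exceeds the bound by one.
    var-nilpotent : ∀ p → var p ^ suc (lookup bound p) ≈ 0#
    var-nilpotent p = trans (mono-^ (ε p) c) (coefficients (λ e e≤ → mono-other (times c (ε p)) e (λ eq →
      ℕP.<⇒≢ (s≤s (Pointwise.lookup e≤ p)) (≡.sym (exponent e eq)))))
      where
      c = suc (lookup bound p)
      exponent : ∀ e → times c (ε p) ≡ e → c ≡ lookup e p
      exponent e ≡.refl = ≡.sym (≡.trans (VecP.lookup-map p (c ℕ.*_) (ε p))
        (≡.trans (cong (c ℕ.*_) (lookup-ε p)) (ℕP.*-identityʳ c)))

    p : ℕ → ℕ
    p = extend (lookup a) 0

    nil : ∀ i → i < m → x i ^ suc (p i) ≈ 0#
    nil i i<m rewrite extend-< (λ i → var (xpos m n i)) 0# i<m | extend-< (lookup a) 0 i<m =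
      subst (λ c → var (xpos m n (fromℕ< i<m)) ^ suc c ≈ 0#) (VecP.lookup-++ˡ a b (fromℕ< i<m))
        (var-nilpotent (xpos m n (fromℕ< i<m)))

    prod : ℕ → (ℕ → Carrier) → Carrier
    prod zero g = 1#
    prod (suc j) g = prod j g * g j

    prod-head : ∀ j g → prod (suc j) g ≈ g 0 * prod j (g ∘ suc)
    prod-head zero g = *-comm _ _
    prod-head (suc j) g = trans (*-congʳ (prod-head j g)) (*-assoc _ _ _)

    prod-cong : ∀ j {g h} → (∀ i → g i ≈ h i) → prod j g ≈ prod j h
    prod-cong zero eq = refl
    prod-cong (suc j) eq = *-cong (prod-cong j eq) (eq j)

    ∏-extend : ∀ {j} {A : Set} (h : Fin j → A) (g : A → Carrier) u →
      ∏ (toList (tabulate h)) g ≈ prod j (extend (g ∘ h) u)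
    ∏-extend {zero} h g u = refl
    ∏-extend {suc j} h g u = trans (*-congˡ (∏-extend (h ∘ suc) g u)) (sym (prod-head j _))

    prod-swap : ∀ i j (g : ℕ → ℕ → Carrier) →
      prod i (λ i′ → prod j (g i′)) ≈ prod j (λ j′ → prod i (λ i′ → g i′ j′))
    prod-swap zero j g = sym (prod-one j)
      where
      prod-one : ∀ j → prod j (λ _ → 1#) ≈ 1#
      prod-one zero = refl
      prod-one (suc j) = trans (*-identityʳ _) (prod-one j)
    prod-swap (suc i) j g = trans (*-congʳ (prod-swap i j g)) (merge j)
      where
      open import Algebra.Properties.CommutativeSemigroup *-commutativeSemigroup using (interchange)
      merge : ∀ j → prod j (λ j′ → prod i (λ i′ → g i′ j′)) * prod j (g i)
        ≈ prod j (λ j′ → prod i (λ i′ → g i′ j′) * g i j′)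
      merge zero = *-identityˡ _
      merge (suc j) = trans (interchange _ _ _ _) (*-congʳ (merge j))

    -- `kernel` lists its factors with the x variables outermost, whereas the eigenvalues of the
    -- operators of y_j come with j outermost; hence the interchange at the end.
    kernel-prod : kernel m n ≈ prod n (λ j → prod m (λ i → f i j))
    kernel-prod = begin
      foldr _*ₛ_ oneₛ factors ≈⟨ foldr-∏ factors ⟩
      ∏ factors id ≈⟨ ∏-concatMap _ (toList (allFin m)) id ⟩
      ∏ (toList (allFin m)) (λ i → ∏ (List.map (kernelFactor m n i) (toList (allFin n))) id)
        ≈⟨ ∏-cong (toList (allFin m)) (λ i → trans (∏-map (kernelFactor m n i) (toList (allFin n)) id)
             (∏-extend id (kernelFactor m n i) 1#)) ⟩
      ∏ (toList (allFin m)) (λ i → prod n (extend (kernelFactor m n i) 1#))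
        ≈⟨ ∏-extend {m} id (λ i → prod n (extend (kernelFactor m n i) 1#)) (prod n (λ _ → 1#)) ⟩
      prod m (extend (λ i → prod n (extend (kernelFactor m n i) 1#)) (prod n (λ _ → 1#)))
        ≈⟨ prod-cong m (λ i → reflexive (extend-commute (λ i → extend (kernelFactor m n i) 1#) i)) ⟩
      prod m (λ i → prod n (f i)) ≈⟨ prod-swap m n f ⟩
      prod n (λ j → prod m (λ i → f i j)) ∎
      where
      factors = concatMap (λ i → List.map (λ j → kernelFactor m n i j) (toList (allFin n))) (toList (allFin m))
      foldr-∏ : ∀ fs → foldr _*ₛ_ oneₛ fs ≈ ∏ fs id
      foldr-∏ [] = refl
      foldr-∏ (g ∷ fs) = trans (coefficients (λ e _ → *ₛ≡⋆ₛ g (foldr _*ₛ_ oneₛ fs) e)) (*-congˡ {g} (foldr-∏ fs))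
      extend-commute : ∀ {m} (h : Fin m → ℕ → Carrier) i →
        extend (λ i → prod n (h i)) (prod n (λ _ → 1#)) i ≡ prod n (λ j → extend (λ i → h i j) 1# i)
      extend-commute {zero} h i = ≡.refl
      extend-commute {suc m} h zero = ≡.refl
      extend-commute {suc m} h (suc i) = extend-commute (h ∘ suc) i

open KernelRing

-- Fillings

∧-true : ∀ {a b} → a ∧ b ≡ true → a ≡ true × b ≡ true
∧-true {true} {true} _ = ≡.refl , ≡.refl

∧-intro : ∀ {a b} → a ≡ true → b ≡ true → a ∧ b ≡ true
∧-intro ≡.refl ≡.refl = ≡.refl

≡-from-⇔ : ∀ {a b} → (a ≡ true → b ≡ true) → (b ≡ true → a ≡ true) → a ≡ b
≡-from-⇔ {false} {false} f g = ≡.refl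
≡-from-⇔ {false} {true} f g = g ≡.refl
≡-from-⇔ {true} {b} f g = ≡.sym (f ≡.refl)

∧-interchange : ∀ a b c d → (a ∧ b) ∧ (c ∧ d) ≡ (a ∧ c) ∧ (b ∧ d)
∧-interchange true true c d = ≡.refl
∧-interchange true false c d = ≡.sym (BoolP.∧-zeroʳ c)
∧-interchange false b c d = ≡.refl

all-true : {A : Set} {p : A → Bool} (as : List A) → all p as ≡ true → ∀ {a} → a ∈ as → p a ≡ true
all-true (a ∷ as) h (here ≡.refl) = proj₁ (∧-true h)
all-true (a ∷ as) h (there a∈) = all-true as (proj₂ (∧-true h)) a∈

all-intro : {A : Set} {p : A → Bool} (as : List A) → (∀ {a} → a ∈ as → p a ≡ true) → all p as ≡ true
all-intro [] h = ≡.refl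
all-intro (a ∷ as) h = ∧-intro (h (here ≡.refl)) (all-intro as (λ a∈ → h (there a∈)))

all-map : {A B : Set} (p : B → Bool) (f : A → B) (as : List A) → all p (map f as) ≡ all (λ a → p (f a)) as
all-map p f [] = ≡.refl
all-map p f (a ∷ as) = cong (p (f a) ∧_) (all-map p f as)

allPairs : {A : Set} → (A → A → Bool) → List A → Bool
allPairs ok as = all (λ a → all (λ a′ → ok a a′) as) as

allPairs-true : {A : Set} {ok : A → A → Bool} (as : List A) → allPairs ok as ≡ true →
  ∀ {a a′} → a ∈ as → a′ ∈ as → ok a a′ ≡ true
allPairs-true as h a∈ a′∈ = all-true as (all-true as h a∈) a′∈

allPairs-intro : {A : Set} {ok : A → A → Bool} (as : List A) →
  (∀ {a a′} → a ∈ as → a′ ∈ as → ok a a′ ≡ true) → allPairs ok as ≡ true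
allPairs-intro as h = all-intro as (λ a∈ → all-intro as (λ a′∈ → h a∈ a′∈))

relabel : {B C C′ : Set} → (C → C′) → List (B × C) → List (B × C′)
relabel f = map (map₂ f)

∈-assignments : {B C : Set} (bs : List B) (cs : List C) {F : List (B × C)} → F ∈ assignments bs cs →
  map proj₁ F ≡ bs × (∀ {p} → p ∈ F → proj₂ p ∈ cs)
∈-assignments [] cs (here ≡.refl) = ≡.refl , λ ()
∈-assignments (b ∷ bs) cs F∈
  with find (∈-concatMap⁻ (λ c → map ((b , c) ∷_) (assignments bs cs)) {xs = cs} F∈)
... | c , c∈ , F∈′ with ∈-map⁻ ((b , c) ∷_) F∈′
...   | F′ , F′∈ , ≡.refl with ∈-assignments bs cs F′∈
...     | bs≡ , letters = cong (b ∷_) bs≡ , λ { (here ≡.refl) → c∈ ; (there p∈) → letters p∈ }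

Status : Set
Status = Maybe Bool

-- A box filled with entries up to c is split into its status and, if it also contains smaller
-- entries, those entries: nothing stands for a box with only the entry c, and just o for a box
-- with smaller entries, which contains c iff o is true.
options : {C : Set} → List C → Status → List (Maybe (Bool × C))
options cs nothing = nothing ∷ []
options cs (just o) = map (λ c → just (o , c)) cs

enriched : {C : Set} → List Status → List C → List (Maybe (Bool × C))
enriched sts cs = concatMap (options cs) sts

kept : {B : Set} → List (B × Status) → List B
kept [] = []
kept ((b , nothing) ∷ S) = kept S
kept ((b , just _) ∷ S) = b ∷ kept S

module _ {B C : Set} where
  statusOf : List (B × Maybe (Bool × C)) → List (B × Status)
  statusOf = relabel (Maybe.map proj₁)

  present : List (B × Maybe (Bool × C)) → List (B × C)
  present [] = []
  present ((b , nothing) ∷ G) = present G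
  present ((b , just (o , c)) ∷ G) = (b , c) ∷ present G

  ∈-statusOf⁻ : ∀ {G : List (B × Maybe (Bool × C))} {b a} → (b , a) ∈ statusOf G → ∃ λ e → (b , e) ∈ G × a ≡ Maybe.map proj₁ e
  ∈-statusOf⁻ a∈ with ∈-map⁻ (map₂ (Maybe.map proj₁)) a∈
  ... | (b , e) , e∈ , ≡.refl = e , e∈ , ≡.refl

  ∈-present⁻ : ∀ (G : List (B × Maybe (Bool × C))) {b c} → (b , c) ∈ present G → ∃ λ o → (b , just (o , c)) ∈ G
  ∈-present⁻ ((b , nothing) ∷ G) c∈ with ∈-present⁻ G c∈
  ... | o , e∈ = o , there e∈
  ∈-present⁻ ((b , just (o , c)) ∷ G) (here ≡.refl) = o , here ≡.refl
  ∈-present⁻ ((b , just (o , c)) ∷ G) (there c∈) with ∈-present⁻ G c∈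
  ... | o′ , e∈ = o′ , there e∈

  ∈-present⁺ : ∀ (G : List (B × Maybe (Bool × C))) {b o c} → (b , just (o , c)) ∈ G → (b , c) ∈ present G
  ∈-present⁺ ((b , nothing) ∷ G) (there e∈) = ∈-present⁺ G e∈
  ∈-present⁺ ((b , just (o , c)) ∷ G) (here ≡.refl) = here ≡.refl
  ∈-present⁺ ((b , just (o , c)) ∷ G) (there e∈) = there (∈-present⁺ G e∈)

module AssignmentSums (R : CommutativeRing 0ℓ 0ℓ) where
  open CommutativeRing R hiding (zero)
  open FiniteSums R
  open import Relation.Binary.Reasoning.Setoid setoid

  ∑-assignments-∷ : {B C : Set} (b : B) (bs : List B) (cs : List C) (Φ : List (B × C) → Carrier) →
    ∑ (assignments (b ∷ bs) cs) Φ ≈ ∑ cs (λ c → ∑ (assignments bs cs) (λ F → Φ ((b , c) ∷ F)))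
  ∑-assignments-∷ b bs cs Φ = trans (∑-concatMap _ cs Φ)
    (∑-cong cs (λ c → ∑-map ((b , c) ∷_) (assignments bs cs) Φ))

  ∑-relabel : {B C E : Set} (f : E → C) (cs : List C) (es : List E) →
    (∀ φ → ∑ cs φ ≈ ∑ es (λ e → φ (f e))) → (bs : List B) (Φ : List (B × C) → Carrier) →
    ∑ (assignments bs cs) Φ ≈ ∑ (assignments bs es) (λ G → Φ (relabel f G))
  ∑-relabel f cs es eq [] Φ = refl
  ∑-relabel f cs es eq (b ∷ bs) Φ = begin
    ∑ (assignments (b ∷ bs) cs) Φ ≈⟨ ∑-assignments-∷ b bs cs Φ ⟩
    ∑ cs (λ c → ∑ (assignments bs cs) (λ F → Φ ((b , c) ∷ F)))
      ≈⟨ ∑-cong cs (λ c → ∑-relabel f cs es eq bs _) ⟩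
    ∑ cs (λ c → ∑ (assignments bs es) (λ G → Φ ((b , c) ∷ relabel f G))) ≈⟨ eq _ ⟩
    ∑ es (λ e → ∑ (assignments bs es) (λ G → Φ ((b , f e) ∷ relabel f G))) ≈⟨ ∑-assignments-∷ b bs es _ ⟨
    ∑ (assignments (b ∷ bs) es) (λ G → Φ (relabel f G)) ∎

  -- Separates the position of the largest letter from everything else: the inner sum is again a sum
  -- over fillings, but of the kept boxes only.
  ∑-split : {B C : Set} (sts : List Status) (cs : List C) (bs : List B)
    (ψ : List (B × Status) → List (B × C) → Carrier) →
    ∑ (assignments bs (enriched sts cs)) (λ G → ψ (statusOf G) (present G))
      ≈ ∑ (assignments bs sts) (λ S → ∑ (assignments (kept S) cs) (ψ S))
  ∑-split sts cs [] ψ = sym (trans (+-identityʳ _) refl)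
  ∑-split {B} {C} sts cs (b ∷ bs) ψ = begin
    ∑ (assignments (b ∷ bs) es) (λ G → ψ (statusOf G) (present G)) ≈⟨ ∑-assignments-∷ b bs es _ ⟩
    ∑ es (λ e → ∑ (assignments bs es) (λ G → ψ (statusOf ((b , e) ∷ G)) (present ((b , e) ∷ G))))
      ≈⟨ ∑-concatMap _ sts _ ⟩
    ∑ sts _ ≈⟨ ∑-cong sts by-status ⟩
    ∑ sts (λ a → ∑ (assignments bs sts) (λ S → ∑ (assignments (kept ((b , a) ∷ S)) cs) (ψ ((b , a) ∷ S))))
      ≈⟨ ∑-assignments-∷ b bs sts _ ⟨
    ∑ (assignments (b ∷ bs) sts) (λ S → ∑ (assignments (kept S) cs) (ψ S)) ∎
    where
    es = enriched sts cs
    summand : Maybe (Bool × C) → Carrier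
    summand e = ∑ (assignments bs es) (λ G → ψ (statusOf ((b , e) ∷ G)) (present ((b , e) ∷ G)))
    by-status : ∀ a → ∑ (options cs a) summand
      ≈ ∑ (assignments bs sts) (λ S → ∑ (assignments (kept ((b , a) ∷ S)) cs) (ψ ((b , a) ∷ S)))
    by-status nothing = trans (+-identityʳ _) (∑-split sts cs bs (λ S → ψ ((b , nothing) ∷ S)))
    by-status (just o) = begin
      ∑ (map (λ c → just (o , c)) cs) summand ≈⟨ ∑-map _ cs summand ⟩
      ∑ cs (λ c → summand (just (o , c)))
        ≈⟨ ∑-cong cs (λ c → ∑-split sts cs bs (λ S F → ψ ((b , just o) ∷ S) ((b , c) ∷ F))) ⟩
      ∑ cs (λ c → ∑ (assignments bs sts) (λ S → ∑ (assignments (kept S) cs) (λ F → ψ ((b , just o) ∷ S) ((b , c) ∷ F))))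
        ≈⟨ ∑-swap cs (assignments bs sts) _ ⟩
      ∑ (assignments bs sts) (λ S → ∑ cs (λ c → ∑ (assignments (kept S) cs) (λ F → ψ ((b , just o) ∷ S) ((b , c) ∷ F))))
        ≈⟨ ∑-cong (assignments bs sts) (λ S → ∑-assignments-∷ b (kept S) cs (ψ ((b , just o) ∷ S))) ⟨
      ∑ (assignments bs sts) (λ S → ∑ (assignments (b ∷ kept S) cs) (ψ ((b , just o) ∷ S))) ∎

  -- Distributivity. It applies as soon as validity of a status assignment has become a condition on
  -- single boxes.
  ∑-assignments-∏ : {B C : Set} (bs : List B) (cs : List C) (g : B × C → Carrier) →
    ∑ (assignments bs cs) (λ F → ∏ F g) ≈ ∏ bs (λ b → ∑ cs (λ c → g (b , c)))
  ∑-assignments-∏ [] cs g = +-identityʳ 1#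
  ∑-assignments-∏ (b ∷ bs) cs g = begin
    ∑ (assignments (b ∷ bs) cs) (λ F → ∏ F g) ≈⟨ ∑-assignments-∷ b bs cs _ ⟩
    ∑ cs (λ c → ∑ (assignments bs cs) (λ F → g (b , c) * ∏ F g))
      ≈⟨ ∑-cong cs (λ c → sym (∑-distribˡ (assignments bs cs) _ _)) ⟩
    ∑ cs (λ c → g (b , c) * ∑ (assignments bs cs) (λ F → ∏ F g)) ≈⟨ ∑-distribʳ cs _ _ ⟨
    ∑ cs (λ c → g (b , c)) * ∑ (assignments bs cs) (λ F → ∏ F g) ≈⟨ *-congˡ (∑-assignments-∏ bs cs g) ⟩
    ∑ cs (λ c → g (b , c)) * ∏ bs (λ b′ → ∑ cs (λ c → g (b′ , c))) ∎

-- Shapes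

Box : Set
Box = ℕ × ℕ

<ᵇ-true : ∀ {m n} → m < n → (m <ᵇ n) ≡ true
<ᵇ-true {m} {n} m<n = BoolP.T-≡ .Function.Equivalence.to (ℕP.<⇒<ᵇ m<n)
  where import Function

<ᵇ-< : ∀ {m n} → (m <ᵇ n) ≡ true → m < n
<ᵇ-< {m} {n} eq = ℕP.<ᵇ⇒< m n (BoolP.T-≡ .Function.Equivalence.from eq)
  where import Function

<ᵇ-false : ∀ {m n} → n ≤ m → (m <ᵇ n) ≡ false
<ᵇ-false {m} {n} n≤m with m <ᵇ n in eq
... | true = ⊥-elim (ℕP.<⇒≱ (<ᵇ-< {m} {n} eq) n≤m)
... | false = ≡.refl

<ᵇ-≥ : ∀ {m n} → (m <ᵇ n) ≡ false → n ≤ m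
<ᵇ-≥ {m} {n} eq = ℕP.≮⇒≥ (λ m<n → case (≡.trans (≡.sym (<ᵇ-true m<n)) eq))
  where
  case : true ≡ false → ⊥
  case ()

≤ᵇ-true : ∀ {m n} → m ≤ n → (m ≤ᵇ n) ≡ true
≤ᵇ-true {zero} _ = ≡.refl
≤ᵇ-true {suc m} m≤n = <ᵇ-true m≤n

≤ᵇ-≤ : ∀ {m n} → (m ≤ᵇ n) ≡ true → m ≤ n
≤ᵇ-≤ {zero} _ = z≤n
≤ᵇ-≤ {suc m} eq = <ᵇ-< eq

≤ᵇ-false : ∀ {m n} → n < m → (m ≤ᵇ n) ≡ false
≤ᵇ-false {suc m} (s≤s n≤m) = <ᵇ-false n≤m

bit : Bool → ℕ
bit true = 1
bit false = 0

parts : ∀ {L} → Vec Bool L → List ℕ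
parts [] = []
parts {suc L} (true ∷ w) = suc L ∷ parts w
parts (false ∷ w) = parts w

-- The number of boxes of content s, that is, of parts greater than s.
height : ∀ {L} → Vec Bool L → ℕ → ℕ
height [] s = 0
height {suc L} (b ∷ w) s = (if s <ᵇ suc L then bit b else 0) ℕ.+ height w s

height-∷ : ∀ {L} b (w : Vec Bool L) {s} → s ≤ L → height (b ∷ w) s ≡ bit b ℕ.+ height w s
height-∷ b w s≤L rewrite <ᵇ-true (s≤s s≤L) = ≡.refl

height-top : ∀ {L} (w : Vec Bool L) {s} → L ≤ s → height w s ≡ 0
height-top [] _ = ≡.refl
height-top {suc L} (b ∷ w) {s} L<s rewrite <ᵇ-false L<s = height-top w (ℕP.<⇒≤ L<s)

height-anti : ∀ {L} (w : Vec Bool L) s → height w (suc s) ≤ height w s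
height-anti [] s = z≤n
height-anti {suc L} (b ∷ w) s with s <ᵇ L in eq
... | true rewrite <ᵇ-true (ℕP.m≤n⇒m≤1+n (<ᵇ-< {s} {L} eq)) = ℕP.+-monoʳ-≤ (bit b) (height-anti w s)
... | false = ℕP.≤-trans (height-anti w s) (ℕP.m≤n+m _ _)

height-step : ∀ {L} (w : Vec Bool L) s → height w s ≤ suc (height w (suc s))
height-step [] s = z≤n
height-step {suc L} (b ∷ w) s with s <ᵇ L in eq
... | true rewrite <ᵇ-true (ℕP.m≤n⇒m≤1+n (<ᵇ-< {s} {L} eq)) =
  ℕP.≤-trans (ℕP.+-monoʳ-≤ (bit b) (height-step w s)) (ℕP.≤-reflexive (ℕP.+-suc (bit b) _))
... | false rewrite height-top w (<ᵇ-≥ {s} {L} eq) | height-top w (ℕP.m≤n⇒m≤1+n (<ᵇ-≥ {s} {L} eq)) with s <ᵇ suc L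
...   | true = ℕP.≤-trans (ℕP.≤-reflexive (ℕP.+-identityʳ (bit b))) (bit≤1 b)
  where
  bit≤1 : ∀ b → bit b ≤ 1
  bit≤1 true = ℕP.≤-refl
  bit≤1 false = z≤n
...   | false = z≤n

at-parts-≤ : ∀ {L} (w : Vec Bool L) r → at (parts w) r ≤ L
at-parts-≤ [] r = z≤n
at-parts-≤ (true ∷ w) zero = ℕP.≤-refl
at-parts-≤ (true ∷ w) (suc r) = ℕP.m≤n⇒m≤1+n (at-parts-≤ w r)
at-parts-≤ (false ∷ w) r = ℕP.m≤n⇒m≤1+n (at-parts-≤ w r)

-- Row lengths and diagonal lengths describe the same diagram. The diagrams of the statement are
-- listed by rows, but transfer matrices run through diagonals; this implication and its converse
-- `height⇒at` translate between the two.
at⇒height : ∀ {L} (w : Vec Bool L) r s → s < at (parts w) r → r < height w s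
at⇒height {suc L} (true ∷ w) zero s s< rewrite <ᵇ-true s< = s≤s z≤n
at⇒height {suc L} (true ∷ w) (suc r) s s<
  rewrite <ᵇ-true (ℕP.m≤n⇒m≤1+n (ℕP.≤-trans s< (at-parts-≤ w r))) = s≤s (at⇒height w r s s<)
at⇒height (false ∷ w) r s s< = ℕP.≤-trans (at⇒height w r s s<) (ℕP.m≤n+m _ _)

height⇒at : ∀ {L} (w : Vec Bool L) r s → r < height w s → s < at (parts w) r
height⇒at {suc L} (true ∷ w) r s r< with s <ᵇ suc L in eq
height⇒at {suc L} (true ∷ w) zero s r< | true = <ᵇ-< {s} {suc L} eq
height⇒at {suc L} (true ∷ w) (suc r) s (s≤s r<) | true = height⇒at w r s r<
height⇒at {suc L} (true ∷ w) r s r< | false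
  rewrite height-top w (ℕP.≤-trans (ℕP.n≤1+n L) (<ᵇ-≥ {s} {suc L} eq)) = ⊥-elim (ℕP.n≮0 r<)
height⇒at {suc L} (false ∷ w) r s r< with s <ᵇ suc L
... | true = height⇒at w r s r<
... | false = height⇒at w r s r<

at-height-≤ : ∀ {L} (v w : Vec Bool L) → (∀ s → height v s ≤ height w s) → ∀ r → at (parts v) r ≤ at (parts w) r
at-height-≤ v w h r with at (parts v) r in eq
... | zero = z≤n
... | suc s = height⇒at w r s (ℕP.≤-trans (at⇒height v r s (ℕP.≤-reflexive (≡.sym eq))) (h s))

height-injective : ∀ {L} (v w : Vec Bool L) → (∀ s → height v s ≡ height w s) → v ≡ w
height-injective [] [] h = ≡.refl
height-injective {suc L} (a ∷ v) (b ∷ w) h = cong₂ _∷_ heads (height-injective v w tails)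
  where
  bit-injective : ∀ a b → bit a ≡ bit b → a ≡ b
  bit-injective true true _ = ≡.refl
  bit-injective false false _ = ≡.refl
  top : ∀ b (w : Vec Bool L) → height (b ∷ w) L ≡ bit b
  top b w = ≡.trans (height-∷ b w ℕP.≤-refl)
    (≡.trans (cong (bit b ℕ.+_) (height-top w ℕP.≤-refl)) (ℕP.+-identityʳ _))
  heads : a ≡ b
  heads = bit-injective a b (≡.trans (≡.sym (top a v)) (≡.trans (h L) (top b w)))
  tails : ∀ s → height v s ≡ height w s
  tails s with s <ᵇ suc L in eq
  ... | true = ℕP.+-cancelˡ-≡ (bit a) _ _ (≡.trans (≡.sym (height-∷ a v s≤L))
      (≡.trans (h s) (≡.trans (height-∷ b w s≤L) (cong (λ c → bit c ℕ.+ height w s) (≡.sym heads)))))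
    where s≤L = ℕP.≤-pred (<ᵇ-< {s} {suc L} eq)
  ... | false = ≡.trans (height-top v L≤s) (≡.sym (height-top w L≤s))
    where L≤s = ℕP.≤-trans (ℕP.n≤1+n L) (<ᵇ-≥ {s} {suc L} eq)

inShape : ∀ {L} → Vec Bool L → Box → Bool
inShape w (r , c) = (r ≤ᵇ c) ∧ (r <ᵇ height w (c ∸ r))

∈-boxesFrom⁻ : ∀ k ls {p} → p ∈ boxesFrom k ls → ∃[ i ] ∃[ j ] (p ≡ (k ℕ.+ i , k ℕ.+ i ℕ.+ j)) × j < at ls i
∈-boxesFrom⁻ k (l ∷ ls) p∈ with ∈-++⁻ (map (λ j → (k , k ℕ.+ j)) (upTo l)) p∈
... | inj₁ p∈row with ∈-map⁻ (λ j → (k , k ℕ.+ j)) p∈row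
...   | j , j∈ , ≡.refl = 0 , j , cong (λ k′ → k′ , k′ ℕ.+ j) (≡.sym (ℕP.+-identityʳ k)) , ∈-upTo⁻ j∈
∈-boxesFrom⁻ k (l ∷ ls) p∈ | inj₂ p∈rest with ∈-boxesFrom⁻ (suc k) ls p∈rest
... | i , j , ≡.refl , j< = suc i , j , cong (λ k′ → k′ , k′ ℕ.+ j) (≡.sym (ℕP.+-suc k i)) , j<

∈-boxesFrom⁺ : ∀ k ls i j → j < at ls i → (k ℕ.+ i , k ℕ.+ i ℕ.+ j) ∈ boxesFrom k ls
∈-boxesFrom⁺ k (l ∷ ls) zero j j< rewrite ℕP.+-identityʳ k =
  ∈-++⁺ˡ (∈-map⁺ (λ j → (k , k ℕ.+ j)) (∈-upTo⁺ j<))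
∈-boxesFrom⁺ k (l ∷ ls) (suc i) j j< rewrite ℕP.+-suc k i =
  ∈-++⁺ʳ (map (λ j → (k , k ℕ.+ j)) (upTo l)) (∈-boxesFrom⁺ (suc k) ls i j j<)

boxes-unique : ∀ k ls → Unique (boxesFrom k ls)
boxes-unique k [] = []
boxes-unique k (l ∷ ls) = UniqueP.++⁺
  (UniqueP.map⁺ (λ eq → ℕP.+-cancelˡ-≡ k _ _ (cong proj₂ eq)) (UniqueP.upTo⁺ l))
  (boxes-unique (suc k) ls) disjoint
  where
  disjoint : ∀ {p} → (p ∈ map (λ j → (k , k ℕ.+ j)) (upTo l)) × (p ∈ boxesFrom (suc k) ls) → ⊥
  disjoint (p∈ , p∈′) with ∈-map⁻ (λ j → (k , k ℕ.+ j)) p∈ | ∈-boxesFrom⁻ (suc k) ls p∈′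
  ... | j , _ , ≡.refl | i , j′ , eq , _ = ℕP.<⇒≢ (s≤s (ℕP.m≤m+n k i)) (cong proj₁ eq)

cell : ℕ → ℕ → Box
cell r s = r , r ℕ.+ s

module _ {L} (w : Vec Bool L) where
  inShape-cell : ∀ r s → inShape w (cell r s) ≡ (r <ᵇ height w s)
  inShape-cell r s rewrite ≤ᵇ-true (ℕP.m≤m+n r s) | ℕP.m+n∸m≡n r s = ≡.refl

  ∈-boxes⁻ : ∀ {p} → p ∈ boxes (parts w) → ∃[ r ] ∃[ s ] (p ≡ cell r s) × r < height w s
  ∈-boxes⁻ p∈ with ∈-boxesFrom⁻ 0 (parts w) p∈
  ... | r , s , eq , s< = r , s , eq , at⇒height w r s s<

  ∈-boxes⁺ : ∀ r s → r < height w s → cell r s ∈ boxes (parts w)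
  ∈-boxes⁺ r s r< = ∈-boxesFrom⁺ 0 (parts w) r s (height⇒at w r s r<)

filter-cong : {A : Set} {p q : A → Bool} (as : List A) → (∀ {a} → a ∈ as → p a ≡ q a) → filterᵇ p as ≡ filterᵇ q as
filter-cong [] eq = ≡.refl
filter-cong {p = p} {q} (a ∷ as) eq with p a | q a | eq (here ≡.refl)
... | true | _ | ≡.refl = cong (a ∷_) (filter-cong as (λ a∈ → eq (there a∈)))
... | false | _ | ≡.refl = filter-cong as (λ a∈ → eq (there a∈))

filter-all : {A : Set} {p : A → Bool} (as : List A) → (∀ {a} → a ∈ as → p a ≡ true) → filterᵇ p as ≡ as
filter-all [] eq = ≡.refl
filter-all {p = p} (a ∷ as) eq with p a | eq (here ≡.refl)
... | true | _ = cong (a ∷_) (filter-all as (λ a∈ → eq (there a∈)))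

filter-none : {A : Set} {p : A → Bool} (as : List A) → (∀ {a} → a ∈ as → p a ≡ false) → filterᵇ p as ≡ []
filter-none [] eq = ≡.refl
filter-none {p = p} (a ∷ as) eq with p a | eq (here ≡.refl)
... | false | _ = filter-none as (λ a∈ → eq (there a∈))

filterᵇ-∈ : {A : Set} (p : A → Bool) (as : List A) {a : A} → a ∈ filterᵇ p as → a ∈ as × p a ≡ true
filterᵇ-∈ p (b ∷ as) a∈ with p b in eq
filterᵇ-∈ p (b ∷ as) (here ≡.refl) | true = here ≡.refl , eq
filterᵇ-∈ p (b ∷ as) (there a∈) | true with filterᵇ-∈ p as a∈
... | a∈′ , pa = there a∈′ , pa
filterᵇ-∈ p (b ∷ as) a∈ | false with filterᵇ-∈ p as a∈
... | a∈′ , pa = there a∈′ , pa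

filterᵇ-∈⁺ : {A : Set} (p : A → Bool) (as : List A) {a : A} → a ∈ as → p a ≡ true → a ∈ filterᵇ p as
filterᵇ-∈⁺ p (b ∷ as) (here ≡.refl) h rewrite h = here ≡.refl
filterᵇ-∈⁺ p (b ∷ as) (there a∈) h with p b
... | true = there (filterᵇ-∈⁺ p as a∈ h)
... | false = filterᵇ-∈⁺ p as a∈ h

filter-++ : {A : Set} (p : A → Bool) (as bs : List A) → filterᵇ p (as ++ bs) ≡ filterᵇ p as ++ filterᵇ p bs
filter-++ p [] bs = ≡.refl
filter-++ p (a ∷ as) bs with p a
... | true = cong (a ∷_) (filter-++ p as bs)
... | false = filter-++ p as bs

filter-map : {A B : Set} (p : B → Bool) (f : A → B) (as : List A) → filterᵇ p (map f as) ≡ map f (filterᵇ (p ∘ f) as)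
filter-map p f [] = ≡.refl
filter-map p f (a ∷ as) with p (f a)
... | true = cong (f a ∷_) (filter-map p f as)
... | false = filter-map p f as

filter-upTo : ∀ m l → m ≤ l → filterᵇ (_<ᵇ m) (upTo l) ≡ upTo m
filter-upTo m zero z≤n = ≡.refl
filter-upTo m (suc l) m≤ with ℕP.m≤n⇒m<n∨m≡n m≤
... | inj₂ ≡.refl = filter-all (upTo (suc l)) (λ j∈ → <ᵇ-true (∈-upTo⁻ j∈))
... | inj₁ (s≤s m≤l) = ≡.trans (cong (filterᵇ (_<ᵇ m)) (≡.sym (ListP.upTo-∷ʳ l)))
  (≡.trans (filter-++ (_<ᵇ m) (upTo l) (l ∷ []))
  (≡.trans (cong₂ _++_ (filter-upTo m l m≤l) (filter-none {p = _<ᵇ m} (l ∷ []) (λ { (here ≡.refl) → <ᵇ-false m≤l })))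
    (ListP.++-identityʳ (upTo m))))

filter-boxesFrom : ∀ k ls ms → (∀ i → at ms i ≤ at ls i) →
  filterᵇ (λ (r , c) → (c ∸ r) <ᵇ at ms (r ∸ k)) (boxesFrom k ls) ≡ boxesFrom k ms
filter-boxesFrom k [] ms le = empty k ms le
  where
  empty : ∀ k ms → (∀ i → at ms i ≤ 0) → [] ≡ boxesFrom k ms
  empty k [] le = ≡.refl
  empty k (m ∷ ms) le with m | le 0
  ... | zero | z≤n = empty (suc k) ms (λ i → le (suc i))
filter-boxesFrom k (l ∷ ls) ms le = ≡.trans (filter-++ _ (map (λ j → (k , k ℕ.+ j)) (upTo l)) _)
  (≡.trans (cong₂ _++_ row-part (rest-part ms (λ i → le (suc i)))) (join ms))
  where
  tail : List ℕ → List ℕ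
  tail [] = []
  tail (_ ∷ ms) = ms
  row-part : filterᵇ (λ (r , c) → (c ∸ r) <ᵇ at ms (r ∸ k)) (map (λ j → (k , k ℕ.+ j)) (upTo l))
    ≡ map (λ j → (k , k ℕ.+ j)) (upTo (at ms 0))
  row-part = ≡.trans (filter-map _ (λ j → (k , k ℕ.+ j)) (upTo l))
    (cong (map (λ j → (k , k ℕ.+ j))) (≡.trans
      (filter-cong (upTo l) (λ {j} _ → cong₂ (λ a b → a <ᵇ at ms b) (ℕP.m+n∸m≡n k j) (ℕP.n∸n≡0 k)))
      (filter-upTo (at ms 0) l (le 0))))
  at-tail : ∀ ms i → at ms (suc i) ≡ at (tail ms) i
  at-tail [] i = ≡.refl
  at-tail (_ ∷ ms) i = ≡.refl
  rest-part : ∀ ms → (∀ i → at ms (suc i) ≤ at ls i) →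
    filterᵇ (λ (r , c) → (c ∸ r) <ᵇ at ms (r ∸ k)) (boxesFrom (suc k) ls) ≡ boxesFrom (suc k) (tail ms)
  rest-part ms le′ = ≡.trans (filter-cong (boxesFrom (suc k) ls) same)
    (filter-boxesFrom (suc k) ls (tail ms) (λ i → subst (_≤ at ls i) (at-tail ms i) (le′ i)))
    where
    same : ∀ {p} → p ∈ boxesFrom (suc k) ls →
      ((proj₂ p ∸ proj₁ p) <ᵇ at ms (proj₁ p ∸ k)) ≡ ((proj₂ p ∸ proj₁ p) <ᵇ at (tail ms) (proj₁ p ∸ suc k))
    same p∈ with ∈-boxesFrom⁻ (suc k) ls p∈
    ... | i , j , ≡.refl , _ = cong ((suc k ℕ.+ i ℕ.+ j ∸ (suc k ℕ.+ i)) <ᵇ_) (≡.trans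
      (cong (at ms) (≡.trans (cong (_∸ k) (≡.sym (ℕP.+-suc k i))) (ℕP.m+n∸m≡n k (suc i))))
      (≡.trans (at-tail ms i) (cong (at (tail ms)) (≡.sym (ℕP.m+n∸m≡n k i)))))
  join : ∀ ms → map (λ j → (k , k ℕ.+ j)) (upTo (at ms 0)) ++ boxesFrom (suc k) (tail ms) ≡ boxesFrom k ms
  join [] = ≡.refl
  join (m ∷ ms) = ≡.refl

filter-shape : ∀ {L} (v w : Vec Bool L) → (∀ s → height v s ≤ height w s) →
  filterᵇ (inShape v) (boxes (parts w)) ≡ boxes (parts v)
filter-shape v w sub = ≡.trans (filter-cong (boxes (parts w)) same)
  (filter-boxesFrom 0 (parts w) (parts v) (at-height-≤ v w sub))
  where
  same : ∀ {p} → p ∈ boxes (parts w) → inShape v p ≡ ((proj₂ p ∸ proj₁ p) <ᵇ at (parts v) (proj₁ p))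
  same p∈ with ∈-boxes⁻ w p∈
  ... | r , s , ≡.refl , _ = ≡.trans (inShape-cell v r s) (≡-from-⇔
    (λ h → <ᵇ-true (subst (_< at (parts v) r) (≡.sym (ℕP.m+n∸m≡n r s)) (height⇒at v r s (<ᵇ-< {r} h))))
    (λ h → <ᵇ-true (at⇒height v r s (subst (_< at (parts v) r) (ℕP.m+n∸m≡n r s) (<ᵇ-< {r ℕ.+ s ∸ r} h)))))

-- `A` and `B` count the parts read so far of the given shape and of the result. The next candidate
-- on the diagonal of content `L` is the box of row `B`; the result receives the part L + 1 exactly
-- if that box exists and is kept.
shapeOf : (ℕ → ℕ → Bool) → ℕ → ℕ → ∀ {L} → Vec Bool L → Vec Bool L
shapeOf k A B [] = []
shapeOf k A B {suc L} (b ∷ w) = v ∷ shapeOf k (A ℕ.+ bit b) (B ℕ.+ bit v) w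
  where v = (B <ᵇ A ℕ.+ bit b) ∧ k B L

-- A set k of boxes of the shape λ that is closed under taking neighbours to the left and above is
-- the shape whose bits are read off at the corners met when scanning the contents downwards.
shapeOf-spec : ∀ k {L} (w : Vec Bool L) A B → B ≤ A → (∀ r → r < A → k r L ≡ (r <ᵇ B)) →
  (∀ r s → suc s ≤ L → r < A ℕ.+ height w (suc s) → k r (suc s) ≡ true → k r s ≡ true) →
  (∀ r s → suc s ≤ L → suc r < A ℕ.+ height w s → k (suc r) s ≡ true → k r (suc s) ≡ true) →
  ∀ s → s ≤ L → (B ℕ.+ height (shapeOf k A B w) s ≤ A ℕ.+ height w s)
    × (∀ r → r < A ℕ.+ height w s → k r s ≡ (r <ᵇ B ℕ.+ height (shapeOf k A B w) s))
shapeOf-spec k [] A B B≤A top right below zero z≤n rewrite ℕP.+-identityʳ A | ℕP.+-identityʳ B = B≤A , top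
shapeOf-spec k {suc L} (b ∷ w) A B B≤A top right below s s≤ with ℕP.m≤n⇒m<n∨m≡n s≤
... | inj₂ ≡.refl rewrite height-top (b ∷ w) {suc L} ℕP.≤-refl
  | height-top (shapeOf k A B (b ∷ w)) {suc L} ℕP.≤-refl | ℕP.+-identityʳ A | ℕP.+-identityʳ B = B≤A , top
... | inj₁ (s≤s s≤L) rewrite height-∷ b w s≤L
  | height-∷ ((B <ᵇ A ℕ.+ bit b) ∧ k B L) (shapeOf k (A ℕ.+ bit b) (B ℕ.+ bit ((B <ᵇ A ℕ.+ bit b) ∧ k B L)) w) s≤L
  | ≡.sym (ℕP.+-assoc A (bit b) (height w s))
  | ≡.sym (ℕP.+-assoc B (bit ((B <ᵇ A ℕ.+ bit b) ∧ k B L)) (height (shapeOf k (A ℕ.+ bit b) (B ℕ.+ bit ((B <ᵇ A ℕ.+ bit b) ∧ k B L)) w) s))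
  = shapeOf-spec k w A′ B′ B′≤A′ top′
      (λ r s s<L r< → right r s (ℕP.m≤n⇒m≤1+n s<L) (subst (r <_) (≡.sym (shift s<L)) r<))
      (λ r s s<L r< → below r s (ℕP.m≤n⇒m≤1+n s<L) (subst (suc r <_) (≡.sym (shift (ℕP.<⇒≤ s<L))) r<)) s s≤L
  where
  A′ B′ : ℕ
  A′ = A ℕ.+ bit b
  B′ = B ℕ.+ bit ((B <ᵇ A ℕ.+ bit b) ∧ k B L)
  shift : ∀ {s} → s ≤ L → A ℕ.+ height (b ∷ w) s ≡ A′ ℕ.+ height w s
  shift {s} s≤L = ≡.trans (cong (A ℕ.+_) (height-∷ b w s≤L)) (≡.sym (ℕP.+-assoc A (bit b) (height w s)))
  bit≤1 : ∀ b → bit b ≤ 1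
  bit≤1 true = ℕP.≤-refl
  bit≤1 false = z≤n
  B′≤A′ : B′ ≤ A′
  B′≤A′ with B <ᵇ A ℕ.+ bit b in eq
  ... | false = subst (_≤ A′) (≡.sym (ℕP.+-identityʳ B)) (ℕP.≤-trans B≤A (ℕP.m≤m+n A _))
  ... | true = ℕP.≤-trans (ℕP.+-monoʳ-≤ B (bit≤1 (k B L)))
    (ℕP.≤-trans (ℕP.≤-reflexive (ℕP.+-comm B 1)) (<ᵇ-< {B} eq))
  at-suc-L : A ℕ.+ height (b ∷ w) (suc L) ≡ A
  at-suc-L = ≡.trans (cong (A ℕ.+_) (height-top (b ∷ w) ℕP.≤-refl)) (ℕP.+-identityʳ A)
  at-L : A ℕ.+ height (b ∷ w) L ≡ A′
  at-L = ≡.trans (shift ℕP.≤-refl) (≡.trans (cong (A′ ℕ.+_) (height-top w ℕP.≤-refl)) (ℕP.+-identityʳ A′))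
  top′ : ∀ r → r < A′ → k r L ≡ (r <ᵇ B′)
  top′ r r<A′ with ℕP.<-cmp r B
  ... | tri< r<B _ _ = ≡.trans
    (right r L ℕP.≤-refl (subst (r <_) (≡.sym at-suc-L) (ℕP.<-≤-trans r<B B≤A))
      (≡.trans (top r (ℕP.<-≤-trans r<B B≤A)) (<ᵇ-true r<B)))
    (≡.sym (<ᵇ-true (ℕP.<-≤-trans r<B (ℕP.m≤m+n B _))))
  ... | tri≈ _ ≡.refl _ rewrite <ᵇ-true r<A′ with k r L
  ...   | true = ≡.sym (<ᵇ-true (ℕP.≤-reflexive (ℕP.+-comm 1 r)))
  ...   | false = ≡.sym (<ᵇ-false (ℕP.≤-reflexive (ℕP.+-identityʳ r)))
  top′ (suc r) r<A′ | tri> _ _ (s≤s B≤r) = ≡.trans not-kept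
    (≡.sym (<ᵇ-false (ℕP.≤-trans (ℕP.+-monoʳ-≤ B (bit≤1 _)) (ℕP.≤-trans (ℕP.≤-reflexive (ℕP.+-comm B 1)) (s≤s B≤r)))))
    where
    r<A : r < A
    r<A = ℕP.≤-pred (ℕP.≤-trans r<A′ (ℕP.≤-trans (ℕP.+-monoʳ-≤ A (bit≤1 b)) (ℕP.≤-reflexive (ℕP.+-comm A 1))))
    not-kept : k (suc r) L ≡ false
    not-kept with k (suc r) L in eq
    ... | false = ≡.refl
    ... | true with ≡.trans (≡.sym (below r L ℕP.≤-refl (subst (suc r <_) (≡.sym at-L) r<A′) eq))
      (≡.trans (top r r<A) (<ᵇ-false B≤r))
    ...   | ()

eqᵇ : Bool → Bool → Bool
eqᵇ true b = b
eqᵇ false b = not b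

eqᵇ-sound : ∀ a b → eqᵇ a b ≡ true → a ≡ b
eqᵇ-sound true true _ = ≡.refl
eqᵇ-sound false false _ = ≡.refl

eqᵇ-refl : ∀ a → eqᵇ a a ≡ true
eqᵇ-refl true = ≡.refl
eqᵇ-refl false = ≡.refl

vecEq : ∀ {L} → Vec Bool L → Vec Bool L → Bool
vecEq [] [] = true
vecEq (a ∷ v) (b ∷ w) = eqᵇ a b ∧ vecEq v w

vecEq-sound : ∀ {L} (v w : Vec Bool L) → vecEq v w ≡ true → v ≡ w
vecEq-sound [] [] _ = ≡.refl
vecEq-sound (a ∷ v) (b ∷ w) h with ∧-true h
... | h₁ , h₂ = cong₂ _∷_ (eqᵇ-sound a b h₁) (vecEq-sound v w h₂)

vecEq-refl : ∀ {L} (v : Vec Bool L) → vecEq v v ≡ true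
vecEq-refl [] = ≡.refl
vecEq-refl (a ∷ v) = ∧-intro (eqᵇ-refl a) (vecEq-refl v)

subShape : ∀ {L} → Vec Bool L → Vec Bool L → Bool
subShape {L} v w = all (λ s → height v s ≤ᵇ height w s) (upTo L)

subShape-sound : ∀ {L} (v w : Vec Bool L) → subShape v w ≡ true → ∀ s → height v s ≤ height w s
subShape-sound {L} v w h s with s <ᵇ L in eq
... | true = ≤ᵇ-≤ {height v s} (all-true (upTo L) h (∈-upTo⁺ (<ᵇ-< {s} {L} eq)))
... | false rewrite height-top v (<ᵇ-≥ {s} {L} eq) = z≤n

subShape-intro : ∀ {L} (v w : Vec Bool L) → (∀ s → height v s ≤ height w s) → subShape v w ≡ true
subShape-intro {L} v w h = all-intro (upTo L) (λ {s} _ → ≤ᵇ-true (h s))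

agree : ∀ {L} → Vec Bool L → List (Box × Status) → Bool
agree v S = all (λ (b , a) → eqᵇ (is-just a) (inShape v b)) S

-- In coordinates of row and content, the box above `cell (suc r) s` is `cell r (suc s)`.
Lower : List (Box × Status) → Set
Lower S = (∀ {r s o a} → (cell r (suc s) , just o) ∈ S → (cell r s , a) ∈ S → is-just a ≡ true) ×
          (∀ {r s o a} → (cell (suc r) s , just o) ∈ S → (cell r (suc s) , a) ∈ S → is-just a ≡ true)

module _ {L} (w : Vec Bool L) {sts : List Status} {S : List (Box × Status)}
  (S∈ : S ∈ assignments (boxes (parts w)) sts) where

  boxes-of : map proj₁ S ≡ boxes (parts w)
  boxes-of = proj₁ (∈-assignments _ sts S∈)

  status-at : ∀ r s → r < height w s → ∃ λ a → (cell r s , a) ∈ S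
  status-at r s r< with ∈-map⁻ proj₁ (subst (cell r s ∈_) (≡.sym boxes-of) (∈-boxes⁺ w r s r<))
  ... | (_ , a) , p∈ , ≡.refl = a , p∈

  cell-of : ∀ {b a} → (b , a) ∈ S → ∃[ r ] ∃[ s ] (b ≡ cell r s) × r < height w s
  cell-of p∈ = ∈-boxes⁻ w (subst (_ ∈_) boxes-of (∈-map⁺ proj₁ p∈))

  kept-agree : ∀ v → subShape v w ≡ true → agree v S ≡ true → kept S ≡ boxes (parts v)
  kept-agree v sub ag = ≡.trans (go S ag)
    (≡.trans (cong (filterᵇ (inShape v)) boxes-of) (filter-shape v w (subShape-sound v w sub)))
    where
    go : ∀ S → agree v S ≡ true → kept S ≡ filterᵇ (inShape v) (map proj₁ S)
    go [] _ = ≡.refl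
    go ((b , nothing) ∷ S) ag with inShape v b
    ... | false = go S ag
    ... | true = ⊥-elim (case ag)
      where
      case : false ≡ true → ⊥
      case ()
    go ((b , just _) ∷ S) ag with inShape v b
    ... | true = cong (b ∷_) (go S ag)

  private
    _≟_ = ΣP.≡-dec ℕP._≟_ ℕP._≟_

    keepAt : List (Box × Status) → Box → Bool
    keepAt [] b = false
    keepAt ((b′ , a) ∷ S) b = if does (b ≟ b′) then is-just a else keepAt S b

    keepAt-∈ : ∀ S → Unique (map proj₁ S) → ∀ {b a} → (b , a) ∈ S → keepAt S b ≡ is-just a
    keepAt-∈ ((b , a) ∷ S) u (here ≡.refl) with b ≟ b
    ... | yes _ = ≡.refl
    ... | no b≢b = ⊥-elim (b≢b ≡.refl)
    keepAt-∈ ((b′ , a′) ∷ S) (b′∉ ∷ u) {b} (there p∈) with b ≟ b′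
    ... | yes ≡.refl = ⊥-elim (All.lookup b′∉ (∈-map⁺ proj₁ p∈) ≡.refl)
    ... | no _ = keepAt-∈ S u p∈

    k : ℕ → ℕ → Bool
    k r s = keepAt S (cell r s)

    k-∈ : ∀ {r s a} → (cell r s , a) ∈ S → k r s ≡ is-just a
    k-∈ = keepAt-∈ S (subst Unique (≡.sym boxes-of) (boxes-unique 0 (parts w)))

  keptShape : Vec Bool L
  keptShape = shapeOf k 0 0 w

  module _ (low : Lower S) where
    private
      spec : ∀ s → s ≤ L → (height keptShape s ≤ height w s) × (∀ r → r < height w s → k r s ≡ (r <ᵇ height keptShape s))
      spec = shapeOf-spec k w 0 0 z≤n (λ _ ()) right below
        where
        right : ∀ r s → suc s ≤ L → r < height w (suc s) → k r (suc s) ≡ true → k r s ≡ true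
        right r s _ r< kr with status-at r (suc s) r< | status-at r s (ℕP.<-≤-trans r< (height-anti w s))
        ... | just o , p∈ | a , q∈ = ≡.trans (k-∈ q∈) (proj₁ low p∈ q∈)
        ... | nothing , p∈ | a , q∈ with ≡.trans (≡.sym kr) (k-∈ p∈)
        ...   | ()
        below : ∀ r s → suc s ≤ L → suc r < height w s → k (suc r) s ≡ true → k r (suc s) ≡ true
        below r s _ r< kr
          with status-at (suc r) s r< | status-at r (suc s) (ℕP.≤-pred (ℕP.≤-trans r< (height-step w s)))
        ... | just o , p∈ | a , q∈ = ≡.trans (k-∈ q∈) (proj₂ low p∈ q∈)
        ... | nothing , p∈ | a , q∈ with ≡.trans (≡.sym kr) (k-∈ p∈)
        ...   | ()

      sub-kept : ∀ s → height keptShape s ≤ height w s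
      sub-kept s with s <ᵇ L in eq
      ... | true = proj₁ (spec s (ℕP.<⇒≤ (<ᵇ-< {s} {L} eq)))
      ... | false rewrite height-top keptShape (<ᵇ-≥ {s} {L} eq) = z≤n

      k-shape : ∀ r s → r < height w s → k r s ≡ (r <ᵇ height keptShape s)
      k-shape r s r< with s <ᵇ L in eq
      ... | true = proj₂ (spec s (ℕP.<⇒≤ (<ᵇ-< {s} {L} eq))) r r<
      ... | false rewrite height-top w (<ᵇ-≥ {s} {L} eq) = ⊥-elim (ℕP.n≮0 r<)

    -- A set of boxes closed towards the left and above is the diagram of exactly one shape,
    -- determined by its heights. The Boolean form lets `∑-same` collapse a sum over shapes.
    keptShape-unique : ∀ v → (subShape v w ∧ agree v S) ≡ vecEq v keptShape
    keptShape-unique v = ≡-from-⇔ to from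
      where
      from : vecEq v keptShape ≡ true → (subShape v w ∧ agree v S) ≡ true
      from h with vecEq-sound v keptShape h
      ... | ≡.refl = ∧-intro (subShape-intro keptShape w sub-kept) (all-intro S agrees)
        where
        agrees : ∀ {p} → p ∈ S → eqᵇ (is-just (proj₂ p)) (inShape keptShape (proj₁ p)) ≡ true
        agrees {b , a} p∈ with cell-of p∈
        ... | r , s , ≡.refl , r< rewrite inShape-cell keptShape r s | ≡.sym (k-shape r s r<) | k-∈ p∈ = eqᵇ-refl (is-just a)
      to : (subShape v w ∧ agree v S) ≡ true → vecEq v keptShape ≡ true
      to h with ∧-true h
      ... | sub , ag = ≡.trans (cong (vecEq v) (≡.sym (height-injective v keptShape heights))) (vecEq-refl v)
        where
        v≤w = subShape-sound v w sub
        tests : ∀ r s → r < height w s → (r <ᵇ height v s) ≡ (r <ᵇ height keptShape s)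
        tests r s r< with status-at r s r<
        ... | a , p∈ = ≡.trans (≡.sym (≡.trans (eqᵇ-sound (is-just a) _ (all-true S ag p∈)) (inShape-cell v r s)))
          (≡.trans (≡.sym (k-∈ p∈)) (k-shape r s r<))
        heights : ∀ s → height v s ≡ height keptShape s
        heights s = ℕP.≤-antisym
          (≤-by-tests (height v s) (height keptShape s) (v≤w s) (λ r r< → ≡.trans (≡.sym (tests r s r<))))
          (≤-by-tests (height keptShape s) (height v s) (sub-kept s) (λ r r< → ≡.trans (tests r s r<)))
          where
          ≤-by-tests : ∀ m n → m ≤ height w s → (∀ r → r < height w s → (r <ᵇ m) ≡ true → (r <ᵇ n) ≡ true) → m ≤ n
          ≤-by-tests zero n m≤ t = z≤n
          ≤-by-tests (suc m) n m≤ t = <ᵇ-< {m} (t m m≤ (<ᵇ-true {m} ℕP.≤-refl))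

module ShapeSums (R : CommutativeRing 0ℓ 0ℓ) where
  open CommutativeRing R hiding (zero)
  open FiniteSums R
  open import Relation.Binary.Reasoning.Setoid setoid

  ∑-same : ∀ {L} (w : Vec Bool L) c → ∑ (configs L) (λ v → iverson (vecEq v w) c) ≈ c
  ∑-same [] c = +-identityʳ c
  ∑-same {suc L} (b ∷ w) c = trans (∑-++ (map (false ∷_) (configs L)) _ _) (trans
    (+-cong (∑-map (false ∷_) (configs L) _) (∑-map (true ∷_) (configs L) _)) (halves b))
    where
    none : ∑ (configs L) (λ v → iverson false c) ≈ 0#
    none = ∑-zero (configs L) (λ _ → refl)
    halves : ∀ b → ∑ (configs L) (λ v → iverson (vecEq (false ∷ v) (b ∷ w)) c)
      + ∑ (configs L) (λ v → iverson (vecEq (true ∷ v) (b ∷ w)) c) ≈ c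
    halves true = trans (+-cong none (∑-same w c)) (+-identityˡ c)
    halves false = trans (+-cong (∑-same w c) none) (+-identityʳ c)

  ∑-iverson : {A : Set} (p : Bool) (as : List A) (f : A → Carrier) → ∑ as (λ a → iverson p (f a)) ≈ iverson p (∑ as f)
  ∑-iverson true as f = refl
  ∑-iverson false as f = ∑-zero as (λ _ → refl)

  -- Inserts a sum over all shapes of which one term survives for each valid assignment, namely the
  -- shape of its kept boxes. Afterwards the shape is fixed and the remaining sum can be evaluated
  -- box by box.
  ∑-shapes : ∀ {L} (w : Vec Bool L) (sts : List Status) (V : List (Box × Status) → Bool)
    (h : List (Box × Status) → Carrier) →
    (∀ {S} → S ∈ assignments (boxes (parts w)) sts → V S ≡ true → Lower S) →
    ∑ (assignments (boxes (parts w)) sts) (λ S → iverson (V S) (h S)) ≈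
    ∑ (configs L) (λ v → iverson (subShape v w)
      (∑ (assignments (boxes (parts w)) sts) (λ S → iverson (agree v S ∧ V S) (h S))))
  ∑-shapes {L} w sts V h low = sym (begin
    ∑ (configs L) (λ v → iverson (subShape v w) (∑ as (λ S → iverson (agree v S ∧ V S) (h S))))
      ≈⟨ ∑-cong (configs L) (λ v → ∑-iverson (subShape v w) as _) ⟨
    ∑ (configs L) (λ v → ∑ as (λ S → iverson (subShape v w) (iverson (agree v S ∧ V S) (h S))))
      ≈⟨ ∑-swap (configs L) as _ ⟩
    ∑ as (λ S → ∑ (configs L) (λ v → iverson (subShape v w) (iverson (agree v S ∧ V S) (h S))))
      ≈⟨ ∑-cong-∈ as unique ⟩
    ∑ as (λ S → iverson (V S) (h S)) ∎)
    where
    as = assignments (boxes (parts w)) sts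
    unique : ∀ {S} → S ∈ as → ∑ (configs L) (λ v → iverson (subShape v w) (iverson (agree v S ∧ V S) (h S)))
      ≈ iverson (V S) (h S)
    unique {S} S∈ with V S in eq
    ... | false = ∑-zero (configs L) (λ v → vanish (subShape v w) (agree v S))
      where
      vanish : ∀ p q → iverson p (iverson (q ∧ false) (h S)) ≈ 0#
      vanish false q = refl
      vanish true false = refl
      vanish true true = refl
    ... | true = trans (∑-cong (configs L) (λ v → trans (regroup (subShape v w) (agree v S))
        (reflexive (cong (λ p → iverson p (h S)) (keptShape-unique w S∈ (low S∈ eq) v)))))
      (∑-same (keptShape w S∈) (h S))
      where
      regroup : ∀ p q → iverson p (iverson (q ∧ true) (h S)) ≈ iverson (p ∧ q) (h S)
      regroup false q = refl
      regroup true false = refl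
      regroup true true = refl

  ∏-upTo-suc : ∀ n (f : ℕ → Carrier) → ∏ (upTo (suc n)) f ≈ f 0 * ∏ (upTo n) (f ∘ suc)
  ∏-upTo-suc n f = *-congˡ (trans (reflexive (cong (λ is → ∏ is f) (≡.sym (ListP.map-upTo suc n)))) (∏-map suc (upTo n) f))

  ∏-upTo-last : ∀ n (f : ℕ → Carrier) → ∏ (upTo (suc n)) f ≈ ∏ (upTo n) f * f n
  ∏-upTo-last n f = trans (reflexive (cong (λ is → ∏ is f) (≡.sym (ListP.upTo-∷ʳ n))))
    (trans (∏-++ (upTo n) (n ∷ []) f) (*-congˡ (*-identityʳ _)))

  -- Passes from rows to diagonals. The induction removes the longest row, which has one box on each
  -- diagonal of content at most L and shifts the other rows by one.
  ∏-boxes : ∀ {L} (w : Vec Bool L) k (g : Box → Carrier) →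
    ∏ (boxesFrom k (parts w)) g ≈ ∏ (upTo L) (λ s → ∏ (upTo (height w s)) (λ r → g (cell (k ℕ.+ r) s)))
  ∏-boxes [] k g = refl
  ∏-boxes {suc L} (false ∷ w) k g = begin
    ∏ (boxesFrom k (parts w)) g ≈⟨ ∏-boxes w k g ⟩
    ∏ (upTo L) (edge w) ≈⟨ ∏-cong-∈ (upTo L) (λ {s} s∈ → reflexive (cong (λ h → ∏ (upTo h) (λ r → g (cell (k ℕ.+ r) s)))
      (≡.sym (height-∷ false w (ℕP.<⇒≤ (∈-upTo⁻ s∈)))))) ⟩
    ∏ (upTo L) (edge (false ∷ w)) ≈⟨ *-identityʳ _ ⟨
    ∏ (upTo L) (edge (false ∷ w)) * 1#
      ≈⟨ *-congˡ (reflexive (cong (λ h → ∏ (upTo h) (λ r → g (cell (k ℕ.+ r) L))) (≡.sym (≡.trans (height-∷ false w ℕP.≤-refl) (height-top w ℕP.≤-refl))))) ⟩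
    ∏ (upTo L) (edge (false ∷ w)) * edge (false ∷ w) L ≈⟨ ∏-upTo-last L (edge (false ∷ w)) ⟨
    ∏ (upTo (suc L)) (edge (false ∷ w)) ∎
    where
    edge : ∀ {L} → Vec Bool L → ℕ → Carrier
    edge w s = ∏ (upTo (height w s)) (λ r → g (cell (k ℕ.+ r) s))
  ∏-boxes {suc L} (true ∷ w) k g = begin
    ∏ (map (λ j → (k , k ℕ.+ j)) (upTo (suc L)) ++ boxesFrom (suc k) (parts w)) g
      ≈⟨ ∏-++ (map (λ j → (k , k ℕ.+ j)) (upTo (suc L))) _ g ⟩
    ∏ (map (λ j → (k , k ℕ.+ j)) (upTo (suc L))) g * ∏ (boxesFrom (suc k) (parts w)) g
      ≈⟨ *-cong (∏-map _ (upTo (suc L)) g) (trans (∏-boxes w (suc k) g) (sym (trans (∏-upTo-last L rest)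
           (trans (*-congˡ (reflexive (cong (λ h → ∏ (upTo h) (λ r → g (cell (suc k ℕ.+ r) L))) (height-top w ℕP.≤-refl)))) (*-identityʳ _))))) ⟩
    ∏ (upTo (suc L)) (λ s → g (cell k s)) * ∏ (upTo (suc L)) rest ≈⟨ ∏-* (upTo (suc L)) _ _ ⟨
    ∏ (upTo (suc L)) (λ s → g (cell k s) * rest s) ≈⟨ ∏-cong-∈ (upTo (suc L)) merge ⟩
    ∏ (upTo (suc L)) (λ s → ∏ (upTo (height (true ∷ w) s)) (λ r → g (cell (k ℕ.+ r) s))) ∎
    where
    rest : ℕ → Carrier
    rest s = ∏ (upTo (height w s)) (λ r → g (cell (suc k ℕ.+ r) s))
    merge : ∀ {s} → s ∈ upTo (suc L) → g (cell k s) * rest s ≈ ∏ (upTo (height (true ∷ w) s)) (λ r → g (cell (k ℕ.+ r) s))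
    merge {s} s∈ rewrite height-∷ true w (ℕP.≤-pred (∈-upTo⁻ s∈)) = sym (trans (∏-upTo-suc (height w s) _)
      (*-cong (reflexive (cong (λ i → g (cell i s)) (ℕP.+-identityʳ k)))
        (∏-cong (upTo (height w s)) (λ r → reflexive (cong (λ i → g (cell i s)) (ℕP.+-suc k r))))))

-- Matrix entries as products over boxes

inc : Bool → ℕ → ℕ
inc true n = suc n
inc false n = n

inc-+ : ∀ b n m → inc b n ℕ.+ m ≡ n ℕ.+ (bit b ℕ.+ m)
inc-+ true n m = ≡.sym (ℕP.+-suc n m)
inc-+ false n m = ≡.refl

height-offset-top : ∀ {L} B (v : Vec Bool (suc L)) (h : ℕ → ℕ) → (∀ s → s ≤ suc L → h s ≡ B ℕ.+ height v s) → h (suc L) ≡ B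
height-offset-top {L} B v h eq = ≡.trans (eq (suc L) ℕP.≤-refl)
  (≡.trans (cong (B ℕ.+_) (height-top v ℕP.≤-refl)) (ℕP.+-identityʳ B))

height-offset : ∀ {L} B b (v : Vec Bool L) (h : ℕ → ℕ) → (∀ s → s ≤ suc L → h s ≡ B ℕ.+ height (b ∷ v) s) →
  ∀ s → s ≤ L → h s ≡ inc b B ℕ.+ height v s
height-offset B b v h eq s s≤L = ≡.trans (eq s (ℕP.m≤n⇒m≤1+n s≤L))
  (≡.trans (cong (B ℕ.+_) (height-∷ b v s≤L)) (≡.sym (inc-+ b B (height v s))))

height-offset-below : ∀ {L} B b (v : Vec Bool L) (h : ℕ → ℕ) → (∀ s → s ≤ suc L → h s ≡ B ℕ.+ height (b ∷ v) s) → h L ≡ inc b B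
height-offset-below {L} B b v h eq = ≡.trans (height-offset B b v h eq L ℕP.≤-refl)
  (≡.trans (cong (inc b B ℕ.+_) (height-top v ℕP.≤-refl)) (ℕP.+-identityʳ _))

-- Whether the box weights at content 0 differ from those at other contents.
wallUp wallDown : Kind → Letter → Bool
wallUp 𝒫 primed = true
wallUp _ _ = false
wallDown 𝒬 unprimed = true
wallDown _ _ = false

before : Letter → ℕ → ℕ → ℕ
before unprimed B A = B
before primed B A = A

-- For a box of row r and content s, with ν ⊆ λ, the numbers B = height ν s, C = height at s + 1
-- of ν (unprimed) or λ (primed), D = height at s - 1 of λ (unprimed) or ν (primed) determine
-- whether the neighbours of the box lie in ν or λ.
allowed newOK : Letter → Bool → ℕ → ℕ → ℕ → Bool
allowed ℓ wall C D r = not (r <ᵇ C) ∧ not (suc r <ᵇ D) ∧ not wall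
newOK unprimed wall C D r = not (suc r <ᵇ D)
newOK primed wall C D r = not (r <ᵇ C) ∧ not wall

leader : Letter → Bool → ℕ → ℕ → Bool
leader unprimed first D r = not (suc r <ᵇ D)
leader primed first D r = (r <ᵇ D) ∨ first

isZero : ℕ → Bool
isZero zero = true
isZero (suc _) = false

previous : (ℕ → ℕ) → ℕ → ℕ
previous h zero = 0
previous h (suc s) = h s

nextOf previousOf : Letter → (hν hλ : ℕ → ℕ) → ℕ → ℕ
nextOf ℓ hν hλ s = before ℓ (hν (suc s)) (hλ (suc s))
previousOf unprimed hν hλ = previous hλ
previousOf primed hν hλ = previous hν

module EdgeProducts (R : CommutativeRing 0ℓ 0ℓ) (t : CommutativeRing.Carrier R) where
  open CommutativeRing R hiding (zero)
  open FiniteSums R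
  open ShapeSums R
  open Kernels R t using (upKernel; downKernel)
  open import Relation.Binary.Reasoning.Setoid setoid

  ∏-zero : {A : Set} (as : List A) {f : A → Carrier} {a : A} → a ∈ as → f a ≈ 0# → ∏ as f ≈ 0#
  ∏-zero (a ∷ as) (here ≡.refl) f0 = trans (*-congʳ f0) (zeroˡ _)
  ∏-zero (a ∷ as) (there a∈) f0 = trans (*-congˡ (∏-zero as a∈ f0)) (zeroʳ _)

  ∏-one-∈ : {A : Set} (as : List A) {f : A → Carrier} → (∀ {a} → a ∈ as → f a ≈ 1#) → ∏ as f ≈ 1#
  ∏-one-∈ as eq = trans (∏-cong-∈ as eq) (∏-one as (λ _ → refl))

  ∏-iverson : {A : Set} (as : List A) (p : A → Bool) (f : A → Carrier) →
    ∏ as (λ a → iverson (p a) (f a)) ≈ iverson (all p as) (∏ as f)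
  ∏-iverson [] p f = refl
  ∏-iverson (a ∷ as) p f with p a
  ... | true = trans (*-congˡ (∏-iverson as p f)) (pull (all p as))
    where
    pull : ∀ q → f a * iverson q (∏ as f) ≈ iverson q (f a * ∏ as f)
    pull true = refl
    pull false = zeroʳ _
  ... | false = zeroˡ _

  module UpEdges (x : Carrier) where
    open UpWeights (ringOperations R) t x

    -- A box of ν contributes 1 without the letter and -xt = βx with it, in total `b` where the
    -- letter is allowed. A new box contains the letter alone and contributes x.
    boxWeight : Letter → Bool → ℕ → ℕ → ℕ → ℕ → Carrier
    boxWeight ℓ wall C B D r =
      if r <ᵇ B then (if allowed ℓ wall C D r then b else 1#) else iverson (newOK ℓ wall C D r) x

    edge : Letter → Bool → ℕ → ℕ → ℕ → ℕ → Carrier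
    edge ℓ wall C B A D = iverson (B ≤ᵇ A) (∏ (upTo A) (boxWeight ℓ wall C B D))

    edge-idle : ∀ ℓ wall B D → edge ℓ wall B B B D ≈ 1#
    edge-idle ℓ wall B D rewrite ≤ᵇ-true (ℕP.≤-refl {B}) = ∏-one-∈ (upTo B) one
      where
      one : ∀ {r} → r ∈ upTo B → boxWeight ℓ wall B B D r ≈ 1#
      one {r} r∈ rewrite <ᵇ-true (∈-upTo⁻ r∈) = refl

    edge-pend : ∀ ℓ wall C D → edge ℓ wall C (suc C) (suc C) D ≈ (if not (suc C <ᵇ D) ∧ not wall then b else 1#)
    edge-pend ℓ wall C D rewrite <ᵇ-true (ℕP.≤-refl {suc C}) =
      trans (∏-upTo-last C _) (trans (*-congʳ (∏-one-∈ (upTo C) one)) (trans (*-identityˡ _) last))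
      where
      one : ∀ {r} → r ∈ upTo C → boxWeight ℓ wall C (suc C) D r ≈ 1#
      one {r} r∈ rewrite <ᵇ-true (ℕP.m≤n⇒m≤1+n (∈-upTo⁻ r∈)) | <ᵇ-true (∈-upTo⁻ r∈) = refl
      last : boxWeight ℓ wall C (suc C) D C ≈ (if not (suc C <ᵇ D) ∧ not wall then b else 1#)
      last rewrite <ᵇ-true (ℕP.≤-refl {suc C}) | <ᵇ-false (ℕP.≤-refl {C}) = refl

    edge-hop : ∀ ℓ wall B D → edge ℓ wall B B (suc B) D ≈ iverson (newOK ℓ wall B D B) x
    edge-hop ℓ wall B D rewrite ≤ᵇ-true (ℕP.n≤1+n B) =
      trans (∏-upTo-last B _) (trans (*-congʳ (∏-one-∈ (upTo B) one)) (trans (*-identityˡ _) last))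
      where
      one : ∀ {r} → r ∈ upTo B → boxWeight ℓ wall B B D r ≈ 1#
      one {r} r∈ rewrite <ᵇ-true (∈-upTo⁻ r∈) = refl
      last : boxWeight ℓ wall B B D B ≈ iverson (newOK ℓ wall B D B) x
      last rewrite <ᵇ-false (ℕP.≤-refl {B}) = refl

    edge-negative : ∀ ℓ wall C B A D → A < B → edge ℓ wall C B A D ≈ 0#
    edge-negative ℓ wall C B A D A<B rewrite ≤ᵇ-false A<B = refl

    -- The box of row B is new and its right neighbour belongs to λ, hence is new as well: a primed
    -- letter would occur twice in the row.
    edge-blocked : ∀ wall B A D → B < A → edge primed wall (suc B) B A D ≈ 0#
    edge-blocked wall B A D B<A rewrite ≤ᵇ-true (ℕP.<⇒≤ B<A) = ∏-zero (upTo A) (∈-upTo⁺ B<A) zero-at-B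
      where
      zero-at-B : boxWeight primed wall (suc B) B D B ≈ 0#
      zero-at-B rewrite <ᵇ-false (ℕP.≤-refl {B}) | <ᵇ-true (ℕP.≤-refl {suc B}) = refl

    after : Letter → ℕ → ℕ → ℕ
    after unprimed B′ A′ = A′
    after primed B′ A′ = B′

    edges : Letter → Bool → ∀ {L} → ℕ → ℕ → ℕ → Vec Bool (suc L) → Vec Bool (suc L) → Carrier
    edges ℓ wall {zero} C B A (v ∷ []) (w ∷ []) =
      edge ℓ false C B A (after ℓ (inc v B) (inc w A)) * edge ℓ wall (before ℓ B A) (inc v B) (inc w A) 0
    edges ℓ wall {suc L} C B A (v ∷ vs) (w ∷ ws) =
      edge ℓ false C B A (after ℓ (inc v B) (inc w A)) * edges ℓ wall (before ℓ B A) (inc v B) (inc w A) vs ws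

    edges-zero : ∀ ℓ wall {L} C B A (vs ws : Vec Bool (suc L)) → (∀ D → edge ℓ false C B A D ≈ 0#) →
      edges ℓ wall C B A vs ws ≈ 0#
    edges-zero ℓ wall {zero} C B A (v ∷ []) (w ∷ []) e0 = trans (*-congʳ (e0 _)) (zeroˡ _)
    edges-zero ℓ wall {suc L} C B A (v ∷ vs) (w ∷ ws) e0 = trans (*-congʳ (e0 _)) (zeroˡ _)

    -- The edge states are the possible positions of the two heights relative to `n`, the height `C`
    -- taken at the next larger content: both equal to it, both larger by one, or only that of λ
    -- larger. In the state `pend` the last box of the diagonal has no right neighbour in the
    -- relevant shape, so it may still receive the letter.
    heightν heightλ : Edge → ℕ → ℕ
    heightν pend n = suc n
    heightν _ n = n
    heightλ idle n = n
    heightλ _ n = suc n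

    private
      weight : Letter → Bool → Bool → Edge → ℕ → Carrier
      weight ℓ v w e n = edge ℓ false n (heightν e n) (heightλ e n)
        (after ℓ (inc v (heightν e n)) (inc w (heightλ e n)))

      -- One site of the upward kernel, with f and g the remaining sites in the two descriptions.
      site : ∀ ℓ v w e n (f : Edge → Carrier) (g : ℕ → ℕ → ℕ → Carrier) →
        (∀ e n → f e ≈ g n (heightν e n) (heightλ e n)) →
        (∀ C B A → A < B → g C B A ≈ 0#) →
        (∀ B A → ℓ ≡ primed → B < A → g (suc B) B A ≈ 0#) →
        close (up ℓ v w e) f ≈
          weight ℓ v w e n * g (before ℓ (heightν e n) (heightλ e n)) (inc v (heightν e n)) (inc w (heightλ e n))
      site unprimed false false idle n f g h neg blk = *-cong (sym (edge-idle unprimed false n n)) (h idle n)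
      site unprimed false true idle n f g h neg blk = *-cong (sym (edge-idle unprimed false n (suc n))) (h hop n)
      site unprimed true true idle n f g h neg blk = *-cong (sym (edge-idle unprimed false n (suc n))) (h pend n)
      site unprimed true false idle n f g h neg blk = sym (trans (*-congˡ (neg _ _ _ ℕP.≤-refl)) (zeroʳ _))
      site unprimed false false pend n f g h neg blk = *-cong
        (sym (trans (edge-pend unprimed false n (suc n))
          (reflexive (cong (λ p → if not p ∧ true then b else 1#) (<ᵇ-false (ℕP.≤-refl {suc n}))))))
        (h idle (suc n))
      site unprimed false true pend n f g h neg blk = *-cong
        (sym (trans (edge-pend unprimed false n (suc (suc n)))
          (reflexive (cong (λ p → if not p ∧ true then b else 1#) (<ᵇ-true (ℕP.≤-refl {suc (suc n)}))))))
        (h hop (suc n))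
      site unprimed true true pend n f g h neg blk = *-cong
        (sym (trans (edge-pend unprimed false n (suc (suc n)))
          (reflexive (cong (λ p → if not p ∧ true then b else 1#) (<ᵇ-true (ℕP.≤-refl {suc (suc n)}))))))
        (h pend (suc n))
      site unprimed true false pend n f g h neg blk = sym (trans (*-congˡ (neg _ _ _ ℕP.≤-refl)) (zeroʳ _))
      site unprimed false false hop n f g h neg blk = *-cong
        (sym (trans (edge-hop unprimed false n (suc n))
          (reflexive (cong (λ p → iverson (not p) x) (<ᵇ-false (ℕP.≤-refl {suc n}))))))
        (h hop n)
      site unprimed false true hop n f g h neg blk = sym (trans (*-congʳ
        (trans (edge-hop unprimed false n (suc (suc n)))
          (reflexive (cong (λ p → iverson (not p) x) (<ᵇ-true (ℕP.≤-refl {suc (suc n)})))))) (zeroˡ _))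
      site unprimed true true hop n f g h neg blk = sym (trans (*-congʳ
        (trans (edge-hop unprimed false n (suc (suc n)))
          (reflexive (cong (λ p → iverson (not p) x) (<ᵇ-true (ℕP.≤-refl {suc (suc n)})))))) (zeroˡ _))
      site unprimed true false hop n f g h neg blk = *-cong
        (sym (trans (edge-hop unprimed false n (suc n))
          (reflexive (cong (λ p → iverson (not p) x) (<ᵇ-false (ℕP.≤-refl {suc n}))))))
        (h pend n)
      site primed false false idle n f g h neg blk = *-cong (sym (edge-idle primed false n n)) (h idle n)
      site primed false true idle n f g h neg blk = *-cong (sym (edge-idle primed false n n)) (h hop n)
      site primed true true idle n f g h neg blk = *-cong (sym (edge-idle primed false n (suc n))) (h pend n)
      site primed true false idle n f g h neg blk = sym (trans (*-congˡ (neg _ _ _ ℕP.≤-refl)) (zeroʳ _))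
      site primed false false pend n f g h neg blk = *-cong
        (sym (trans (edge-pend primed false n (suc n))
          (reflexive (cong (λ p → if not p ∧ true then b else 1#) (<ᵇ-false (ℕP.≤-refl {suc n}))))))
        (h idle (suc n))
      site primed false true pend n f g h neg blk = *-cong
        (sym (trans (edge-pend primed false n (suc n))
          (reflexive (cong (λ p → if not p ∧ true then b else 1#) (<ᵇ-false (ℕP.≤-refl {suc n}))))))
        (h hop (suc n))
      site primed true true pend n f g h neg blk = *-cong
        (sym (trans (edge-pend primed false n (suc (suc n)))
          (reflexive (cong (λ p → if not p ∧ true then b else 1#) (<ᵇ-true (ℕP.≤-refl {suc (suc n)}))))))
        (h pend (suc n))
      site primed true false pend n f g h neg blk = sym (trans (*-congˡ (neg _ _ _ ℕP.≤-refl)) (zeroʳ _))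
      site primed false false hop n f g h neg blk = sym (trans (*-congˡ (blk _ _ ≡.refl ℕP.≤-refl)) (zeroʳ _))
      site primed false true hop n f g h neg blk =
        sym (trans (*-congˡ (blk _ _ ≡.refl (ℕP.m≤n⇒m≤1+n ℕP.≤-refl))) (zeroʳ _))
      site primed true true hop n f g h neg blk = *-cong
        (sym (trans (edge-hop primed false n (suc n))
          (reflexive (cong (λ p → iverson (not p ∧ true) x) (<ᵇ-false (ℕP.≤-refl {n}))))))
        (h hop (suc n))
      site primed true false hop n f g h neg blk = *-cong
        (sym (trans (edge-hop primed false n (suc n))
          (reflexive (cong (λ p → iverson (not p ∧ true) x) (<ᵇ-false (ℕP.≤-refl {n}))))))
        (h idle (suc n))

      reservoir-edge : ∀ κ ℓ e n → reservoir κ ℓ e ≈ edge ℓ (wallUp κ ℓ) n (heightν e n) (heightλ e n) 0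
      reservoir-edge 𝒬 primed idle n = sym (edge-idle primed false n 0)
      reservoir-edge 𝒬 unprimed idle n = sym (edge-idle unprimed false n 0)
      reservoir-edge 𝒫 primed idle n = sym (edge-idle primed true n 0)
      reservoir-edge 𝒫 unprimed idle n = sym (edge-idle unprimed false n 0)
      reservoir-edge 𝒬 primed pend n = sym (edge-pend primed false n 0)
      reservoir-edge 𝒬 unprimed pend n = sym (edge-pend unprimed false n 0)
      reservoir-edge 𝒫 primed pend n = sym (edge-pend primed true n 0)
      reservoir-edge 𝒫 unprimed pend n = sym (edge-pend unprimed false n 0)
      reservoir-edge 𝒬 unprimed hop n = sym (edge-hop unprimed false n 0)
      reservoir-edge 𝒫 unprimed hop n = sym (edge-hop unprimed false n 0)
      reservoir-edge 𝒬 primed hop n = sym (trans (edge-hop primed false n 0)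
        (reflexive (cong (λ p → iverson (not p ∧ true) x) (<ᵇ-false (ℕP.≤-refl {n})))))
      reservoir-edge 𝒫 primed hop n = sym (trans (edge-hop primed true n 0)
        (reflexive (cong (λ p → iverson (not p ∧ false) x) (<ᵇ-false (ℕP.≤-refl {n})))))

    upKernel-edges : ∀ κ ℓ {L} (v w : Vec Bool (suc L)) e n →
      upKernel x ℓ (upBase κ ℓ) v w e ≈ edges ℓ (wallUp κ ℓ) n (heightν e n) (heightλ e n) v w
    upKernel-edges κ ℓ {zero} (v ∷ []) (w ∷ []) e n = site ℓ v w e n (reservoir κ ℓ)
      (λ C B A → edge ℓ (wallUp κ ℓ) C B A 0) (reservoir-edge κ ℓ)
      (λ C B A A<B → edge-negative ℓ _ C B A 0 A<B) (λ { B A ≡.refl B<A → edge-blocked _ B A 0 B<A })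
    upKernel-edges κ ℓ {suc L} (v ∷ vs) (w ∷ ws) e n = site ℓ v w e n (upKernel x ℓ (upBase κ ℓ) vs ws)
      (λ C B A → edges ℓ (wallUp κ ℓ) C B A vs ws) (upKernel-edges κ ℓ vs ws)
      (λ C B A A<B → edges-zero ℓ _ C B A vs ws (λ D → edge-negative ℓ false C B A D A<B))
      (λ { B A ≡.refl B<A → edges-zero primed _ (suc B) B A vs ws (λ D → edge-blocked false B A D B<A) })

    edgeAt : Letter → Bool → (hν hλ : ℕ → ℕ) → ℕ → Carrier
    edgeAt ℓ wall hν hλ s = edge ℓ (wall ∧ isZero s) (nextOf ℓ hν hλ s) (hν s) (hλ s) (previousOf ℓ hν hλ s)

    edges-∏ : ∀ ℓ wall {L} C B A (v w : Vec Bool (suc L)) (hν hλ : ℕ → ℕ) →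
      (∀ s → s ≤ suc L → hν s ≡ B ℕ.+ height v s) → (∀ s → s ≤ suc L → hλ s ≡ A ℕ.+ height w s) →
      nextOf ℓ hν hλ (suc L) ≡ C →
      edges ℓ wall C B A v w ≈ ∏ (upTo (suc (suc L))) (edgeAt ℓ wall hν hλ)
    edges-∏ ℓ wall {L} C B A v w hν hλ eqν eqλ eqC = go {L} v w eqν eqλ eqC
      where
      edge-top : ∀ {L} {C B A B′ A′} → nextOf ℓ hν hλ (suc L) ≡ C → hν (suc L) ≡ B → hλ (suc L) ≡ A →
        hν L ≡ B′ → hλ L ≡ A′ → edge ℓ false C B A (after ℓ B′ A′) ≈ edgeAt ℓ wall hν hλ (suc L)
      edge-top {L} ≡.refl ≡.refl ≡.refl ≡.refl ≡.refl = reflexive (cong₂ (λ z D → edge ℓ z (nextOf ℓ hν hλ (suc L)) (hν (suc L)) (hλ (suc L)) D)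
        (≡.sym (BoolP.∧-zeroʳ wall)) (prev ℓ))
        where
        prev : ∀ ℓ → after ℓ (hν L) (hλ L) ≡ previousOf ℓ hν hλ (suc L)
        prev unprimed = ≡.refl
        prev primed = ≡.refl
      edge-bottom : ∀ {C B A} → nextOf ℓ hν hλ 0 ≡ C → hν 0 ≡ B → hλ 0 ≡ A → edge ℓ wall C B A 0 ≈ edgeAt ℓ wall hν hλ 0
      edge-bottom ≡.refl ≡.refl ≡.refl = reflexive (cong₂ (λ z D → edge ℓ z (nextOf ℓ hν hλ 0) (hν 0) (hλ 0) D)
        (≡.sym (BoolP.∧-identityʳ wall)) (prev ℓ))
        where
        prev : ∀ ℓ → 0 ≡ previousOf ℓ hν hλ 0
        prev unprimed = ≡.refl
        prev primed = ≡.refl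
      next : ∀ {L B A} → hν (suc L) ≡ B → hλ (suc L) ≡ A → nextOf ℓ hν hλ L ≡ before ℓ B A
      next ≡.refl ≡.refl = ≡.refl
      go : ∀ {L} {C B A} (v w : Vec Bool (suc L)) →
        (∀ s → s ≤ suc L → hν s ≡ B ℕ.+ height v s) → (∀ s → s ≤ suc L → hλ s ≡ A ℕ.+ height w s) →
        nextOf ℓ hν hλ (suc L) ≡ C →
        edges ℓ wall C B A v w ≈ ∏ (upTo (suc (suc L))) (edgeAt ℓ wall hν hλ)
      go {zero} {C} {B} {A} (b ∷ []) (c ∷ []) eqν eqλ eqC = trans (*-comm _ _) (trans (*-cong
        (edge-bottom (next (height-offset-top B (b ∷ []) hν eqν) (height-offset-top A (c ∷ []) hλ eqλ))
          (height-offset-below B b [] hν eqν) (height-offset-below A c [] hλ eqλ))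
        (trans (edge-top eqC (height-offset-top B (b ∷ []) hν eqν) (height-offset-top A (c ∷ []) hλ eqλ)
          (height-offset-below B b [] hν eqν) (height-offset-below A c [] hλ eqλ)) (sym (*-identityʳ _)))) refl)
      go {suc L} {C} {B} {A} (b ∷ v) (c ∷ w) eqν eqλ eqC = trans (*-cong
        (edge-top eqC (height-offset-top B (b ∷ v) hν eqν) (height-offset-top A (c ∷ w) hλ eqλ)
          (height-offset-below B b v hν eqν) (height-offset-below A c w hλ eqλ))
        (go v w (height-offset B b v hν eqν) (height-offset A c w hλ eqλ)
          (next (height-offset-top B (b ∷ v) hν eqν) (height-offset-top A (c ∷ w) hλ eqλ))))
        (trans (*-comm _ _) (sym (∏-upTo-last (suc (suc L)) (edgeAt ℓ wall hν hλ))))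

    γ : Letter → Bool → (hν hλ : ℕ → ℕ) → Box → Carrier
    γ ℓ wall hν hλ (r , c) =
      boxWeight ℓ (wall ∧ isZero (c ∸ r)) (nextOf ℓ hν hλ (c ∸ r)) (hν (c ∸ r)) (previousOf ℓ hν hλ (c ∸ r)) r

    -- The steps of the matrix become one weight for each content, and the product over contents
    -- becomes one over boxes. The comparisons `B ≤ᵇ A` of all edges together say that one shape
    -- contains the other; content L + 1 is added as an empty diagonal to start from.
    upKernel-boxes : ∀ κ ℓ {L} (v w : Vec Bool (suc L)) →
      iverson (subShape v w) (∏ (boxes (parts w)) (γ ℓ (wallUp κ ℓ) (height v) (height w)))
        ≈ upKernel x ℓ (upBase κ ℓ) v w idle
    upKernel-boxes κ ℓ {L} v w = sym (begin
      upKernel x ℓ (upBase κ ℓ) v w idle ≈⟨ upKernel-edges κ ℓ v w idle 0 ⟩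
      edges ℓ (wallUp κ ℓ) 0 0 0 v w
        ≈⟨ edges-∏ ℓ (wallUp κ ℓ) 0 0 0 v w (height v) (height w) (λ _ _ → ≡.refl) (λ _ _ → ≡.refl) (top-zero ℓ) ⟩
      ∏ (upTo (suc (suc L))) E ≈⟨ ∏-upTo-last (suc L) E ⟩
      ∏ (upTo (suc L)) E * E (suc L) ≈⟨ *-congˡ E-top ⟩
      ∏ (upTo (suc L)) E * 1# ≈⟨ *-identityʳ _ ⟩
      ∏ (upTo (suc L)) E ≈⟨ ∏-iverson (upTo (suc L)) (λ s → height v s ≤ᵇ height w s) (λ s → ∏ (upTo (height w s)) (weightAt s)) ⟩
      iverson (subShape v w) (∏ (upTo (suc L)) (λ s → ∏ (upTo (height w s)) (weightAt s)))
        ≈⟨ iverson-cong (subShape v w) (trans (∏-boxes w 0 (γ ℓ (wallUp κ ℓ) (height v) (height w)))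
             (∏-cong (upTo (suc L)) (λ s → ∏-cong (upTo (height w s)) (λ r → reflexive (γ-cell r s))))) ⟨
      iverson (subShape v w) (∏ (boxes (parts w)) (γ ℓ (wallUp κ ℓ) (height v) (height w))) ∎)
      where
      E = edgeAt ℓ (wallUp κ ℓ) (height v) (height w)
      weightAt : ℕ → ℕ → Carrier
      weightAt s = boxWeight ℓ (wallUp κ ℓ ∧ isZero s) (nextOf ℓ (height v) (height w) s) (height v s) (previousOf ℓ (height v) (height w) s)
      γ-cell : ∀ r s → γ ℓ (wallUp κ ℓ) (height v) (height w) (cell r s) ≡ weightAt s r
      γ-cell r s = cong (λ s → weightAt s r) (ℕP.m+n∸m≡n r s)
      top-zero : ∀ ℓ → nextOf ℓ (height v) (height w) (suc L) ≡ 0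
      top-zero unprimed = height-top v (ℕP.n≤1+n (suc L))
      top-zero primed = height-top w (ℕP.n≤1+n (suc L))
      E-top : E (suc L) ≈ 1#
      E-top rewrite height-top v (ℕP.≤-refl {suc L}) | height-top w (ℕP.≤-refl {suc L}) = refl

  module DownEdges (y : Carrier) where
    open DownWeights (ringOperations R) t y 1# 1# 1#

    -- Leaders are chosen so that each row (primed) or column (unprimed) met by the letter has one
    -- of them. The product is then y to the number of lines times t to the number of remaining
    -- boxes.
    boxWeight : Letter → Bool → Bool → ℕ → ℕ → ℕ → Carrier
    boxWeight ℓ first wall B D r =
      if r <ᵇ B then 1# else iverson (not wall) (if leader ℓ first D r then y else t)

    edge : Letter → Bool → Bool → ℕ → ℕ → ℕ → Carrier
    edge ℓ first wall B A D = iverson (B ≤ᵇ A) (∏ (upTo A) (boxWeight ℓ first wall B D))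

    private
      range : ∀ n {B A} → A ≡ n ℕ.+ B → (B ≤ᵇ A) ≡ true
      range n {B} ≡.refl = ≤ᵇ-true (ℕP.m≤n+m B n)

      edge-range : ∀ ℓ first wall n B D (c : ℕ → Carrier) → c 0 ≈ 1# →
        (∀ j → j < n → c (suc j) ≈ c j * iverson (not wall) (if leader ℓ first D (j ℕ.+ B) then y else t)) →
        edge ℓ first wall B (n ℕ.+ B) D ≈ c n
      edge-range ℓ first wall n B D c c0 cs rewrite range n {B} ≡.refl = go n ℕP.≤-refl
        where
        go : ∀ j → j ≤ n → ∏ (upTo (j ℕ.+ B)) (boxWeight ℓ first wall B D) ≈ c j
        go zero _ = trans (∏-one-∈ (upTo B) one) (sym c0)
          where
          one : ∀ {r} → r ∈ upTo B → boxWeight ℓ first wall B D r ≈ 1#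
          one {r} r∈ rewrite <ᵇ-true (∈-upTo⁻ r∈) = refl
        go (suc j) j<n = trans (∏-upTo-last (j ℕ.+ B) _) (trans (*-cong (go j (ℕP.<⇒≤ j<n)) last) (sym (cs j j<n)))
          where
          last : boxWeight ℓ first wall B D (j ℕ.+ B) ≈ iverson (not wall) (if leader ℓ first D (j ℕ.+ B) then y else t)
          last rewrite <ᵇ-false (ℕP.m≤n+m B j) = refl

      if-cong : ∀ {p} q {c d : Carrier} → p ≡ q → (if p then c else d) ≈ (if q then c else d)
      if-cong q ≡.refl = refl

      -- the product of the weights of n new boxes, one of which is a leader
      led : ℕ → Carrier
      led zero = 1#
      led (suc n) = y * T n

      plain-primed : ∀ n B → edge primed false false B (n ℕ.+ B) B ≈ T n
      plain-primed n B = edge-range primed false false n B B T refl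
        (λ j _ → trans (*-comm _ _) (*-congˡ (sym (if-cong false (no-leader j)))))
        where
        no-leader : ∀ j → ((j ℕ.+ B <ᵇ B) ∨ false) ≡ false
        no-leader j rewrite <ᵇ-false (ℕP.m≤n+m B j) = ≡.refl

      led-primed : ∀ n B → edge primed false false B (n ℕ.+ B) (suc B) ≈ led n
      led-primed n B = edge-range primed false false n B (suc B) led refl next
        where
        next : ∀ j → j < n → led (suc j) ≈ led j * (if ((j ℕ.+ B <ᵇ suc B) ∨ false) then y else t)
        next zero _ rewrite <ᵇ-true (ℕP.≤-refl {suc B}) = *-comm _ _
        next (suc j) _ rewrite <ᵇ-false (s≤s (ℕP.m≤n+m B j)) = trans (*-congˡ (*-comm _ _)) (sym (*-assoc _ _ _))

      plain-unprimed : ∀ n B → edge unprimed false false B (n ℕ.+ B) (suc (n ℕ.+ B)) ≈ T n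
      plain-unprimed n B = edge-range unprimed false false n B (suc (n ℕ.+ B)) T refl
        (λ j j<n → trans (*-comm _ _) (*-congˡ (sym (if-cong false
          (cong not (<ᵇ-true (s≤s (ℕP.+-monoˡ-< B j<n))))))))

      -- For an unprimed letter the leader is the last new box of the diagonal, not the first as for
      -- a primed one. The partial products are therefore powers of t until the final step, which
      -- accounts for the case distinction in the auxiliary sequence.
      led-unprimed : ∀ n B → edge unprimed false false B (n ℕ.+ B) (n ℕ.+ B) ≈ led n
      led-unprimed zero B = edge-range unprimed false false 0 B B (λ _ → 1#) refl (λ _ ())
      led-unprimed (suc n) B = trans
        (edge-range unprimed false false (suc n) B (suc n ℕ.+ B) (λ j → if j <ᵇ suc n then T j else y * T n) refl next)
        (if-cong false (<ᵇ-false (ℕP.≤-refl {n})))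
        where
        next : ∀ j → j < suc n → (if suc j <ᵇ suc n then T (suc j) else y * T n)
          ≈ (if j <ᵇ suc n then T j else y * T n) * (if not (suc (j ℕ.+ B) <ᵇ suc n ℕ.+ B) then y else t)
        next j (s≤s j≤n) with ℕP.m≤n⇒m<n∨m≡n j≤n
        ... | inj₁ j<n rewrite <ᵇ-true j<n | <ᵇ-true (ℕP.m≤n⇒m≤1+n j<n) | <ᵇ-true (ℕP.+-monoˡ-< B j<n) = *-comm _ _
        ... | inj₂ ≡.refl rewrite <ᵇ-false (ℕP.≤-refl {j}) | <ᵇ-true (ℕP.≤-refl {suc j}) | <ᵇ-false (ℕP.≤-refl {j ℕ.+ B}) = *-comm _ _

      edge-negative : ∀ ℓ first wall B A D → A < B → edge ℓ first wall B A D ≈ 0#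
      edge-negative ℓ first wall B A D A<B rewrite ≤ᵇ-false A<B = refl

    after : Letter → ℕ → ℕ → ℕ
    after unprimed B′ A′ = A′
    after primed B′ A′ = B′

    edges : Letter → Bool → ∀ {L} → ℕ → ℕ → Vec Bool (suc L) → Vec Bool (suc L) → Carrier
    edges ℓ wall {zero} B A (v ∷ []) (w ∷ []) =
      edge ℓ false false B A (after ℓ (inc v B) (inc w A)) * edge ℓ true wall (inc v B) (inc w A) 0
    edges ℓ wall {suc L} B A (v ∷ vs) (w ∷ ws) =
      edge ℓ false false B A (after ℓ (inc v B) (inc w A)) * edges ℓ wall (inc v B) (inc w A) vs ws

    private
      edges-negative : ∀ ℓ wall {L} B A (vs ws : Vec Bool (suc L)) → A < B → edges ℓ wall B A vs ws ≈ 0#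
      edges-negative ℓ wall {zero} B A (v ∷ []) (w ∷ []) A<B = trans (*-congʳ (edge-negative ℓ false false B A _ A<B)) (zeroˡ _)
      edges-negative ℓ wall {suc L} B A (v ∷ vs) (w ∷ ws) A<B = trans (*-congʳ (edge-negative ℓ false false B A _ A<B)) (zeroˡ _)

      site : ∀ ℓ v w n B (f : ℕ → Carrier) (g : ℕ → ℕ → Carrier) →
        (∀ n B → f n ≈ g B (n ℕ.+ B)) → (∀ B A → A < B → g B A ≈ 0#) →
        closeDown (down ℓ w v n) f ≈
          edge ℓ false false B (n ℕ.+ B) (after ℓ (inc v B) (inc w (n ℕ.+ B))) * g (inc v B) (inc w (n ℕ.+ B))
      site primed false false n B f g h neg = *-cong (sym (plain-primed n B)) (h n B)
      site primed false true n B f g h neg = *-cong (sym (plain-primed n B)) (h (suc n) B)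
      site primed true true zero B f g h neg = *-cong (sym (led-primed 0 B)) (h 0 (suc B))
      site primed true true (suc n) B f g h neg = *-cong (sym (led-primed (suc n) B))
        (trans (h (suc n) (suc B)) (reflexive (cong (g (suc B)) (cong suc (ℕP.+-suc n B)))))
      site primed true false zero B f g h neg = sym (trans (*-congˡ (neg (suc B) B ℕP.≤-refl)) (zeroʳ _))
      site primed true false (suc n) B f g h neg = *-cong (sym (led-primed (suc n) B))
        (trans (h n (suc B)) (reflexive (cong (g (suc B)) (ℕP.+-suc n B))))
      site unprimed false false zero B f g h neg = *-cong (sym (led-unprimed 0 B)) (h 0 B)
      site unprimed false false (suc n) B f g h neg = *-cong (sym (led-unprimed (suc n) B)) (h (suc n) B)
      site unprimed false true n B f g h neg = *-cong (sym (plain-unprimed n B)) (h (suc n) B)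
      site unprimed true true n B f g h neg = *-cong (sym (plain-unprimed n B))
        (trans (h n (suc B)) (reflexive (cong (g (suc B)) (ℕP.+-suc n B))))
      site unprimed true false zero B f g h neg = sym (trans (*-congˡ (neg (suc B) B ℕP.≤-refl)) (zeroʳ _))
      site unprimed true false (suc n) B f g h neg = *-cong (sym (led-unprimed (suc n) B))
        (trans (h n (suc B)) (reflexive (cong (g (suc B)) (ℕP.+-suc n B))))

      sink-edge : ∀ κ ℓ n B → sink κ ℓ n ≈ edge ℓ true (wallDown κ ℓ) B (n ℕ.+ B) 0
      sink-edge 𝒬 primed n B = sym (edge-range primed true false n B 0 Y refl (λ _ _ → *-comm _ _))
      sink-edge 𝒫 primed n B = sym (edge-range primed true false n B 0 Y refl (λ _ _ → *-comm _ _))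
      sink-edge 𝒫 unprimed n B = sym (edge-range unprimed true false n B 0 Y refl (λ _ _ → *-comm _ _))
      sink-edge 𝒬 unprimed n B = sym (edge-range unprimed true true n B 0 E refl (λ _ _ → sym (zeroʳ _)))

    -- The flow is the excess of the height of λ over that of ν. A step that would make it negative
    -- is `nothing` in the matrix, and an edge with A < B here.
    downKernel-edges : ∀ κ ℓ {L} (v w : Vec Bool (suc L)) n B →
      downKernel y ℓ (downBase κ ℓ) w v n ≈ edges ℓ (wallDown κ ℓ) B (n ℕ.+ B) v w
    downKernel-edges κ ℓ {zero} (v ∷ []) (w ∷ []) n B = site ℓ v w n B (sink κ ℓ)
      (λ B A → edge ℓ true (wallDown κ ℓ) B A 0) (sink-edge κ ℓ) (λ B A A<B → edge-negative ℓ true (wallDown κ ℓ) B A 0 A<B)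
    downKernel-edges κ ℓ {suc L} (v ∷ vs) (w ∷ ws) n B = site ℓ v w n B (downKernel y ℓ (downBase κ ℓ) ws vs)
      (λ B A → edges ℓ (wallDown κ ℓ) B A vs ws) (downKernel-edges κ ℓ vs ws)
      (λ B A A<B → edges-negative ℓ (wallDown κ ℓ) B A vs ws A<B)

    γ : Letter → Bool → (hν hλ : ℕ → ℕ) → Box → Carrier
    γ ℓ wall hν hλ (r , c) =
      boxWeight ℓ (isZero (c ∸ r)) (wall ∧ isZero (c ∸ r)) (hν (c ∸ r)) (previousOf ℓ hν hλ (c ∸ r)) r

    private
      edgeAt : Letter → Bool → (hν hλ : ℕ → ℕ) → ℕ → Carrier
      edgeAt ℓ wall hν hλ s = edge ℓ (isZero s) (wall ∧ isZero s) (hν s) (hλ s) (previousOf ℓ hν hλ s)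

      edges-∏ : ∀ ℓ wall {L} {B A} (v w : Vec Bool (suc L)) (hν hλ : ℕ → ℕ) →
        (∀ s → s ≤ suc L → hν s ≡ B ℕ.+ height v s) → (∀ s → s ≤ suc L → hλ s ≡ A ℕ.+ height w s) →
        edges ℓ wall B A v w ≈ ∏ (upTo (suc (suc L))) (edgeAt ℓ wall hν hλ)
      edges-∏ ℓ wall v w hν hλ = go v w
        where
        edge-top : ∀ {L} {B A B′ A′} → hν (suc L) ≡ B → hλ (suc L) ≡ A → hν L ≡ B′ → hλ L ≡ A′ →
          edge ℓ false false B A (after ℓ B′ A′) ≈ edgeAt ℓ wall hν hλ (suc L)
        edge-top {L} ≡.refl ≡.refl ≡.refl ≡.refl = reflexive (cong₂ (λ z D → edge ℓ false z (hν (suc L)) (hλ (suc L)) D)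
          (≡.sym (BoolP.∧-zeroʳ wall)) (prev ℓ))
          where
          prev : ∀ ℓ → after ℓ (hν L) (hλ L) ≡ previousOf ℓ hν hλ (suc L)
          prev unprimed = ≡.refl
          prev primed = ≡.refl
        edge-bottom : ∀ {B A} → hν 0 ≡ B → hλ 0 ≡ A → edge ℓ true wall B A 0 ≈ edgeAt ℓ wall hν hλ 0
        edge-bottom ≡.refl ≡.refl = reflexive (cong₂ (λ z D → edge ℓ true z (hν 0) (hλ 0) D)
          (≡.sym (BoolP.∧-identityʳ wall)) (prev ℓ))
          where
          prev : ∀ ℓ → 0 ≡ previousOf ℓ hν hλ 0
          prev unprimed = ≡.refl
          prev primed = ≡.refl
        go : ∀ {L} {B A} (v w : Vec Bool (suc L)) →
          (∀ s → s ≤ suc L → hν s ≡ B ℕ.+ height v s) → (∀ s → s ≤ suc L → hλ s ≡ A ℕ.+ height w s) →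
          edges ℓ wall B A v w ≈ ∏ (upTo (suc (suc L))) (edgeAt ℓ wall hν hλ)
        go {zero} {B} {A} (b ∷ []) (c ∷ []) eqν eqλ = trans (*-comm _ _) (*-cong
          (edge-bottom (height-offset-below B b [] hν eqν) (height-offset-below A c [] hλ eqλ))
          (trans (edge-top (height-offset-top B (b ∷ []) hν eqν) (height-offset-top A (c ∷ []) hλ eqλ)
            (height-offset-below B b [] hν eqν) (height-offset-below A c [] hλ eqλ)) (sym (*-identityʳ _))))
        go {suc L} {B} {A} (b ∷ v) (c ∷ w) eqν eqλ = trans (*-cong
          (edge-top (height-offset-top B (b ∷ v) hν eqν) (height-offset-top A (c ∷ w) hλ eqλ)
            (height-offset-below B b v hν eqν) (height-offset-below A c w hλ eqλ))
          (go v w (height-offset B b v hν eqν) (height-offset A c w hλ eqλ)))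
          (trans (*-comm _ _) (sym (∏-upTo-last (suc (suc L)) (edgeAt ℓ wall hν hλ))))

    downKernel-boxes : ∀ κ ℓ {L} (v w : Vec Bool (suc L)) →
      iverson (subShape v w) (∏ (boxes (parts w)) (γ ℓ (wallDown κ ℓ) (height v) (height w)))
        ≈ downKernel y ℓ (downBase κ ℓ) w v 0
    downKernel-boxes κ ℓ {L} v w = sym (begin
      downKernel y ℓ (downBase κ ℓ) w v 0 ≈⟨ downKernel-edges κ ℓ v w 0 0 ⟩
      edges ℓ (wallDown κ ℓ) 0 0 v w
        ≈⟨ edges-∏ ℓ (wallDown κ ℓ) v w (height v) (height w) (λ _ _ → ≡.refl) (λ _ _ → ≡.refl) ⟩
      ∏ (upTo (suc (suc L))) E′ ≈⟨ ∏-upTo-last (suc L) E′ ⟩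
      ∏ (upTo (suc L)) E′ * E′ (suc L) ≈⟨ *-congˡ E-top ⟩
      ∏ (upTo (suc L)) E′ * 1# ≈⟨ *-identityʳ _ ⟩
      ∏ (upTo (suc L)) E′
        ≈⟨ ∏-iverson (upTo (suc L)) (λ s → height v s ≤ᵇ height w s) (λ s → ∏ (upTo (height w s)) (weightAt s)) ⟩
      iverson (subShape v w) (∏ (upTo (suc L)) (λ s → ∏ (upTo (height w s)) (weightAt s)))
        ≈⟨ iverson-cong (subShape v w) (trans (∏-boxes w 0 (γ ℓ (wallDown κ ℓ) (height v) (height w)))
             (∏-cong (upTo (suc L)) (λ s → ∏-cong (upTo (height w s)) (λ r → reflexive (γ-cell r s))))) ⟨
      iverson (subShape v w) (∏ (boxes (parts w)) (γ ℓ (wallDown κ ℓ) (height v) (height w))) ∎)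
      where
      E′ = edgeAt ℓ (wallDown κ ℓ) (height v) (height w)
      weightAt : ℕ → ℕ → Carrier
      weightAt s = boxWeight ℓ (isZero s) (wallDown κ ℓ ∧ isZero s) (height v s) (previousOf ℓ (height v) (height w) s)
      γ-cell : ∀ r s → γ ℓ (wallDown κ ℓ) (height v) (height w) (cell r s) ≡ weightAt s r
      γ-cell r s = cong (λ s → weightAt s r) (ℕP.m+n∸m≡n r s)
      E-top : E′ (suc L) ≈ 1#
      E-top rewrite height-top v (ℕP.≤-refl {suc L}) | height-top w (ℕP.≤-refl {suc L}) = refl

-- Removing the largest letter of a set-valued tableau

false≢true : {A : Set} → false ≡ true → A
false≢true ()

⇒ᵇ-elim : ∀ {a b} → (a ⇒ᵇ b) ≡ true → a ≡ true → b ≡ true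
⇒ᵇ-elim {true} h ≡.refl = h

⇒ᵇ-intro : ∀ {a b} → (a ≡ true → b ≡ true) → (a ⇒ᵇ b) ≡ true
⇒ᵇ-intro {true} h = h ≡.refl
⇒ᵇ-intro {false} h = ≡.refl

≡ᵇ-true : ∀ {m n} → m ≡ n → (m ≡ᵇ n) ≡ true
≡ᵇ-true {zero} ≡.refl = ≡.refl
≡ᵇ-true {suc m} ≡.refl = ≡ᵇ-true {m} ≡.refl

≡ᵇ-≡ : ∀ m n → (m ≡ᵇ n) ≡ true → m ≡ n
≡ᵇ-≡ zero zero _ = ≡.refl
≡ᵇ-≡ (suc m) (suc n) h = cong suc (≡ᵇ-≡ m n h)

not-≡ᵇ : ∀ {m n} → m ≢ n → not (m ≡ᵇ n) ≡ true
not-≡ᵇ {m} {n} m≢n with m ≡ᵇ n in eq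
... | true = ⊥-elim (m≢n (≡ᵇ-≡ m n eq))
... | false = ≡.refl

not-≡ᵇ-≢ : ∀ m n → not (m ≡ᵇ n) ≡ true → m ≢ n
not-≡ᵇ-≢ m .m h ≡.refl rewrite ≡ᵇ-true {m} ≡.refl = false≢true h

not-true : ∀ {a} → not a ≡ true → a ≡ true → ⊥
not-true {false} h ()

not-intro : ∀ {a} → (a ≡ true → ⊥) → not a ≡ true
not-intro {true} h = ⊥-elim (h ≡.refl)
not-intro {false} h = ≡.refl

any-true : {A : Set} {p : A → Bool} (as : List A) → any p as ≡ true → ∃ λ a → a ∈ as × p a ≡ true
any-true {p = p} (a ∷ as) h with p a in eq
... | true = a , here ≡.refl , eq
... | false with any-true as h
...   | a′ , a′∈ , pa′ = a′ , there a′∈ , pa′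

any-intro : {A : Set} {p : A → Bool} (as : List A) {a : A} → a ∈ as → p a ≡ true → any p as ≡ true
any-intro (a ∷ as) (here ≡.refl) h rewrite h = ≡.refl
any-intro {p = p} (a ∷ as) (there a∈) h with p a
... | true = ≡.refl
... | false = any-intro as a∈ h

member-true : ∀ x as → memberᵇ x as ≡ true → x ∈ as
member-true x as h with any-true as h
... | a , a∈ , eq = subst (_∈ as) (≡.sym (≡ᵇ-≡ x a eq)) a∈

member-intro : ∀ {x} as → x ∈ as → memberᵇ x as ≡ true
member-intro {x} as x∈ = any-intro as x∈ (≡ᵇ-true {x} ≡.refl)

isPrimedLetter : Letter → Bool
isPrimedLetter primed = true
isPrimedLetter unprimed = false

-- `has` says that the box contains the largest letter, `order-ok` that it contains no other. The
-- second must hold to the right of and below any box for which the first does.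
has order-ok : Status → Bool
has nothing = true
has (just o) = o
order-ok nothing = true
order-ok (just _) = false

ordered : Status → Status → Bool
ordered a a′ = not (has a) ∨ order-ok a′

statusPairOK : Letter → Box × Status → Box × Status → Bool
statusPairOK ℓ ((r₁ , c₁) , a₁) ((r₂ , c₂) , a₂) =
  (((r₂ ≡ᵇ suc r₁) ∧ (c₂ ≡ᵇ c₁)) ⇒ᵇ ordered a₁ a₂) ∧
  (((r₂ ≡ᵇ r₁) ∧ (c₂ ≡ᵇ suc c₁)) ⇒ᵇ ordered a₁ a₂) ∧
  (((c₁ ≡ᵇ c₂) ∧ not (r₁ ≡ᵇ r₂)) ⇒ᵇ not (not (isPrimedLetter ℓ) ∧ has a₁ ∧ has a₂)) ∧
  (((r₁ ≡ᵇ r₂) ∧ not (c₁ ≡ᵇ c₂)) ⇒ᵇ not (isPrimedLetter ℓ ∧ has a₁ ∧ has a₂))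

statusDiagOK : Kind → Letter → Box × Status → Bool
statusDiagOK 𝒬 ℓ p = true
statusDiagOK 𝒫 ℓ (b , a) = isDiag b ⇒ᵇ not (isPrimedLetter ℓ ∧ has a)

statusValid : Kind → Letter → List (Box × Status) → Bool
statusValid κ ℓ S = allPairs (statusPairOK ℓ) S ∧ all (statusDiagOK κ ℓ) S

record PairFacts (ℓ : Letter) (r₁ c₁ : ℕ) (a₁ : Status) (r₂ c₂ : ℕ) (a₂ : Status) : Set where
  field
    below : r₂ ≡ suc r₁ → c₂ ≡ c₁ → ordered a₁ a₂ ≡ true
    right : r₂ ≡ r₁ → c₂ ≡ suc c₁ → ordered a₁ a₂ ≡ true
    column : c₁ ≡ c₂ → r₁ ≢ r₂ → ℓ ≡ unprimed → has a₁ ≡ true → has a₂ ≡ true → ⊥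
    rows : r₁ ≡ r₂ → c₁ ≢ c₂ → ℓ ≡ primed → has a₁ ≡ true → has a₂ ≡ true → ⊥

pairFacts : ∀ ℓ r₁ c₁ a₁ r₂ c₂ a₂ → statusPairOK ℓ ((r₁ , c₁) , a₁) ((r₂ , c₂) , a₂) ≡ true →
  PairFacts ℓ r₁ c₁ a₁ r₂ c₂ a₂
pairFacts ℓ r₁ c₁ a₁ r₂ c₂ a₂ h with ∧-true h
... | h₁ , h′ with ∧-true h′
...   | h₂ , h″ with ∧-true {((c₁ ≡ᵇ c₂) ∧ not (r₁ ≡ᵇ r₂)) ⇒ᵇ not (not (isPrimedLetter ℓ) ∧ has a₁ ∧ has a₂)} h″
...     | h₃ , h₄ = record
  { below = λ er ec → ⇒ᵇ-elim h₁ (∧-intro (≡ᵇ-true er) (≡ᵇ-true ec))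
  ; right = λ er ec → ⇒ᵇ-elim h₂ (∧-intro (≡ᵇ-true er) (≡ᵇ-true ec))
  ; column = λ ec nr eℓ ha ha′ → not-true (⇒ᵇ-elim h₃ (∧-intro (≡ᵇ-true ec) (not-≡ᵇ nr)))
      (∧-intro (cong (λ ℓ → not (isPrimedLetter ℓ)) eℓ) (∧-intro ha ha′))
  ; rows = λ er nc eℓ ha ha′ → not-true (⇒ᵇ-elim h₄ (∧-intro (≡ᵇ-true er) (not-≡ᵇ nc)))
      (∧-intro (cong isPrimedLetter eℓ) (∧-intro ha ha′))
  }

pairFacts-intro : ∀ ℓ r₁ c₁ a₁ r₂ c₂ a₂ → PairFacts ℓ r₁ c₁ a₁ r₂ c₂ a₂ →
  statusPairOK ℓ ((r₁ , c₁) , a₁) ((r₂ , c₂) , a₂) ≡ true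
pairFacts-intro ℓ r₁ c₁ a₁ r₂ c₂ a₂ f = ∧-intro
  (⇒ᵇ-intro (λ h → below (≡ᵇ-≡ r₂ _ (proj₁ (∧-true h))) (≡ᵇ-≡ c₂ _ (proj₂ (∧-true {r₂ ≡ᵇ suc r₁} h)))))
  (∧-intro (⇒ᵇ-intro (λ h → right (≡ᵇ-≡ r₂ _ (proj₁ (∧-true h))) (≡ᵇ-≡ c₂ _ (proj₂ (∧-true {r₂ ≡ᵇ r₁} h)))))
  (∧-intro
    (⇒ᵇ-intro (λ h → not-intro (λ g → strip-column ℓ column
      (≡ᵇ-≡ c₁ c₂ (proj₁ (∧-true h))) (not-≡ᵇ-≢ r₁ r₂ (proj₂ (∧-true {c₁ ≡ᵇ c₂} h))) g)))
    (⇒ᵇ-intro (λ h → not-intro (λ g → strip-row ℓ rows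
      (≡ᵇ-≡ r₁ r₂ (proj₁ (∧-true h))) (not-≡ᵇ-≢ c₁ c₂ (proj₂ (∧-true {r₁ ≡ᵇ r₂} h))) g)))))
  where
  open PairFacts f
  strip-column : ∀ ℓ → (c₁ ≡ c₂ → r₁ ≢ r₂ → ℓ ≡ unprimed → has a₁ ≡ true → has a₂ ≡ true → ⊥) →
    c₁ ≡ c₂ → r₁ ≢ r₂ → (not (isPrimedLetter ℓ) ∧ has a₁ ∧ has a₂) ≡ true → ⊥
  strip-column unprimed f ec nr g = f ec nr ≡.refl (proj₁ (∧-true g)) (proj₂ (∧-true {has a₁} g))
  strip-row : ∀ ℓ → (r₁ ≡ r₂ → c₁ ≢ c₂ → ℓ ≡ primed → has a₁ ≡ true → has a₂ ≡ true → ⊥) →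
    r₁ ≡ r₂ → c₁ ≢ c₂ → (isPrimedLetter ℓ ∧ has a₁ ∧ has a₂) ≡ true → ⊥
  strip-row primed f er nc g = f er nc ≡.refl (proj₁ (∧-true g)) (proj₂ (∧-true {has a₁} g))

ordered-kept : ∀ a a′ → ordered a a′ ≡ true → is-just a′ ≡ true → has a ≡ true → ⊥
ordered-kept nothing (just o) h _ _ = false≢true h
ordered-kept (just true) (just o) h _ _ = false≢true h

ordered-new : ∀ a a′ → ordered a a′ ≡ true → has a ≡ true → a′ ≡ nothing
ordered-new a nothing h ha = ≡.refl
ordered-new a (just o) h ha = ⊥-elim (ordered-kept a (just o) h ≡.refl ha)

height-anti-≤ : ∀ {L} (w : Vec Bool L) {s s′} → s ≤ s′ → height w s′ ≤ height w s
height-anti-≤ w {s} {s′} s≤s′ with ℕP.m≤n⇒∃[o]m+o≡n s≤s′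
... | k , ≡.refl = go k
  where
  go : ∀ k → height w (s ℕ.+ k) ≤ height w s
  go zero rewrite ℕP.+-identityʳ s = ℕP.≤-refl
  go (suc k) rewrite ℕP.+-suc s k = ℕP.≤-trans (height-anti w (s ℕ.+ k)) (go k)

-- Moving up k boxes within a column lowers the row and raises the content by k, and stays inside
-- the diagram.
height-diagonal : ∀ {L} (w : Vec Bool L) k {r s} → k ℕ.+ r < height w s → r < height w (k ℕ.+ s)
height-diagonal w zero h = h
height-diagonal w (suc k) {r} {s} h = subst (λ i → r < height w i) (ℕP.+-suc k s)
  (height-diagonal w k (ℕP.≤-pred (ℕP.≤-trans h (height-step w s))))

module Local (κ : Kind) (ℓ : Letter) {L} (v w : Vec Bool L) where

  hν hλ : ℕ → ℕ
  hν = height v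
  hλ = height w

  localAt : ℕ → ℕ → Status → Bool
  localAt r s a = if r <ᵇ hν s then kept-ok a else new-ok a
    where
    kept-ok new-ok : Status → Bool
    kept-ok nothing = false
    kept-ok (just false) = true
    kept-ok (just true) = allowed ℓ (wallUp κ ℓ ∧ isZero s) (nextOf ℓ hν hλ s) (previousOf ℓ hν hλ s) r
    new-ok nothing = newOK ℓ (wallUp κ ℓ ∧ isZero s) (nextOf ℓ hν hλ s) (previousOf ℓ hν hλ s) r
    new-ok (just _) = false

  local : Box × Status → Bool
  local ((r , c) , a) = localAt r (c ∸ r) a

  local-cell : ∀ r s a → local (cell r s , a) ≡ localAt r s a
  local-cell r s a = cong (λ s → localAt r s a) (ℕP.m+n∸m≡n r s)

  data LocalFacts (r s : ℕ) : Status → Set where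
    kept-only : r < hν s → LocalFacts r s (just false)
    kept-both : r < hν s → ¬ (r < nextOf ℓ hν hλ s) → ¬ (suc r < previousOf ℓ hν hλ s) →
      ¬ ((wallUp κ ℓ ∧ isZero s) ≡ true) → LocalFacts r s (just true)
    new : ¬ (r < hν s) → (ℓ ≡ unprimed → ¬ (suc r < previousOf ℓ hν hλ s)) →
      (ℓ ≡ primed → ¬ (r < nextOf ℓ hν hλ s) × ¬ ((wallUp κ ℓ ∧ isZero s) ≡ true)) → LocalFacts r s nothing

  not-<ᵇ : ∀ m n → not (m <ᵇ n) ≡ true → ¬ (m < n)
  not-<ᵇ m n h m<n = not-true h (<ᵇ-true m<n)

  local-facts : ∀ r s a → localAt r s a ≡ true → LocalFacts r s a
  local-facts r s a h with r <ᵇ hν s in eq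
  local-facts r s (just false) h | true = kept-only (<ᵇ-< {r} eq)
  local-facts r s (just true) h | true with ∧-true h
  ... | h₁ , h′ with ∧-true h′
  ...   | h₂ , h₃ = kept-both (<ᵇ-< {r} eq) (not-<ᵇ r _ h₁) (not-<ᵇ (suc r) (previousOf ℓ hν hλ s) h₂) (not-true h₃)
  local-facts r s nothing h | false = new (λ r< → false≢true (≡.trans (≡.sym eq) (<ᵇ-true r<))) (unprimed-facts ℓ h) (primed-facts ℓ h)
    where
    unprimed-facts : ∀ ℓ → newOK ℓ (wallUp κ ℓ ∧ isZero s) (nextOf ℓ hν hλ s) (previousOf ℓ hν hλ s) r ≡ true →
      ℓ ≡ unprimed → ¬ (suc r < previousOf ℓ hν hλ s)
    unprimed-facts unprimed h _ = not-<ᵇ (suc r) (previousOf unprimed hν hλ s) h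
    primed-facts : ∀ ℓ → newOK ℓ (wallUp κ ℓ ∧ isZero s) (nextOf ℓ hν hλ s) (previousOf ℓ hν hλ s) r ≡ true →
      ℓ ≡ primed → ¬ (r < nextOf ℓ hν hλ s) × ¬ ((wallUp κ ℓ ∧ isZero s) ≡ true)
    primed-facts primed h _ = not-<ᵇ r _ (proj₁ (∧-true h)) , not-true (proj₂ (∧-true {not (r <ᵇ hλ (suc s))} h))

  local-intro : ∀ r s a → LocalFacts r s a → localAt r s a ≡ true
  local-intro r s (just false) (kept-only r<) rewrite <ᵇ-true r< = ≡.refl
  local-intro r s (just true) (kept-both r< n₁ n₂ n₃) rewrite <ᵇ-true r< = ∧-intro
    (not-intro (λ h → n₁ (<ᵇ-< {r} h))) (∧-intro (not-intro (λ h → n₂ (<ᵇ-< {suc r} h))) (not-intro n₃))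
  local-intro r s nothing (new r≮ f g) rewrite <ᵇ-false (ℕP.≮⇒≥ r≮) = by-letter ℓ f g
    where
    by-letter : ∀ ℓ → (ℓ ≡ unprimed → ¬ (suc r < previousOf ℓ hν hλ s)) →
      (ℓ ≡ primed → ¬ (r < nextOf ℓ hν hλ s) × ¬ ((wallUp κ ℓ ∧ isZero s) ≡ true)) →
      newOK ℓ (wallUp κ ℓ ∧ isZero s) (nextOf ℓ hν hλ s) (previousOf ℓ hν hλ s) r ≡ true
    by-letter unprimed f g = not-intro (λ h → f ≡.refl (<ᵇ-< {suc r} h))
    by-letter primed f g = ∧-intro (not-intro (λ h → proj₁ (g ≡.refl) (<ᵇ-< {r} h))) (not-intro (proj₂ (g ≡.refl)))

  is-diag : ∀ r s → isDiag (cell r s) ≡ true → s ≡ 0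
  is-diag r s h = ℕP.+-cancelˡ-≡ r s 0 (≡.trans (≡.sym (≡ᵇ-≡ r (r ℕ.+ s) h)) (≡.sym (ℕP.+-identityʳ r)))

  wall-diag : ∀ r s a → statusDiagOK κ ℓ (cell r s , a) ≡ true → has a ≡ true → ¬ ((wallUp κ ℓ ∧ isZero s) ≡ true)
  wall-diag r zero a h ha wall = go κ ℓ h wall
    where
    go : ∀ κ ℓ → statusDiagOK κ ℓ (cell r 0 , a) ≡ true → (wallUp κ ℓ ∧ true) ≡ true → ⊥
    go 𝒫 primed h _ = not-true (⇒ᵇ-elim h (≡ᵇ-true (≡.sym (ℕP.+-identityʳ r)))) ha
    go 𝒫 unprimed h ()
    go 𝒬 primed h ()
    go 𝒬 unprimed h ()
  wall-diag r (suc s) a h ha wall with wallUp κ ℓ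
  wall-diag r (suc s) a h ha () | true
  wall-diag r (suc s) a h ha () | false

  diag-wall : ∀ r s a → (has a ≡ true → ℓ ≡ primed → ¬ ((wallUp κ ℓ ∧ isZero s) ≡ true)) → statusDiagOK κ ℓ (cell r s , a) ≡ true
  diag-wall r s a f = go κ ℓ f
    where
    go : ∀ κ ℓ → (has a ≡ true → ℓ ≡ primed → ¬ ((wallUp κ ℓ ∧ isZero s) ≡ true)) → statusDiagOK κ ℓ (cell r s , a) ≡ true
    go 𝒬 ℓ f = ≡.refl
    go 𝒫 unprimed f = ⇒ᵇ-intro (λ _ → ≡.refl)
    go 𝒫 primed f = ⇒ᵇ-intro (λ d → not-intro (λ ha → f ha ≡.refl (cong isZero (is-diag r s d))))

  module _ (sub : subShape v w ≡ true) {sts} {S : List (Box × Status)} (S∈ : S ∈ assignments (boxes (parts w)) sts) where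
    private
      ν≤λ : ∀ s → hν s ≤ hλ s
      ν≤λ = subShape-sound v w sub

    -- Validity speaks of all pairs of boxes, `local` of one box and the heights at the adjacent
    -- contents. The reduction is possible because rows and columns of λ have no gaps: a repetition
    -- at any distance puts the immediate neighbour of the first occurrence into λ, and order
    -- between neighbours forces that neighbour to contain the letter alone.
    agree-local : (agree v S ∧ statusValid κ ℓ S) ≡ all local S
    agree-local = ≡-from-⇔ to from
      where
      to : (agree v S ∧ statusValid κ ℓ S) ≡ true → all local S ≡ true
      to h = all-intro S each
        where
        ag : agree v S ≡ true
        ag = proj₁ (∧-true h)
        pairs : allPairs (statusPairOK ℓ) S ≡ true
        pairs = proj₁ (∧-true (proj₂ (∧-true {agree v S} h)))
        diags : all (statusDiagOK κ ℓ) S ≡ true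
        diags = proj₂ (∧-true {allPairs (statusPairOK ℓ) S} (proj₂ (∧-true {agree v S} h)))
        facts : ∀ r s {a} r′ s′ {a′} → (cell r s , a) ∈ S → (cell r′ s′ , a′) ∈ S → PairFacts ℓ r (r ℕ.+ s) a r′ (r′ ℕ.+ s′) a′
        facts r s r′ s′ p∈ q∈ = pairFacts ℓ _ _ _ _ _ _ (allPairs-true S pairs p∈ q∈)
        in-ν : ∀ r s {a} → (cell r s , a) ∈ S → is-just a ≡ (r <ᵇ hν s)
        in-ν r s {a} p∈ = ≡.trans (eqᵇ-sound (is-just a) _ (all-true S ag p∈)) (inShape-cell v r s)
        no-right-kept : ∀ r s {a} → (cell r s , a) ∈ S → has a ≡ true → ¬ (r < hν (suc s))
        no-right-kept r s {a} p∈ ha r< with status-at w S∈ r (suc s) (ℕP.<-≤-trans r< (ν≤λ (suc s)))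
        ... | a′ , q∈ =
          ordered-kept a a′ (PairFacts.right (facts r s r (suc s) p∈ q∈) ≡.refl (ℕP.+-suc r s)) (≡.trans (in-ν r (suc s) q∈) (<ᵇ-true r<)) ha
        no-right : ∀ r s {a} → (cell r s , a) ∈ S → has a ≡ true → ℓ ≡ primed → ¬ (r < hλ (suc s))
        no-right r s {a} p∈ ha pr r< with status-at w S∈ r (suc s) r<
        ... | a′ , q∈ with ordered-new a a′ (PairFacts.right (facts r s r (suc s) p∈ q∈) ≡.refl (ℕP.+-suc r s)) ha
        ...   | ≡.refl = PairFacts.rows (facts r s r (suc s) p∈ q∈) ≡.refl (λ eq → ℕP.1+n≢n (≡.trans (≡.sym (ℕP.+-suc r s)) (≡.sym eq))) pr ha ≡.refl
        no-below-kept : ∀ r s {a} → (cell r s , a) ∈ S → has a ≡ true → ¬ (suc r < previous hν s)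
        no-below-kept r zero p∈ ha ()
        no-below-kept r (suc s) {a} p∈ ha r< with status-at w S∈ (suc r) s (ℕP.<-≤-trans r< (ν≤λ s))
        ... | a′ , q∈ =
          ordered-kept a a′ (PairFacts.below (facts r (suc s) (suc r) s p∈ q∈) ≡.refl (≡.sym (ℕP.+-suc r s))) (≡.trans (in-ν (suc r) s q∈) (<ᵇ-true r<)) ha
        no-below : ∀ r s {a} → (cell r s , a) ∈ S → has a ≡ true → ℓ ≡ unprimed → ¬ (suc r < previous hλ s)
        no-below r zero p∈ ha un ()
        no-below r (suc s) {a} p∈ ha un r< with status-at w S∈ (suc r) s r<
        ... | a′ , q∈ with ordered-new a a′ (PairFacts.below (facts r (suc s) (suc r) s p∈ q∈) ≡.refl (≡.sym (ℕP.+-suc r s))) ha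
        ...   | ≡.refl = PairFacts.column (facts r (suc s) (suc r) s p∈ q∈) (ℕP.+-suc r s) (λ eq → ℕP.1+n≢n (≡.sym eq)) un ha ≡.refl
        each : ∀ {p} → p ∈ S → local p ≡ true
        each {b , a} p∈ with cell-of w S∈ p∈
        ... | r , s , ≡.refl , r< = ≡.trans (local-cell r s a) (local-intro r s a (classify a p∈ (in-ν r s p∈)))
          where
          classify : ∀ a → (cell r s , a) ∈ S → is-just a ≡ (r <ᵇ hν s) → LocalFacts r s a
          classify (just false) p∈ eq = kept-only (<ᵇ-< {r} (≡.sym eq))
          classify (just true) p∈ eq = kept-both (<ᵇ-< {r} (≡.sym eq)) (no-next ℓ ≡.refl) (no-prev ℓ ≡.refl)
            (wall-diag r s (just true) (all-true S diags p∈) ≡.refl)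
            where
            no-next : ∀ ℓ′ → ℓ′ ≡ ℓ → ¬ (r < nextOf ℓ′ hν hλ s)
            no-next unprimed _ = no-right-kept r s p∈ ≡.refl
            no-next primed eq = no-right r s p∈ ≡.refl (≡.sym eq)
            no-prev : ∀ ℓ′ → ℓ′ ≡ ℓ → ¬ (suc r < previousOf ℓ′ hν hλ s)
            no-prev unprimed eq = no-below r s p∈ ≡.refl (≡.sym eq)
            no-prev primed _ = no-below-kept r s p∈ ≡.refl
          classify nothing p∈ eq = new (λ r< → false≢true (≡.trans eq (<ᵇ-true r<)))
            (λ { ≡.refl → no-below r s p∈ ≡.refl ≡.refl })
            (λ { ≡.refl → no-right r s p∈ ≡.refl ≡.refl , wall-diag r s nothing (all-true S diags p∈) ≡.refl })
      from : all local S ≡ true → (agree v S ∧ statusValid κ ℓ S) ≡ true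
      from h = ∧-intro (all-intro S agrees) (∧-intro (allPairs-intro S pair) (all-intro S diag))
        where
        facts : ∀ r s {a} → (cell r s , a) ∈ S → LocalFacts r s a
        facts r s {a} p∈ = local-facts r s a (≡.trans (≡.sym (local-cell r s a)) (all-true S h p∈))
        agrees : ∀ {p} → p ∈ S → eqᵇ (is-just (proj₂ p)) (inShape v (proj₁ p)) ≡ true
        agrees {b , a} p∈ with cell-of w S∈ p∈
        ... | r , s , ≡.refl , _ rewrite inShape-cell v r s with a | facts r s p∈
        ...   | _ | kept-only r< = <ᵇ-true r<
        ...   | _ | kept-both r< _ _ _ = <ᵇ-true r<
        ...   | _ | new r≮ _ _ rewrite <ᵇ-false (ℕP.≮⇒≥ r≮) = ≡.refl
        diag : ∀ {p} → p ∈ S → statusDiagOK κ ℓ p ≡ true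
        diag {b , a} p∈ with cell-of w S∈ p∈
        ... | r , s , ≡.refl , _ = diag-wall r s a (no-wall a (facts r s p∈))
          where
          no-wall : ∀ a → LocalFacts r s a → has a ≡ true → ℓ ≡ primed → ¬ ((wallUp κ ℓ ∧ isZero s) ≡ true)
          no-wall _ (kept-only _) () _
          no-wall _ (kept-both _ _ _ n) _ _ = n
          no-wall _ (new _ _ g) _ pr = proj₂ (g pr)
        new-below : ∀ {r s a} → LocalFacts r s a → has a ≡ true → ℓ ≡ unprimed → ¬ (suc r < previous hλ s)
        new-below (kept-both _ _ n _) _ ≡.refl = n
        new-below (new _ f _) _ ≡.refl = f ≡.refl
        new-right : ∀ {r s a} → LocalFacts r s a → has a ≡ true → ℓ ≡ primed → ¬ (r < hλ (suc s))
        new-right (kept-both _ n _ _) _ ≡.refl = n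
        new-right (new _ _ g) _ ≡.refl = proj₁ (g ≡.refl)
        not-kept : ∀ {r s a} → LocalFacts r s a → ¬ (r < hν s) → order-ok a ≡ true
        not-kept (kept-only r<) r≮ = ⊥-elim (r≮ r<)
        not-kept (kept-both r< _ _ _) r≮ = ⊥-elim (r≮ r<)
        not-kept (new _ _ _) _ = ≡.refl
        ordered-by : ∀ a a′ → (has a ≡ true → order-ok a′ ≡ true) → ordered a a′ ≡ true
        ordered-by nothing a′ f = f ≡.refl
        ordered-by (just true) a′ f = f ≡.refl
        ordered-by (just false) a′ f = ≡.refl
        right-new : ∀ {r s a a′} → LocalFacts r s a → LocalFacts r (suc s) a′ → r < hλ (suc s) → has a ≡ true → order-ok a′ ≡ true
        right-new (kept-both r< n _ _) q r<λ _ = not-kept q (go ℓ ≡.refl n)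
          where
          go : ∀ ℓ′ → ℓ′ ≡ ℓ → ¬ (_ < nextOf ℓ′ hν hλ _) → ¬ (_ < hν (suc _))
          go unprimed _ n = n
          go primed _ n = λ _ → n r<λ
        right-new (new r≮ _ _) q _ _ = not-kept q (λ r< → r≮ (ℕP.<-≤-trans r< (height-anti v _)))
        below-new : ∀ {r s a a′} → LocalFacts r (suc s) a → LocalFacts (suc r) s a′ → suc r < hλ s → has a ≡ true → order-ok a′ ≡ true
        below-new (kept-both r< _ n _) q r<λ _ = not-kept q (go ℓ ≡.refl n)
          where
          go : ∀ ℓ′ → ℓ′ ≡ ℓ → ¬ (_ < previousOf ℓ′ hν hλ (suc _)) → ¬ (_ < hν _)
          go unprimed _ n = λ _ → n r<λ
          go primed _ n = n
        below-new (new r≮ _ _) q _ _ = not-kept q (λ r< → r≮ (ℕP.≤-pred (ℕP.≤-trans r< (height-step v _))))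
        -- A second occurrence further down the column, at whatever distance, means that the box
        -- directly below the first lies in λ, and this the local condition excludes.
        column-strip : ∀ {r s a r′ s′} → LocalFacts r s a → has a ≡ true → ℓ ≡ unprimed → r′ < hλ s′ → r ℕ.+ s ≡ r′ ℕ.+ s′ → r < r′ → ⊥
        column-strip {r} {s} {a} {r′} {s′} f ha un r′< ec r<r′ with ℕP.m≤n⇒∃[o]m+o≡n r<r′
        ... | k , ≡.refl = new-below f ha un (subst (λ i → suc r < previous hλ i) s≡
            (height-diagonal w k (subst (_< hλ s′) (ℕP.+-comm (suc r) k) r′<)))
          where
          s≡ : suc (k ℕ.+ s′) ≡ s
          s≡ = ℕP.+-cancelˡ-≡ r _ _ (≡.trans (≡.trans (ℕP.+-suc r (k ℕ.+ s′)) (cong suc (≡.sym (ℕP.+-assoc r k s′)))) (≡.sym ec))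
        row-strip : ∀ {r s a s′} → LocalFacts r s a → has a ≡ true → ℓ ≡ primed → r < hλ s′ → s < s′ → ⊥
        row-strip f ha pr r< s<s′ = new-right f ha pr (ℕP.<-≤-trans r< (height-anti-≤ w s<s′))
        pair : ∀ {p q} → p ∈ S → q ∈ S → statusPairOK ℓ p q ≡ true
        pair {b , a} {b′ , a′} p∈ q∈ with cell-of w S∈ p∈ | cell-of w S∈ q∈
        ... | r , s , ≡.refl , r< | r′ , s′ , ≡.refl , r′< = pairFacts-intro ℓ r (r ℕ.+ s) a r′ (r′ ℕ.+ s′) a′ (record
          { below = λ { ≡.refl ec → ordered-by a a′ (at-below ≡.refl (ℕP.+-cancelˡ-≡ r _ _ (≡.trans (ℕP.+-suc r s′) ec))) }
          ; right = λ { ≡.refl ec → ordered-by a a′ (at-right ≡.refl (ℕP.+-cancelˡ-≡ r _ _ (≡.trans ec (≡.sym (ℕP.+-suc r s))))) }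
          ; column = λ ec nr un ha ha′ → by-rows ec nr un ha ha′
          ; rows = λ { ≡.refl nc pr ha ha′ → by-columns ≡.refl (λ eq → nc (cong (r ℕ.+_) eq)) pr ha ha′ }
          })
          where
          at-below : r′ ≡ suc r → suc s′ ≡ s → has a ≡ true → order-ok a′ ≡ true
          at-below ≡.refl ≡.refl = below-new (facts r s p∈) (facts r′ s′ q∈) r′<
          at-right : r′ ≡ r → s′ ≡ suc s → has a ≡ true → order-ok a′ ≡ true
          at-right ≡.refl ≡.refl = right-new (facts r s p∈) (facts r′ s′ q∈) r′<
          by-rows : r ℕ.+ s ≡ r′ ℕ.+ s′ → r ≢ r′ → ℓ ≡ unprimed → has a ≡ true → has a′ ≡ true → ⊥
          by-rows ec nr un ha ha′ with ℕP.<-cmp r r′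
          ... | tri< r<r′ _ _ = column-strip (facts r s p∈) ha un r′< ec r<r′
          ... | tri≈ _ eq _ = nr eq
          ... | tri> _ _ r>r′ = column-strip (facts r′ s′ q∈) ha′ un r< (≡.sym ec) r>r′
          by-columns : r′ ≡ r → s ≢ s′ → ℓ ≡ primed → has a ≡ true → has a′ ≡ true → ⊥
          by-columns ≡.refl ns pr ha ha′ with ℕP.<-cmp s s′
          ... | tri< s<s′ _ _ = row-strip (facts r s p∈) ha pr r′< s<s′
          ... | tri≈ _ eq _ = ns eq
          ... | tri> _ _ s>s′ = row-strip (facts r′ s′ q∈) ha′ pr r< s>s′

Entry : Set
Entry = Maybe (Bool × List ℕ)

statuses : List Status
statuses = just false ∷ just true ∷ nothing ∷ []

letterSets : ℕ → List (List ℕ)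
letterSets c = filterᵇ nonEmpty (sublists (upTo c))

oldPart : Entry → List ℕ
oldPart nothing = []
oldPart (just (_ , S)) = S

fullSet : ℕ → Entry → List ℕ
fullSet c nothing = c ∷ []
fullSet c (just (false , S)) = S
fullSet c (just (true , S)) = S ++ c ∷ []

Below : ℕ → Entry → Set
Below c e = (∀ {s} → s ∈ oldPart e → s < c) × (∀ {o S} → e ≡ just (o , S) → ∃ λ s → s ∈ S)

statusEntry : Entry → Status
statusEntry = Maybe.map proj₁

private
  ∈-sublists : {A : Set} (as : List A) {S : List A} → S ∈ sublists as → ∀ {a} → a ∈ S → a ∈ as
  ∈-sublists [] (here ≡.refl) ()
  ∈-sublists (b ∷ as) S∈ a∈ with ∈-++⁻ (map (b ∷_) (sublists as)) S∈
  ... | inj₂ S∈′ = there (∈-sublists as S∈′ a∈)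
  ... | inj₁ S∈′ with ∈-map⁻ (b ∷_) S∈′
  ∈-sublists (b ∷ as) S∈ (here ≡.refl) | inj₁ _ | S′ , S′∈ , ≡.refl = here ≡.refl
  ∈-sublists (b ∷ as) S∈ (there a∈) | inj₁ _ | S′ , S′∈ , ≡.refl = there (∈-sublists as S′∈ a∈)

∈-letterSets : ∀ c {S} → S ∈ letterSets c → (∀ {s} → s ∈ S → s < c) × ∃ λ s → s ∈ S
∈-letterSets c S∈ with filterᵇ-∈ nonEmpty (sublists (upTo c)) S∈
∈-letterSets c {s ∷ S} S∈ | S∈′ , _ = (λ s∈ → ∈-upTo⁻ (∈-sublists (upTo c) S∈′ s∈)) , s , here ≡.refl

enriched-below : ∀ c {e} → e ∈ enriched statuses (letterSets c) → Below c e
enriched-below c e∈ with find (∈-concatMap⁻ (options (letterSets c)) {xs = statuses} e∈)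
... | nothing , _ , here ≡.refl = (λ ()) , λ ()
... | just o , _ , e∈′ with ∈-map⁻ (λ S → just (o , S)) e∈′
...   | S , S∈ , ≡.refl = proj₁ (∈-letterSets c S∈) , λ { ≡.refl → proj₂ (∈-letterSets c S∈) }

module _ (c : ℕ) where
  ∈-fullSet⁻ : ∀ e {s} → s ∈ fullSet c e → (s ≡ c × has (statusEntry e) ≡ true) ⊎ s ∈ oldPart e
  ∈-fullSet⁻ nothing (here ≡.refl) = inj₁ (≡.refl , ≡.refl)
  ∈-fullSet⁻ (just (false , S)) s∈ = inj₂ s∈
  ∈-fullSet⁻ (just (true , S)) s∈ with ∈-++⁻ S s∈
  ... | inj₁ s∈S = inj₂ s∈S
  ... | inj₂ (here ≡.refl) = inj₁ (≡.refl , ≡.refl)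

  ∈-fullSet-new : ∀ e → has (statusEntry e) ≡ true → c ∈ fullSet c e
  ∈-fullSet-new nothing _ = here ≡.refl
  ∈-fullSet-new (just (true , S)) _ = ∈-++⁺ʳ S (here ≡.refl)

  ∈-fullSet-old : ∀ e {s} → s ∈ oldPart e → s ∈ fullSet c e
  ∈-fullSet-old (just (false , S)) s∈ = s∈
  ∈-fullSet-old (just (true , S)) s∈ = ∈-++⁺ˡ s∈

  leSets-true : ∀ A B → leSets A B ≡ true → ∀ {s u} → s ∈ A → u ∈ B → s ≤ u
  leSets-true A B h {s} s∈ u∈ = ≤ᵇ-≤ {s} (all-true B (all-true A h s∈) u∈)

  leSets-intro : ∀ A B → (∀ {s u} → s ∈ A → u ∈ B → s ≤ u) → leSets A B ≡ true
  leSets-intro A B h = all-intro A (λ s∈ → all-intro B (λ u∈ → ≤ᵇ-true (h s∈ u∈)))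

  no-old : ∀ e → statusEntry e ≡ nothing → ∀ {s} → s ∈ oldPart e → ⊥
  no-old nothing _ ()

  -- Since `c` exceeds all old letters, it may be followed only by boxes whose sole entry is `c`.
  -- That this is necessary uses that the old part of a kept box is nonempty.
  leSets-full : ∀ e e′ → Below c e → Below c e′ → leSets (fullSet c e) (fullSet c e′)
    ≡ ordered (statusEntry e) (statusEntry e′) ∧ leSets (oldPart e) (oldPart e′)
  leSets-full e e′ (lt , _) (lt′ , ne′) = ≡-from-⇔
    (λ h → ∧-intro (to-ordered e′ ≡.refl h)
      (leSets-intro (oldPart e) (oldPart e′)
        (λ s∈ u∈ → leSets-true (fullSet c e) (fullSet c e′) h (∈-fullSet-old e s∈) (∈-fullSet-old e′ u∈))))
    (λ h → leSets-intro (fullSet c e) (fullSet c e′) (from h))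
    where
    to-ordered : ∀ e″ → e″ ≡ e′ → leSets (fullSet c e) (fullSet c e′) ≡ true → ordered (statusEntry e) (statusEntry e″) ≡ true
    to-ordered nothing _ _ = BoolP.∨-zeroʳ _
    to-ordered (just (o , S)) ≡.refl h with has (statusEntry e) in eq
    ... | false = ≡.refl
    ... | true with ne′ ≡.refl
    ...   | s , s∈ = ⊥-elim (ℕP.<⇒≱ (lt′ s∈)
      (leSets-true (fullSet c e) (fullSet c (just (o , S))) h (∈-fullSet-new e eq) (∈-fullSet-old (just (o , S)) s∈)))
    from : (ordered (statusEntry e) (statusEntry e′) ∧ leSets (oldPart e) (oldPart e′)) ≡ true →
      ∀ {s u} → s ∈ fullSet c e → u ∈ fullSet c e′ → s ≤ u
    from h s∈ u∈ with ∈-fullSet⁻ e s∈ | ∈-fullSet⁻ e′ u∈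
    ... | inj₁ (≡.refl , _) | inj₁ (≡.refl , _) = ℕP.≤-refl
    ... | inj₂ s∈′ | inj₁ (≡.refl , _) = ℕP.<⇒≤ (lt s∈′)
    ... | inj₂ s∈′ | inj₂ u∈′ = leSets-true (oldPart e) (oldPart e′) (proj₂ (∧-true {ordered (statusEntry e) (statusEntry e′)} h)) s∈′ u∈′
    ... | inj₁ (≡.refl , hs) | inj₂ u∈′ =
      ⊥-elim (no-old e′ (ordered-new (statusEntry e) (statusEntry e′) (proj₁ (∧-true h)) hs) u∈′)

  common-true : ∀ P A B → commonWith P A B ≡ true → ∃ λ s → s ∈ A × P s ≡ true × s ∈ B
  common-true P A B h with any-true A h
  ... | s , s∈ , ps = s , s∈ , proj₁ (∧-true ps) , member-true s B (proj₂ (∧-true {P s} ps))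

  common-intro : ∀ P A B {s} → s ∈ A → P s ≡ true → s ∈ B → commonWith P A B ≡ true
  common-intro P A B s∈ ps s∈B = any-intro A s∈ (∧-intro ps (member-intro B s∈B))

  -- A common letter is either `c`, new in both boxes, or old in both; in a mixed case an old letter
  -- would equal `c`.
  common-full : ∀ P e e′ → Below c e → Below c e′ → commonWith P (fullSet c e) (fullSet c e′)
    ≡ (P c ∧ has (statusEntry e) ∧ has (statusEntry e′)) ∨ commonWith P (oldPart e) (oldPart e′)
  common-full P e e′ (lt , _) (lt′ , _) = ≡-from-⇔ to from
    where
    ∨-introˡ : ∀ {a b} → a ≡ true → a ∨ b ≡ true
    ∨-introˡ ≡.refl = ≡.refl
    ∨-introʳ : ∀ {a b} → b ≡ true → a ∨ b ≡ true
    ∨-introʳ {a} ≡.refl = BoolP.∨-zeroʳ a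
    ∨-true : ∀ {a b} → a ∨ b ≡ true → a ≡ true ⊎ b ≡ true
    ∨-true {true} _ = inj₁ ≡.refl
    ∨-true {false} h = inj₂ h
    to : commonWith P (fullSet c e) (fullSet c e′) ≡ true →
      ((P c ∧ has (statusEntry e) ∧ has (statusEntry e′)) ∨ commonWith P (oldPart e) (oldPart e′)) ≡ true
    to h with common-true P (fullSet c e) (fullSet c e′) h
    ... | s , s∈ , ps , s∈′ with ∈-fullSet⁻ e s∈ | ∈-fullSet⁻ e′ s∈′
    ...   | inj₁ (≡.refl , hs) | inj₁ (_ , hs′) = ∨-introˡ (∧-intro ps (∧-intro hs hs′))
    ...   | inj₁ (≡.refl , _) | inj₂ s∈ᵒ = ⊥-elim (ℕP.<-irrefl ≡.refl (lt′ s∈ᵒ))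
    ...   | inj₂ s∈ᵒ | inj₁ (≡.refl , _) = ⊥-elim (ℕP.<-irrefl ≡.refl (lt s∈ᵒ))
    ...   | inj₂ s∈ᵒ | inj₂ s∈ᵒ′ = ∨-introʳ {P c ∧ has (statusEntry e) ∧ has (statusEntry e′)}
      (common-intro P (oldPart e) (oldPart e′) s∈ᵒ ps s∈ᵒ′)
    from : ((P c ∧ has (statusEntry e) ∧ has (statusEntry e′)) ∨ commonWith P (oldPart e) (oldPart e′)) ≡ true →
      commonWith P (fullSet c e) (fullSet c e′) ≡ true
    from h with ∨-true {P c ∧ has (statusEntry e) ∧ has (statusEntry e′)} h
    ... | inj₁ h′ = common-intro P (fullSet c e) (fullSet c e′) (∈-fullSet-new e (proj₁ (∧-true (proj₂ (∧-true {P c} h′)))))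
      (proj₁ (∧-true h′)) (∈-fullSet-new e′ (proj₂ (∧-true {has (statusEntry e)} (proj₂ (∧-true {P c} h′)))))
    ... | inj₂ h′ with common-true P (oldPart e) (oldPart e′) h′
    ...   | s , s∈ , ps , s∈′ = common-intro P (fullSet c e) (fullSet c e′) (∈-fullSet-old e s∈) ps (∈-fullSet-old e′ s∈′)

  any-full : ∀ P e → Below c e → any P (fullSet c e) ≡ (P c ∧ has (statusEntry e)) ∨ any P (oldPart e)
  any-full P nothing _ = ≡.trans (BoolP.∨-identityʳ (P c)) (≡.sym (≡.trans (BoolP.∨-identityʳ _) (BoolP.∧-identityʳ (P c))))
  any-full P (just (false , S)) _ = cong (_∨ any P S) (≡.sym (BoolP.∧-zeroʳ (P c)))
  any-full P (just (true , S)) _ = ≡.trans (go S) (cong (_∨ any P S) (≡.sym (BoolP.∧-identityʳ (P c))))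
    where
    go : ∀ S → any P (S ++ c ∷ []) ≡ P c ∨ any P S
    go [] = ≡.refl
    go (s ∷ S) with P s
    ... | true = ≡.sym (BoolP.∨-zeroʳ (P c))
    ... | false = go S

svPairOK-split : ∀ B R C W {l o l₀ u u₀ u₁ v v₀ v₁} → l ≡ o ∧ l₀ → u ≡ u₀ ∨ u₁ → v ≡ v₀ ∨ v₁ →
  ((B ⇒ᵇ l) ∧ (R ⇒ᵇ l) ∧ (C ⇒ᵇ not u) ∧ (W ⇒ᵇ not v)) ≡
  ((B ⇒ᵇ o) ∧ (R ⇒ᵇ o) ∧ (C ⇒ᵇ not u₀) ∧ (W ⇒ᵇ not v₀)) ∧ ((B ⇒ᵇ l₀) ∧ (R ⇒ᵇ l₀) ∧ (C ⇒ᵇ not u₁) ∧ (W ⇒ᵇ not v₁))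
svPairOK-split B R C W {o = o} {l₀} {u₀ = u₀} {u₁} {v₀ = v₀} {v₁} ≡.refl ≡.refl ≡.refl = ≡.trans
  (cong₂ _∧_ (⇒-∧ B o l₀) (≡.trans
    (cong₂ _∧_ (⇒-∧ R o l₀) (≡.trans (cong₂ _∧_ (⇒-not-∨ C u₀ u₁) (⇒-not-∨ W v₀ v₁)) (∧-interchange (C ⇒ᵇ not u₀) _ _ _)))
    (∧-interchange (R ⇒ᵇ o) _ _ _)))
  (∧-interchange (B ⇒ᵇ o) _ _ _)
  where
  ⇒-∧ : ∀ X a b → (X ⇒ᵇ (a ∧ b)) ≡ (X ⇒ᵇ a) ∧ (X ⇒ᵇ b)
  ⇒-∧ true a b = ≡.refl
  ⇒-∧ false a b = ≡.refl
  ⇒-not-∨ : ∀ X a b → (X ⇒ᵇ not (a ∨ b)) ≡ (X ⇒ᵇ not a) ∧ (X ⇒ᵇ not b)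
  ⇒-not-∨ X true b = ⇒-∧ X false (not b)
  ⇒-not-∨ X false b = ⇒-∧ X true (not b)

svPairOK-full : ∀ c ℓ → isPrimed c ≡ isPrimedLetter ℓ → ∀ p q e e′ → Below c e → Below c e′ →
  svPairOK (p , fullSet c e) (q , fullSet c e′)
    ≡ statusPairOK ℓ (p , statusEntry e) (q , statusEntry e′) ∧ svPairOK (p , oldPart e) (q , oldPart e′)
svPairOK-full c ℓ pr (r₁ , c₁) (r₂ , c₂) e e′ b b′ rewrite ≡.sym pr = svPairOK-split
  ((r₂ ≡ᵇ suc r₁) ∧ (c₂ ≡ᵇ c₁)) ((r₂ ≡ᵇ r₁) ∧ (c₂ ≡ᵇ suc c₁)) ((c₁ ≡ᵇ c₂) ∧ not (r₁ ≡ᵇ r₂)) ((r₁ ≡ᵇ r₂) ∧ not (c₁ ≡ᵇ c₂))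
  (leSets-full c e e′ b b′) (common-full c (λ s → not (isPrimed s)) e e′ b b′) (common-full c isPrimed e e′ b b′)

-- Boxes without old letters disappear from `present`, so the clauses about them have to hold
-- vacuously.
svPairOK-empty : ∀ p q A B → A ≡ [] ⊎ B ≡ [] → svPairOK (p , A) (q , B) ≡ true
svPairOK-empty (r₁ , c₁) (r₂ , c₂) A B em =
  ∧-intro (implied ((r₂ ≡ᵇ suc r₁) ∧ (c₂ ≡ᵇ c₁)) le)
  (∧-intro (implied ((r₂ ≡ᵇ r₁) ∧ (c₂ ≡ᵇ suc c₁)) le)
  (∧-intro (implied ((c₁ ≡ᵇ c₂) ∧ not (r₁ ≡ᵇ r₂)) (not-common (λ s → not (isPrimed s))))
    (implied ((r₁ ≡ᵇ r₂) ∧ not (c₁ ≡ᵇ c₂)) (not-common isPrimed))))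
  where
  implied : ∀ X {a} → a ≡ true → (X ⇒ᵇ a) ≡ true
  implied X ≡.refl = BoolP.∨-zeroʳ (not X)
  le : leSets A B ≡ true
  le = leSets-intro 0 A B (λ s∈ u∈ → ⊥-elim (inhabited s∈ u∈ em))
    where
    inhabited : ∀ {s u} → s ∈ A → u ∈ B → A ≡ [] ⊎ B ≡ [] → ⊥
    inhabited () _ (inj₁ ≡.refl)
    inhabited _ () (inj₂ ≡.refl)
  not-common : ∀ P → not (commonWith P A B) ≡ true
  not-common P = not-intro (λ h → none (common-true 0 P A B h) em)
    where
    none : (∃ λ s → s ∈ A × P s ≡ true × s ∈ B) → A ≡ [] ⊎ B ≡ [] → ⊥
    none (_ , () , _) (inj₁ ≡.refl)
    none (_ , _ , _ , ()) (inj₂ ≡.refl)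

svDiagOK : Kind → SVFilling → Bool
svDiagOK 𝒬 F = true
svDiagOK 𝒫 F = svNoPrimedDiag F

module _ (c : ℕ) (ℓ : Letter) (pr : isPrimed c ≡ isPrimedLetter ℓ) where

  svValid-split : ∀ (G : List (Box × Entry)) → (∀ {p} → p ∈ G → Below c (proj₂ p)) →
    svValid (relabel (fullSet c) G) ≡ allPairs (statusPairOK ℓ) (statusOf G) ∧ svValid (present G)
  svValid-split G bel = ≡-from-⇔ to from
    where
    F = relabel (fullSet c) G
    split : ∀ {p e q e′} → (p , e) ∈ G → (q , e′) ∈ G → svPairOK (p , fullSet c e) (q , fullSet c e′)
      ≡ statusPairOK ℓ (p , statusEntry e) (q , statusEntry e′) ∧ svPairOK (p , oldPart e) (q , oldPart e′)
    split {p} {e} {q} {e′} e∈ e∈′ = svPairOK-full c ℓ pr p q e e′ (bel e∈) (bel e∈′)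
    to : svValid F ≡ true → (allPairs (statusPairOK ℓ) (statusOf G) ∧ svValid (present G)) ≡ true
    to h = ∧-intro
      (allPairs-intro (statusOf G) (λ a∈ a∈′ → status-pair (∈-statusOf⁻ a∈) (∈-statusOf⁻ a∈′)))
      (allPairs-intro (present G) (λ S∈ S∈′ → set-pair (∈-present⁻ G S∈) (∈-present⁻ G S∈′)))
      where
      both : ∀ {p e q e′} → (p , e) ∈ G → (q , e′) ∈ G →
        (statusPairOK ℓ (p , statusEntry e) (q , statusEntry e′) ∧ svPairOK (p , oldPart e) (q , oldPart e′)) ≡ true
      both e∈ e∈′ = ≡.trans (≡.sym (split e∈ e∈′))
        (allPairs-true F h (∈-map⁺ (map₂ (fullSet c)) e∈) (∈-map⁺ (map₂ (fullSet c)) e∈′))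
      status-pair : ∀ {p a q a′} → (∃ λ e → (p , e) ∈ G × a ≡ statusEntry e) → (∃ λ e → (q , e) ∈ G × a′ ≡ statusEntry e) →
        statusPairOK ℓ (p , a) (q , a′) ≡ true
      status-pair (e , e∈ , ≡.refl) (e′ , e∈′ , ≡.refl) = proj₁ (∧-true (both e∈ e∈′))
      set-pair : ∀ {p S q S′} → (∃ λ o → (p , just (o , S)) ∈ G) → (∃ λ o → (q , just (o , S′)) ∈ G) →
        svPairOK (p , S) (q , S′) ≡ true
      set-pair {p} {q = q} (o , e∈) (o′ , e∈′) = proj₂ (∧-true {statusPairOK ℓ (p , just o) (q , just o′)} (both e∈ e∈′))
    from : (allPairs (statusPairOK ℓ) (statusOf G) ∧ svValid (present G)) ≡ true → svValid F ≡ true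
    from h = allPairs-intro F (λ f∈ f∈′ → full-pair (∈-map⁻ (map₂ (fullSet c)) f∈) (∈-map⁻ (map₂ (fullSet c)) f∈′))
      where
      full-pair : ∀ {f f′} → (∃ λ g → g ∈ G × f ≡ map₂ (fullSet c) g) → (∃ λ g → g ∈ G × f′ ≡ map₂ (fullSet c) g) →
        svPairOK f f′ ≡ true
      full-pair ((p , e) , e∈ , ≡.refl) ((q , e′) , e∈′ , ≡.refl) = ≡.trans (split e∈ e∈′)
        (∧-intro (allPairs-true (statusOf G) (proj₁ (∧-true h)) (∈-map⁺ (map₂ statusEntry) e∈) (∈-map⁺ (map₂ statusEntry) e∈′))
          (old e e′ e∈ e∈′))
        where
        old : ∀ e e′ → (p , e) ∈ G → (q , e′) ∈ G → svPairOK (p , oldPart e) (q , oldPart e′) ≡ true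
        old nothing e′ _ _ = svPairOK-empty p q [] (oldPart e′) (inj₁ ≡.refl)
        old (just (o , S)) nothing _ _ = svPairOK-empty p q S [] (inj₂ ≡.refl)
        old (just (o , S)) (just (o′ , S′)) e∈ e∈′ =
          allPairs-true (present G) (proj₂ (∧-true {allPairs (statusPairOK ℓ) (statusOf G)} h)) (∈-present⁺ G e∈) (∈-present⁺ G e∈′)

  svDiag-split : ∀ κ (G : List (Box × Entry)) → (∀ {p} → p ∈ G → Below c (proj₂ p)) →
    svDiagOK κ (relabel (fullSet c) G) ≡ all (statusDiagOK κ ℓ) (statusOf G) ∧ svDiagOK κ (present G)
  svDiag-split 𝒬 G bel = ≡.sym (≡.trans (BoolP.∧-identityʳ _) (all-intro (statusOf G) (λ _ → ≡.refl)))
  svDiag-split 𝒫 [] bel = ≡.refl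
  svDiag-split 𝒫 ((p , e) ∷ G) bel = ≡.trans (cong₂ _∧_ head-split (svDiag-split 𝒫 G (λ e∈ → bel (there e∈)))) (tail-split e)
    where
    head-split : (isDiag p ⇒ᵇ not (any isPrimed (fullSet c e)))
      ≡ statusDiagOK 𝒫 ℓ (p , statusEntry e) ∧ (isDiag p ⇒ᵇ not (any isPrimed (oldPart e)))
    head-split rewrite any-full c isPrimed e (bel (here ≡.refl)) | pr = go (isDiag p) (isPrimedLetter ℓ ∧ has (statusEntry e))
      where
      go : ∀ X a {b} → (X ⇒ᵇ not (a ∨ b)) ≡ (X ⇒ᵇ not a) ∧ (X ⇒ᵇ not b)
      go true true = ≡.refl
      go true false = ≡.refl
      go false a = ≡.refl
    tail-split : ∀ e → (statusDiagOK 𝒫 ℓ (p , statusEntry e) ∧ (isDiag p ⇒ᵇ not (any isPrimed (oldPart e))))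
        ∧ (all (statusDiagOK 𝒫 ℓ) (statusOf G) ∧ svNoPrimedDiag (present G))
      ≡ all (statusDiagOK 𝒫 ℓ) (statusOf ((p , e) ∷ G)) ∧ svNoPrimedDiag (present ((p , e) ∷ G))
    tail-split nothing = ≡.trans
      (∧-interchange (statusDiagOK 𝒫 ℓ (p , nothing)) (isDiag p ⇒ᵇ true) (all (statusDiagOK 𝒫 ℓ) (statusOf G)) (svNoPrimedDiag (present G)))
      (cong ((statusDiagOK 𝒫 ℓ (p , nothing) ∧ all (statusDiagOK 𝒫 ℓ) (statusOf G)) ∧_)
        (cong (_∧ svNoPrimedDiag (present G)) (BoolP.∨-zeroʳ (not (isDiag p)))))
    tail-split (just (o , S)) = ∧-interchange (statusDiagOK 𝒫 ℓ (p , just o))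
      (isDiag p ⇒ᵇ not (any isPrimed S)) (all (statusDiagOK 𝒫 ℓ) (statusOf G)) (svNoPrimedDiag (present G))

module SVTSums (R : CommutativeRing 0ℓ 0ℓ) (t : CommutativeRing.Carrier R) (x : ℕ → CommutativeRing.Carrier R) (κ : Kind) where
  open CommutativeRing R hiding (zero)
  open FiniteSums R
  open AssignmentSums R
  open ShapeSums R
  open EdgeProducts R t
  open Kernels R t using (Vector; upKernel)
  open import Relation.Binary.Reasoning.Setoid setoid
  open import Algebra.Properties.Semiring.Exp semiring using (_^_)
  open import Algebra.Properties.CommutativeSemigroup *-commutativeSemigroup using (interchange)
  open import Algebra.Properties.Ring ring using (-‿distribˡ-*)

  setWeight : List ℕ → Carrier
  setWeight S = (- t) ^ (length S ∸ 1) * ∏ S x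

  weight : SVFilling → Carrier
  weight F = ∏ F (λ p → setWeight (proj₂ p))

  tableauSum : ℕ → List Box → Carrier
  tableauSum c bs = ∑ (assignments bs (letterSets c)) (λ F → iverson (svValid F ∧ svDiagOK κ F) (weight F))

  module Peel (c : ℕ) (ℓ : Letter) (pr : isPrimed c ≡ isPrimedLetter ℓ) where

    statusWeight : Status → Carrier
    statusWeight nothing = x c
    statusWeight (just false) = 1#
    statusWeight (just true) = - (x c * t)

    -- A nonempty set of letters up to `c` omits `c`, or contains `c` and others, or is the
    -- singleton of `c`. Adding `c` makes the empty set admissible, so it is split off from the sets
    -- with `c` and yields the third case.
    ∑-letterSets : ∀ φ → ∑ (letterSets (suc c)) φ ≈ ∑ (enriched statuses (letterSets c)) (λ e → φ (fullSet c e))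
    ∑-letterSets φ = begin
      ∑ (filterᵇ nonEmpty (sublists (upTo (suc c)))) φ ≈⟨ ∑-filter nonEmpty (sublists (upTo (suc c))) φ ⟩
      ∑ (sublists (upTo (suc c))) ψ ≈⟨ reflexive (cong (λ as → ∑ (sublists as) ψ) (≡.sym (ListP.upTo-∷ʳ c))) ⟩
      ∑ (sublists (upTo c ++ c ∷ [])) ψ ≈⟨ snoc (upTo c) ψ ⟩
      ∑ (sublists (upTo c)) (λ S → ψ (S ++ c ∷ [])) + ∑ (sublists (upTo c)) ψ
        ≈⟨ +-cong (trans (split-empty (upTo c) (λ S → ψ (S ++ c ∷ [])))
             (+-congʳ (trans (∑-cong (sublists (upTo c)) nonempty) (sym (∑-filter nonEmpty (sublists (upTo c)) _)))))
             (sym (∑-filter nonEmpty (sublists (upTo c)) φ)) ⟩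
      ∑ Ls (λ S → φ (S ++ c ∷ [])) + φ (c ∷ []) + ∑ Ls φ ≈⟨ +-comm _ _ ⟩
      ∑ Ls φ + (∑ Ls (λ S → φ (S ++ c ∷ [])) + φ (c ∷ []))
        ≈⟨ +-cong (∑-map _ Ls _) (+-cong (∑-map _ Ls _) (+-identityʳ _)) ⟨
      ∑ (map (λ S → just (false , S)) Ls) φ′ + (∑ (map (λ S → just (true , S)) Ls) φ′ + (φ (c ∷ []) + 0#))
        ≈⟨ trans (∑-concatMap (options Ls) statuses φ′) (+-congˡ (+-congˡ (+-identityʳ _))) ⟨
      ∑ (enriched statuses Ls) φ′ ∎
      where
      Ls = letterSets c
      ψ : List ℕ → Carrier
      ψ S = iverson (nonEmpty S) (φ S)
      φ′ : Entry → Carrier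
      φ′ e = φ (fullSet c e)
      snoc : ∀ as χ → ∑ (sublists (as ++ c ∷ [])) χ ≈ ∑ (sublists as) (λ S → χ (S ++ c ∷ [])) + ∑ (sublists as) χ
      snoc [] χ = +-cong (sym (+-identityʳ _)) refl
      snoc (a ∷ as) χ = begin
        ∑ (map (a ∷_) (sublists (as ++ c ∷ [])) ++ sublists (as ++ c ∷ [])) χ
          ≈⟨ trans (∑-++ (map (a ∷_) (sublists (as ++ c ∷ []))) _ χ) (+-congʳ (∑-map (a ∷_) (sublists (as ++ c ∷ [])) χ)) ⟩
        ∑ (sublists (as ++ c ∷ [])) (λ S → χ (a ∷ S)) + ∑ (sublists (as ++ c ∷ [])) χ
          ≈⟨ +-cong (snoc as (λ S → χ (a ∷ S))) (snoc as χ) ⟩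
        ∑ (sublists as) (λ S → χ (a ∷ S ++ c ∷ [])) + ∑ (sublists as) (λ S → χ (a ∷ S))
          + (∑ (sublists as) (λ S → χ (S ++ c ∷ [])) + ∑ (sublists as) χ) ≈⟨ +-interchange _ _ _ _ ⟩
        ∑ (sublists as) (λ S → χ (a ∷ S ++ c ∷ [])) + ∑ (sublists as) (λ S → χ (S ++ c ∷ []))
          + (∑ (sublists as) (λ S → χ (a ∷ S)) + ∑ (sublists as) χ)
          ≈⟨ +-cong (trans (∑-++ (map (a ∷_) (sublists as)) _ _) (+-congʳ (∑-map (a ∷_) (sublists as) _)))
               (trans (∑-++ (map (a ∷_) (sublists as)) _ _) (+-congʳ (∑-map (a ∷_) (sublists as) _))) ⟨
        ∑ (sublists (a ∷ as)) (λ S → χ (S ++ c ∷ [])) + ∑ (sublists (a ∷ as)) χ ∎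
        where open import Algebra.Properties.CommutativeSemigroup +-commutativeSemigroup using () renaming (interchange to +-interchange)
      split-empty : ∀ as χ → ∑ (sublists as) χ ≈ ∑ (sublists as) (λ S → iverson (nonEmpty S) (χ S)) + χ []
      split-empty [] χ = trans (+-identityʳ _) (sym (trans (+-congʳ (+-identityˡ 0#)) (+-identityˡ _)))
      split-empty (a ∷ as) χ = begin
        ∑ (sublists (a ∷ as)) χ ≈⟨ ∑-++ (map (a ∷_) (sublists as)) _ χ ⟩
        ∑ (map (a ∷_) (sublists as)) χ + ∑ (sublists as) χ
          ≈⟨ +-cong (trans (∑-map (a ∷_) (sublists as) χ) (sym (∑-map (a ∷_) (sublists as) _))) (split-empty as χ) ⟩
        ∑ (map (a ∷_) (sublists as)) (λ S → iverson (nonEmpty S) (χ S)) + (∑ (sublists as) (λ S → iverson (nonEmpty S) (χ S)) + χ [])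
          ≈⟨ trans (sym (+-assoc _ _ _)) (+-congʳ (sym (∑-++ (map (a ∷_) (sublists as)) _ _))) ⟩
        ∑ (sublists (a ∷ as)) (λ S → iverson (nonEmpty S) (χ S)) + χ [] ∎
      nonempty : ∀ S → iverson (nonEmpty S) (ψ (S ++ c ∷ [])) ≈ iverson (nonEmpty S) (φ (S ++ c ∷ []))
      nonempty [] = refl
      nonempty (s ∷ S) = refl

    -- The exponent of β is a truncated difference, so adding `c` to a set raises it by one only if
    -- the set was nonempty; hence the second hypothesis.
    entry-weight : ∀ e → e ≡ nothing ⊎ (∃ λ s → s ∈ oldPart e) →
      setWeight (fullSet c e) ≈ statusWeight (statusEntry e) * (if is-just e then setWeight (oldPart e) else 1#)
    entry-weight nothing _ = trans (*-identityˡ _) refl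
    entry-weight (just (false , S)) _ = sym (*-identityˡ _)
    entry-weight (just (true , [])) (inj₂ (_ , ()))
    entry-weight (just (true , s ∷ S)) _ = begin
      (- t) ^ length (S ++ c ∷ []) * (x s * ∏ (S ++ c ∷ []) x)
        ≈⟨ *-cong (reflexive (cong ((- t) ^_) (≡.trans (ListP.length-++ S) (ℕP.+-comm (length S) 1))))
             (*-congˡ (trans (∏-++ S (c ∷ []) x) (*-congˡ (*-identityʳ _)))) ⟩
      - t * (- t) ^ length S * (x s * (∏ S x * x c)) ≈⟨ *-congˡ (trans (sym (*-assoc _ _ _)) (*-comm _ _)) ⟩
      - t * (- t) ^ length S * (x c * (x s * ∏ S x)) ≈⟨ interchange _ _ _ _ ⟩
      - t * x c * ((- t) ^ length S * (x s * ∏ S x))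
        ≈⟨ *-congʳ (trans (sym (-‿distribˡ-* _ _)) (-‿cong (*-comm _ _))) ⟩
      - (x c * t) * ((- t) ^ length S * (x s * ∏ S x)) ∎

    weight-split : ∀ (G : List (Box × Entry)) → (∀ {p} → p ∈ G → Below c (proj₂ p)) →
      weight (relabel (fullSet c) G) ≈ ∏ (statusOf G) (λ p → statusWeight (proj₂ p)) * weight (present G)
    weight-split [] bel = sym (*-identityˡ 1#)
    weight-split ((p , e) ∷ G) bel = trans (*-cong (entry-weight e (inhabited e (bel (here ≡.refl)))) (weight-split G (λ e∈ → bel (there e∈))))
      (trans (interchange _ _ _ _) (*-congˡ (absorb e)))
      where
      inhabited : ∀ e → Below c e → e ≡ nothing ⊎ (∃ λ s → s ∈ oldPart e)
      inhabited nothing _ = inj₁ ≡.refl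
      inhabited (just (o , S)) (_ , ne) = inj₂ (ne ≡.refl)
      absorb : ∀ e → (if is-just e then setWeight (oldPart e) else 1#) * weight (present G) ≈ weight (present ((p , e) ∷ G))
      absorb nothing = *-identityˡ _
      absorb (just (o , S)) = refl

    statusSum : (bs : List Box) → tableauSum (suc c) bs ≈
      ∑ (assignments bs statuses) (λ S → iverson (statusValid κ ℓ S) (∏ S (λ p → statusWeight (proj₂ p)) * tableauSum c (kept S)))
    statusSum bs = begin
      ∑ (assignments bs (letterSets (suc c))) (λ F → iverson (svValid F ∧ svDiagOK κ F) (weight F))
        ≈⟨ ∑-relabel (fullSet c) (letterSets (suc c)) es ∑-letterSets bs _ ⟩
      ∑ (assignments bs es) (λ G → iverson (svValid (relabel (fullSet c) G) ∧ svDiagOK κ (relabel (fullSet c) G)) (weight (relabel (fullSet c) G)))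
        ≈⟨ ∑-cong-∈ (assignments bs es) (λ {G} G∈ → summand G (λ p∈ → enriched-below c (proj₂ (∈-assignments bs es G∈) p∈))) ⟩
      ∑ (assignments bs es) (λ G → ψ (statusOf G) (present G)) ≈⟨ ∑-split statuses (letterSets c) bs ψ ⟩
      ∑ (assignments bs statuses) (λ S → ∑ (assignments (kept S) (letterSets c)) (ψ S))
        ≈⟨ ∑-cong (assignments bs statuses) (λ S → trans (sym (∑-distribˡ (assignments (kept S) (letterSets c)) _ _))
             (iverson-*ˡ (statusValid κ ℓ S) _ _)) ⟩
      ∑ (assignments bs statuses) (λ S → iverson (statusValid κ ℓ S) (∏ S (λ p → statusWeight (proj₂ p)) * tableauSum c (kept S))) ∎
      where
      es = enriched statuses (letterSets c)
      ψ : List (Box × Status) → SVFilling → Carrier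
      ψ S F = iverson (statusValid κ ℓ S) (∏ S (λ p → statusWeight (proj₂ p))) * iverson (svValid F ∧ svDiagOK κ F) (weight F)
      summand : ∀ G → (∀ {p} → p ∈ G → Below c (proj₂ p)) →
        iverson (svValid (relabel (fullSet c) G) ∧ svDiagOK κ (relabel (fullSet c) G)) (weight (relabel (fullSet c) G)) ≈ ψ (statusOf G) (present G)
      summand G bel = begin
        iverson (svValid (relabel (fullSet c) G) ∧ svDiagOK κ (relabel (fullSet c) G)) (weight (relabel (fullSet c) G))
          ≈⟨ reflexive (cong (λ p → iverson p (weight (relabel (fullSet c) G)))
               (≡.trans (cong₂ _∧_ (svValid-split c ℓ pr G bel) (svDiag-split c ℓ pr κ G bel))
                 (∧-interchange (allPairs (statusPairOK ℓ) (statusOf G)) _ _ _))) ⟩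
        iverson (statusValid κ ℓ (statusOf G) ∧ (svValid (present G) ∧ svDiagOK κ (present G))) (weight (relabel (fullSet c) G))
          ≈⟨ iverson-cong (statusValid κ ℓ (statusOf G) ∧ (svValid (present G) ∧ svDiagOK κ (present G))) (weight-split G bel) ⟩
        iverson (statusValid κ ℓ (statusOf G) ∧ (svValid (present G) ∧ svDiagOK κ (present G))) (∏ (statusOf G) (λ p → statusWeight (proj₂ p)) * weight (present G))
          ≈⟨ iverson-∧-* (statusValid κ ℓ (statusOf G)) _ _ _ ⟩
        ψ (statusOf G) (present G) ∎

    lower : ∀ {L} (w : Vec Bool L) {S} → S ∈ assignments (boxes (parts w)) statuses → statusValid κ ℓ S ≡ true → Lower S
    lower w {S} S∈ h = (λ {r} {s} {o} {a} p∈ q∈ → kept-status a (λ ha → ordered-kept a (just o)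
        (PairFacts.right (pairFacts ℓ r (r ℕ.+ s) a r (r ℕ.+ suc s) (just o) (allPairs-true S pairs q∈ p∈)) ≡.refl (ℕP.+-suc r s)) ≡.refl ha)) ,
      (λ {r} {s} {o} {a} p∈ q∈ → kept-status a (λ ha → ordered-kept a (just o)
        (PairFacts.below (pairFacts ℓ r (r ℕ.+ suc s) a (suc r) (suc r ℕ.+ s) (just o) (allPairs-true S pairs q∈ p∈)) ≡.refl (≡.sym (ℕP.+-suc r s))) ≡.refl ha))
      where
      pairs : allPairs (statusPairOK ℓ) S ≡ true
      pairs = proj₁ (∧-true h)
      kept-status : ∀ a → ¬ (has a ≡ true) → is-just a ≡ true
      kept-status nothing n = ⊥-elim (n ≡.refl)
      kept-status (just _) n = ≡.refl

    open UpEdges (x c) using (upKernel-boxes; γ)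
    open UpWeights (ringOperations R) t (x c) using (b; upBase)

    localSum : ∀ {L} (v w : Vec Bool (suc L)) → subShape v w ≡ true →
      ∑ (assignments (boxes (parts w)) statuses) (λ S → iverson (agree v S ∧ statusValid κ ℓ S) (∏ S (λ p → statusWeight (proj₂ p))))
        ≈ ∏ (boxes (parts w)) (γ ℓ (wallUp κ ℓ) (height v) (height w))
    localSum v w sub = begin
      ∑ as (λ S → iverson (agree v S ∧ statusValid κ ℓ S) (∏ S (λ p → statusWeight (proj₂ p))))
        ≈⟨ ∑-cong-∈ as (λ {S} S∈ → trans (reflexive (cong (λ q → iverson q (∏ S (λ p → statusWeight (proj₂ p)))) (agree-local sub S∈)))
             (sym (∏-iverson S local (λ p → statusWeight (proj₂ p))))) ⟩
      ∑ as (λ S → ∏ S (λ p → iverson (local p) (statusWeight (proj₂ p))))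
        ≈⟨ ∑-assignments-∏ (boxes (parts w)) statuses (λ p → iverson (local p) (statusWeight (proj₂ p))) ⟩
      ∏ (boxes (parts w)) (λ b′ → ∑ statuses (λ a → iverson (local (b′ , a)) (statusWeight a)))
        ≈⟨ ∏-cong (boxes (parts w)) box ⟩
      ∏ (boxes (parts w)) (γ ℓ (wallUp κ ℓ) (height v) (height w)) ∎
      where
      open Local κ ℓ v w
      as = assignments (boxes (parts w)) statuses
      box : ∀ b′ → ∑ statuses (λ a → iverson (local (b′ , a)) (statusWeight a)) ≈ γ ℓ (wallUp κ ℓ) (height v) (height w) b′
      box (r , col) = at-content (col ∸ r)
        where
        at-content : ∀ s → ∑ statuses (λ a → iverson (localAt r s a) (statusWeight a)) ≈
          UpEdges.boxWeight (x c) ℓ (wallUp κ ℓ ∧ isZero s) (nextOf ℓ (height v) (height w) s) (height v s) (previousOf ℓ (height v) (height w) s) r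
        at-content s with r <ᵇ height v s
        ... | false = trans (+-identityˡ _) (trans (+-identityˡ _) (+-identityʳ _))
        ... | true with allowed ℓ (wallUp κ ℓ ∧ isZero s) (nextOf ℓ (height v) (height w) s) (previousOf ℓ (height v) (height w) s) r
        ...   | true = +-congˡ (trans (+-congˡ (+-identityʳ 0#)) (+-identityʳ _))
        ...   | false = trans (+-congˡ (trans (+-congˡ (+-identityʳ 0#)) (+-identityʳ 0#))) (+-identityʳ 1#)

    -- The sum over old letters depends on the statuses only through the kept boxes. With these
    -- fixed to be a shape v it comes out as a factor, and what is left is the product over boxes
    -- that equals the matrix entry.
    peel : ∀ {L} (w : Vec Bool (suc L)) → tableauSum (suc c) (boxes (parts w)) ≈
      ∑ (configs (suc L)) (λ v → tableauSum c (boxes (parts v)) * upKernel (x c) ℓ (upBase κ ℓ) v w idle)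
    peel {L} w = begin
      tableauSum (suc c) (boxes (parts w)) ≈⟨ statusSum (boxes (parts w)) ⟩
      ∑ as (λ S → iverson (statusValid κ ℓ S) (h S)) ≈⟨ ∑-shapes w statuses (statusValid κ ℓ) h (lower w) ⟩
      ∑ (configs (suc L)) (λ v → iverson (subShape v w) (∑ as (λ S → iverson (agree v S ∧ statusValid κ ℓ S) (h S))))
        ≈⟨ ∑-cong (configs (suc L)) (λ v → iverson-cong-if (subShape v w) (factor v)) ⟩
      ∑ (configs (suc L)) (λ v → iverson (subShape v w) (tableauSum c (boxes (parts v)) * ∏ (boxes (parts w)) (γ ℓ (wallUp κ ℓ) (height v) (height w))))
        ≈⟨ ∑-cong (configs (suc L)) (λ v → trans (iverson-*ʳ (subShape v w) _ _) (*-congˡ (upKernel-boxes κ ℓ v w))) ⟩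
      ∑ (configs (suc L)) (λ v → tableauSum c (boxes (parts v)) * upKernel (x c) ℓ (upBase κ ℓ) v w idle) ∎
      where
      as = assignments (boxes (parts w)) statuses
      h : List (Box × Status) → Carrier
      h S = ∏ S (λ p → statusWeight (proj₂ p)) * tableauSum c (kept S)
      factor : ∀ v → subShape v w ≡ true → ∑ as (λ S → iverson (agree v S ∧ statusValid κ ℓ S) (h S))
        ≈ tableauSum c (boxes (parts v)) * ∏ (boxes (parts w)) (γ ℓ (wallUp κ ℓ) (height v) (height w))
      factor v sub = begin
        ∑ as (λ S → iverson (agree v S ∧ statusValid κ ℓ S) (h S)) ≈⟨ ∑-cong-∈ as each ⟩
        ∑ as (λ S → tableauSum c (boxes (parts v)) * iverson (agree v S ∧ statusValid κ ℓ S) (∏ S (λ p → statusWeight (proj₂ p))))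
          ≈⟨ ∑-distribˡ as _ _ ⟨
        tableauSum c (boxes (parts v)) * ∑ as (λ S → iverson (agree v S ∧ statusValid κ ℓ S) (∏ S (λ p → statusWeight (proj₂ p))))
          ≈⟨ *-congˡ (localSum v w sub) ⟩
        tableauSum c (boxes (parts v)) * ∏ (boxes (parts w)) (γ ℓ (wallUp κ ℓ) (height v) (height w)) ∎
        where
        each : ∀ {S} → S ∈ as → iverson (agree v S ∧ statusValid κ ℓ S) (h S)
          ≈ tableauSum c (boxes (parts v)) * iverson (agree v S ∧ statusValid κ ℓ S) (∏ S (λ p → statusWeight (proj₂ p)))
        each {S} S∈ = trans (iverson-cong-if (agree v S ∧ statusValid κ ℓ S) (λ av →
            trans (*-congˡ (reflexive (cong (tableauSum c) (kept-agree w S∈ v sub (proj₁ (∧-true av)))))) (*-comm _ _)))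
          (iverson-*ʳ (agree v S ∧ statusValid κ ℓ S) _ _)

-- Removing the largest letter of a plane partition

unique-↭ : {A : Set} {as bs : List A} → Unique as → Unique bs → (∀ {a} → a ∈ as → a ∈ bs) → (∀ {a} → a ∈ bs → a ∈ as) → as ↭ bs
unique-↭ u u′ f g = ∼bag⇒↭ (unique∧set⇒bag u u′ (mk⇔ f g))

unique-map-filter : {A B : Set} (p : A → Bool) (key : A → B) (as : List A) → Unique as →
  (∀ {a a′} → a ∈ as → a′ ∈ as → p a ≡ true → p a′ ≡ true → key a ≡ key a′ → a ≡ a′) →
  Unique (map key (filterᵇ p as))
unique-map-filter p key [] _ _ = []
unique-map-filter p key (a ∷ as) (a∉ ∷ u) inj with p a in eq
... | false = unique-map-filter p key as u (λ a∈ a∈′ → inj (there a∈) (there a∈′))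
... | true = All.tabulate distinct ∷ unique-map-filter p key as u (λ a∈ a∈′ → inj (there a∈) (there a∈′))
  where
  distinct : ∀ {k} → k ∈ map key (filterᵇ p as) → key a ≢ k
  distinct k∈ keq with ∈-map⁻ key k∈
  ... | a′ , a′∈ , ≡.refl with filterᵇ-∈ p as a′∈
  ...   | a′∈as , pa′ = All.lookup a∉ a′∈as (inj (here ≡.refl) (there a′∈as) eq pa′ keq)

-- The predicate marks exactly one element above each key, so marked elements and distinct keys are
-- in bijection.
distinct-keys : {A : Set} (p : A → Bool) (key : A → ℕ) (as : List A) → Unique as →
  (∀ {a a′} → a ∈ as → a′ ∈ as → p a ≡ true → p a′ ≡ true → key a ≡ key a′ → a ≡ a′) →
  (∀ {a} → a ∈ as → ∃ λ a′ → a′ ∈ as × p a′ ≡ true × key a′ ≡ key a) →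
  length (deduplicate ℕP._≟_ (map key as)) ≡ length (filterᵇ p as)
distinct-keys p key as u inj lead = ≡.trans
  (↭-length (unique-↭ (deduplicate-! (map key as)) (unique-map-filter p key as u inj) to from))
  (ListP.length-map key (filterᵇ p as))
  where
  to : ∀ {k} → k ∈ deduplicate ℕP._≟_ (map key as) → k ∈ map key (filterᵇ p as)
  to k∈ with ∈-map⁻ key (∈-deduplicate⁻ ℕP._≟_ (map key as) k∈)
  ... | a , a∈ , ≡.refl with lead a∈
  ...   | a′ , a′∈ , pa′ , keq = subst (_∈ map key (filterᵇ p as)) keq (∈-map⁺ key (filterᵇ-∈⁺ p as a′∈ pa′))
  from : ∀ {k} → k ∈ map key (filterᵇ p as) → k ∈ deduplicate ℕP._≟_ (map key as)
  from k∈ with ∈-map⁻ key k∈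
  ... | a , a∈ , ≡.refl = ∈-deduplicate⁺ ℕP._≟_ (∈-map⁺ key (proj₁ (filterᵇ-∈ p as a∈)))

LetterEntry : Set
LetterEntry = Maybe (Bool × ℕ)

-- A box of a plane partition holds a single letter, so the status `just true` does not arise.
letterStatuses : List Status
letterStatuses = just false ∷ nothing ∷ []

entryStatus : LetterEntry → Status
entryStatus = Maybe.map proj₁

fullLetter : ℕ → LetterEntry → ℕ
fullLetter c nothing = c
fullLetter c (just (_ , e)) = e

BelowLetter : ℕ → LetterEntry → Set
BelowLetter c e = ∀ {o e′} → e ≡ just (o , e′) → e′ < c

letters-below : ∀ c {e} → e ∈ enriched letterStatuses (upTo c) → BelowLetter c e
letters-below c e∈ ≡.refl with find (∈-concatMap⁻ (options (upTo c)) {xs = letterStatuses} e∈)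
... | nothing , _ , here ()
... | just o , _ , e∈′ with ∈-map⁻ (λ e → just (o , e)) e∈′
...   | e , e∈ , ≡.refl = ∈-upTo⁻ e∈

-- The pattern of `ppPairOK` with an arbitrary Boolean for the comparison. It distributes over
-- conjunction, so the comparison can be divided into a part about statuses and a part about old
-- letters.
pairRule : Box → Box → Bool → Bool
pairRule (r₁ , c₁) (r₂ , c₂) a =
  (((r₁ ≡ᵇ r₂) ∧ (c₁ <ᵇ c₂)) ⇒ᵇ a) ∧ (((c₁ ≡ᵇ c₂) ∧ (r₁ <ᵇ r₂)) ⇒ᵇ a)

pairRule-true : ∀ p q → pairRule p q true ≡ true
pairRule-true (r₁ , c₁) (r₂ , c₂) = ∧-intro (BoolP.∨-zeroʳ (not ((r₁ ≡ᵇ r₂) ∧ (c₁ <ᵇ c₂)))) (BoolP.∨-zeroʳ (not ((c₁ ≡ᵇ c₂) ∧ (r₁ <ᵇ r₂))))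

pairRule-∧ : ∀ p q a b → pairRule p q (a ∧ b) ≡ pairRule p q a ∧ pairRule p q b
pairRule-∧ p q true b = cong (_∧ pairRule p q b) (≡.sym (pairRule-true p q))
pairRule-∧ (r₁ , c₁) (r₂ , c₂) false b = go ((r₁ ≡ᵇ r₂) ∧ (c₁ <ᵇ c₂)) ((c₁ ≡ᵇ c₂) ∧ (r₁ <ᵇ r₂)) b
  where
  go : ∀ X Y b → ((X ⇒ᵇ false) ∧ (Y ⇒ᵇ false)) ≡ ((X ⇒ᵇ false) ∧ (Y ⇒ᵇ false)) ∧ ((X ⇒ᵇ b) ∧ (Y ⇒ᵇ b))
  go true Y b = ≡.refl
  go false true b = ≡.refl
  go false false b = ≡.refl

pairRule-row : ∀ r c c′ {a} → pairRule (r , c) (r , c′) a ≡ true → c < c′ → a ≡ true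
pairRule-row r c c′ h lt = ⇒ᵇ-elim (proj₁ (∧-true h)) (∧-intro (≡ᵇ-true {r} ≡.refl) (<ᵇ-true lt))

pairRule-column : ∀ c r r′ {a} → pairRule (r , c) (r′ , c) a ≡ true → r < r′ → a ≡ true
pairRule-column c r r′ {a} h lt =
  ⇒ᵇ-elim (proj₂ (∧-true {((r ≡ᵇ r′) ∧ (c <ᵇ c)) ⇒ᵇ a} h)) (∧-intro (≡ᵇ-true {c} ≡.refl) (<ᵇ-true lt))

pairRule-intro : ∀ r c r′ c′ a → (r ≡ r′ → c < c′ → a ≡ true) → (c ≡ c′ → r < r′ → a ≡ true) →
  pairRule (r , c) (r′ , c′) a ≡ true
pairRule-intro r c r′ c′ a f g = ∧-intro
  (⇒ᵇ-intro (λ h → f (≡ᵇ-≡ r r′ (proj₁ (∧-true h))) (<ᵇ-< {c} (proj₂ (∧-true {r ≡ᵇ r′} h)))))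
  (⇒ᵇ-intro (λ h → g (≡ᵇ-≡ c c′ (proj₁ (∧-true h))) (<ᵇ-< {r} (proj₂ (∧-true {c ≡ᵇ c′} h)))))

keptFirst : Status → Status → Bool
keptFirst a a′ = is-just a′ ⇒ᵇ is-just a

letterPairOK : Box × Status → Box × Status → Bool
letterPairOK (p , a) (q , a′) = pairRule p q (keptFirst a a′)

letterDiagOK : Kind → Letter → Box × Status → Bool
letterDiagOK 𝒫 ℓ p = true
letterDiagOK 𝒬 ℓ (b , a) = isDiag b ⇒ᵇ (is-just a ∨ isPrimedLetter ℓ)

letterValid : Kind → Letter → List (Box × Status) → Bool
letterValid κ ℓ S = allPairs letterPairOK S ∧ all (letterDiagOK κ ℓ) S

ppDiagOK : Kind → PPFilling → Bool
ppDiagOK 𝒬 F = ppNoUnprimedDiag F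
ppDiagOK 𝒫 F = true

oldOrdered : LetterEntry → LetterEntry → Bool
oldOrdered (just (_ , e)) (just (_ , e′)) = e ≤ᵇ e′
oldOrdered _ _ = true

≤ᵇ-full : ∀ c e e′ → BelowLetter c e → BelowLetter c e′ →
  (fullLetter c e ≤ᵇ fullLetter c e′) ≡ keptFirst (entryStatus e) (entryStatus e′) ∧ oldOrdered e e′
≤ᵇ-full c nothing nothing _ _ = ≤ᵇ-true (ℕP.≤-refl {c})
≤ᵇ-full c nothing (just (_ , e′)) _ lt = ≤ᵇ-false (lt ≡.refl)
≤ᵇ-full c (just (_ , e)) nothing lt _ = ≤ᵇ-true (ℕP.<⇒≤ (lt ≡.refl))
≤ᵇ-full c (just (_ , e)) (just (_ , e′)) _ _ = ≡.refl

module _ (c : ℕ) where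
  ppPairOK-full : ∀ p q e e′ → BelowLetter c e → BelowLetter c e′ → ppPairOK (p , fullLetter c e) (q , fullLetter c e′)
    ≡ letterPairOK (p , entryStatus e) (q , entryStatus e′) ∧ pairRule p q (oldOrdered e e′)
  ppPairOK-full p q e e′ b b′ = ≡.trans (cong (pairRule p q) (≤ᵇ-full c e e′ b b′)) (pairRule-∧ p q _ _)

  ppValid-split : ∀ (G : List (Box × LetterEntry)) → (∀ {p} → p ∈ G → BelowLetter c (proj₂ p)) →
    ppValid (relabel (fullLetter c) G) ≡ allPairs letterPairOK (statusOf G) ∧ ppValid (present G)
  ppValid-split G bel = ≡-from-⇔ to from
    where
    F = relabel (fullLetter c) G
    split : ∀ {p e q e′} → (p , e) ∈ G → (q , e′) ∈ G → ppPairOK (p , fullLetter c e) (q , fullLetter c e′)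
      ≡ letterPairOK (p , entryStatus e) (q , entryStatus e′) ∧ pairRule p q (oldOrdered e e′)
    split {p} {e} {q} {e′} e∈ e∈′ = ppPairOK-full p q e e′ (bel e∈) (bel e∈′)
    to : ppValid F ≡ true → (allPairs letterPairOK (statusOf G) ∧ ppValid (present G)) ≡ true
    to h = ∧-intro
      (allPairs-intro (statusOf G) (λ a∈ a∈′ → status-pair (∈-statusOf⁻ a∈) (∈-statusOf⁻ a∈′)))
      (allPairs-intro (present G) (λ e∈ e∈′ → letter-pair (∈-present⁻ G e∈) (∈-present⁻ G e∈′)))
      where
      both : ∀ {p e q e′} → (p , e) ∈ G → (q , e′) ∈ G →
        (letterPairOK (p , entryStatus e) (q , entryStatus e′) ∧ pairRule p q (oldOrdered e e′)) ≡ true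
      both e∈ e∈′ = ≡.trans (≡.sym (split e∈ e∈′))
        (allPairs-true F h (∈-map⁺ (map₂ (fullLetter c)) e∈) (∈-map⁺ (map₂ (fullLetter c)) e∈′))
      status-pair : ∀ {p a q a′} → (∃ λ e → (p , e) ∈ G × a ≡ entryStatus e) → (∃ λ e → (q , e) ∈ G × a′ ≡ entryStatus e) →
        letterPairOK (p , a) (q , a′) ≡ true
      status-pair (e , e∈ , ≡.refl) (e′ , e∈′ , ≡.refl) = proj₁ (∧-true (both e∈ e∈′))
      letter-pair : ∀ {p e q e′} → (∃ λ o → (p , just (o , e)) ∈ G) → (∃ λ o → (q , just (o , e′)) ∈ G) →
        ppPairOK (p , e) (q , e′) ≡ true
      letter-pair {p} {q = q} (o , e∈) (o′ , e∈′) = proj₂ (∧-true {letterPairOK (p , just o) (q , just o′)} (both e∈ e∈′))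
    from : (allPairs letterPairOK (statusOf G) ∧ ppValid (present G)) ≡ true → ppValid F ≡ true
    from h = allPairs-intro F (λ f∈ f∈′ → full-pair (∈-map⁻ (map₂ (fullLetter c)) f∈) (∈-map⁻ (map₂ (fullLetter c)) f∈′))
      where
      full-pair : ∀ {f f′} → (∃ λ g → g ∈ G × f ≡ map₂ (fullLetter c) g) → (∃ λ g → g ∈ G × f′ ≡ map₂ (fullLetter c) g) →
        ppPairOK f f′ ≡ true
      full-pair ((p , e) , e∈ , ≡.refl) ((q , e′) , e∈′ , ≡.refl) = ≡.trans (split e∈ e∈′)
        (∧-intro (allPairs-true (statusOf G) (proj₁ (∧-true h)) (∈-map⁺ (map₂ entryStatus) e∈) (∈-map⁺ (map₂ entryStatus) e∈′))
          (old e e′ e∈ e∈′))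
        where
        old : ∀ e e′ → (p , e) ∈ G → (q , e′) ∈ G → pairRule p q (oldOrdered e e′) ≡ true
        old nothing e′ _ _ = pairRule-true p q
        old (just (o , S)) nothing _ _ = pairRule-true p q
        old (just (o , S)) (just (o′ , S′)) e∈ e∈′ =
          allPairs-true (present G) (proj₂ (∧-true {allPairs letterPairOK (statusOf G)} h)) (∈-present⁺ G e∈) (∈-present⁺ G e∈′)

  ppDiag-split : ∀ κ ℓ → isPrimed c ≡ isPrimedLetter ℓ → ∀ (G : List (Box × LetterEntry)) →
    ppDiagOK κ (relabel (fullLetter c) G) ≡ all (letterDiagOK κ ℓ) (statusOf G) ∧ ppDiagOK κ (present G)
  ppDiag-split 𝒫 ℓ pr G = ≡.sym (≡.trans (BoolP.∧-identityʳ _) (all-intro (statusOf G) (λ _ → ≡.refl)))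
  ppDiag-split 𝒬 ℓ pr [] = ≡.refl
  ppDiag-split 𝒬 ℓ pr ((p , nothing) ∷ G) rewrite pr = ≡.trans
    (cong ((isDiag p ⇒ᵇ isPrimedLetter ℓ) ∧_) (ppDiag-split 𝒬 ℓ pr G))
    (≡.sym (BoolP.∧-assoc (isDiag p ⇒ᵇ isPrimedLetter ℓ) (all (letterDiagOK 𝒬 ℓ) (statusOf G)) _))
  ppDiag-split 𝒬 ℓ pr ((p , just (o , e)) ∷ G) = ≡.trans
    (cong ((isDiag p ⇒ᵇ isPrimed e) ∧_) (ppDiag-split 𝒬 ℓ pr G))
    (go (isDiag p ⇒ᵇ isPrimed e) (all (letterDiagOK 𝒬 ℓ) (statusOf G)) (not (isDiag p)))
    where
    go : ∀ a b d {c} → a ∧ (b ∧ c) ≡ ((d ∨ true) ∧ b) ∧ (a ∧ c)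
    go a b d {c} rewrite BoolP.∨-zeroʳ d = x∙yz≈y∙xz a b c
      where
      open import Algebra.Bundles using (CommutativeMonoid)
      open import Algebra.Properties.CommutativeSemigroup (CommutativeMonoid.commutativeSemigroup BoolP.∧-commutativeMonoid) using (x∙yz≈y∙xz)

newBoxes : {B : Set} → List (B × Status) → List B
newBoxes [] = []
newBoxes ((b , nothing) ∷ S) = b ∷ newBoxes S
newBoxes ((b , just _) ∷ S) = newBoxes S

∈-newBoxes⁻ : {B : Set} (S : List (B × Status)) {b : B} → b ∈ newBoxes S → (b , nothing) ∈ S
∈-newBoxes⁻ ((b , nothing) ∷ S) (here ≡.refl) = here ≡.refl
∈-newBoxes⁻ ((b , nothing) ∷ S) (there b∈) = there (∈-newBoxes⁻ S b∈)
∈-newBoxes⁻ ((b , just _) ∷ S) b∈ = there (∈-newBoxes⁻ S b∈)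

∈-newBoxes⁺ : {B : Set} (S : List (B × Status)) {b : B} → (b , nothing) ∈ S → b ∈ newBoxes S
∈-newBoxes⁺ ((b , nothing) ∷ S) (here ≡.refl) = here ≡.refl
∈-newBoxes⁺ ((b , nothing) ∷ S) (there b∈) = there (∈-newBoxes⁺ S b∈)
∈-newBoxes⁺ ((b , just _) ∷ S) (there b∈) = ∈-newBoxes⁺ S b∈

newBoxes-unique : {B : Set} (S : List (B × Status)) → Unique (map proj₁ S) → Unique (newBoxes S)
newBoxes-unique [] _ = []
newBoxes-unique ((b , just _) ∷ S) (_ ∷ u) = newBoxes-unique S u
newBoxes-unique ((b , nothing) ∷ S) (b∉ ∷ u) =
  All.tabulate (λ b′∈ → All.lookup b∉ (∈-map⁺ proj₁ (∈-newBoxes⁻ S b′∈))) ∷ newBoxes-unique S u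

-- The variable of a primed letter counts rows and that of an unprimed letter counts columns.
line : Letter → Box → ℕ
line primed = row
line unprimed = col

module Strip (κ : Kind) (ℓ : Letter) {L} (v w : Vec Bool L) where
  hν hλ : ℕ → ℕ
  hν = height v
  hλ = height w

  stripAt : ℕ → ℕ → Status → Bool
  stripAt r s a = if r <ᵇ hν s then is-just a else (not (is-just a) ∧ not (wallDown κ ℓ ∧ isZero s))

  strip : Box × Status → Bool
  strip ((r , c) , a) = stripAt r (c ∸ r) a

  strip-cell : ∀ r s a → strip (cell r s , a) ≡ stripAt r s a
  strip-cell r s a = cong (λ s → stripAt r s a) (ℕP.m+n∸m≡n r s)

  leads : Box → Bool
  leads (r , c) = leader ℓ (isZero (c ∸ r)) (previousOf ℓ hν hλ (c ∸ r)) r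

  leads-cell : ∀ r s → leads (cell r s) ≡ leader ℓ (isZero s) (previousOf ℓ hν hλ s) r
  leads-cell r s = cong (λ s → leader ℓ (isZero s) (previousOf ℓ hν hλ s) r) (ℕP.m+n∸m≡n r s)

  wall-diag : ∀ κ ℓ r s a → letterDiagOK κ ℓ (cell r s , a) ≡ true → is-just a ≡ false → not (wallDown κ ℓ ∧ isZero s) ≡ true
  wall-diag 𝒫 primed r s a h n = ≡.refl
  wall-diag 𝒫 unprimed r s a h n = ≡.refl
  wall-diag 𝒬 primed r s a h n = ≡.refl
  wall-diag 𝒬 unprimed r (suc s) a h n = ≡.refl
  wall-diag 𝒬 unprimed r zero nothing h n = ⊥-elim (false≢true (⇒ᵇ-elim h (≡ᵇ-true (≡.sym (ℕP.+-identityʳ r)))))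

  diag-wall : ∀ κ ℓ r s a → (is-just a ≡ false → not (wallDown κ ℓ ∧ isZero s) ≡ true) → letterDiagOK κ ℓ (cell r s , a) ≡ true
  diag-wall 𝒫 ℓ r s a f = ≡.refl
  diag-wall 𝒬 ℓ r s (just _) f = BoolP.∨-zeroʳ (not (isDiag (cell r s)))
  diag-wall 𝒬 primed r s nothing f = BoolP.∨-zeroʳ (not (isDiag (cell r s)))
  diag-wall 𝒬 unprimed r s nothing f = ⇒ᵇ-intro (λ d → ⊥-elim (not-true (f ≡.refl) (cong isZero (is-diag d))))
    where
    is-diag : isDiag (cell r s) ≡ true → s ≡ 0
    is-diag h = ℕP.+-cancelˡ-≡ r s 0 (≡.trans (≡.sym (≡ᵇ-≡ r (r ℕ.+ s) h)) (≡.sym (ℕP.+-identityʳ r)))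

  strip-status : ∀ r s a → stripAt r s a ≡ true →
    is-just a ≡ (r <ᵇ hν s) × (is-just a ≡ false → not (wallDown κ ℓ ∧ isZero s) ≡ true)
  strip-status r s a h with r <ᵇ hν s
  strip-status r s (just _) h | true = ≡.refl , λ ()
  strip-status r s nothing h | false = ≡.refl , λ _ → h

  module _ (sub : subShape v w ≡ true) {sts} {S : List (Box × Status)} (S∈ : S ∈ assignments (boxes (parts w)) sts) where
    private
      ν≤λ : ∀ s → hν s ≤ hλ s
      ν≤λ = subShape-sound v w sub

    in-ν : agree v S ≡ true → ∀ r s {a} → (cell r s , a) ∈ S → is-just a ≡ (r <ᵇ hν s)
    in-ν ag r s {a} p∈ = ≡.trans (eqᵇ-sound (is-just a) _ (all-true S ag p∈)) (inShape-cell v r s)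

    -- There is no strip condition here: once the kept boxes form the shape ν, the order between old
    -- and new boxes is automatic, and only the diagonal imposes a restriction.
    agree-strip : (agree v S ∧ letterValid κ ℓ S) ≡ all strip S
    agree-strip = ≡-from-⇔ to from
      where
      to : (agree v S ∧ letterValid κ ℓ S) ≡ true → all strip S ≡ true
      to h = all-intro S each
        where
        each : ∀ {p} → p ∈ S → strip p ≡ true
        each {b , a} p∈ with cell-of w S∈ p∈
        ... | r , s , ≡.refl , _ = ≡.trans (strip-cell r s a)
          (go a (in-ν (proj₁ (∧-true h)) r s p∈)
            (wall-diag κ ℓ r s a (all-true S (proj₂ (∧-true {allPairs letterPairOK S} (proj₂ (∧-true {agree v S} h)))) p∈)))
          where
          go : ∀ a → is-just a ≡ (r <ᵇ hν s) → (is-just a ≡ false → not (wallDown κ ℓ ∧ isZero s) ≡ true) → stripAt r s a ≡ true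
          go (just _) eq f rewrite ≡.sym eq = ≡.refl
          go nothing eq f rewrite ≡.sym eq = f ≡.refl
      from : all strip S ≡ true → (agree v S ∧ letterValid κ ℓ S) ≡ true
      from h = ∧-intro (all-intro S agrees) (∧-intro (allPairs-intro S pair) (all-intro S diag))
        where
        facts : ∀ r s {a} → (cell r s , a) ∈ S → is-just a ≡ (r <ᵇ hν s) × (is-just a ≡ false → not (wallDown κ ℓ ∧ isZero s) ≡ true)
        facts r s {a} p∈ = strip-status r s a (≡.trans (≡.sym (strip-cell r s a)) (all-true S h p∈))
        agrees : ∀ {p} → p ∈ S → eqᵇ (is-just (proj₂ p)) (inShape v (proj₁ p)) ≡ true
        agrees {b , a} p∈ with cell-of w S∈ p∈
        ... | r , s , ≡.refl , _ rewrite inShape-cell v r s | proj₁ (facts r s p∈) = eqᵇ-refl (r <ᵇ hν s)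
        diag : ∀ {p} → p ∈ S → letterDiagOK κ ℓ p ≡ true
        diag {b , a} p∈ with cell-of w S∈ p∈
        ... | r , s , ≡.refl , _ = diag-wall κ ℓ r s a (proj₂ (facts r s p∈))
        pair : ∀ {p q} → p ∈ S → q ∈ S → letterPairOK p q ≡ true
        pair {b , a} {b′ , a′} p∈ q∈ with cell-of w S∈ p∈ | cell-of w S∈ q∈
        ... | r , s , ≡.refl , _ | r′ , s′ , ≡.refl , _ = pairRule-intro r (r ℕ.+ s) r′ (r′ ℕ.+ s′) _
          (λ { ≡.refl lt → first (λ r< → ℕP.<-≤-trans r< (height-anti-≤ v (ℕP.<⇒≤ (ℕP.+-cancelˡ-< r _ _ lt)))) })
          (λ eq lt → first (column eq (ℕP.m≤n⇒∃[o]m+o≡n (ℕP.<⇒≤ lt))))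
          where
          first : (r′ < hν s′ → r < hν s) → keptFirst a a′ ≡ true
          first f rewrite proj₁ (facts r s p∈) | proj₁ (facts r′ s′ q∈) = ⇒ᵇ-intro (λ h → <ᵇ-true (f (<ᵇ-< {r′} h)))
          column : r ℕ.+ s ≡ r′ ℕ.+ s′ → (∃ λ k → r ℕ.+ k ≡ r′) → r′ < hν s′ → r < hν s
          column eq (k , ≡.refl) r< = subst (λ i → r < hν i)
            (ℕP.+-cancelˡ-≡ r _ _ (≡.trans (≡.sym (ℕP.+-assoc r k s′)) (≡.sym eq)))
            (height-diagonal v k (subst (_< hν s′) (ℕP.+-comm r k) r<))

    module _ (ag : agree v S ≡ true) where
      private
        new-cell : ∀ {b} → b ∈ newBoxes S → ∃[ r ] ∃[ s ] (b ≡ cell r s) × r < hλ s × hν s ≤ r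
        new-cell b∈ with cell-of w S∈ (∈-newBoxes⁻ S b∈)
        ... | r , s , ≡.refl , r< = r , s , ≡.refl , r< , <ᵇ-≥ {r} (≡.sym (in-ν ag r s (∈-newBoxes⁻ S b∈)))

        cell-new : ∀ r s → r < hλ s → hν s ≤ r → cell r s ∈ newBoxes S
        cell-new r s r<λ ν≤r with status-at w S∈ r s r<λ
        ... | nothing , p∈ = ∈-newBoxes⁺ S p∈
        ... | just o , p∈ = ⊥-elim (false≢true (≡.trans (≡.sym (<ᵇ-false ν≤r)) (≡.sym (in-ν ag r s p∈))))

        -- Walks to the left along the new boxes of the row, until the left neighbour lies in ν or
        -- the diagonal is reached.
        row-start : ∀ r s → r < hλ s → hν s ≤ r →
          ∃ λ s₀ → r < hλ s₀ × hν s₀ ≤ r × ((r <ᵇ previous hν s₀) ∨ isZero s₀) ≡ true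
        row-start r zero r<λ ν≤r = 0 , r<λ , ν≤r , BoolP.∨-zeroʳ (r <ᵇ 0)
        row-start r (suc s) r<λ ν≤r with r <ᵇ hν s in eq
        ... | true = suc s , r<λ , ν≤r , cong (_∨ false) eq
        ... | false = row-start r s (ℕP.<-≤-trans r<λ (height-anti w s)) (<ᵇ-≥ {r} eq)

        -- Walks down the column while the box below belongs to λ; that box is again new, because ν
        -- is a shape.
        column-end : ∀ r s → r < hλ s → hν s ≤ r →
          ∃[ r₀ ] ∃[ s₀ ] r₀ < hλ s₀ × hν s₀ ≤ r₀ × not (suc r₀ <ᵇ previous hλ s₀) ≡ true × r₀ ℕ.+ s₀ ≡ r ℕ.+ s
        column-end r zero r<λ ν≤r = r , 0 , r<λ , ν≤r , ≡.refl , ≡.refl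
        column-end r (suc s) r<λ ν≤r with suc r <ᵇ hλ s in eq
        ... | false = r , suc s , r<λ , ν≤r , cong not eq , ≡.refl
        ... | true with column-end (suc r) s (<ᵇ-< {suc r} eq) (ℕP.≤-trans (height-step v s) (s≤s ν≤r))
        ...   | r₀ , s₀ , lt , le , lead , on = r₀ , s₀ , lt , le , lead , ≡.trans on (≡.sym (ℕP.+-suc r s))

        lead-exists : ∀ ℓ′ → ℓ′ ≡ ℓ → ∀ {b} → b ∈ newBoxes S → ∃ λ b′ → b′ ∈ newBoxes S × leads b′ ≡ true × line ℓ′ b′ ≡ line ℓ′ b
        lead-exists primed ≡.refl b∈ with new-cell b∈
        ... | r , s , ≡.refl , r<λ , ν≤r with row-start r s r<λ ν≤r
        ...   | s₀ , lt , le , lead = cell r s₀ , cell-new r s₀ lt le , ≡.trans (leads-cell r s₀) lead , ≡.refl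
        lead-exists unprimed ≡.refl b∈ with new-cell b∈
        ... | r , s , ≡.refl , r<λ , ν≤r with column-end r s r<λ ν≤r
        ...   | r₀ , s₀ , lt , le , lead , on = cell r₀ s₀ , cell-new r₀ s₀ lt le , ≡.trans (leads-cell r₀ s₀) lead , on

        -- The later of two new boxes in a row has its left neighbour outside ν, so it cannot be a
        -- leader.
        row-once : ∀ r s s′ → hν s ≤ r → s < s′ → ((r <ᵇ previous hν s′) ∨ isZero s′) ≡ true → ⊥
        row-once r s (suc s′) ν≤r (s≤s s≤s′) lead =
          ℕP.<⇒≱ (<ᵇ-< {r} (≡.trans (≡.sym (BoolP.∨-identityʳ _)) lead)) (ℕP.≤-trans (height-anti-≤ v s≤s′) ν≤r)

        column-once : ∀ r s r′ s′ → r′ < hλ s′ → r ℕ.+ s ≡ r′ ℕ.+ s′ → r < r′ → not (suc r <ᵇ previous hλ s) ≡ true → ⊥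
        column-once r s r′ s′ r′< on lt lead with ℕP.m≤n⇒∃[o]m+o≡n lt
        ... | k , ≡.refl = not-true lead (<ᵇ-true (subst (λ i → suc r < previous hλ i) s≡
            (height-diagonal w k (subst (_< hλ s′) (ℕP.+-comm (suc r) k) r′<))))
          where
          s≡ : suc (k ℕ.+ s′) ≡ s
          s≡ = ℕP.+-cancelˡ-≡ r _ _ (≡.trans (≡.trans (ℕP.+-suc r (k ℕ.+ s′)) (cong suc (≡.sym (ℕP.+-assoc r k s′)))) (≡.sym on))

        lead-once : ∀ ℓ′ → ℓ′ ≡ ℓ → ∀ {b b′} → b ∈ newBoxes S → b′ ∈ newBoxes S → leads b ≡ true → leads b′ ≡ true →
          line ℓ′ b ≡ line ℓ′ b′ → b ≡ b′
        lead-once ℓ′ eqℓ b∈ b∈′ lb lb′ on with new-cell b∈ | new-cell b∈′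
        lead-once primed ≡.refl b∈ b∈′ lb lb′ ≡.refl | r , s , ≡.refl , r<λ , ν≤r | r , s′ , ≡.refl , r′<λ , ν≤r′ with ℕP.<-cmp s s′
        ... | tri≈ _ ≡.refl _ = ≡.refl
        ... | tri< lt _ _ = ⊥-elim (row-once r s s′ ν≤r lt (≡.trans (≡.sym (leads-cell r s′)) lb′))
        ... | tri> _ _ gt = ⊥-elim (row-once r s′ s ν≤r′ gt (≡.trans (≡.sym (leads-cell r s)) lb))
        lead-once unprimed ≡.refl b∈ b∈′ lb lb′ on | r , s , ≡.refl , r<λ , ν≤r | r′ , s′ , ≡.refl , r′<λ , ν≤r′ with ℕP.<-cmp r r′
        ... | tri≈ _ ≡.refl _ = cong (r ,_) on
        ... | tri< lt _ _ = ⊥-elim (column-once r s r′ s′ r′<λ on lt (≡.trans (≡.sym (leads-cell r s)) lb))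
        ... | tri> _ _ gt = ⊥-elim (column-once r′ s′ r s r<λ (≡.sym on) gt (≡.trans (≡.sym (leads-cell r′ s′)) lb′))

      lines-leaders : length (deduplicate ℕP._≟_ (map (line ℓ) (newBoxes S))) ≡ length (filterᵇ leads (newBoxes S))
      lines-leaders = distinct-keys leads (line ℓ) (newBoxes S)
        (newBoxes-unique S (subst Unique (≡.sym (boxes-of w S∈)) (boxes-unique 0 (parts w))))
        (lead-once ℓ ≡.refl) (lead-exists ℓ ≡.refl)

occurrences : PPFilling → ℕ → List Box
occurrences F e = map proj₁ (filterᵇ (λ p → proj₂ p ≡ᵇ e) F)

lineOf : ℕ → Box → ℕ
lineOf e = if isPrimed e then row else col

lines : ℕ → List Box → ℕ
lines e bs = length (deduplicate ℕP._≟_ (map (lineOf e) bs))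

≡ᵇ-false : ∀ {m n} → m ≢ n → (m ≡ᵇ n) ≡ false
≡ᵇ-false {zero} {zero} n = ⊥-elim (n ≡.refl)
≡ᵇ-false {zero} {suc _} n = ≡.refl
≡ᵇ-false {suc _} {zero} n = ≡.refl
≡ᵇ-false {suc m} {suc k} n = ≡ᵇ-false (λ eq → n (cong suc eq))

occurrences-old : ∀ c (G : List (Box × LetterEntry)) {e} → e < c →
  occurrences (relabel (fullLetter c) G) e ≡ occurrences (present G) e
occurrences-old c [] lt = ≡.refl
occurrences-old c ((b , nothing) ∷ G) {e} lt rewrite ≡ᵇ-false (λ eq → ℕP.<⇒≢ lt (≡.sym eq)) = occurrences-old c G lt
occurrences-old c ((b , just (o , e′)) ∷ G) {e} lt with e′ ≡ᵇ e
... | true = cong (b ∷_) (occurrences-old c G lt)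
... | false = occurrences-old c G lt

occurrences-new : ∀ c (G : List (Box × LetterEntry)) → (∀ {p} → p ∈ G → BelowLetter c (proj₂ p)) →
  occurrences (relabel (fullLetter c) G) c ≡ newBoxes (statusOf G)
occurrences-new c [] bel = ≡.refl
occurrences-new c ((b , nothing) ∷ G) bel rewrite ≡ᵇ-true {c} ≡.refl = cong (b ∷_) (occurrences-new c G (λ p∈ → bel (there p∈)))
occurrences-new c ((b , just (o , e)) ∷ G) bel rewrite ≡ᵇ-false (ℕP.<⇒≢ (bel (here ≡.refl) ≡.refl)) = occurrences-new c G (λ p∈ → bel (there p∈))

module PPSums (R : CommutativeRing 0ℓ 0ℓ) (t : CommutativeRing.Carrier R) (y : ℕ → CommutativeRing.Carrier R) (κ : Kind) where
  open CommutativeRing R hiding (zero)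
  open FiniteSums R
  open AssignmentSums R
  open ShapeSums R
  open EdgeProducts R t
  open Kernels R t using (Vector; downKernel)
  open import Relation.Binary.Reasoning.Setoid setoid
  open import Algebra.Properties.Semiring.Exp semiring using (_^_)
  open import Algebra.Properties.CommutativeSemigroup *-commutativeSemigroup using (x∙yz≈y∙xz)

  -- This distributes (-β) to the power |λ| - |wt| over the letters: for each letter, every line
  -- counts once with `y` and every further box with `t` = -β.
  boxesWeight : ℕ → List Box → Carrier
  boxesWeight e bs = y e ^ lines e bs * t ^ (length bs ∸ lines e bs)

  weight : ℕ → PPFilling → Carrier
  weight c F = ∏ (upTo c) (λ e → boxesWeight e (occurrences F e))

  partitionSum : ℕ → List Box → Carrier
  partitionSum c bs = ∑ (assignments bs (upTo c)) (λ F → iverson (ppValid F ∧ ppDiagOK κ F) (weight c F))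

  module Peel (c : ℕ) (ℓ : Letter) (pr : isPrimed c ≡ isPrimedLetter ℓ) where

    ∑-letters : ∀ φ → ∑ (upTo (suc c)) φ ≈ ∑ (enriched letterStatuses (upTo c)) (λ e → φ (fullLetter c e))
    ∑-letters φ = begin
      ∑ (upTo (suc c)) φ ≈⟨ reflexive (cong (λ as → ∑ as φ) (≡.sym (ListP.upTo-∷ʳ c))) ⟩
      ∑ (upTo c ++ c ∷ []) φ ≈⟨ ∑-++ (upTo c) (c ∷ []) φ ⟩
      ∑ (upTo c) φ + (φ c + 0#) ≈⟨ +-cong (∑-map (λ e → just (false , e)) (upTo c) φ′) (+-identityʳ _) ⟨
      ∑ (map (λ e → just (false , e)) (upTo c)) φ′ + (φ c + 0# + 0#)
        ≈⟨ ∑-concatMap (options (upTo c)) letterStatuses φ′ ⟨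
      ∑ (enriched letterStatuses (upTo c)) φ′ ∎
      where
      φ′ : LetterEntry → Carrier
      φ′ e = φ (fullLetter c e)

    weight-split : ∀ (G : List (Box × LetterEntry)) → (∀ {p} → p ∈ G → BelowLetter c (proj₂ p)) →
      weight (suc c) (relabel (fullLetter c) G) ≈ boxesWeight c (newBoxes (statusOf G)) * weight c (present G)
    weight-split G bel = trans (∏-upTo-last c _) (trans (*-cong
      (∏-cong-∈ (upTo c) (λ {e} e∈ → reflexive (cong (boxesWeight e) (occurrences-old c G (∈-upTo⁻ e∈)))))
      (reflexive (cong (boxesWeight c) (occurrences-new c G bel)))) (*-comm _ _))

    statusSum : (bs : List Box) → partitionSum (suc c) bs ≈
      ∑ (assignments bs letterStatuses) (λ S → iverson (letterValid κ ℓ S) (boxesWeight c (newBoxes S) * partitionSum c (kept S)))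
    statusSum bs = begin
      ∑ (assignments bs (upTo (suc c))) (λ F → iverson (ppValid F ∧ ppDiagOK κ F) (weight (suc c) F))
        ≈⟨ ∑-relabel (fullLetter c) (upTo (suc c)) es ∑-letters bs _ ⟩
      ∑ (assignments bs es) (λ G → iverson (ppValid (relabel (fullLetter c) G) ∧ ppDiagOK κ (relabel (fullLetter c) G)) (weight (suc c) (relabel (fullLetter c) G)))
        ≈⟨ ∑-cong-∈ (assignments bs es) (λ {G} G∈ → summand G (λ p∈ → letters-below c (proj₂ (∈-assignments bs es G∈) p∈))) ⟩
      ∑ (assignments bs es) (λ G → ψ (statusOf G) (present G)) ≈⟨ ∑-split letterStatuses (upTo c) bs ψ ⟩
      ∑ (assignments bs letterStatuses) (λ S → ∑ (assignments (kept S) (upTo c)) (ψ S))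
        ≈⟨ ∑-cong (assignments bs letterStatuses) (λ S → trans (sym (∑-distribˡ (assignments (kept S) (upTo c)) _ _))
             (iverson-*ˡ (letterValid κ ℓ S) _ _)) ⟩
      ∑ (assignments bs letterStatuses) (λ S → iverson (letterValid κ ℓ S) (boxesWeight c (newBoxes S) * partitionSum c (kept S))) ∎
      where
      es = enriched letterStatuses (upTo c)
      ψ : List (Box × Status) → PPFilling → Carrier
      ψ S F = iverson (letterValid κ ℓ S) (boxesWeight c (newBoxes S)) * iverson (ppValid F ∧ ppDiagOK κ F) (weight c F)
      summand : ∀ G → (∀ {p} → p ∈ G → BelowLetter c (proj₂ p)) →
        iverson (ppValid (relabel (fullLetter c) G) ∧ ppDiagOK κ (relabel (fullLetter c) G)) (weight (suc c) (relabel (fullLetter c) G)) ≈ ψ (statusOf G) (present G)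
      summand G bel = begin
        iverson (ppValid F ∧ ppDiagOK κ F) (weight (suc c) F)
          ≈⟨ reflexive (cong (λ p → iverson p (weight (suc c) F))
               (≡.trans (cong₂ _∧_ (ppValid-split c G bel) (ppDiag-split c κ ℓ pr G))
                 (∧-interchange (allPairs letterPairOK (statusOf G)) (ppValid (present G)) (all (letterDiagOK κ ℓ) (statusOf G)) (ppDiagOK κ (present G))))) ⟩
        iverson (letterValid κ ℓ (statusOf G) ∧ (ppValid (present G) ∧ ppDiagOK κ (present G))) (weight (suc c) F)
          ≈⟨ iverson-cong (letterValid κ ℓ (statusOf G) ∧ (ppValid (present G) ∧ ppDiagOK κ (present G))) (weight-split G bel) ⟩
        iverson (letterValid κ ℓ (statusOf G) ∧ (ppValid (present G) ∧ ppDiagOK κ (present G))) (boxesWeight c (newBoxes (statusOf G)) * weight c (present G))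
          ≈⟨ iverson-∧-* (letterValid κ ℓ (statusOf G)) (ppValid (present G) ∧ ppDiagOK κ (present G)) _ _ ⟩
        ψ (statusOf G) (present G) ∎
        where F = relabel (fullLetter c) G

    lower : ∀ {L} (w : Vec Bool L) {S} → S ∈ assignments (boxes (parts w)) letterStatuses → letterValid κ ℓ S ≡ true → Lower S
    lower w {S} S∈ h =
      (λ {r} {s} {o} {a} p∈ q∈ → pairRule-row r (r ℕ.+ s) (r ℕ.+ suc s) (allPairs-true S pairs q∈ p∈)
        (ℕP.+-monoʳ-< r ℕP.≤-refl)) ,
      (λ {r} {s} {o} {a} p∈ q∈ → pairRule-column (r ℕ.+ suc s) r (suc r)
        (subst (λ c′ → pairRule (r , r ℕ.+ suc s) (suc r , c′) (is-just a) ≡ true) (≡.sym (ℕP.+-suc r s))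
          (allPairs-true S pairs q∈ p∈)) ℕP.≤-refl)
      where
      pairs : allPairs letterPairOK S ≡ true
      pairs = proj₁ (∧-true h)

    open DownEdges (y c) using (downKernel-boxes; γ)
    open DownWeights (ringOperations R) t (y c) 1# 1# 1# using (downBase)

    module _ {L} (v w : Vec Bool (suc L)) where
      open Strip κ ℓ v w

      stripWeight : Box × Status → Carrier
      stripWeight (b , just _) = 1#
      stripWeight (b , nothing) = if leads b then y c else t

      ∏-leads : ∀ bs → ∏ bs (λ b → if leads b then y c else t)
        ≈ y c ^ length (filterᵇ leads bs) * t ^ (length bs ∸ length (filterᵇ leads bs))
      ∏-leads [] = sym (*-identityˡ 1#)
      ∏-leads (b ∷ bs) with leads b
      ... | true = trans (*-congˡ (∏-leads bs)) (sym (*-assoc _ _ _))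
      ... | false = trans (*-congˡ (∏-leads bs)) (trans (x∙yz≈y∙xz _ _ _) (*-congˡ (reflexive
          (cong (t ^_) (≡.sym (ℕP.+-∸-assoc 1 (fewer bs)))))))
        where
        fewer : ∀ bs → length (filterᵇ leads bs) ≤ length bs
        fewer [] = z≤n
        fewer (b ∷ bs) with leads b
        ... | true = s≤s (fewer bs)
        ... | false = ℕP.m≤n⇒m≤1+n (fewer bs)

      ∏-stripWeight : ∀ S → ∏ S stripWeight ≈ ∏ (newBoxes S) (λ b → if leads b then y c else t)
      ∏-stripWeight [] = refl
      ∏-stripWeight ((b , just _) ∷ S) = trans (*-identityˡ _) (∏-stripWeight S)
      ∏-stripWeight ((b , nothing) ∷ S) = *-congˡ (∏-stripWeight S)

      line≡lineOf : ∀ ℓ → isPrimed c ≡ isPrimedLetter ℓ → lineOf c ≡ line ℓ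
      line≡lineOf primed eq rewrite eq = ≡.refl
      line≡lineOf unprimed eq rewrite eq = ≡.refl

      module _ (sub : subShape v w ≡ true) where
        as = assignments (boxes (parts w)) letterStatuses

        new-weight : ∀ {S} → S ∈ as → agree v S ≡ true → boxesWeight c (newBoxes S) ≈ ∏ S stripWeight
        new-weight {S} S∈ ag = trans
          (reflexive (cong (λ d → y c ^ d * t ^ (length (newBoxes S) ∸ d))
            (≡.trans (cong (λ key → length (deduplicate ℕP._≟_ (map key (newBoxes S)))) (line≡lineOf ℓ pr)) (lines-leaders sub S∈ ag))))
          (sym (trans (∏-stripWeight S) (∏-leads (newBoxes S))))

        localSum : ∑ as (λ S → iverson (agree v S ∧ letterValid κ ℓ S) (∏ S stripWeight))
          ≈ ∏ (boxes (parts w)) (γ ℓ (wallDown κ ℓ) (height v) (height w))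
        localSum = begin
          ∑ as (λ S → iverson (agree v S ∧ letterValid κ ℓ S) (∏ S stripWeight))
            ≈⟨ ∑-cong-∈ as (λ {S} S∈ → trans (reflexive (cong (λ q → iverson q (∏ S stripWeight)) (agree-strip sub S∈)))
                 (sym (∏-iverson S strip stripWeight))) ⟩
          ∑ as (λ S → ∏ S (λ p → iverson (strip p) (stripWeight p)))
            ≈⟨ ∑-assignments-∏ (boxes (parts w)) letterStatuses (λ p → iverson (strip p) (stripWeight p)) ⟩
          ∏ (boxes (parts w)) (λ b → ∑ letterStatuses (λ a → iverson (strip (b , a)) (stripWeight (b , a))))
            ≈⟨ ∏-cong (boxes (parts w)) box ⟩
          ∏ (boxes (parts w)) (γ ℓ (wallDown κ ℓ) (height v) (height w)) ∎
          where
          box : ∀ b → ∑ letterStatuses (λ a → iverson (strip (b , a)) (stripWeight (b , a))) ≈ γ ℓ (wallDown κ ℓ) (height v) (height w) b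
          box (r , col) with r <ᵇ height v (col ∸ r)
          ... | true = trans (+-congˡ (+-identityʳ _)) (+-identityʳ _)
          ... | false = trans (+-identityˡ _) (+-identityʳ _)

    peel : ∀ {L} (w : Vec Bool (suc L)) → partitionSum (suc c) (boxes (parts w)) ≈
      ∑ (configs (suc L)) (λ v → downKernel (y c) ℓ (downBase κ ℓ) w v 0 * partitionSum c (boxes (parts v)))
    peel {L} w = begin
      partitionSum (suc c) (boxes (parts w)) ≈⟨ statusSum (boxes (parts w)) ⟩
      ∑ as′ (λ S → iverson (letterValid κ ℓ S) (h S)) ≈⟨ ∑-shapes w letterStatuses (letterValid κ ℓ) h (lower w) ⟩
      ∑ (configs (suc L)) (λ v → iverson (subShape v w) (∑ as′ (λ S → iverson (agree v S ∧ letterValid κ ℓ S) (h S))))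
        ≈⟨ ∑-cong (configs (suc L)) (λ v → iverson-cong-if (subShape v w) (factor v)) ⟩
      ∑ (configs (suc L)) (λ v → iverson (subShape v w) (∏ (boxes (parts w)) (γ ℓ (wallDown κ ℓ) (height v) (height w)) * partitionSum c (boxes (parts v))))
        ≈⟨ ∑-cong (configs (suc L)) (λ v → trans (sym (iverson-*ˡ (subShape v w) _ _)) (*-congʳ (downKernel-boxes κ ℓ v w))) ⟩
      ∑ (configs (suc L)) (λ v → downKernel (y c) ℓ (downBase κ ℓ) w v 0 * partitionSum c (boxes (parts v))) ∎
      where
      as′ = assignments (boxes (parts w)) letterStatuses
      h : List (Box × Status) → Carrier
      h S = boxesWeight c (newBoxes S) * partitionSum c (kept S)
      factor : ∀ v → subShape v w ≡ true → ∑ as′ (λ S → iverson (agree v S ∧ letterValid κ ℓ S) (h S))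
        ≈ ∏ (boxes (parts w)) (γ ℓ (wallDown κ ℓ) (height v) (height w)) * partitionSum c (boxes (parts v))
      factor v sub = begin
        ∑ as′ (λ S → iverson (agree v S ∧ letterValid κ ℓ S) (h S)) ≈⟨ ∑-cong-∈ as′ each ⟩
        ∑ as′ (λ S → iverson (agree v S ∧ letterValid κ ℓ S) (∏ S (stripWeight v w)) * partitionSum c (boxes (parts v)))
          ≈⟨ ∑-distribʳ as′ _ _ ⟨
        ∑ as′ (λ S → iverson (agree v S ∧ letterValid κ ℓ S) (∏ S (stripWeight v w))) * partitionSum c (boxes (parts v))
          ≈⟨ *-congʳ (localSum v w sub) ⟩
        ∏ (boxes (parts w)) (γ ℓ (wallDown κ ℓ) (height v) (height w)) * partitionSum c (boxes (parts v)) ∎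
        where
        each : ∀ {S} → S ∈ as′ → iverson (agree v S ∧ letterValid κ ℓ S) (h S)
          ≈ iverson (agree v S ∧ letterValid κ ℓ S) (∏ S (stripWeight v w)) * partitionSum c (boxes (parts v))
        each {S} S∈ = trans (iverson-cong-if (agree v S ∧ letterValid κ ℓ S) (λ av →
            *-cong (new-weight v w sub S∈ (proj₁ (∧-true av)))
              (reflexive (cong (partitionSum c) (kept-agree w S∈ v sub (proj₁ (∧-true av)))))))
          (sym (iverson-*ˡ (agree v S ∧ letterValid κ ℓ S) _ _))

-- Coefficients of the tableau sums

half-primed : ∀ i → ⌊ primedCode i /2⌋ ≡ i
half-primed zero = ≡.refl
half-primed (suc i) rewrite ℕP.+-suc i (i ℕ.+ 0) = cong suc (half-primed i)

half-unprimed : ∀ i → ⌊ unprimedCode i /2⌋ ≡ i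
half-unprimed zero = ≡.refl
half-unprimed (suc i) rewrite ℕP.+-suc i (i ℕ.+ 0) = cong suc (half-unprimed i)

isPrimed-primed : ∀ i → isPrimed (primedCode i) ≡ true
isPrimed-primed i = cong (_≡ᵇ 0) (≡.trans (cong (_% 2) (ℕP.*-comm 2 i)) (m*n%n≡0 i 2))

isPrimed-unprimed : ∀ i → isPrimed (unprimedCode i) ≡ false
isPrimed-unprimed i = cong (_≡ᵇ 0) (≡.trans (cong (λ c → suc c % 2) (ℕP.*-comm 2 i)) ([m+kn]%n≡m%n 1 i 2))

code-suc : ∀ i → 2 ℕ.* suc i ≡ suc (suc (2 ℕ.* i))
code-suc i = cong suc (ℕP.+-suc i (i ℕ.+ 0))

module Links (R : CommutativeRing 0ℓ 0ℓ) (t : CommutativeRing.Carrier R) (κ : Kind)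
  (x y : ℕ → CommutativeRing.Carrier R) where
  open CommutativeRing R hiding (zero)
  open FiniteSums R
  open Cauchy R t κ x y
  private
    module T = SVTSums R t (λ c → x ⌊ c /2⌋) κ
    module P = PPSums R t (λ c → y ⌊ c /2⌋) κ
  open T using (tableauSum) public
  open P using (partitionSum) public

  private
    data Boxes : List Box → Bool → Set where
      none : Boxes [] true
      some : ∀ b bs → Boxes (b ∷ bs) false

    boxes-clear : ∀ {L} (w : Vec Bool L) k → Boxes (boxesFrom k (parts w)) (clear L w)
    boxes-clear [] k = none
    boxes-clear (true ∷ w) k = some _ _
    boxes-clear (false ∷ w) k = boxes-clear w k

    base : ∀ {C : Set} {L} (w : Vec Bool (suc L)) (φ : List (Box × C) → Carrier) → φ [] ≈ 1# →
      ∑ (assignments (boxes (parts w)) []) φ ≈ vacuum w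
    base {L = L} w φ eq with boxes (parts w) | clear (suc L) w | boxes-clear w 0
    ... | _ | _ | none = trans (+-identityʳ _) eq
    ... | _ | _ | some b bs = refl

    diag-empty : ∀ κ → svDiagOK κ [] ≡ true
    diag-empty 𝒬 = ≡.refl
    diag-empty 𝒫 = ≡.refl

    ppDiag-empty : ∀ κ → ppDiagOK κ [] ≡ true
    ppDiag-empty 𝒬 = ≡.refl
    ppDiag-empty 𝒫 = ≡.refl

  -- Each variable owns two consecutive codes. The unprimed one is larger, so it is peeled off first
  -- and its operator is applied last.
  tableauSum-Φ : ∀ i {L} (w : Vec Bool (suc L)) → tableauSum (2 ℕ.* i) (boxes (parts w)) ≈ Φ i w
  tableauSum-Φ zero w = base w _ (reflexive (cong (λ p → iverson p 1#) (diag-empty κ)))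
  tableauSum-Φ (suc i) {L} w = trans (reflexive (cong (λ c → tableauSum c (boxes (parts w))) (code-suc i))) (trans
    (T.Peel.peel (unprimedCode i) unprimed (isPrimed-unprimed i) w)
    (∑-cong (configs (suc L)) (λ v → *-cong (trans
      (T.Peel.peel (primedCode i) primed (isPrimed-primed i) v)
      (∑-cong (configs (suc L)) (λ u → *-cong (tableauSum-Φ i u)
        (reflexive (cong (λ j → upKernel (x j) primed (UpBases.upBase (x j) κ primed) u v idle) (half-primed i))))))
      (reflexive (cong (λ j → upKernel (x j) unprimed (UpBases.upBase (x j) κ unprimed) v w idle) (half-unprimed i))))))
    where
    module UpBases x′ = UpWeights (ringOperations R) t x′

  partitionSum-Γ : ∀ j {L} (w : Vec Bool (suc L)) → partitionSum (2 ℕ.* j) (boxes (parts w)) ≈ Γ j w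
  partitionSum-Γ zero w = base w _ (reflexive (cong (λ p → iverson p 1#) (ppDiag-empty κ)))
  partitionSum-Γ (suc j) {L} w = trans (reflexive (cong (λ c → partitionSum c (boxes (parts w))) (code-suc j))) (trans
    (P.Peel.peel (unprimedCode j) unprimed (isPrimed-unprimed j) w)
    (∑-cong (configs (suc L)) (λ v → *-cong
      (reflexive (cong (λ i → downKernel (y i) unprimed (DownBases.downBase (y i) κ unprimed) w v 0) (half-unprimed j)))
      (trans (P.Peel.peel (primedCode j) primed (isPrimed-primed j) v)
      (∑-cong (configs (suc L)) (λ u → *-cong
        (reflexive (cong (λ i → downKernel (y i) primed (DownBases.downBase (y i) κ primed) v u 0) (half-primed j)))
        (partitionSum-Γ j u)))))))
    where
    module DownBases y′ = DownWeights (ringOperations R) t y′ 1# 1# 1#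

δ : ℕ → ℕ → ℕ
δ i j = bit (i ≡ᵇ j)

δ-self : ∀ i → δ i i ≡ 1
δ-self i = cong bit (≡ᵇ-true {i} ≡.refl)

δ-other : ∀ {i j} → i ≢ j → δ i j ≡ 0
δ-other i≢j = cong bit (≡ᵇ-false i≢j)

ofVar-half : ∀ i c → ofVar i c ≡ (⌊ c /2⌋ ≡ᵇ i)
ofVar-half zero zero = ≡.refl
ofVar-half zero (suc zero) = ≡.refl
ofVar-half zero (suc (suc c)) = ≡.refl
ofVar-half (suc i) zero = ≡.refl
ofVar-half (suc i) (suc zero) rewrite ℕP.+-suc i (i ℕ.+ 0) = ≡.refl
ofVar-half (suc i) (suc (suc c)) rewrite ℕP.+-suc i (i ℕ.+ 0) = ofVar-half i c

count-∷ : ∀ i c S → count (ofVar i) (c ∷ S) ≡ δ ⌊ c /2⌋ i ℕ.+ count (ofVar i) S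
count-∷ i c S rewrite ≡.sym (ofVar-half i c) with ofVar i c
... | true = ≡.refl
... | false = ≡.refl

half-< : ∀ c m → c < 2 ℕ.* m → ⌊ c /2⌋ < m
half-< c zero ()
half-< zero (suc m) _ = s≤s z≤n
half-< (suc zero) (suc m) _ = s≤s z≤n
half-< (suc (suc c)) (suc m) lt = s≤s (half-< c m (ℕP.≤-pred (ℕP.≤-pred (subst (suc (suc c) <_) (code-suc m) lt))))

svExcess : SVFilling → ℕ
svExcess F = sum (map (λ p → length (proj₂ p) ∸ 1) F)

sumTo : ℕ → (ℕ → ℕ) → ℕ
sumTo zero g = 0
sumTo (suc c) g = sumTo c g ℕ.+ g c

excess : PPFilling → ℕ → ℕ
excess F e = length (occurrences F e) ∸ lines e (occurrences F e)

lines-primed : ∀ F i → lines (primedCode i) (occurrences F (primedCode i)) ≡ distinctRows F (primedCode i)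
lines-primed F i = ≡.trans
  (cong (λ q → length (deduplicate ℕP._≟_ (map (if q then row else col) (occurrences F (primedCode i))))) (isPrimed-primed i))
  (cong (λ ks → length (deduplicate ℕP._≟_ ks))
    (≡.sym (ListP.map-∘ {g = row} {f = proj₁} (filterᵇ (λ p → proj₂ p ≡ᵇ primedCode i) F))))

lines-unprimed : ∀ F i → lines (unprimedCode i) (occurrences F (unprimedCode i)) ≡ distinctCols F (unprimedCode i)
lines-unprimed F i = ≡.trans
  (cong (λ q → length (deduplicate ℕP._≟_ (map (if q then row else col) (occurrences F (unprimedCode i))))) (isPrimed-unprimed i))
  (cong (λ ks → length (deduplicate ℕP._≟_ ks))
    (≡.sym (ListP.map-∘ {g = col} {f = proj₁} (filterᵇ (λ p → proj₂ p ≡ᵇ unprimedCode i) F))))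

-- `power j u v` stands for the monomial with exponent j of β, u of the x variables and v of the y
-- variables. Only its multiplicativity and the values at the generators are assumed, which keeps
-- the computation of weights apart from the representation of series.
module Monomials (R : CommutativeRing 0ℓ 0ℓ) (t : CommutativeRing.Carrier R) (x y : ℕ → CommutativeRing.Carrier R)
  (m n : ℕ) (power : ℕ → (ℕ → ℕ) → (ℕ → ℕ) → CommutativeRing.Carrier R) where
  open CommutativeRing R hiding (zero)
  open FiniteSums R
  open ShapeSums R using (∏-upTo-last)
  open import Relation.Binary.Reasoning.Setoid setoid
  open import Algebra.Properties.Semiring.Exp semiring using (_^_; ^-homo-*)
  open import Algebra.Properties.CommutativeSemigroup *-commutativeSemigroup using (interchange)
  open import Algebra.Properties.Ring ring using (-‿distribˡ-*; -‿involutive)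

  none : ℕ → ℕ
  none _ = 0

  signed : ℕ → Carrier → Carrier
  signed zero c = c
  signed (suc j) c = - signed j c

  module _
    (power-one : 1# ≈ power 0 none none)
    (power-* : ∀ j u v j′ u′ v′ → power j u v * power j′ u′ v′ ≈ power (j ℕ.+ j′) (λ i → u i ℕ.+ u′ i) (λ i → v i ℕ.+ v′ i))
    (power-cong : ∀ {j u v j′ u′ v′} → j ≡ j′ → (∀ i → i < m → u i ≡ u′ i) → (∀ i → i < n → v i ≡ v′ i) →
      power j u v ≈ power j′ u′ v′)
    (t-power : - t ≈ power 1 none none)
    (x-power : ∀ i → i < m → x i ≈ power 0 (δ i) none)
    (y-power : ∀ j → j < n → y j ≈ power 0 none (δ j))
    (κ : Kind) where

    open SVTSums R t (λ c → x ⌊ c /2⌋) κ using (setWeight; tableauSum) renaming (weight to svWeight)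
    open PPSums R t (λ c → y ⌊ c /2⌋) κ using (boxesWeight; partitionSum) renaming (weight to ppWeight)

    t-powers : ∀ j → (- t) ^ j ≈ power j none none
    t-powers zero = power-one
    t-powers (suc j) = trans (*-cong t-power (t-powers j)) (power-* 1 none none j none none)

    letters-power : ∀ S → (∀ {s} → s ∈ S → s < 2 ℕ.* m) → ∏ S (λ c → x ⌊ c /2⌋) ≈ power 0 (λ i → count (ofVar i) S) none
    letters-power [] lt = power-one
    letters-power (c ∷ S) lt = trans
      (*-cong (x-power ⌊ c /2⌋ (half-< c m (lt (here ≡.refl)))) (letters-power S (λ s∈ → lt (there s∈))))
      (trans (power-* 0 _ _ 0 _ _) (power-cong ≡.refl (λ i _ → ≡.sym (count-∷ i c S)) (λ _ _ → ≡.refl)))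

    set-power : ∀ S → (∀ {s} → s ∈ S → s < 2 ℕ.* m) → setWeight S ≈ power (length S ∸ 1) (λ i → count (ofVar i) S) none
    set-power S lt = trans (*-cong (t-powers (length S ∸ 1)) (letters-power S lt))
      (trans (power-* _ _ _ 0 _ _) (power-cong (ℕP.+-identityʳ _) (λ _ _ → ≡.refl) (λ _ _ → ≡.refl)))

    svWeight-power : ∀ F → (∀ {p s} → p ∈ F → s ∈ proj₂ p → s < 2 ℕ.* m) → svWeight F ≈ power (svExcess F) (svContent F) none
    svWeight-power [] lt = power-one
    svWeight-power ((b , S) ∷ F) lt = trans (*-cong (set-power S (lt (here ≡.refl))) (svWeight-power F (λ p∈ → lt (there p∈))))
      (power-* _ _ _ _ _ _)

    tableauSum-power : ∀ bs → tableauSum (2 ℕ.* m) bs ≈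
      ∑ (assignments bs (letterSets (2 ℕ.* m))) (λ F → iverson (svValid F ∧ svDiagOK κ F) (power (svExcess F) (svContent F) none))
    tableauSum-power bs = ∑-cong-∈ (assignments bs (letterSets (2 ℕ.* m))) (λ {F} F∈ →
      iverson-cong (svValid F ∧ svDiagOK κ F) (svWeight-power F (λ p∈ s∈ →
        proj₁ (∈-letterSets (2 ℕ.* m) (proj₂ (∈-assignments bs _ F∈) p∈)) s∈)))

    y-powers : ∀ j → j < n → ∀ d → y j ^ d ≈ power 0 none (λ i → d ℕ.* δ j i)
    y-powers j j<n zero = power-one
    y-powers j j<n (suc d) = trans (*-cong (y-power j j<n) (y-powers j j<n d)) (power-* 0 _ _ 0 _ _)

    signed-cong : ∀ j {c d} → c ≈ d → signed j c ≈ signed j d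
    signed-cong zero eq = eq
    signed-cong (suc j) eq = -‿cong (signed-cong j eq)

    signed-* : ∀ j c d → signed j c * d ≈ signed j (c * d)
    signed-* zero c d = refl
    signed-* (suc j) c d = trans (sym (-‿distribˡ-* _ _)) (-‿cong (signed-* j c d))

    t^-signed : ∀ j → t ^ j ≈ signed j ((- t) ^ j)
    t^-signed zero = refl
    t^-signed (suc j) = begin
      t * t ^ j ≈⟨ *-cong (sym (-‿involutive t)) (t^-signed j) ⟩
      - (- t) * signed j ((- t) ^ j) ≈⟨ -‿distribˡ-* _ _ ⟨
      - (- t * signed j ((- t) ^ j)) ≈⟨ -‿cong (trans (*-comm _ _) (trans (signed-* j _ _) (signed-cong j (*-comm _ _)))) ⟩
      - signed j (- t * (- t) ^ j) ∎

    -- Exponents of the variables treated so far, and zero for the later ones, so that each step of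
    -- the induction is a product of monomials.
    upToVar : PPFilling → ℕ → ℕ → ℕ
    upToVar F j i = if i <ᵇ j then ppWt F i else 0

    -- Both codes 2j and 2j + 1 belong to `y j`: the rows of the primed letter and the columns of
    -- the unprimed one add up to the exponent `ppWt F j`.
    ppWeight-split : ∀ F j → j ≤ n → ppWeight (2 ℕ.* j) F ≈ t ^ sumTo (2 ℕ.* j) (excess F) * power 0 none (upToVar F j)
    ppWeight-split F zero _ = trans power-one (sym (*-identityˡ _))
    ppWeight-split F (suc j) j<n = subst
      (λ c → ppWeight c F ≈ t ^ sumTo c (excess F) * power 0 none (upToVar F (suc j))) (≡.sym (code-suc j)) (begin
      ppWeight (suc (suc c)) F ≈⟨ trans (∏-upTo-last (suc c) W) (*-congʳ (∏-upTo-last c W)) ⟩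
      ppWeight c F * W c * W (suc c) ≈⟨ *-cong (*-cong (ppWeight-split F j (ℕP.<⇒≤ j<n)) (W-power c (half-primed j))) (W-power (suc c) (half-unprimed j)) ⟩
      t ^ s * P * (t ^ excess F c * Q) * (t ^ excess F (suc c) * Q′)
        ≈⟨ trans (*-congʳ (interchange _ _ _ _)) (interchange _ _ _ _) ⟩
      t ^ s * t ^ excess F c * t ^ excess F (suc c) * (P * Q * Q′)
        ≈⟨ *-cong (trans (*-congʳ (sym (^-homo-* t s (excess F c)))) (sym (^-homo-* t (s ℕ.+ excess F c) (excess F (suc c)))))
             (trans (*-congʳ (power-* 0 _ _ 0 _ _)) (trans (power-* 0 _ _ 0 _ _) (power-cong ≡.refl (λ _ _ → ≡.refl) (λ i _ → exponents i)))) ⟩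
      t ^ sumTo (suc (suc c)) (excess F) * power 0 none (upToVar F (suc j)) ∎)
      where
      c = 2 ℕ.* j
      s = sumTo c (excess F)
      W : ℕ → Carrier
      W e = boxesWeight e (occurrences F e)
      d : ℕ → ℕ
      d e = lines e (occurrences F e)
      P Q Q′ : Carrier
      P = power 0 none (upToVar F j)
      Q = power 0 none (λ i → d c ℕ.* δ j i)
      Q′ = power 0 none (λ i → d (suc c) ℕ.* δ j i)
      W-power : ∀ e → ⌊ e /2⌋ ≡ j → W e ≈ t ^ excess F e * power 0 none (λ i → d e ℕ.* δ j i)
      W-power e eq = trans (*-comm _ _) (*-congˡ (trans (reflexive (cong (λ i → y i ^ d e) eq)) (y-powers j j<n (d e))))
      exponents : ∀ i → upToVar F j i ℕ.+ d c ℕ.* δ j i ℕ.+ d (suc c) ℕ.* δ j i ≡ upToVar F (suc j) i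
      exponents i with ℕP.<-cmp i j
      ... | tri< i<j i≢j _ rewrite <ᵇ-true i<j | <ᵇ-true (ℕP.m≤n⇒m≤1+n i<j) | δ-other {j} {i} (λ eq → i≢j (≡.sym eq))
        | ℕP.*-zeroʳ (d c) | ℕP.*-zeroʳ (d (suc c)) = ≡.trans (ℕP.+-identityʳ _) (ℕP.+-identityʳ _)
      ... | tri> _ i≢j j<i rewrite <ᵇ-false (ℕP.<⇒≤ j<i) | <ᵇ-false {i} {suc j} j<i | δ-other {j} {i} (λ eq → i≢j (≡.sym eq))
        | ℕP.*-zeroʳ (d c) | ℕP.*-zeroʳ (d (suc c)) = ≡.refl
      ... | tri≈ _ ≡.refl _ rewrite <ᵇ-false (ℕP.≤-refl {j}) | <ᵇ-true (ℕP.≤-refl {suc j}) | δ-self j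
        | ℕP.*-identityʳ (d c) | ℕP.*-identityʳ (d (suc c)) =
        ≡.trans (ℕP.+-comm (d c) (d (suc c))) (cong₂ ℕ._+_ (lines-unprimed F j) (lines-primed F j))

    ppWeight-power : ∀ F → ppWeight (2 ℕ.* n) F ≈
      signed (sumTo (2 ℕ.* n) (excess F)) (power (sumTo (2 ℕ.* n) (excess F)) none (ppWt F))
    ppWeight-power F = trans (ppWeight-split F n ℕP.≤-refl) (trans (*-congʳ (t^-signed J)) (trans (signed-* J _ _)
      (signed-cong J (trans (*-congʳ (t-powers J)) (trans (power-* J _ _ 0 _ _)
        (power-cong (ℕP.+-identityʳ J) (λ _ _ → ≡.refl) (λ i i<n → cong (λ q → if q then ppWt F i else 0) (<ᵇ-true i<n))))))))
      where J = sumTo (2 ℕ.* n) (excess F)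

    partitionSum-power : ∀ bs → partitionSum (2 ℕ.* n) bs ≈
      ∑ (assignments bs (upTo (2 ℕ.* n))) (λ F → iverson (ppValid F ∧ ppDiagOK κ F)
        (signed (sumTo (2 ℕ.* n) (excess F)) (power (sumTo (2 ℕ.* n) (excess F)) none (ppWt F))))
    partitionSum-power bs = ∑-cong (assignments bs (upTo (2 ℕ.* n))) (λ F →
      iverson-cong (ppValid F ∧ ppDiagOK κ F) (ppWeight-power F))

tabulate-zeros : ∀ m → tabulate {n = m} (λ _ → 0) ≡ zeros
tabulate-zeros zero = ≡.refl
tabulate-zeros (suc m) = cong (0 ∷_) (tabulate-zeros m)

zeros-++ : ∀ m n → zeros {m ℕ.+ n} ≡ zeros {m} ++ᵥ zeros {n}
zeros-++ zero n = ≡.refl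
zeros-++ (suc m) n = cong (0 ∷_) (zeros-++ m n)

ε-left : ∀ {m} (i : Fin m) n → ε (i ↑ˡ n) ≡ tabulate (δ (toℕ i) ∘ toℕ) ++ᵥ zeros {n}
ε-left {suc m} Fin.zero n = cong (1 ∷_) (≡.trans (zeros-++ m n) (cong (_++ᵥ zeros {n}) (≡.sym (tabulate-zeros m))))
ε-left (Fin.suc i) n = cong (0 ∷_) (ε-left i n)

ε-right : ∀ m {n} (j : Fin n) → ε (m ↑ʳ j) ≡ zeros {m} ++ᵥ tabulate (δ (toℕ j) ∘ toℕ)
ε-right zero {suc n} Fin.zero = cong (1 ∷_) (≡.sym (tabulate-zeros n))
ε-right zero (Fin.suc j) = cong (0 ∷_) (ε-right zero j)
ε-right (suc m) j = cong (0 ∷_) (ε-right m j)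

at-lookup : ∀ {m} (a : Vec ℕ m) i → at (toList a) (toℕ i) ≡ lookup a i
at-lookup (x ∷ a) Fin.zero = ≡.refl
at-lookup (x ∷ a) (Fin.suc i) = at-lookup a i

matches : (ℕ → ℕ) → ∀ {m} → Vec ℕ m → Bool
matches u {m} a = all (λ i → u i ≡ᵇ at (toList a) i) (upTo m)

matches-sound : ∀ u {m} (a : Vec ℕ m) → matches u a ≡ true → tabulate (u ∘ toℕ) ≡ a
matches-sound u {m} a h = ≡.trans (VecP.tabulate-cong (λ i →
  ≡.trans (≡ᵇ-≡ _ _ (all-true (upTo m) h (∈-upTo⁺ (FinP.toℕ<n i)))) (at-lookup a i))) (VecP.tabulate∘lookup a)

matches-complete : ∀ u {m} (a : Vec ℕ m) → tabulate (u ∘ toℕ) ≡ a → matches u a ≡ true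
matches-complete u {m} _ ≡.refl = all-intro (upTo m) (λ {i} i∈ → ≡ᵇ-true {u i} (≡.sym (value i (∈-upTo⁻ i∈))))
  where
  value : ∀ i → i < m → at (toList (tabulate {n = m} (u ∘ toℕ))) i ≡ u i
  value i i<m = ≡.trans (cong (at (toList (tabulate {n = m} (u ∘ toℕ)))) (≡.sym (FinP.toℕ-fromℕ< i<m)))
    (≡.trans (at-lookup (tabulate {n = m} (u ∘ toℕ)) (fromℕ< i<m))
    (≡.trans (VecP.lookup∘tabulate (u ∘ toℕ) (fromℕ< i<m)) (cong u (FinP.toℕ-fromℕ< i<m))))

open ∑ℤ using (∑; iverson)

∑-count : {A : Set} (p : A → Bool) (as : List A) → ∑ as (λ a → iverson (p a) (+ 1)) ≡ + count p as
∑-count p [] = ≡.refl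
∑-count p (a ∷ as) with p a
... | true = cong (λ z → (+ 1) ℤ.+ z) (∑-count p as)
... | false = ≡.trans (ℤP.+-identityˡ _) (∑-count p as)

iverson-iverson : ∀ p q c → iverson p (iverson q c) ≡ iverson (p ∧ q) c
iverson-iverson true q c = ≡.refl
iverson-iverson false q c = ≡.refl

module Evaluation (m n : ℕ) where
  exponents : ℕ → (ℕ → ℕ) → (ℕ → ℕ) → Vec ℕ (suc (m ℕ.+ n))
  exponents j u v = j ∷ (tabulate {n = m} (u ∘ toℕ) ++ᵥ tabulate {n = n} (v ∘ toℕ))

  power : ℕ → (ℕ → ℕ) → (ℕ → ℕ) → Ser (suc (m ℕ.+ n))
  power j u v = mono (exponents j u v)

  exponents-+ : ∀ j u v j′ u′ v′ →
    exponents j u v +ᵥ exponents j′ u′ v′ ≡ exponents (j ℕ.+ j′) (λ i → u i ℕ.+ u′ i) (λ i → v i ℕ.+ v′ i)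
  exponents-+ j u v j′ u′ v′ = cong (j ℕ.+ j′ ∷_) (≡.trans
    (VecP.zipWith-++ ℕ._+_ (tabulate {n = m} (u ∘ toℕ)) (tabulate {n = n} (v ∘ toℕ)) (tabulate (u′ ∘ toℕ)) (tabulate (v′ ∘ toℕ)))
    (cong₂ (_++ᵥ_ {m = m} {n = n}) (zip (u ∘ toℕ) (u′ ∘ toℕ)) (zip (v ∘ toℕ) (v′ ∘ toℕ))))
    where
    zip : ∀ {d} (f g : Fin d → ℕ) → tabulate f +ᵥ tabulate g ≡ tabulate (λ i → f i ℕ.+ g i)
    zip {zero} f g = ≡.refl
    zip {suc d} f g = cong (f Fin.zero ℕ.+ g Fin.zero ∷_) (zip (f ∘ Fin.suc) (g ∘ Fin.suc))

  exponents-cong : ∀ {j u v j′ u′ v′} → j ≡ j′ → (∀ i → i < m → u i ≡ u′ i) → (∀ i → i < n → v i ≡ v′ i) →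
    exponents j u v ≡ exponents j′ u′ v′
  exponents-cong {j} ≡.refl equ eqv = cong₂ (λ (a : Vec ℕ m) (b : Vec ℕ n) → j ∷ (a ++ᵥ b))
    (VecP.tabulate-cong (λ i → equ (toℕ i) (FinP.toℕ<n i))) (VecP.tabulate-cong (λ i → eqv (toℕ i) (FinP.toℕ<n i)))

  power-at : ∀ j u v k (a : Vec ℕ m) (b : Vec ℕ n) →
    power j u v (k ∷ (a ++ᵥ b)) ≡ iverson ((j ≡ᵇ k) ∧ matches u a ∧ matches v b) (+ 1)
  power-at j u v k a b with (j ≡ᵇ k) ∧ matches u a ∧ matches v b in eq
  ... | true with ∧-true eq
  ...   | h₁ , h with ∧-true h
  ...     | h₂ , h₃ = ≡.trans (cong (power j u v) (≡.sym equal)) (mono-self (exponents j u v))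
    where
    equal : exponents j u v ≡ k ∷ (a ++ᵥ b)
    equal = cong₂ _∷_ (≡ᵇ-≡ j k h₁) (cong₂ _++ᵥ_ (matches-sound u a h₂) (matches-sound v b h₃))
  power-at j u v k a b | false = mono-other (exponents j u v) (k ∷ (a ++ᵥ b)) (λ e → differ (VecP.∷-injective e))
    where
    differ : (j ≡ k) × (tabulate {n = m} (u ∘ toℕ) ++ᵥ tabulate {n = n} (v ∘ toℕ) ≡ a ++ᵥ b) → ⊥
    differ (j≡ , e) = case (≡.trans (≡.sym eq) (∧-intro (≡ᵇ-true j≡) (∧-intro
        (matches-complete u a (VecP.++-injectiveˡ {ys = tabulate (v ∘ toℕ)} {zs = b} (tabulate (u ∘ toℕ)) a e))
        (matches-complete v b (VecP.++-injectiveʳ {ys = tabulate (v ∘ toℕ)} {zs = b} (tabulate (u ∘ toℕ)) a e)))))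
      where
      case : false ≡ true → ⊥
      case ()

  matches-zeros : ∀ {d} (c : Vec ℕ d) → c ≢ zeros → matches (λ _ → 0) c ≡ false
  matches-zeros {d} c ne with matches (λ _ → 0) c in eq
  ... | false = ≡.refl
  ... | true = ⊥-elim (ne (≡.trans (≡.sym (matches-sound (λ _ → 0) c eq)) (tabulate-zeros d)))

  matches-zero : ∀ {d} → matches (λ _ → 0) (zeros {d}) ≡ true
  matches-zero {d} = matches-complete (λ _ → 0) zeros (tabulate-zeros d)

  module _ (bound : Vec ℕ (suc (m ℕ.+ n))) where
    open CommutativeRing (truncatedRing bound) using (_≈_; 1#; _+_; _*_; trans; sym; reflexive) renaming (-_ to neg)
    open FiniteSums (truncatedRing bound) using () renaming (∑ to ∑ₛ; iverson to iversonₛ)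

    ∑ₛ-at : {A : Set} (as : List A) (f : A → Ser (suc (m ℕ.+ n))) → ∀ e → ∑ₛ as f e ≡ ∑ as (λ a → f a e)
    ∑ₛ-at [] f e = ≡.refl
    ∑ₛ-at (a ∷ as) f e = cong (λ z → f a e ℤ.+ z) (∑ₛ-at as f e)

    iversonₛ-at : ∀ p (f : Ser (suc (m ℕ.+ n))) e → iversonₛ p f e ≡ iverson p (f e)
    iversonₛ-at true f e = ≡.refl
    iversonₛ-at false f e = ≡.refl

    power-one : 1# ≈ power 0 (λ _ → 0) (λ _ → 0)
    power-one = trans (coefficients (λ e _ → ≡.sym (mono-zeros e))) (reflexive (cong mono
      (cong (0 ∷_) (≡.trans (zeros-++ m n) (cong₂ _++ᵥ_ (≡.sym (tabulate-zeros m)) (≡.sym (tabulate-zeros n)))))))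

    power-* : ∀ j u v j′ u′ v′ →
      power j u v * power j′ u′ v′ ≈ power (j ℕ.+ j′) (λ i → u i ℕ.+ u′ i) (λ i → v i ℕ.+ v′ i)
    power-* j u v j′ u′ v′ = trans (mono-* (exponents j u v) (exponents j′ u′ v′) bound)
      (reflexive (cong mono (exponents-+ j u v j′ u′ v′)))

length-boxes : ∀ k ls → length (boxesFrom k ls) ≡ sum ls
length-boxes k [] = ≡.refl
length-boxes k (l ∷ ls) = ≡.trans (ListP.length-++ (map (λ j → (k , k ℕ.+ j)) (upTo l)))
  (cong₂ ℕ._+_ (≡.trans (ListP.length-map _ (upTo l)) (ListP.length-upTo l)) (length-boxes (suc k) ls))

length-assignment : {C : Set} (λ′ : List ℕ) (cs : List C) {F : List (Box × C)} →
  F ∈ assignments (boxes λ′) cs → length F ≡ sum λ′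
length-assignment λ′ cs {F} F∈ = ≡.trans (≡.sym (ListP.length-map proj₁ F))
  (≡.trans (cong length (proj₁ (∈-assignments (boxes λ′) cs F∈))) (length-boxes 0 λ′))

svSize-excess : ∀ F → (∀ {p} → p ∈ F → 1 ≤ length (proj₂ p)) → svSize F ≡ length F ℕ.+ svExcess F
svSize-excess [] ne = ≡.refl
svSize-excess ((b , []) ∷ F) ne = ⊥-elim (ℕP.n≮0 (ne (here ≡.refl)))
svSize-excess ((b , s ∷ S) ∷ F) ne = cong suc (≡.trans (cong (length S ℕ.+_) (svSize-excess F (λ p∈ → ne (there p∈))))
  (x∙yz≈y∙xz (length S) (length F) (svExcess F)))
  where open import Algebra.Properties.CommutativeSemigroup ℕP.+-commutativeSemigroup using (x∙yz≈y∙xz)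

svSize-shape : ∀ (λ′ : List ℕ) c {F} → F ∈ assignments (boxes λ′) (letterSets c) → svSize F ≡ sum λ′ ℕ.+ svExcess F
svSize-shape λ′ c {F} F∈ = ≡.trans (svSize-excess F (λ p∈ → nonempty (proj₂ (∈-letterSets c (proj₂ (∈-assignments (boxes λ′) _ F∈) p∈)))))
  (cong (ℕ._+ svExcess F) (length-assignment λ′ (letterSets c) F∈))
  where
  nonempty : ∀ {S : List ℕ} → (∃ λ s → s ∈ S) → 1 ≤ length S
  nonempty {s ∷ S} _ = s≤s z≤n

sumTo-+ : ∀ c f g → sumTo c (λ e → f e ℕ.+ g e) ≡ sumTo c f ℕ.+ sumTo c g
sumTo-+ zero f g = ≡.refl
sumTo-+ (suc c) f g = ≡.trans (cong (ℕ._+ (f c ℕ.+ g c)) (sumTo-+ c f g)) (interchange (sumTo c f) (sumTo c g) (f c) (g c))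
  where open import Algebra.Properties.CommutativeSemigroup ℕP.+-commutativeSemigroup using (interchange)

sumTo-cong : ∀ c {f g} → (∀ e → e < c → f e ≡ g e) → sumTo c f ≡ sumTo c g
sumTo-cong zero eq = ≡.refl
sumTo-cong (suc c) eq = cong₂ ℕ._+_ (sumTo-cong c (λ e e<c → eq e (ℕP.m≤n⇒m≤1+n e<c))) (eq c ℕP.≤-refl)

sumTo-zero : ∀ c → sumTo c (λ _ → 0) ≡ 0
sumTo-zero zero = ≡.refl
sumTo-zero (suc c) = ≡.trans (ℕP.+-identityʳ _) (sumTo-zero c)

sumTo-δ : ∀ c {e} → e < c → sumTo c (δ e) ≡ 1
sumTo-δ (suc c) {e} e<c with ℕP.m≤n⇒m<n∨m≡n e<c
... | inj₁ (s≤s e<c′) = ≡.trans (cong₂ ℕ._+_ (sumTo-δ c e<c′) (δ-other (ℕP.<⇒≢ e<c′))) ≡.refl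
... | inj₂ ≡.refl = ≡.trans (cong₂ ℕ._+_ (≡.trans (sumTo-cong c (λ i i<c → δ-other (λ eq → ℕP.<⇒≢ i<c (≡.sym eq)))) (sumTo-zero c)) (δ-self e)) ≡.refl

sumTo-occurrences : ∀ c (F : PPFilling) → (∀ {p} → p ∈ F → proj₂ p < c) → sumTo c (λ e → length (occurrences F e)) ≡ length F
sumTo-occurrences c [] lt = sumTo-zero c
sumTo-occurrences c ((b , e) ∷ F) lt = ≡.trans (sumTo-cong c (λ e′ _ → head e′))
  (≡.trans (sumTo-+ c (δ e) (λ e′ → length (occurrences F e′)))
    (cong₂ ℕ._+_ (sumTo-δ c (lt (here ≡.refl))) (sumTo-occurrences c F (λ p∈ → lt (there p∈)))))
  where
  head : ∀ e′ → length (occurrences ((b , e) ∷ F) e′) ≡ δ e e′ ℕ.+ length (occurrences F e′)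
  head e′ with e ≡ᵇ e′
  ... | true = ≡.refl
  ... | false = ≡.refl

sumTo-pairs : ∀ j (g : ℕ → ℕ) → sumTo (2 ℕ.* j) g ≡ sumTo j (λ i → g (unprimedCode i) ℕ.+ g (primedCode i))
sumTo-pairs zero g = ≡.refl
sumTo-pairs (suc j) g = ≡.trans (cong (λ c → sumTo c g) (code-suc j)) (≡.trans (ℕP.+-assoc _ (g (primedCode j)) (g (unprimedCode j)))
  (cong₂ ℕ._+_ (sumTo-pairs j g) (ℕP.+-comm (g (primedCode j)) (g (unprimedCode j)))))

sumTo-head : ∀ c g → sumTo (suc c) g ≡ g 0 ℕ.+ sumTo c (g ∘ suc)
sumTo-head zero g = ≡.sym (ℕP.+-identityʳ (g 0))
sumTo-head (suc c) g = ≡.trans (cong (ℕ._+ g (suc c)) (sumTo-head c g)) (ℕP.+-assoc (g 0) _ _)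

sum-at : ∀ {n} (b : Vec ℕ n) → sum (toList b) ≡ sumTo n (at (toList b))
sum-at [] = ≡.refl
sum-at {suc n} (x ∷ b) = ≡.trans (cong (x ℕ.+_) (sum-at b)) (≡.sym (sumTo-head n (at (x ∷ toList b))))

-- For each letter the number of lines plus the excess is the number of its boxes. Summed over the
-- letters this says that the exponent of -β is |λ| - |wt|.
ppWt-excess : ∀ n (F : PPFilling) → (∀ {p} → p ∈ F → proj₂ p < 2 ℕ.* n) →
  sumTo n (ppWt F) ℕ.+ sumTo (2 ℕ.* n) (excess F) ≡ length F
ppWt-excess n F lt = ≡.trans (cong (ℕ._+ sumTo (2 ℕ.* n) (excess F)) (≡.sym (≡.trans
    (sumTo-pairs n (λ e → lines e (occurrences F e)))
    (sumTo-cong n (λ i _ → cong₂ ℕ._+_ (lines-unprimed F i) (lines-primed F i))))))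
  (≡.trans (≡.sym (sumTo-+ (2 ℕ.* n) _ (excess F)))
  (≡.trans (sumTo-cong (2 ℕ.* n) (λ e _ → ℕP.m+[n∸m]≡n (fewer e))) (sumTo-occurrences (2 ℕ.* n) F lt)))
  where
  fewer : ∀ e → lines e (occurrences F e) ≤ length (occurrences F e)
  fewer e = ℕP.≤-trans (ListP.length-deduplicate ℕP._≟_ (map (lineOf e) (occurrences F e)))
    (ℕP.≤-reflexive (ListP.length-map (lineOf e) (occurrences F e)))

+-≡ᵇ : ∀ s i j → (s ℕ.+ i ≡ᵇ s ℕ.+ j) ≡ (i ≡ᵇ j)
+-≡ᵇ zero i j = ≡.refl
+-≡ᵇ (suc s) i j = +-≡ᵇ s i j

tableauCoef partitionCoef : Kind → List ℕ → List ℕ → ℕ → ℤ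
tableauCoef 𝒬 = GQcoef
tableauCoef 𝒫 = GPcoef
partitionCoef 𝒬 = PPPcoef
partitionCoef 𝒫 = PPQcoef

count-cong : {A : Set} (as : List A) {p q : A → Bool} → (∀ {a} → a ∈ as → p a ≡ q a) → count p as ≡ count q as
count-cong as eq = cong length (filter-cong as eq)

-- The number `l` of variables is an argument of its own because the length of `toList a` equals m
-- only propositionally.
svCond : Kind → List ℕ → (l : ℕ) → List ℕ → ℕ → SVFilling → Bool
svCond κ λ′ l a k F = (svValid F ∧ svDiagOK κ F) ∧ all (λ i → svContent F i ≡ᵇ at a i) (upTo l) ∧ (svSize F ≡ᵇ sum λ′ ℕ.+ k)

tableauCoef-count : ∀ κ λ′ a k → tableauCoef κ λ′ a k ≡ + count (svCond κ λ′ (length a) a k) (svFillings λ′ (length a))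
tableauCoef-count 𝒬 λ′ a k = cong (λ c → + c) (count-cong (svFillings λ′ (length a)) (λ {F} _ →
  cong (_∧ (svWeightIs F a ∧ (svSize F ≡ᵇ sum λ′ ℕ.+ k))) (≡.sym (BoolP.∧-identityʳ (svValid F)))))
tableauCoef-count 𝒫 λ′ a k = cong (λ c → + c) (count-cong (svFillings λ′ (length a)) (λ {F} _ →
  ≡.sym (BoolP.∧-assoc (svValid F) (svNoPrimedDiag F) (svWeightIs F a ∧ (svSize F ≡ᵇ sum λ′ ℕ.+ k)))))

ppCond : Kind → List ℕ → (l : ℕ) → List ℕ → ℕ → PPFilling → Bool
ppCond κ λ′ l b k F = (ppValid F ∧ ppDiagOK κ F) ∧ all (λ i → ppWt F i ≡ᵇ at b i) (upTo l) ∧ (sum b ℕ.+ k ≡ᵇ sum λ′)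

partitionCoef-count : ∀ κ λ′ b k → partitionCoef κ λ′ b k ≡ negOnePow k ℤ.* (+ count (ppCond κ λ′ (length b) b k) (ppFillings λ′ (length b)))
partitionCoef-count 𝒫 λ′ b k = cong (λ c → negOnePow k ℤ.* (+ c)) (count-cong (ppFillings λ′ (length b)) (λ {F} _ →
  cong (_∧ (ppWeightIs F b ∧ (sum b ℕ.+ k ≡ᵇ sum λ′))) (≡.sym (BoolP.∧-identityʳ (ppValid F)))))
partitionCoef-count 𝒬 λ′ b k = cong (λ c → negOnePow k ℤ.* (+ c)) (count-cong (ppFillings λ′ (length b)) (λ {F} _ →
  ≡.sym (BoolP.∧-assoc (ppValid F) (ppNoUnprimedDiag F) (ppWeightIs F b ∧ (sum b ℕ.+ k ≡ᵇ sum λ′)))))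

module Extraction (κ : Kind) (m n k : ℕ) (a : Vec ℕ m) (b : Vec ℕ n) where
  open Truncation m n k a b
  open Evaluation m n
  open CommutativeRing R using (_≈_; 1#; _*_; trans; sym; refl; reflexive; *-cong; ring; +-cong) renaming (-_ to neg)
  open FiniteSums R using () renaming (∑ to ∑ₛ; iverson to iversonₛ; ∑-cong to ∑ₛ-cong)
  open import Algebra.Properties.Ring ring using (-‿involutive)

  none : ℕ → ℕ
  none _ = 0

  module M = Monomials R t x y m n power
  open M using (signed)

  x-power : ∀ i → i < m → x i ≈ power 0 (δ i) none
  x-power i i<m rewrite extend-< (λ i → var (xpos m n i)) (λ _ → + 0) i<m = reflexive (cong mono (cong (0 ∷_)
    (≡.trans (ε-left (fromℕ< i<m) n) (cong₂ _++ᵥ_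
      (VecP.tabulate-cong (λ j → cong (λ i → δ i (toℕ j)) (FinP.toℕ-fromℕ< i<m))) (≡.sym (tabulate-zeros n))))))

  y-power : ∀ j → j < n → y j ≈ power 0 none (δ j)
  y-power j j<n rewrite extend-< (λ j → var (ypos m n j)) (λ _ → + 0) j<n = reflexive (cong mono (cong (0 ∷_)
    (≡.trans (ε-right m (fromℕ< j<n)) (cong₂ _++ᵥ_ (≡.sym (tabulate-zeros m))
      (VecP.tabulate-cong (λ i → cong (λ j → δ j (toℕ i)) (FinP.toℕ-fromℕ< j<n)))))))

  t-power : neg t ≈ power 1 none none
  t-power = trans (-‿involutive β) (reflexive (cong mono (cong (1 ∷_)
    (≡.trans (zeros-++ m n) (cong₂ _++ᵥ_ (≡.sym (tabulate-zeros m)) (≡.sym (tabulate-zeros n)))))))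

  svTerm : SVFilling → Ser (suc (m ℕ.+ n))
  svTerm F = iversonₛ (svValid F ∧ svDiagOK κ F) (power (svExcess F) (svContent F) none)

  ppTerm : PPFilling → Ser (suc (m ℕ.+ n))
  ppTerm F = iversonₛ (ppValid F ∧ ppDiagOK κ F)
    (signed (sumTo (2 ℕ.* n) (excess F)) (power (sumTo (2 ℕ.* n) (excess F)) none (ppWt F)))

  tableauSeries partitionSeries : List ℕ → Ser (suc (m ℕ.+ n))
  tableauSeries λ′ = ∑ₛ (assignments (boxes λ′) (letterSets (2 ℕ.* m))) svTerm
  partitionSeries λ′ = ∑ₛ (assignments (boxes λ′) (upTo (2 ℕ.* n))) ppTerm

  -- The margin provides the room that Φ needs. The summand |a| ensures in addition that all strict
  -- partitions of size at most |a| have parts within the bound.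
  L : ℕ
  L = sum (toList a) ℕ.+ Cauchy.margin R t κ x y p m

  cauchy-series : ∑ₛ (configs (suc L)) (λ w → tableauSeries (parts w) * partitionSeries (parts w)) ≈ kernel m n
  cauchy-series = trans (∑ₛ-cong (configs (suc L)) (λ w → sym (*-cong
      {tableauSum (2 ℕ.* m) (boxes (parts w))} {tableauSeries (parts w)}
      {partitionSum (2 ℕ.* n) (boxes (parts w))} {partitionSeries (parts w)}
      (M.tableauSum-power (power-one bound) (power-* bound) (λ {j} {u} {v} {j′} {u′} {v′} → power-cong {j} {u} {v} {j′} {u′} {v′}) t-power x-power y-power κ (boxes (parts w)))
      (M.partitionSum-power (power-one bound) (power-* bound) (λ {j} {u} {v} {j′} {u′} {v′} → power-cong {j} {u} {v} {j′} {u′} {v′}) t-power x-power y-power κ (boxes (parts w))))))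
    (trans (∑ₛ-cong (configs (suc L)) (λ w → *-cong
      {tableauSum (2 ℕ.* m) (boxes (parts w))} {C.Φ m w} {partitionSum (2 ℕ.* n) (boxes (parts w))} {C.Γ n w}
      (tableauSum-Φ m w) (partitionSum-Γ n w)))
    (trans (C.cauchy p f m n nil factor {L} (ℕP.m≤n⇒m≤1+n (ℕP.m≤n+m _ (sum (toList a)))) n ℕP.≤-refl)
    (trans (reflexive (≡.trans (prods n _) (prods-cong n (λ j → prods m (λ i → f i j))))) (sym kernel-prod))))
    where
    open Links R t κ x y
    module C = Cauchy R t κ x y
    prods : ∀ j g → C.prod j g ≡ prod j g
    prods zero g = ≡.refl
    prods (suc j) g = cong (_* g j) (prods j g)
    prods-cong : ∀ j {g h : ℕ → Ser (suc (m ℕ.+ n))} → (∀ i → g i ≡ h i) → prod j g ≡ prod j h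
    prods-cong zero eq = ≡.refl
    prods-cong (suc j) eq = cong₂ _*_ (prods-cong j eq) (eq j)
    power-cong : ∀ {j u v j′ u′ v′} → j ≡ j′ → (∀ i → i < m → u i ≡ u′ i) → (∀ i → i < n → v i ≡ v′ i) →
      power j u v ≈ power j′ u′ v′
    power-cong {j} {u} {v} {j′} {u′} {v′} eqj equ eqv =
      reflexive (cong mono (exponents-cong {j} {u} {v} {j′} {u′} {v′} eqj equ eqv))

  svTerm-at : ∀ F k₁ (a′ : Vec ℕ m) (b′ : Vec ℕ n) → svTerm F (k₁ ∷ (a′ ++ᵥ b′))
    ≡ iverson ((svValid F ∧ svDiagOK κ F) ∧ (svExcess F ≡ᵇ k₁) ∧ matches (svContent F) a′ ∧ matches none b′) (+ 1)
  svTerm-at F k₁ a′ b′ = ≡.trans (iversonₛ-at bound (svValid F ∧ svDiagOK κ F) _ (k₁ ∷ (a′ ++ᵥ b′)))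
    (≡.trans (cong (iverson (svValid F ∧ svDiagOK κ F)) (power-at (svExcess F) (svContent F) none k₁ a′ b′))
      (iverson-iverson (svValid F ∧ svDiagOK κ F) _ (+ 1)))

  tableauSeries-at : ∀ λ′ k₁ (a′ : Vec ℕ m) (b′ : Vec ℕ n) → tableauSeries λ′ (k₁ ∷ (a′ ++ᵥ b′))
    ≡ + count (λ F → (svValid F ∧ svDiagOK κ F) ∧ (svExcess F ≡ᵇ k₁) ∧ matches (svContent F) a′ ∧ matches none b′)
          (assignments (boxes λ′) (letterSets (2 ℕ.* m)))
  tableauSeries-at λ′ k₁ a′ b′ = ≡.trans (∑ₛ-at bound as svTerm (k₁ ∷ (a′ ++ᵥ b′)))
    (≡.trans (∑ℤ.∑-cong as (λ F → svTerm-at F k₁ a′ b′)) (∑-count _ as))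
    where as = assignments (boxes λ′) (letterSets (2 ℕ.* m))

  count-none : {A : Set} (as : List A) {q : A → Bool} → (∀ {c} → c ∈ as → q c ≡ false) → + count q as ≡ + 0
  count-none as eq = cong (λ cs → + length cs) (filter-none as eq)

  tableauSeries-support : ∀ λ′ k₁ (a′ : Vec ℕ m) (b′ : Vec ℕ n) → b′ ≢ zeros → tableauSeries λ′ (k₁ ∷ (a′ ++ᵥ b′)) ≡ + 0
  tableauSeries-support λ′ k₁ a′ b′ ne = ≡.trans (tableauSeries-at λ′ k₁ a′ b′)
    (count-none (assignments (boxes λ′) (letterSets (2 ℕ.* m))) (λ {F} _ → vanish (svValid F ∧ svDiagOK κ F) (svExcess F ≡ᵇ k₁) (matches (svContent F) a′) (matches-zeros b′ ne)))
    where
    vanish : ∀ c d e {g} → g ≡ false → (c ∧ d ∧ e ∧ g) ≡ false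
    vanish false d e ≡.refl = ≡.refl
    vanish true false e ≡.refl = ≡.refl
    vanish true true false ≡.refl = ≡.refl
    vanish true true true ≡.refl = ≡.refl

  tableauSeries-coef : ∀ λ′ k₁ → tableauSeries λ′ (k₁ ∷ (a ++ᵥ zeros {n})) ≡ tableauCoef κ λ′ (toList a) k₁
  tableauSeries-coef λ′ k₁ = ≡.trans (tableauSeries-at λ′ k₁ a zeros) (≡.trans
    (cong (λ c → + c) (count-cong (assignments (boxes λ′) (letterSets (2 ℕ.* m))) same))
    (≡.trans (cong (λ l → + count (svCond κ λ′ l (toList a) k₁) (svFillings λ′ l)) (≡.sym (VecP.length-toList a)))
      (≡.sym (tableauCoef-count κ λ′ (toList a) k₁))))
    where
    swap : ∀ c d e {g} → g ≡ true → (c ∧ d ∧ e ∧ g) ≡ (c ∧ e ∧ d)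
    swap false d e _ = ≡.refl
    swap true true e ≡.refl = ≡.refl
    swap true false e ≡.refl = ≡.sym (BoolP.∧-zeroʳ e)
    same : ∀ {F} → F ∈ assignments (boxes λ′) (letterSets (2 ℕ.* m)) →
      ((svValid F ∧ svDiagOK κ F) ∧ (svExcess F ≡ᵇ k₁) ∧ matches (svContent F) a ∧ matches none (zeros {n})) ≡ svCond κ λ′ m (toList a) k₁ F
    same {F} F∈ rewrite svSize-shape λ′ (2 ℕ.* m) F∈ | +-≡ᵇ (sum λ′) (svExcess F) k₁ =
      swap (svValid F ∧ svDiagOK κ F) (svExcess F ≡ᵇ k₁) (matches (svContent F) a) (matches-zero {n})

  signed-at : ∀ j (g : Ser (suc (m ℕ.+ n))) e → signed j g e ≡ negOnePow j ℤ.* g e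
  signed-at zero g e = ≡.sym (ℤP.*-identityˡ (g e))
  signed-at (suc j) g e = ≡.trans (cong ℤ.-_ (signed-at j g e)) (ℤP.neg-distribˡ-* (negOnePow j) (g e))

  ppCondition : PPFilling → ℕ → Vec ℕ m → Vec ℕ n → Bool
  ppCondition F k₂ a′ b′ = (ppValid F ∧ ppDiagOK κ F) ∧ (sumTo (2 ℕ.* n) (excess F) ≡ᵇ k₂) ∧ matches none a′ ∧ matches (ppWt F) b′

  ppTerm-at : ∀ F k₂ (a′ : Vec ℕ m) (b′ : Vec ℕ n) → ppTerm F (k₂ ∷ (a′ ++ᵥ b′)) ≡ negOnePow k₂ ℤ.* iverson (ppCondition F k₂ a′ b′) (+ 1)
  ppTerm-at F k₂ a′ b′ = ≡.trans (iversonₛ-at bound V _ (k₂ ∷ (a′ ++ᵥ b′)))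
    (≡.trans (cong (iverson V) (≡.trans (signed-at J (power J none (ppWt F)) (k₂ ∷ (a′ ++ᵥ b′)))
      (cong (negOnePow J ℤ.*_) (power-at J none (ppWt F) k₂ a′ b′))))
      (evaluate V (J ≡ᵇ k₂) (λ eq → ≡ᵇ-≡ J k₂ eq) (matches none a′ ∧ matches (ppWt F) b′)))
    where
    J = sumTo (2 ℕ.* n) (excess F)
    V = ppValid F ∧ ppDiagOK κ F
    evaluate : ∀ V q → (q ≡ true → J ≡ k₂) → ∀ r →
      iverson V (negOnePow J ℤ.* iverson (q ∧ r) (+ 1)) ≡ negOnePow k₂ ℤ.* iverson (V ∧ q ∧ r) (+ 1)
    evaluate false q eq r = ≡.sym (ℤP.*-zeroʳ (negOnePow k₂))
    evaluate true false eq r = ≡.trans (ℤP.*-zeroʳ (negOnePow J)) (≡.sym (ℤP.*-zeroʳ (negOnePow k₂)))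
    evaluate true true eq r = cong (λ j → negOnePow j ℤ.* iverson r (+ 1)) (eq ≡.refl)

  partitionSeries-at : ∀ λ′ k₂ (a′ : Vec ℕ m) (b′ : Vec ℕ n) → partitionSeries λ′ (k₂ ∷ (a′ ++ᵥ b′))
    ≡ negOnePow k₂ ℤ.* + count (λ F → ppCondition F k₂ a′ b′) (assignments (boxes λ′) (upTo (2 ℕ.* n)))
  partitionSeries-at λ′ k₂ a′ b′ = ≡.trans (∑ₛ-at bound as ppTerm (k₂ ∷ (a′ ++ᵥ b′)))
    (≡.trans (∑ℤ.∑-cong as (λ F → ppTerm-at F k₂ a′ b′))
    (≡.trans (≡.sym (∑ℤ.∑-distribˡ as (negOnePow k₂) _)) (cong (negOnePow k₂ ℤ.*_) (∑-count _ as))))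
    where as = assignments (boxes λ′) (upTo (2 ℕ.* n))

  partitionSeries-support : ∀ λ′ k₂ (a′ : Vec ℕ m) (b′ : Vec ℕ n) → a′ ≢ zeros → partitionSeries λ′ (k₂ ∷ (a′ ++ᵥ b′)) ≡ + 0
  partitionSeries-support λ′ k₂ a′ b′ ne = ≡.trans (partitionSeries-at λ′ k₂ a′ b′)
    (≡.trans (cong (negOnePow k₂ ℤ.*_) (count-none (assignments (boxes λ′) (upTo (2 ℕ.* n)))
        (λ {F} _ → vanish (ppValid F ∧ ppDiagOK κ F) (sumTo (2 ℕ.* n) (excess F) ≡ᵇ k₂) (matches (ppWt F) b′) (matches-zeros a′ ne))))
      (ℤP.*-zeroʳ (negOnePow k₂)))
    where
    vanish : ∀ c d e {g} → g ≡ false → (c ∧ d ∧ g ∧ e) ≡ false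
    vanish false d e ≡.refl = ≡.refl
    vanish true false e ≡.refl = ≡.refl
    vanish true true e ≡.refl = ≡.refl

  partitionSeries-coef : ∀ λ′ k₂ → partitionSeries λ′ (k₂ ∷ (zeros {m} ++ᵥ b)) ≡ partitionCoef κ λ′ (toList b) k₂
  partitionSeries-coef λ′ k₂ = ≡.trans (partitionSeries-at λ′ k₂ zeros b) (≡.trans
    (cong (λ c → negOnePow k₂ ℤ.* + c) (count-cong (assignments (boxes λ′) (upTo (2 ℕ.* n))) same))
    (≡.trans (cong (λ l → negOnePow k₂ ℤ.* + count (ppCond κ λ′ l (toList b) k₂) (ppFillings λ′ l)) (≡.sym (VecP.length-toList b)))
      (≡.sym (partitionCoef-count κ λ′ (toList b) k₂))))
    where
    regroup : ∀ c d e f {g} → g ≡ true → (e ≡ true → d ≡ f) → (c ∧ d ∧ g ∧ e) ≡ (c ∧ e ∧ f)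
    regroup false d e f _ _ = ≡.refl
    regroup true d false f ≡.refl _ = BoolP.∧-zeroʳ d
    regroup true d true f ≡.refl eq = ≡.trans (BoolP.∧-identityʳ d) (eq ≡.refl)
    same : ∀ {F} → F ∈ assignments (boxes λ′) (upTo (2 ℕ.* n)) → ppCondition F k₂ zeros b ≡ ppCond κ λ′ n (toList b) k₂ F
    same {F} F∈ = regroup (ppValid F ∧ ppDiagOK κ F) (J ≡ᵇ k₂) (matches (ppWt F) b) (sum (toList b) ℕ.+ k₂ ≡ᵇ sum λ′) (matches-zero {m}) degree
      where
      J = sumTo (2 ℕ.* n) (excess F)
      size : sumTo n (ppWt F) ℕ.+ J ≡ sum λ′
      size = ≡.trans (ppWt-excess n F (λ p∈ → ∈-upTo⁻ (proj₂ (∈-assignments (boxes λ′) _ F∈) p∈))) (length-assignment λ′ (upTo (2 ℕ.* n)) F∈)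
      ≡ᵇ-sym : ∀ i j → (i ≡ᵇ j) ≡ (j ≡ᵇ i)
      ≡ᵇ-sym zero zero = ≡.refl
      ≡ᵇ-sym zero (suc j) = ≡.refl
      ≡ᵇ-sym (suc i) zero = ≡.refl
      ≡ᵇ-sym (suc i) (suc j) = ≡ᵇ-sym i j
      -- The total excess is |λ| - |wt|, so it can be compared with the degree condition of the
      -- statement only after the weight is known to be b.
      degree : matches (ppWt F) b ≡ true → (J ≡ᵇ k₂) ≡ (sum (toList b) ℕ.+ k₂ ≡ᵇ sum λ′)
      degree h = ≡.trans (≡ᵇ-sym J k₂) (≡.trans (≡.sym (+-≡ᵇ (sum (toList b)) k₂ J))
        (cong (sum (toList b) ℕ.+ k₂ ≡ᵇ_) (≡.trans (cong (ℕ._+ J) (≡.trans (sum-at b)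
          (sumTo-cong n (λ i i<n → ≡.sym (≡ᵇ-≡ _ _ (all-true (upTo n) h (∈-upTo⁺ i<n))))))) size)))

  -- A tableau series involves only β and the x variables, a partition series only β and the y
  -- variables. Hence the coefficient of a product splits in x and y, and only the powers of β are
  -- convolved.
  cauchy-coefficients : ∑ (configs (suc L)) (λ w → ∑ (upTo (suc k)) (λ k₁ →
    tableauCoef κ (parts w) (toList a) k₁ ℤ.* partitionCoef κ (parts w) (toList b) (k ∸ k₁))) ≡ kernel m n (k ∷ (a ++ᵥ b))
  cauchy-coefficients = ≡.trans (∑ℤ.∑-cong (configs (suc L)) (λ w → ≡.sym (≡.trans
      (conv-∑ k (λ i e → tableauSeries (parts w) (i ∷ e)) (λ i e → partitionSeries (parts w) (i ∷ e)) (a ++ᵥ b))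
      (∑ℤ.∑-cong (upTo (suc k)) (λ k₁ → ≡.trans
        (split-⋆ m n (λ e → tableauSeries (parts w) (k₁ ∷ e)) (λ e → partitionSeries (parts w) ((k ∸ k₁) ∷ e)) a b
          (tableauSeries-support (parts w) k₁) (partitionSeries-support (parts w) (k ∸ k₁)))
        (cong₂ ℤ._*_ (tableauSeries-coef (parts w) k₁) (partitionSeries-coef (parts w) (k ∸ k₁))))))))
    (≡.trans (≡.sym (∑ₛ-at bound (configs (suc L)) (λ w → tableauSeries (parts w) * partitionSeries (parts w)) bound))
      (equal-at bound cauchy-series))

-- Triangularity

strict-∷ : ∀ x l → isStrictᵇ (x ∷ l) ≡ true → at l 0 < x × isStrictᵇ l ≡ true
strict-∷ x [] h = ≤ᵇ-≤ {1} h , ≡.refl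
strict-∷ x (y ∷ l) h = <ᵇ-< {y} (proj₁ (∧-true h)) , proj₂ (∧-true {y <ᵇ x} h)

at-strict : ∀ l → isStrictᵇ l ≡ true → ∀ r {s} → s < at l (suc r) → suc s < at l r
at-strict (x ∷ l) h zero s< = ℕP.<-≤-trans (s≤s s<) (proj₁ (strict-∷ x l h))
at-strict (x ∷ l) h (suc r) s< = at-strict l (proj₂ (strict-∷ x l h)) r s<

letterSum : (ℕ → ℕ) → List ℕ → ℕ
letterSum φ S = sum (map (λ s → φ ⌊ s /2⌋) S)

fillingSum : (ℕ → ℕ) → SVFilling → ℕ
fillingSum φ F = sum (map (λ p → letterSum φ (proj₂ p)) F)

sumTo-scale-δ : ∀ (φ : ℕ → ℕ) m {h} → h < m → sumTo m (λ i → φ i ℕ.* δ h i) ≡ φ h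
sumTo-scale-δ φ (suc m) {h} h<m with ℕP.m≤n⇒m<n∨m≡n h<m
... | inj₁ (s≤s h<m′) = ≡.trans (cong₂ ℕ._+_ (sumTo-scale-δ φ m h<m′)
      (≡.trans (cong (φ m ℕ.*_) (δ-other (ℕP.<⇒≢ h<m′))) (ℕP.*-zeroʳ (φ m)))) (ℕP.+-identityʳ _)
... | inj₂ ≡.refl = cong₂ ℕ._+_
    (≡.trans (sumTo-cong m (λ i i<m → ≡.trans (cong (φ i ℕ.*_) (δ-other (λ eq → ℕP.<⇒≢ i<m (≡.sym eq)))) (ℕP.*-zeroʳ (φ i)))) (sumTo-zero m))
    (≡.trans (cong (φ m ℕ.*_) (δ-self m)) (ℕP.*-identityʳ (φ m)))

sumTo-scale-+ : ∀ (φ : ℕ → ℕ) m (f g : ℕ → ℕ) → sumTo m (λ i → φ i ℕ.* (f i ℕ.+ g i)) ≡ sumTo m (λ i → φ i ℕ.* f i) ℕ.+ sumTo m (λ i → φ i ℕ.* g i)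
sumTo-scale-+ φ m f g = ≡.trans (sumTo-cong m (λ i _ → ℕP.*-distribˡ-+ (φ i) (f i) (g i))) (sumTo-+ m (λ i → φ i ℕ.* f i) (λ i → φ i ℕ.* g i))

sumTo-scale-zero : ∀ (φ : ℕ → ℕ) m → sumTo m (λ i → φ i ℕ.* 0) ≡ 0
sumTo-scale-zero φ m = ≡.trans (sumTo-cong m (λ i _ → ℕP.*-zeroʳ (φ i))) (sumTo-zero m)

letterSum-content : ∀ (φ : ℕ → ℕ) m S → (∀ {s} → s ∈ S → s < 2 ℕ.* m) → letterSum φ S ≡ sumTo m (λ i → φ i ℕ.* count (ofVar i) S)
letterSum-content φ m [] lt = ≡.sym (sumTo-scale-zero φ m)
letterSum-content φ m (s ∷ S) lt = ≡.sym (≡.trans (sumTo-cong m (λ i _ → cong (φ i ℕ.*_) (count-∷ i s S)))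
  (≡.trans (sumTo-scale-+ φ m (δ ⌊ s /2⌋) (λ i → count (ofVar i) S)) (cong₂ ℕ._+_ (sumTo-scale-δ φ m (half-< s m (lt (here ≡.refl))))
    (≡.sym (letterSum-content φ m S (λ s∈ → lt (there s∈)))))))

-- Double counting over entries and over variables. The constant φ = 1 gives the degree of the
-- monomial, φ = id the sum of the indices of all entries.
fillingSum-content : ∀ (φ : ℕ → ℕ) m F → (∀ {p s} → p ∈ F → s ∈ proj₂ p → s < 2 ℕ.* m) →
  fillingSum φ F ≡ sumTo m (λ i → φ i ℕ.* svContent F i)
fillingSum-content φ m [] lt = ≡.sym (sumTo-scale-zero φ m)
fillingSum-content φ m ((b , S) ∷ F) lt = ≡.sym (≡.trans (sumTo-scale-+ φ m (λ i → count (ofVar i) S) (svContent F))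
  (≡.sym (cong₂ ℕ._+_ (letterSum-content φ m S (lt (here ≡.refl))) (fillingSum-content φ m F (λ p∈ → lt (there p∈))))))

sum-at-list : ∀ (a : List ℕ) → sum a ≡ sumTo (length a) (at a)
sum-at-list [] = ≡.refl
sum-at-list (x ∷ a) = ≡.trans (cong (x ℕ.+_) (sum-at-list a)) (≡.sym (sumTo-head (length a) (at (x ∷ a))))

svSize-letters : ∀ F → svSize F ≡ fillingSum (λ _ → 1) F
svSize-letters [] = ≡.refl
svSize-letters ((b , S) ∷ F) = cong₂ ℕ._+_ (ones S) (svSize-letters F)
  where
  ones : ∀ S → length S ≡ letterSum (λ _ → 1) S
  ones [] = ≡.refl
  ones (s ∷ S) = cong suc (ones S)

rowSum : List ℕ → ℕ
rowSum λ′ = sum (map row (boxes λ′))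

inRow : ∀ k ls j → sum (map (λ b → δ (row b) (k ℕ.+ j)) (boxesFrom k ls)) ≡ at ls j
inRow k [] j = ≡.refl
inRow k (l ∷ ls) j = ≡.trans (cong sum (ListP.map-++ (λ b → δ (row b) (k ℕ.+ j)) (map (λ c → (k , k ℕ.+ c)) (upTo l)) (boxesFrom (suc k) ls)))
  (≡.trans (sum-++ (map (λ b → δ (row b) (k ℕ.+ j)) (map (λ c → (k , k ℕ.+ c)) (upTo l))) _)
    (split j))
  where
  open import Data.Nat.ListAction.Properties using (sum-++)
  constant : ∀ {A : Set} (c : ℕ) (as : List A) {f : A → ℕ} → (∀ {a} → a ∈ as → f a ≡ c) → sum (map f as) ≡ length as ℕ.* c
  constant c [] eq = ≡.refl
  constant c (a ∷ as) eq = cong₂ ℕ._+_ (eq (here ≡.refl)) (constant c as (λ a∈ → eq (there a∈)))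
  first : ∀ j → List ℕ
  first j = map (λ b → δ (row b) (k ℕ.+ j)) (map (λ c → (k , k ℕ.+ c)) (upTo l))
  first-sum : ∀ j c → δ k (k ℕ.+ j) ≡ c → sum (first j) ≡ l ℕ.* c
  first-sum j c eq = ≡.trans (constant c (map (λ c → (k , k ℕ.+ c)) (upTo l)) same)
    (cong (ℕ._* c) (≡.trans (ListP.length-map _ (upTo l)) (ListP.length-upTo l)))
    where
    same : ∀ {b} → b ∈ map (λ c → (k , k ℕ.+ c)) (upTo l) → δ (row b) (k ℕ.+ j) ≡ c
    same b∈ with ∈-map⁻ (λ c → (k , k ℕ.+ c)) b∈
    ... | _ , _ , ≡.refl = eq
  split : ∀ j → sum (first j) ℕ.+ sum (map (λ b → δ (row b) (k ℕ.+ j)) (boxesFrom (suc k) ls)) ≡ at (l ∷ ls) j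
  split zero = ≡.trans (cong₂ ℕ._+_
    (≡.trans (first-sum 0 1 (≡.trans (cong (δ k) (ℕP.+-identityʳ k)) (δ-self k))) (ℕP.*-identityʳ l))
    (≡.trans (constant 0 (boxesFrom (suc k) ls) later) (ℕP.*-zeroʳ (length (boxesFrom (suc k) ls))))) (ℕP.+-identityʳ l)
    where
    later : ∀ {b} → b ∈ boxesFrom (suc k) ls → δ (row b) (k ℕ.+ 0) ≡ 0
    later b∈ with ∈-boxesFrom⁻ (suc k) ls b∈
    ... | i , _ , ≡.refl , _ = δ-other (λ eq → ℕP.<⇒≢ (s≤s (ℕP.m≤m+n k i)) (≡.sym (≡.trans eq (ℕP.+-identityʳ k))))
  split (suc j) = cong₂ ℕ._+_
    (≡.trans (first-sum (suc j) 0 (δ-other (ℕP.<⇒≢ (ℕP.m<m+n k (s≤s z≤n))))) (ℕP.*-zeroʳ l))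
    (≡.trans (cong (λ i → sum (map (λ b → δ (row b) i) (boxesFrom (suc k) ls))) (ℕP.+-suc k j)) (inRow (suc k) ls j))

record Counted (κ : Kind) (μ a : List ℕ) (k : ℕ) (F : SVFilling) : Set where
  field
    filling : F ∈ assignments (boxes μ) (letterSets (2 ℕ.* length a))
    valid : svValid F ≡ true
    content : ∀ i → i < length a → svContent F i ≡ at a i
    size : svSize F ≡ sum μ ℕ.+ k

  letters-bound : ∀ {p s} → p ∈ F → s ∈ proj₂ p → s < 2 ℕ.* length a
  letters-bound p∈ s∈ = proj₁ (∈-letterSets (2 ℕ.* length a) (proj₂ (∈-assignments (boxes μ) _ filling) p∈)) s∈

  weighted : ∀ φ → fillingSum φ F ≡ sumTo (length a) (λ i → φ i ℕ.* at a i)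
  weighted φ = ≡.trans (fillingSum-content φ (length a) F letters-bound)
    (sumTo-cong (length a) (λ i i<m → cong (φ i ℕ.*_) (content i i<m)))

  degree : sum a ≡ sum μ ℕ.+ k
  degree = ≡.trans (sum-at-list a) (≡.trans (sumTo-cong (length a) (λ i _ → ≡.sym (ℕP.*-identityˡ (at a i))))
    (≡.trans (≡.sym (weighted (λ _ → 1))) (≡.trans (≡.sym (svSize-letters F)) size)))

-- Turns a coefficient that does not vanish into an actual tableau, to which the inequalities
-- between rows and indices apply.
counted : ∀ κ μ a k → tableauCoef κ μ a k ≡ + 0 ⊎ ∃ (Counted κ μ a k)
counted κ μ a k rewrite tableauCoef-count κ μ a k with filterᵇ (svCond κ μ (length a) a k) (svFillings μ (length a)) in eq
... | [] = inj₁ ≡.refl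
... | F ∷ _ = inj₂ (F , facts (filterᵇ-∈ (svCond κ μ (length a) a k) (svFillings μ (length a)) (subst (F ∈_) (≡.sym eq) (here ≡.refl))))
  where
  facts : F ∈ svFillings μ (length a) × svCond κ μ (length a) a k F ≡ true → Counted κ μ a k F
  facts (F∈ , h) = record
    { filling = F∈
    ; valid = proj₁ (∧-true (proj₁ (∧-true {svValid F ∧ svDiagOK κ F} h)))
    ; content = λ i i<m → ≡ᵇ-≡ (svContent F i) (at a i) (all-true (upTo (length a)) (proj₁ (∧-true rest)) (∈-upTo⁺ i<m))
    ; size = ≡ᵇ-≡ (svSize F) (sum μ ℕ.+ k) (proj₂ (∧-true {all (λ i → svContent F i ≡ᵇ at a i) (upTo (length a))} rest))
    }
    where
    rest : (all (λ i → svContent F i ≡ᵇ at a i) (upTo (length a)) ∧ (svSize F ≡ᵇ sum μ ℕ.+ k)) ≡ true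
    rest = proj₂ (∧-true {svValid F ∧ svDiagOK κ F} h)

tableauCoef-degree : ∀ κ μ a k → sum a ≢ sum μ ℕ.+ k → tableauCoef κ μ a k ≡ + 0
tableauCoef-degree κ μ a k ne with counted κ μ a k
... | inj₁ eq = eq
... | inj₂ (F , c) = ⊥-elim (ne (Counted.degree c))

pairRight : ∀ r c S S′ → svPairOK ((r , c) , S) ((r , suc c) , S′) ≡ true →
  leSets S S′ ≡ true × (commonWith isPrimed S S′ ≡ true → ⊥)
pairRight r c S S′ h = ⇒ᵇ-elim (proj₁ (∧-true h₂)) (∧-intro (≡ᵇ-true {r} ≡.refl) (≡ᵇ-true {c} ≡.refl)) ,
  not-true (⇒ᵇ-elim (proj₂ (∧-true {((c ≡ᵇ suc c) ∧ not (r ≡ᵇ r)) ⇒ᵇ not (commonWith (λ s → not (isPrimed s)) S S′)} h₃))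
    (∧-intro (≡ᵇ-true {r} ≡.refl) (not-≡ᵇ {c} (ℕP.<⇒≢ ℕP.≤-refl))))
  where
  h₂ = proj₂ (∧-true {((r ≡ᵇ suc r) ∧ (suc c ≡ᵇ c)) ⇒ᵇ leSets S S′} h)
  h₃ = proj₂ (∧-true {((r ≡ᵇ r) ∧ (suc c ≡ᵇ suc c)) ⇒ᵇ leSets S S′} h₂)

pairBelow : ∀ r c S S′ → svPairOK ((r , c) , S) ((suc r , c) , S′) ≡ true →
  leSets S S′ ≡ true × (commonWith (λ s → not (isPrimed s)) S S′ ≡ true → ⊥)
pairBelow r c S S′ h = ⇒ᵇ-elim (proj₁ (∧-true h)) (∧-intro (≡ᵇ-true {suc r} ≡.refl) (≡ᵇ-true {c} ≡.refl)) ,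
  not-true (⇒ᵇ-elim (proj₁ (∧-true {((c ≡ᵇ c) ∧ not (r ≡ᵇ suc r)) ⇒ᵇ not (commonWith (λ s → not (isPrimed s)) S S′)} h₃))
    (∧-intro (≡ᵇ-true {c} ≡.refl) (not-≡ᵇ {r} (ℕP.<⇒≢ ℕP.≤-refl))))
  where
  h₂ = proj₂ (∧-true {((suc r ≡ᵇ suc r) ∧ (c ≡ᵇ c)) ⇒ᵇ leSets S S′} h)
  h₃ = proj₂ (∧-true {((suc r ≡ᵇ r) ∧ (c ≡ᵇ suc c)) ⇒ᵇ leSets S S′} h₂)

halves : ∀ s → s ≡ primedCode ⌊ s /2⌋ ⊎ s ≡ unprimedCode ⌊ s /2⌋
halves zero = inj₁ ≡.refl
halves (suc zero) = inj₂ ≡.refl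
halves (suc (suc s)) with halves s
... | inj₁ eq = inj₁ (≡.trans (cong (suc ∘ suc) eq) (≡.sym (code-suc ⌊ s /2⌋)))
... | inj₂ eq = inj₂ (≡.trans (cong (suc ∘ suc) eq) (cong suc (≡.sym (code-suc ⌊ s /2⌋))))

module _ {κ μ a k F} (strict : isStrictᵇ μ ≡ true) (c : Counted κ μ a k F) where
  open Counted c

  private
    box-set : ∀ r s → s < at μ r → ∃ λ S → (cell r s , S) ∈ F × ∃ λ e → e ∈ S
    box-set r s s< with ∈-map⁻ proj₁ (subst (cell r s ∈_) (≡.sym (proj₁ (∈-assignments (boxes μ) _ filling))) (∈-boxesFrom⁺ 0 μ r s s<))
    ... | (_ , S) , p∈ , ≡.refl = S , p∈ , proj₂ (∈-letterSets (2 ℕ.* length a) (proj₂ (∈-assignments (boxes μ) _ filling) p∈))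

    -- e₁ ≤ e₂ in a row and e₂ ≤ e₃ in a column: if all belonged to the same variable, e₂ would repeat
    -- a primed letter in a row or an unprimed letter in a column.
    index-increases : ∀ e₁ e₂ e₃ → e₁ ≤ e₂ → e₂ ≤ e₃ → (e₁ ≡ e₂ → isPrimed e₂ ≡ true → ⊥) → (e₂ ≡ e₃ → isPrimed e₂ ≡ false → ⊥) →
      ⌊ e₁ /2⌋ < ⌊ e₃ /2⌋
    index-increases e₁ e₂ e₃ le₁ le₂ no-row no-col with ℕP.m≤n⇒m<n∨m≡n (ℕP.⌊n/2⌋-mono (ℕP.≤-trans le₁ le₂))
    ... | inj₁ lt = lt
    ... | inj₂ eq = ⊥-elim (repeat (halves e₂))
      where
      i = ⌊ e₂ /2⌋
      eq₁ : ⌊ e₁ /2⌋ ≡ i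
      eq₁ = ℕP.≤-antisym (ℕP.⌊n/2⌋-mono le₁) (subst (i ≤_) (≡.sym eq) (ℕP.⌊n/2⌋-mono le₂))
      eq₃ : ⌊ e₃ /2⌋ ≡ i
      eq₃ = ≡.trans (≡.sym eq) eq₁
      lower : ∀ e → primedCode ⌊ e /2⌋ ≤ e
      lower e with halves e
      ... | inj₁ eq = ℕP.≤-reflexive (≡.sym eq)
      ... | inj₂ eq = subst (primedCode ⌊ e /2⌋ ≤_) (≡.sym eq) (ℕP.n≤1+n _)
      upper : ∀ e → e ≤ unprimedCode ⌊ e /2⌋
      upper e with halves e
      ... | inj₁ eq = ℕP.≤-trans (ℕP.≤-reflexive eq) (ℕP.n≤1+n _)
      ... | inj₂ eq = ℕP.≤-reflexive eq
      repeat : e₂ ≡ primedCode i ⊎ e₂ ≡ unprimedCode i → ⊥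
      repeat (inj₁ e₂≡) = no-row (ℕP.≤-antisym le₁ (subst (_≤ e₁) (≡.trans (cong primedCode eq₁) (≡.sym e₂≡)) (lower e₁)))
        (≡.trans (cong isPrimed e₂≡) (isPrimed-primed i))
      repeat (inj₂ e₂≡) = no-col (ℕP.≤-antisym le₂ (subst (e₃ ≤_) (≡.trans (cong unprimedCode eq₃) (≡.sym e₂≡)) (upper e₃)))
        (≡.trans (cong isPrimed e₂≡) (isPrimed-unprimed i))

  -- From a box of row r + 1 one goes to the box above it and then to the left neighbour of that
  -- box, which is on the same diagonal as the original one; both exist since μ is strict. Backwards
  -- along this path the index of the variable increases strictly.
  row≤index : ∀ r s {S e} → s < at μ r → (cell r s , S) ∈ F → e ∈ S → r ≤ ⌊ e /2⌋
  row≤index zero s s< p∈ e∈ = z≤n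
  row≤index (suc r) s {S₃} {e₃} s< p₃ e₃∈ with box-set r s (ℕP.<-trans ℕP.≤-refl (at-strict μ strict r s<)) | box-set r (suc s) (at-strict μ strict r s<)
  ... | S₁ , p₁ , e₁ , e₁∈ | S₂ , p₂ , e₂ , e₂∈ = ℕP.≤-<-trans (row≤index r s (ℕP.<-trans ℕP.≤-refl (at-strict μ strict r s<)) p₁ e₁∈)
    (index-increases e₁ e₂ e₃ (leSets-true 0 S₁ S₂ (proj₁ right) e₁∈ e₂∈) (leSets-true 0 S₂ S₃ (proj₁ under) e₂∈ e₃∈)
      (λ { ≡.refl pr → proj₂ right (common-intro 0 isPrimed S₁ S₂ e₁∈ pr e₂∈) })
      (λ { ≡.refl pr → proj₂ under (common-intro 0 (λ s → not (isPrimed s)) S₂ S₃ e₂∈ (cong not pr) e₃∈) }))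
    where
    right = pairRight r (r ℕ.+ s) S₁ S₂ (subst (λ c → svPairOK (cell r s , S₁) ((r , c) , S₂) ≡ true) (ℕP.+-suc r s) (allPairs-true F valid p₁ p₂))
    under = pairBelow r (r ℕ.+ suc s) S₂ S₃ (subst (λ c → svPairOK (cell r (suc s) , S₂) ((suc r , c) , S₃) ≡ true) (≡.sym (ℕP.+-suc r s)) (allPairs-true F valid p₂ p₃))

  row≤letterSum : ∀ {p} → p ∈ F → row (proj₁ p) ≤ letterSum (λ i → i) (proj₂ p)
  row≤letterSum {b , S} p∈ with ∈-boxesFrom⁻ 0 μ (subst (b ∈_) (proj₁ (∈-assignments (boxes μ) _ filling)) (∈-map⁺ proj₁ p∈))
  ... | r , s , ≡.refl , s< with proj₂ (∈-letterSets (2 ℕ.* length a) (proj₂ (∈-assignments (boxes μ) _ filling) p∈))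
  ...   | e , e∈ = ℕP.≤-trans (row≤index r s s< p∈ e∈) (summand S e∈)
    where
    summand : ∀ S {e} → e ∈ S → ⌊ e /2⌋ ≤ letterSum (λ i → i) S
    summand (e ∷ S) (here ≡.refl) = ℕP.m≤m+n _ _
    summand (e ∷ S) (there e∈) = ℕP.≤-trans (summand S e∈) (ℕP.m≤n+m _ ⌊ e /2⌋)

  rows-of : sum (map (λ p → row (proj₁ p)) F) ≡ rowSum μ
  rows-of = cong sum (≡.trans (ListP.map-∘ {g = row} {f = proj₁} F) (cong (map row) (proj₁ (∈-assignments (boxes μ) _ filling))))

  rowSum≤ : rowSum μ ≤ fillingSum (λ i → i) F
  rowSum≤ = subst (_≤ fillingSum (λ i → i) F) rows-of (go F row≤letterSum)
    where
    go : ∀ F → (∀ {p} → p ∈ F → row (proj₁ p) ≤ letterSum (λ i → i) (proj₂ p)) → sum (map (λ p → row (proj₁ p)) F) ≤ fillingSum (λ i → i) F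
    go [] h = z≤n
    go (p ∷ F) h = ℕP.+-mono-≤ (h (here ≡.refl)) (go F (λ p∈ → h (there p∈)))

  -- Equality of the sums forces equality of row and index sum in every box. For k = 0 each box has
  -- a single entry, whose index is therefore its row, so the content counts boxes by rows.
  content-rows : k ≡ 0 → rowSum μ ≡ fillingSum (λ i → i) F → ∀ i → svContent F i ≡ at μ i
  content-rows ≡.refl eq i = ≡.trans (cong sum (ListP.map-cong-local (All.tabulate each)))
    (≡.trans (cong sum (≡.trans (ListP.map-∘ {g = λ b → δ (row b) i} {f = proj₁} F)
      (cong (map (λ b → δ (row b) i)) (proj₁ (∈-assignments (boxes μ) _ filling))))) (inRow 0 μ i))
    where
    tight : ∀ {A : Set} (as : List A) {f g : A → ℕ} → (∀ {a} → a ∈ as → f a ≤ g a) → sum (map f as) ≡ sum (map g as) → ∀ {a} → a ∈ as → f a ≡ g a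
    tight (a ∷ as) {f} {g} le eq = go
      where
      tails-le : ∀ as → (∀ {a} → a ∈ as → f a ≤ g a) → sum (map f as) ≤ sum (map g as)
      tails-le [] le = z≤n
      tails-le (a ∷ as) le = ℕP.+-mono-≤ (le (here ≡.refl)) (tails-le as (λ a∈ → le (there a∈)))
      le-tail : sum (map f as) ≤ sum (map g as)
      le-tail = tails-le as (λ a∈ → le (there a∈))
      head : f a ≡ g a
      head = ℕP.≤-antisym (le (here ≡.refl)) (ℕP.+-cancelʳ-≤ (sum (map f as)) (g a) (f a)
        (ℕP.≤-trans (ℕP.+-monoʳ-≤ (g a) le-tail) (ℕP.≤-reflexive (≡.sym eq))))
      go : ∀ {a′} → a′ ∈ a ∷ as → f a′ ≡ g a′
      go (here ≡.refl) = head
      go (there a∈) = tight as (λ a∈ → le (there a∈)) (ℕP.+-cancelˡ-≡ (f a) _ _ (≡.trans eq (cong (ℕ._+ sum (map g as)) (≡.sym head)))) a∈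
    excess-zero : svExcess F ≡ 0
    excess-zero = ℕP.+-cancelˡ-≡ (sum μ) _ _ (≡.trans (≡.sym (svSize-shape μ (2 ℕ.* length a) filling)) size)
    no-excess : ∀ F → svExcess F ≡ 0 → ∀ {p} → p ∈ F → length (proj₂ p) ∸ 1 ≡ 0
    no-excess (p ∷ F) eq (here ≡.refl) = ℕP.m+n≡0⇒m≡0 _ eq
    no-excess (p ∷ F) eq (there p∈) = no-excess F (ℕP.m+n≡0⇒n≡0 (length (proj₂ p) ∸ 1) eq) p∈
    single : ∀ S r → length S ∸ 1 ≡ 0 → (∃ λ e → e ∈ S) → r ≡ letterSum (λ i → i) S → count (ofVar i) S ≡ δ r i
    single [] r _ (_ , ()) _
    single (e ∷ []) r _ _ eq = ≡.trans (count-∷ i e []) (≡.trans (ℕP.+-identityʳ _) (cong (λ h → δ h i) (≡.sym (≡.trans eq (ℕP.+-identityʳ _)))))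
    single (e ∷ _ ∷ _) r () _ _
    each : ∀ {p} → p ∈ F → count (ofVar i) (proj₂ p) ≡ δ (row (proj₁ p)) i
    each {p} p∈ = single (proj₂ p) (row (proj₁ p)) (no-excess F excess-zero p∈)
      (proj₂ (∈-letterSets (2 ℕ.* length a) (proj₂ (∈-assignments (boxes μ) _ filling) p∈)))
      (tight F row≤letterSum (≡.trans rows-of eq) p∈)

open ∑ℤ using (∑)

∈-assignments⁺ : {B C : Set} (h : B → C) (bs : List B) (cs : List C) → (∀ {b} → b ∈ bs → h b ∈ cs) →
  map (λ b → b , h b) bs ∈ assignments bs cs
∈-assignments⁺ h [] cs h∈ = here ≡.refl
∈-assignments⁺ h (b ∷ bs) cs h∈ = ∈-concatMap⁺ (λ c → map ((b , c) ∷_) (assignments bs cs))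
  (Any.map (λ { ≡.refl → ∈-map⁺ ((b , h b) ∷_) (∈-assignments⁺ h bs cs (λ b∈ → h∈ (there b∈))) }) (h∈ (here ≡.refl)))

singleton-letterSet : ∀ {c l} → c < l → c ∷ [] ∈ letterSets l
singleton-letterSet {c} {l} c<l = filterᵇ-∈⁺ nonEmpty (sublists (upTo l)) (sublist (upTo l) (∈-upTo⁺ c<l)) ≡.refl
  where
  empty : ∀ as → [] ∈ sublists {ℕ} as
  empty [] = here ≡.refl
  empty (a ∷ as) = ∈-++⁺ʳ (map (a ∷_) (sublists as)) (empty as)
  sublist : ∀ as → c ∈ as → c ∷ [] ∈ sublists as
  sublist (a ∷ as) (here ≡.refl) = ∈-++⁺ˡ (∈-map⁺ (a ∷_) (empty as))
  sublist (a ∷ as) (there c∈) = ∈-++⁺ʳ (map (a ∷_) (sublists as)) (sublist as c∈)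

module RowFilling (μ : List ℕ) where
  rowSet : Box → List ℕ
  rowSet b = unprimedCode (row b) ∷ []

  -- The extremal tableau, in which every index equals its row. Its letters are unprimed, so it is
  -- admissible for both kinds.
  rowFilling : SVFilling
  rowFilling = map (λ b → b , rowSet b) (boxes μ)

  private
    at-positive : ∀ (l : List ℕ) {i s} → s < at l i → i < length l
    at-positive (x ∷ l) {zero} _ = s≤s z≤n
    at-positive (x ∷ l) {suc i} s< = s≤s (at-positive l s<)

    row-< : ∀ {b} → b ∈ boxes μ → row b < length μ
    row-< b∈ with ∈-boxesFrom⁻ 0 μ b∈
    ... | i , j , ≡.refl , j< = at-positive μ j<

    code-< : ∀ {b} → b ∈ boxes μ → unprimedCode (row b) < 2 ℕ.* length μ
    code-< {b} b∈ = ℕP.≤-trans (ℕP.≤-reflexive (≡.sym (code-suc (row b)))) (ℕP.*-monoʳ-≤ 2 (row-< b∈))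

    boxOf : ∀ {p} → p ∈ rowFilling → ∃ λ b → b ∈ boxes μ × p ≡ (b , rowSet b)
    boxOf p∈ = ∈-map⁻ (λ b → b , rowSet b) p∈

    code-mono : ∀ {i j} → i ≤ j → unprimedCode i ≤ unprimedCode j
    code-mono i≤j = s≤s (ℕP.*-monoʳ-≤ 2 i≤j)

  row-valid : svValid rowFilling ≡ true
  row-valid = allPairs-intro rowFilling pair
    where
    pair : ∀ {p q} → p ∈ rowFilling → q ∈ rowFilling → svPairOK p q ≡ true
    pair p∈ q∈ with boxOf p∈ | boxOf q∈
    ... | (r₁ , c₁) , _ , ≡.refl | (r₂ , c₂) , _ , ≡.refl =
      ∧-intro (⇒ᵇ-intro (λ h → weakly (ℕP.≤-trans (ℕP.n≤1+n r₁) (ℕP.≤-reflexive (≡.sym (≡ᵇ-≡ r₂ (suc r₁) (proj₁ (∧-true h))))))))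
      (∧-intro (⇒ᵇ-intro (λ h → weakly (ℕP.≤-reflexive (≡.sym (≡ᵇ-≡ r₂ r₁ (proj₁ (∧-true h)))))))
      (∧-intro (⇒ᵇ-intro (λ h → not-intro (λ g → not-≡ᵇ-≢ r₁ r₂ (proj₂ (∧-true {c₁ ≡ᵇ c₂} h)) (same-row g))))
        (⇒ᵇ-intro (λ h → not-intro primed-common))))
      where
      weakly : r₁ ≤ r₂ → leSets (rowSet (r₁ , c₁)) (rowSet (r₂ , c₂)) ≡ true
      weakly le = leSets-intro 0 (rowSet (r₁ , c₁)) (rowSet (r₂ , c₂)) (λ { (here ≡.refl) (here ≡.refl) → code-mono le })
      same-row : commonWith (λ s → not (isPrimed s)) (rowSet (r₁ , c₁)) (rowSet (r₂ , c₂)) ≡ true → r₁ ≡ r₂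
      same-row g with common-true 0 (λ s → not (isPrimed s)) (rowSet (r₁ , c₁)) (rowSet (r₂ , c₂)) g
      ... | s , here eq₁ , _ , here eq₂ = ≡.trans (≡.sym (half-unprimed r₁))
        (≡.trans (cong ⌊_/2⌋ (≡.trans (≡.sym eq₁) eq₂)) (half-unprimed r₂))
      primed-common : commonWith isPrimed (rowSet (r₁ , c₁)) (rowSet (r₂ , c₂)) ≡ true → ⊥
      primed-common g with common-true 0 isPrimed (rowSet (r₁ , c₁)) (rowSet (r₂ , c₂)) g
      ... | s , here ≡.refl , pr , _ = false≢true (≡.trans (≡.sym (isPrimed-unprimed r₁)) pr)

  row-diag : ∀ κ → svDiagOK κ rowFilling ≡ true
  row-diag 𝒬 = ≡.refl
  row-diag 𝒫 = all-intro rowFilling each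
    where
    each : ∀ {p} → p ∈ rowFilling → (isDiag (proj₁ p) ⇒ᵇ not (any isPrimed (proj₂ p))) ≡ true
    each p∈ with boxOf p∈
    ... | (r , c) , _ , ≡.refl = ⇒ᵇ-intro (λ _ → not-intro impossible)
      where
      impossible : any isPrimed (unprimedCode r ∷ []) ≡ true → ⊥
      impossible g with any-true {p = isPrimed} (unprimedCode r ∷ []) g
      ... | s , here ≡.refl , pr = false≢true (≡.trans (≡.sym (isPrimed-unprimed r)) pr)

  row-content : ∀ i → svContent rowFilling i ≡ at μ i
  row-content i = ≡.trans (cong sum (≡.trans (≡.sym (ListP.map-∘ {g = λ p → count (ofVar i) (proj₂ p)} {f = λ b → b , rowSet b} (boxes μ)))
    (ListP.map-cong (λ b → ≡.trans (count-∷ i (unprimedCode (row b)) []) (≡.trans (ℕP.+-identityʳ _) (cong (λ h → δ h i) (half-unprimed (row b))))) (boxes μ))))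
    (inRow 0 μ i)

  row-size : svSize rowFilling ≡ sum μ
  row-size = ≡.trans (ones (boxes μ)) (length-boxes 0 μ)
    where
    ones : ∀ bs → svSize (map (λ b → b , rowSet b) bs) ≡ length bs
    ones [] = ≡.refl
    ones (b ∷ bs) = cong suc (ones bs)

  row-indices : fillingSum (λ i → i) rowFilling ≡ rowSum μ
  row-indices = go (boxes μ)
    where
    go : ∀ bs → fillingSum (λ i → i) (map (λ b → b , rowSet b) bs) ≡ sum (map row bs)
    go [] = ≡.refl
    go (b ∷ bs) = cong₂ ℕ._+_ (≡.trans (ℕP.+-identityʳ _) (half-unprimed (row b))) (go bs)

  row-member : rowFilling ∈ svFillings μ (length μ)
  row-member = ∈-assignments⁺ rowSet (boxes μ) (letterSets (2 ℕ.* length μ)) (λ b∈ → singleton-letterSet (code-< b∈))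

  rowSum-content : rowSum μ ≡ sumTo (length μ) (λ i → i ℕ.* at μ i)
  rowSum-content = ≡.trans (≡.sym row-indices) (≡.trans
    (fillingSum-content (λ i → i) (length μ) rowFilling (λ p∈ s∈ → proj₁ (∈-letterSets (2 ℕ.* length μ)
      (proj₂ (∈-assignments (boxes μ) _ row-member) p∈)) s∈))
    (sumTo-cong (length μ) (λ i _ → cong (i ℕ.*_) (row-content i))))

  diagonal-coef : ∀ κ → ∃ λ c → tableauCoef κ μ μ 0 ≡ + suc c
  diagonal-coef κ = positive (tableauCoef-count κ μ μ 0) (filterᵇ-∈⁺ (svCond κ μ (length μ) μ 0) (svFillings μ (length μ)) row-member condition)
    where
    condition : svCond κ μ (length μ) μ 0 rowFilling ≡ true
    condition = ∧-intro (∧-intro row-valid (row-diag κ)) (∧-intro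
      (all-intro (upTo (length μ)) (λ {i} _ → ≡ᵇ-true (row-content i)))
      (≡ᵇ-true (≡.trans row-size (≡.sym (ℕP.+-identityʳ (sum μ))))))
    positive : ∀ {z : ℤ} {as : List SVFilling} {F} → z ≡ + length as → F ∈ as → ∃ λ c → z ≡ + suc c
    positive {as = _ ∷ as} eq _ = length as , eq

open RowFilling using (diagonal-coef; rowSum-content)

-- Agreement is known only in the rows of λ; equality of the sizes excludes further rows of μ, since
-- these would be positive.
strict-equal : ∀ λ′ μ → isStrictᵇ λ′ ≡ true → isStrictᵇ μ ≡ true → (∀ i → i < length λ′ → at μ i ≡ at λ′ i) → sum μ ≡ sum λ′ → μ ≡ λ′
strict-equal [] [] _ _ _ _ = ≡.refl
strict-equal [] (y ∷ μ) _ h _ eq = ⊥-elim (ℕP.n≮0 (subst (at μ 0 <_) (ℕP.m+n≡0⇒m≡0 y eq) (proj₁ (strict-∷ y μ h))))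
strict-equal (x ∷ λ′) [] h _ ats _ = ⊥-elim (ℕP.n≮0 (subst (at λ′ 0 <_) (≡.sym (ats 0 (s≤s z≤n))) (proj₁ (strict-∷ x λ′ h))))
strict-equal (x ∷ λ′) (y ∷ μ) h h′ ats eq with ats 0 (s≤s z≤n)
... | ≡.refl = cong (x ∷_) (strict-equal λ′ μ (proj₂ (strict-∷ x λ′ h)) (proj₂ (strict-∷ x μ h′))
  (λ i i< → ats (suc i) (s≤s i<)) (ℕP.+-cancelˡ-≡ x _ _ eq))

tableauCoef-triangular : ∀ κ λ′ μ → isStrictᵇ λ′ ≡ true → isStrictᵇ μ ≡ true →
  tableauCoef κ μ λ′ 0 ≡ + 0 ⊎ rowSum μ < rowSum λ′ ⊎ μ ≡ λ′
tableauCoef-triangular κ λ′ μ hλ hμ with counted κ μ λ′ 0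
... | inj₁ eq = inj₁ eq
... | inj₂ (F , c) with ℕP.m≤n⇒m<n∨m≡n (subst (rowSum μ ≤_) indices (rowSum≤ hμ c))
  where
  indices : fillingSum (λ i → i) F ≡ rowSum λ′
  indices = ≡.trans (Counted.weighted c (λ i → i)) (≡.sym (rowSum-content λ′))
...   | inj₁ lt = inj₂ (inj₁ lt)
...   | inj₂ eq = inj₂ (inj₂ (strict-equal λ′ μ hλ hμ
    (λ i i< → ≡.trans (≡.sym (content-rows hμ c ≡.refl (≡.trans eq (≡.trans (rowSum-content λ′) (≡.sym (Counted.weighted c (λ i → i))))) i)) (Counted.content c i i<))
    (≡.sym (≡.trans (Counted.degree c) (ℕP.+-identityʳ (sum μ))))))

-- Enumeration of strict partitions

unique-concatMap : {A B : Set} (f : B → List A) (bs : List B) → Unique bs → (∀ {b} → b ∈ bs → Unique (f b)) →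
  (∀ {b b′ a} → b ∈ bs → b′ ∈ bs → a ∈ f b → a ∈ f b′ → b ≡ b′) → Unique (concatMap f bs)
unique-concatMap f [] _ _ _ = []
unique-concatMap f (b ∷ bs) (b∉ ∷ u) uf sep = UniqueP.++⁺ (uf (here ≡.refl))
  (unique-concatMap f bs u (λ b∈ → uf (there b∈)) (λ b∈ b∈′ → sep (there b∈) (there b∈′)))
  (λ { (a∈ , a∈′) → disjoint a∈ (find (∈-concatMap⁻ f {xs = bs} a∈′)) })
  where
  disjoint : ∀ {a} → a ∈ f b → (∃ λ b′ → b′ ∈ bs × a ∈ f b′) → ⊥
  disjoint a∈ (b′ , b′∈ , a∈′) = All.lookup b∉ b′∈ (sep (here ≡.refl) (there b′∈) a∈ a∈′)

listsOfLen-length : {A : Set} (n : ℕ) (A′ : List A) {l : List A} → l ∈ listsOfLen n A′ → length l ≡ n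
listsOfLen-length zero A′ (here ≡.refl) = ≡.refl
listsOfLen-length (suc n) A′ l∈ with find (∈-concatMap⁻ (λ x → map (x ∷_) (listsOfLen n A′)) {xs = A′} l∈)
... | x , _ , l∈′ with ∈-map⁻ (x ∷_) l∈′
...   | l , l∈″ , ≡.refl = cong suc (listsOfLen-length n A′ l∈″)

listsOfLen-unique : {A : Set} (n : ℕ) (A′ : List A) → Unique A′ → Unique (listsOfLen n A′)
listsOfLen-unique zero A′ u = [] ∷ []
listsOfLen-unique (suc n) A′ u = unique-concatMap _ A′ u
  (λ _ → UniqueP.map⁺ ListP.∷-injectiveʳ (listsOfLen-unique n A′ u)) (λ _ _ → heads)
  where
  heads : ∀ {x y l} → l ∈ map (x ∷_) (listsOfLen n A′) → l ∈ map (y ∷_) (listsOfLen n A′) → x ≡ y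
  heads {x} {y} l∈ l∈′ with ∈-map⁻ (x ∷_) l∈ | ∈-map⁻ (y ∷_) l∈′
  ... | _ , _ , ≡.refl | _ , _ , ≡.refl = ≡.refl

∈-listsOfLen : {A : Set} (A′ l : List A) → (∀ {x} → x ∈ l → x ∈ A′) → l ∈ listsOfLen (length l) A′
∈-listsOfLen A′ [] h = here ≡.refl
∈-listsOfLen A′ (x ∷ l) h = ∈-concatMap⁺ (λ y → map (y ∷_) (listsOfLen (length l) A′))
  (Any.map (λ { ≡.refl → ∈-map⁺ (x ∷_) (∈-listsOfLen A′ l (λ x∈ → h (there x∈))) }) (h (here ≡.refl)))

strictUpTo-unique : ∀ N → Unique (strictUpTo N)
strictUpTo-unique N = UniqueP.filter⁺ (λ l → BoolP.T? (isStrictᵇ l ∧ (sum l ≤ᵇ N))) (unique-concatMap _ (upTo (suc N)) (UniqueP.upTo⁺ (suc N))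
  (λ {n} _ → listsOfLen-unique n _ (UniqueP.map⁺ ℕP.suc-injective (UniqueP.upTo⁺ N)))
  (λ {n} {n′} _ _ l∈ l∈′ → ≡.trans (≡.sym (listsOfLen-length n _ l∈)) (listsOfLen-length n′ _ l∈′)))

∈-strictUpTo⁻ : ∀ N {l} → l ∈ strictUpTo N → isStrictᵇ l ≡ true × sum l ≤ N
∈-strictUpTo⁻ N {l} l∈ with filterᵇ-∈ (λ l → isStrictᵇ l ∧ (sum l ≤ᵇ N))
  (concatMap (λ len → listsOfLen len (map suc (upTo N))) (upTo (suc N))) l∈
... | _ , h = proj₁ (∧-true h) , ≤ᵇ-≤ {sum l} (proj₂ (∧-true {isStrictᵇ l} h))

∈-strictUpTo⁺ : ∀ N {l} → isStrictᵇ l ≡ true → sum l ≤ N → l ∈ strictUpTo N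
∈-strictUpTo⁺ N {l} strict sum≤ = filterᵇ-∈⁺ (λ l → isStrictᵇ l ∧ (sum l ≤ᵇ N))
  (concatMap (λ len → listsOfLen len (map suc (upTo N))) (upTo (suc N)))
  (∈-concatMap⁺ (λ len → listsOfLen len (map suc (upTo N))) (Any.map (λ { ≡.refl → ∈-listsOfLen _ l (entries l strict sum≤) })
    (∈-upTo⁺ (s≤s (ℕP.≤-trans (length≤sum l strict) sum≤)))))
  (∧-intro strict (≤ᵇ-true sum≤))
  where
  length≤sum : ∀ l → isStrictᵇ l ≡ true → length l ≤ sum l
  length≤sum [] _ = z≤n
  length≤sum (x ∷ l) h with strict-∷ x l h
  ... | lt , h′ = ℕP.+-mono-≤ (ℕP.≤-trans (s≤s z≤n) lt) (length≤sum l h′)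
  entries : ∀ l → isStrictᵇ l ≡ true → sum l ≤ N → ∀ {x} → x ∈ l → x ∈ map suc (upTo N)
  entries (x ∷ l) h le (here ≡.refl) with x | strict-∷ x l h
  ... | suc x′ | _ = ∈-map⁺ suc (∈-upTo⁺ (ℕP.≤-trans (ℕP.m≤m+n (suc x′) (sum l)) le))
  entries (x ∷ l) h le (there x∈) = entries l (proj₂ (strict-∷ x l h)) (ℕP.≤-trans (ℕP.m≤n+m (sum l) x) le) x∈

parts-strict : ∀ {L} (w : Vec Bool L) → isStrictᵇ (parts w) ≡ true
parts-strict [] = ≡.refl
parts-strict (false ∷ w) = parts-strict w
parts-strict {suc L} (true ∷ w) with parts w | parts-strict w | at-parts-≤ w 0
... | [] | _ | _ = ≡.refl
... | y ∷ l | h | le = ∧-intro (<ᵇ-true (s≤s le)) h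

parts-injective : ∀ {L} {v w : Vec Bool L} → parts v ≡ parts w → v ≡ w
parts-injective {v = []} {[]} _ = ≡.refl
parts-injective {v = false ∷ v} {false ∷ w} eq = cong (false ∷_) (parts-injective eq)
parts-injective {v = true ∷ v} {true ∷ w} eq = cong (true ∷_) (parts-injective (ListP.∷-injectiveʳ eq))
parts-injective {suc L} {v = true ∷ v} {false ∷ w} eq = ⊥-elim (ℕP.n≮n L (subst (_≤ L) (≡.sym (cong (λ l → at l 0) eq)) (at-parts-≤ w 0)))
parts-injective {suc L} {v = false ∷ v} {true ∷ w} eq = ⊥-elim (ℕP.n≮n L (subst (_≤ L) (cong (λ l → at l 0) eq) (at-parts-≤ v 0)))

parts-surjective : ∀ L l → isStrictᵇ l ≡ true → at l 0 ≤ L → ∃ λ (w : Vec Bool L) → parts w ≡ l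
parts-surjective zero [] _ _ = [] , ≡.refl
parts-surjective zero (x ∷ l) h le = ⊥-elim (ℕP.n≮0 (ℕP.≤-trans (proj₁ (strict-∷ x l h)) le))
parts-surjective (suc L) [] h _ with parts-surjective L [] h z≤n
... | w , eq = false ∷ w , eq
parts-surjective (suc L) (x ∷ l) h le with ℕP.m≤n⇒m<n∨m≡n le
... | inj₁ (s≤s x≤L) with parts-surjective L (x ∷ l) h x≤L
...   | w , eq = false ∷ w , eq
parts-surjective (suc L) (x ∷ l) h le | inj₂ ≡.refl with strict-∷ x l h
... | s≤s lt , h′ with parts-surjective L l h′ lt
...   | w , eq = true ∷ w , cong (suc L ∷_) eq

configs-unique : ∀ L → Unique (configs L)
configs-unique zero = [] ∷ []
configs-unique (suc L) = UniqueP.++⁺ (UniqueP.map⁺ VecP.∷-injectiveʳ (configs-unique L)) (UniqueP.map⁺ VecP.∷-injectiveʳ (configs-unique L)) disjoint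
  where
  disjoint : ∀ {v} → v ∈ map (false ∷_) (configs L) × v ∈ map (true ∷_) (configs L) → ⊥
  disjoint (v∈ , v∈′) with ∈-map⁻ (false ∷_) v∈ | ∈-map⁻ (true ∷_) v∈′
  ... | _ , _ , ≡.refl | _ , _ , ()

∈-configs : ∀ {L} (w : Vec Bool L) → w ∈ configs L
∈-configs [] = here ≡.refl
∈-configs (false ∷ w) = ∈-++⁺ˡ (∈-map⁺ (false ∷_) (∈-configs w))
∈-configs {suc L} (true ∷ w) = ∈-++⁺ʳ (map (false ∷_) (configs L)) (∈-map⁺ (true ∷_) (∈-configs w))

-- The statement sums over strict partitions of bounded size, the operators over those with bounded
-- parts. The second family is larger, and for degree reasons its surplus contributes nothing.
∑-strictUpTo : ∀ N L → N ≤ L → (h : List ℕ → ℤ) → (∀ l → N < sum l → h l ≡ + 0) →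
  ∑ (strictUpTo N) h ≡ ∑ (configs L) (h ∘ parts)
∑-strictUpTo N L N≤L h vanish = ≡.trans (∑ℤ.∑-↭ h (unique-↭ (strictUpTo-unique N)
    (UniqueP.filter⁺ (λ l → BoolP.T? (sum l ≤ᵇ N)) (UniqueP.map⁺ parts-injective (configs-unique L))) to from))
  (≡.trans (∑ℤ.∑-filter (λ l → sum l ≤ᵇ N) (map parts (configs L)) h)
  (≡.trans (∑ℤ.∑-cong (map parts (configs L)) small) (∑ℤ.∑-map parts (configs L) h)))
  where
  small : ∀ l → ∑ℤ.iverson (sum l ≤ᵇ N) (h l) ≡ h l
  small l with sum l ≤ᵇ N in eq
  ... | true = ≡.refl
  ... | false = ≡.sym (vanish l (ℕP.≰⇒> (λ le → false≢true (≡.trans (≡.sym eq) (≤ᵇ-true le)))))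
  head≤sum : ∀ l → at l 0 ≤ sum l
  head≤sum [] = z≤n
  head≤sum (x ∷ l) = ℕP.m≤m+n x (sum l)
  to : ∀ {l} → l ∈ strictUpTo N → l ∈ filterᵇ (λ l → sum l ≤ᵇ N) (map parts (configs L))
  to {l} l∈ with ∈-strictUpTo⁻ N l∈
  ... | strict , le with parts-surjective L l strict (ℕP.≤-trans (head≤sum l) (ℕP.≤-trans le N≤L))
  ...   | w , ≡.refl = filterᵇ-∈⁺ (λ l → sum l ≤ᵇ N) (map parts (configs L)) (∈-map⁺ parts (∈-configs w)) (≤ᵇ-true le)
  from : ∀ {l} → l ∈ filterᵇ (λ l → sum l ≤ᵇ N) (map parts (configs L)) → l ∈ strictUpTo N
  from {l} l∈ with filterᵇ-∈ (λ l → sum l ≤ᵇ N) (map parts (configs L)) l∈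
  ... | l∈′ , le with ∈-map⁻ parts l∈′
  ...   | w , _ , ≡.refl = ∈-strictUpTo⁺ N (parts-strict w) (≤ᵇ-≤ {sum (parts w)} le)

-- The Cauchy identity as stated, and the uniqueness of its solution.

cauchyIdentity : ∀ κ → CauchyIdentity (tableauCoef κ) (partitionCoef κ)
cauchyIdentity κ m n a b k = ≡.trans
  (sumℤ-∑ (strictUpTo N) (λ λ′ → sumℤ (map (term λ′) (upTo (suc k))))) (≡.trans
  (∑ℤ.∑-cong (strictUpTo N) (λ λ′ → sumℤ-∑ (upTo (suc k)) (term λ′)))
  (≡.trans (∑-strictUpTo N (suc L) (ℕP.m≤n⇒m≤1+n (ℕP.m≤m+n N _)) (λ λ′ → ∑ (upTo (suc k)) (term λ′)) large)
    cauchy-coefficients))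
  where
  open Extraction κ m n k a b
  N = sum (Vec.toList a)
  term : List ℕ → ℕ → ℤ
  term λ′ k₁ = tableauCoef κ λ′ (Vec.toList a) k₁ ℤ.* partitionCoef κ λ′ (Vec.toList b) (k ∸ k₁)
  large : ∀ λ′ → N < sum λ′ → ∑ (upTo (suc k)) (term λ′) ≡ + 0
  large λ′ lt = ∑ℤ.∑-zero (upTo (suc k)) (λ k₁ → cong (ℤ._* partitionCoef κ λ′ (Vec.toList b) (k ∸ k₁))
    (tableauCoef-degree κ λ′ (Vec.toList a) k₁ (ℕP.<⇒≢ (ℕP.<-≤-trans lt (ℕP.m≤m+n (sum λ′) k₁)))))

∑-single : {A : Set} (as : List A) {f : A → ℤ} → Unique as → ∀ {a} → a ∈ as → (∀ {a′} → a′ ∈ as → a′ ≢ a → f a′ ≡ + 0) → ∑ as f ≡ f a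
∑-single (a ∷ as) {f} (a∉ ∷ u) (here ≡.refl) others = ≡.trans
  (cong (λ z → f a ℤ.+ z) (≡.trans (∑ℤ.∑-cong-∈ as (λ a′∈ → others (there a′∈) (λ eq → All.lookup a∉ a′∈ (≡.sym eq)))) (∑ℤ.∑-zero as (λ _ → ≡.refl))))
  (ℤP.+-identityʳ (f a))
∑-single (a ∷ as) {f} (a∉ ∷ u) (there a∈) others = ≡.trans
  (cong₂ ℤ._+_ (others (here ≡.refl) (All.lookup a∉ a∈)) (∑-single as u a∈ (λ a′∈ → others (there a′∈))))
  (ℤP.+-identityˡ _)

module Uniqueness (κ : Kind) (g g′ : List ℕ → List ℕ → ℕ → ℤ)
  (identity : CauchyIdentity (tableauCoef κ) g) (identity′ : CauchyIdentity (tableauCoef κ) g′) (b : List ℕ) where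

  private
    Agree : ℕ → Set
    Agree k = ∀ λ′ → isStrictᵇ λ′ ≡ true → g λ′ b k ≡ g′ λ′ b k

    series : (List ℕ → List ℕ → ℕ → ℤ) → ℕ → List ℕ → List ℕ → ℤ
    series h k λ′ μ = ∑ (upTo (suc k)) (λ k₁ → tableauCoef κ μ λ′ k₁ ℤ.* h μ b (k ∸ k₁))

    -- The monomial in x is chosen to be that of λ itself, in as many variables as λ has parts, so
    -- that triangularity applies. The kernel on the right does not depend on the family h.
    expand : ∀ h k → CauchyIdentity (tableauCoef κ) h → ∀ λ′ →
      ∑ (strictUpTo (sum λ′)) (series h k λ′) ≡ kernel (length λ′) (length b) (k ∷ (Vec.fromList λ′ Vec.++ Vec.fromList b))
    expand h k id λ′ = ≡.trans
      (≡.sym (≡.trans (sumℤ-∑ (strictUpTo (sum λ′)) (λ μ → sumℤ (map (term μ λ′ b) (upTo (suc k)))))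
        (∑ℤ.∑-cong (strictUpTo (sum λ′)) (λ μ → sumℤ-∑ (upTo (suc k)) (term μ λ′ b)))))
      (subst₂ (λ a′ b′ → sumℤ (map (λ μ → sumℤ (map (term μ a′ b′) (upTo (suc k)))) (strictUpTo (sum a′)))
          ≡ kernel (length λ′) (length b) (k ∷ (Vec.fromList λ′ Vec.++ Vec.fromList b)))
        (VecP.toList∘fromList λ′) (VecP.toList∘fromList b) (id (length λ′) (length b) (Vec.fromList λ′) (Vec.fromList b) k))
      where
      term : List ℕ → List ℕ → List ℕ → ℕ → ℤ
      term μ a′ b′ k₁ = tableauCoef κ μ a′ k₁ ℤ.* h μ b′ (k ∸ k₁)

  -- Two nested inductions. The outer one, on the power of β, removes all terms in which the tableau
  -- side contributes a positive power, since they involve smaller powers of the unknown families.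
  -- The inner one, on `rowSum`, removes all μ other than λ by triangularity. There remains the
  -- diagonal coefficient times the difference of the two families.
  determined : ∀ k → Agree k
  determined = <-rec Agree step
    where
    step : ∀ k → (∀ {k′} → k′ < k → Agree k′) → Agree k
    step k smaller = λ λ′ strict → by-rows (rowSum λ′) λ′ strict ≡.refl
      where
      AgreeAt : ℕ → Set
      AgreeAt s = ∀ λ′ → isStrictᵇ λ′ ≡ true → rowSum λ′ ≡ s → g λ′ b k ≡ g′ λ′ b k
      by-rows : ∀ s → AgreeAt s
      by-rows = <-rec AgreeAt inner
        where
        inner : ∀ s → (∀ {s′} → s′ < s → AgreeAt s′) → AgreeAt s
        inner _ lower λ′ strict ≡.refl = ℤP.i-j≡0⇒i≡j _ _ (cancel (diagonal-coef λ′ κ))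
          where
          difference : List ℕ → ℤ
          difference μ = series g k λ′ μ ℤ.- series g′ k λ′ μ
          leading : ∀ μ → isStrictᵇ μ ≡ true → difference μ ≡ tableauCoef κ μ λ′ 0 ℤ.* (g μ b k ℤ.- g′ μ b k)
          leading μ h = ≡.trans (cong₂ ℤ._-_ {x = c ℤ.* g μ b k ℤ.+ rest g} {y = c ℤ.* g μ b k ℤ.+ rest g} ≡.refl
              (cong (λ z → c ℤ.* g′ μ b k ℤ.+ z) (≡.sym rests)))
            (≡.trans (cancel-rest (c ℤ.* g μ b k) (c ℤ.* g′ μ b k) (rest g)) (≡.sym (distrib c (g μ b k) (g′ μ b k))))
            where
            c = tableauCoef κ μ λ′ 0
            rest : (List ℕ → List ℕ → ℕ → ℤ) → ℤ
            rest h = ∑ (List.applyUpTo suc k) (λ k₁ → tableauCoef κ μ λ′ k₁ ℤ.* h μ b (k ∸ k₁))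
            rests : rest g ≡ rest g′
            rests = ∑ℤ.∑-cong-∈ (List.applyUpTo suc k) later
              where
              later : ∀ {k₁} → k₁ ∈ List.applyUpTo suc k → tableauCoef κ μ λ′ k₁ ℤ.* g μ b (k ∸ k₁) ≡ tableauCoef κ μ λ′ k₁ ℤ.* g′ μ b (k ∸ k₁)
              later k₁∈ with ∈-applyUpTo⁻ suc k₁∈
                where open import Data.List.Membership.Propositional.Properties using (∈-applyUpTo⁻)
              ... | i , i<k , ≡.refl = cong (tableauCoef κ μ λ′ (suc i) ℤ.*_) (smaller (ℕP.∸-monoʳ-< (s≤s z≤n) i<k) μ h)
            cancel-rest : ∀ u v r → (u ℤ.+ r) ℤ.- (v ℤ.+ r) ≡ u ℤ.- v
            cancel-rest u v r = solve 3 (λ u v r → (u :+ r) :- (v :+ r) := u :- v) ≡.refl u v r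
              where open import Data.Integer.Solver using (module +-*-Solver)
                    open +-*-Solver
            distrib : ∀ c u v → c ℤ.* (u ℤ.- v) ≡ c ℤ.* u ℤ.- c ℤ.* v
            distrib c u v = solve 3 (λ c u v → c :* (u :- v) := c :* u :- c :* v) ≡.refl c u v
              where open import Data.Integer.Solver using (module +-*-Solver)
                    open +-*-Solver
          others : ∀ {μ} → μ ∈ strictUpTo (sum λ′) → μ ≢ λ′ → difference μ ≡ + 0
          others {μ} μ∈ ne = ≡.trans (leading μ h) (zero-by (tableauCoef-triangular κ λ′ μ strict h))
            where
            h = proj₁ (∈-strictUpTo⁻ (sum λ′) μ∈)
            zero-by : tableauCoef κ μ λ′ 0 ≡ + 0 ⊎ rowSum μ < rowSum λ′ ⊎ μ ≡ λ′ →
              tableauCoef κ μ λ′ 0 ℤ.* (g μ b k ℤ.- g′ μ b k) ≡ + 0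
            zero-by (inj₁ eq) = cong (ℤ._* (g μ b k ℤ.- g′ μ b k)) eq
            zero-by (inj₂ (inj₁ lt)) = ≡.trans (cong (tableauCoef κ μ λ′ 0 ℤ.*_) (ℤP.i≡j⇒i-j≡0 (lower lt μ h ≡.refl))) (ℤP.*-zeroʳ (tableauCoef κ μ λ′ 0))
            zero-by (inj₂ (inj₂ eq)) = ⊥-elim (ne eq)
          total : ∑ (strictUpTo (sum λ′)) difference ≡ + 0
          total = ≡.trans (∑-minus (strictUpTo (sum λ′))) (ℤP.i≡j⇒i-j≡0
            (≡.trans (expand g k identity λ′) (≡.sym (expand g′ k identity′ λ′))))
            where
            ∑-minus : ∀ as → ∑ as difference ≡ ∑ as (series g k λ′) ℤ.- ∑ as (series g′ k λ′)
            ∑-minus [] = ≡.refl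
            ∑-minus (μ ∷ as) = ≡.trans (cong (λ z → difference μ ℤ.+ z) (∑-minus as))
              (solve 4 (λ u v r s → (u :- v) :+ (r :- s) := (u :+ r) :- (v :+ s)) ≡.refl (series g k λ′ μ) (series g′ k λ′ μ) _ _)
              where open import Data.Integer.Solver using (module +-*-Solver)
                    open +-*-Solver
          product-zero : tableauCoef κ λ′ λ′ 0 ℤ.* (g λ′ b k ℤ.- g′ λ′ b k) ≡ + 0
          product-zero = ≡.trans (≡.sym (leading λ′ strict)) (≡.trans
            (≡.sym (∑-single (strictUpTo (sum λ′)) (strictUpTo-unique (sum λ′)) (∈-strictUpTo⁺ (sum λ′) strict ℕP.≤-refl) others)) total)
          -- The diagonal coefficient need not be a unit: for GQ and λ = (1) it is 2, from the
          -- entries 1′ and 1. It is cancelled because ℤ has no zero divisors.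
          cancel : (∃ λ c → tableauCoef κ λ′ λ′ 0 ≡ + suc c) → g λ′ b k ℤ.- g′ λ′ b k ≡ + 0
          cancel (c , eq) with ℤP.i*j≡0⇒i≡0∨j≡0 (tableauCoef κ λ′ λ′ 0) product-zero
          ... | inj₁ z = ⊥-elim (case (≡.trans (≡.sym eq) z))
            where
            case : + suc c ≡ + 0 → ⊥
            case ()
          ... | inj₂ z = z

theorem1p4 :
  ((gp : List ℕ → List ℕ → ℕ → ℤ) → CauchyIdentity GQcoef gp →
     ∀ (λ' : List ℕ) → isStrictᵇ λ' ≡ true →
       ∀ (b : List ℕ) (k : ℕ) → gp λ' b k ≡ PPPcoef λ' b k)
  ×
  ((gq : List ℕ → List ℕ → ℕ → ℤ) → CauchyIdentity GPcoef gq →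
     ∀ (λ' : List ℕ) → isStrictᵇ λ' ≡ true →
       ∀ (b : List ℕ) (k : ℕ) → gq λ' b k ≡ PPQcoef λ' b k)
theorem1p4 =
  (λ gp identity λ′ strict b k → Uniqueness.determined 𝒬 gp PPPcoef identity (cauchyIdentity 𝒬) b k λ′ strict) ,
  (λ gq identity λ′ strict b k → Uniqueness.determined 𝒫 gq PPQcoef identity (cauchyIdentity 𝒫) b k λ′ strict)
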